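{- Work in $\mathbf{ZF}$ (Zermelo-Fraenkel set theory without the axiom of choice). Suppose that the following assertion ($\mathbf{SQHS}$) holds: for all hyperbolic geodesic metric spaces $S$ and $T$, if $S$ is quasi-isometric to $T$ (i.e. there exists a quasi-isometry $S\to T$), then $T$ is quasi-isometric to $S$ (i.e. there exists a quasi-isometry $T\to S$). Then the axiom of choice holds.
   Context: The implication is to be derived from the axioms of $\mathbf{ZF}$ alone. Quasi-isometry: for metric spaces $(S,d_S)$ and $(T,d_T)$, a function $f:S\to T$ is a quasi-isometry if there exists a natural number $N\ge 1$ such that $B(f(S),N)=T$ and for all $x,y\in S$, $\frac1N d_S(x,y)-N\le d_T(f(x),f(y))\le N d_S(x,y)+N$. Here, for $J\subseteq T$, $B(J,p)=\{x\in T: d_T(x,J)\le p\}$ is the closed $p$-neighborhood (with $d_T(x,\emptyset)=+\infty$). If there is a quasi-isometry from $S$ to $T$ we say $S$ is quasi-isometric to $T$; a priori this relation is directional. A metric space $S$ is geodesic if for any $x,y\in S$ there is an isometric embedding $\rho:[0,d_S(x,y)]\to S$ with $\rho(0)=x$, $\rho(d_S(x,y))=y$; its image is called a geodesic segment, denoted $[x,y]$ (not necessarily unique). A geodesic space $S$ is $\delta$-hyperbolic if for any $x,y,z\in S$ (and any choice of geodesic segments) $[x,y]\subseteq B([x,z]\cup[y,z],\delta)$, and hyperbolic if it is $\delta$-hyperbolic for some $\delta\ge 0$. All hyperbolic spaces are understood to be geodesic. Axiom of choice (formulation): if $\mathcal Z$ is a nonempty set consisting of pairwise disjoint nonempty sets,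 then there exists a set $A$ such that $A\cap X$ has cardinality one for all $X\in\mathcal Z$. -}

module Defs where

open import Level using (Level; suc)
open import Algebra.Core using (Op₁; Op₂)
open import Algebra.Structures using (IsCommutativeRing)
open import Data.Fin.Base using (Fin)
open import Data.Nat.Base as ℕ using (ℕ)
open import Data.Product.Base using (Σ; ∃; ∃₂; _×_; _,_; proj₁; proj₂)
open import Data.Product using (∃!)
open import Data.Sum.Base using (_⊎_; [_,_]′)
open import Data.Vec.Base using (Vec; _∷_; lookup)
open import Function.Base using (_on_)
open import Function.Bundles using (_⇔_)
open import Function.Metric.Structures using (IsGeneralMetric)
open import Relation.Binary.Core using (Rel)
open import Relation.Binary.PropositionalEquality using (_≡_; _≢_; refl)
open import Relation.Binary.Structures using (IsTotalOrder)
open import Relation.Nullary.Negation using (¬_)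
open import Relation.Unary using (Pred; _∪_)

------------------------------------------------------------------------
-- Models of ZF

-- First-order formulas in the language {∈, =} with n free variables
-- (de Bruijn indices).

infix  7 _∈′_ _≡′_
infix  6 ¬′_
infixr 5 _∧′_
infixr 4 _∨′_
infixr 3 _⇒′_
infix  2 ∀′_ ∃′_

data Formula (n : ℕ) : Set where
  _∈′_ _≡′_      : Fin n → Fin n → Formula n
  ¬′_            : Formula n → Formula n
  _∧′_ _∨′_ _⇒′_ : Formula n → Formula n → Formula n
  ∀′_ ∃′_        : Formula (ℕ.suc n) → Formula n

-- Tarskian truth with Agda's own connectives.  The logic of ZF
-- being classical, this is meant to be used under ExcludedMiddle ℓ.

module Satisfaction {ℓ} {V : Set ℓ} (_∈_ : Rel V ℓ) where

  infix 4 _⊨_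

  _⊨_ : ∀ {n} → Vec V n → Formula n → Set ℓ
  ρ ⊨ (i ∈′ j) = lookup ρ i ∈ lookup ρ j
  ρ ⊨ (i ≡′ j) = lookup ρ i ≡ lookup ρ j
  ρ ⊨ (¬′ φ)   = ¬ (ρ ⊨ φ)
  ρ ⊨ (φ ∧′ ψ) = (ρ ⊨ φ) × (ρ ⊨ ψ)
  ρ ⊨ (φ ∨′ ψ) = (ρ ⊨ φ) ⊎ (ρ ⊨ ψ)
  ρ ⊨ (φ ⇒′ ψ) = (ρ ⊨ φ) → (ρ ⊨ ψ)
  ρ ⊨ (∀′ φ)   = ∀ x → x ∷ ρ ⊨ φ
  ρ ⊨ (∃′ φ)   = ∃ λ x → x ∷ ρ ⊨ φ

-- Separation and replacement are the first-order schemes (with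
-- parameters ρ).  Letting them range over arbitrary predicates V → Set
-- would be strictly stronger: together with excluded middle, which for
-- Agda's Σ-types acts as a global choice operator, it would give the
-- axiom of choice outright.

record ZFModel (ℓ : Level) : Set (suc ℓ) where
  infix 4 _∈_
  field
    V   : Set ℓ
    _∈_ : Rel V ℓ

  open Satisfaction _∈_ public

  field
    extensionality : ∀ {x y} → (∀ z → z ∈ x ⇔ z ∈ y) → x ≡ y
    foundation     : ∀ a → ∃ (λ x → x ∈ a) →
                     ∃ λ x → x ∈ a × ¬ (∃ λ y → y ∈ x × y ∈ a)
    pairing        : ∀ x y → ∃ λ p → ∀ z → z ∈ p ⇔ (z ≡ x ⊎ z ≡ y)
    union          : ∀ a → ∃ λ u → ∀ z → z ∈ u ⇔ (∃ λ y → y ∈ a × z ∈ y)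
    powerset       : ∀ a → ∃ λ p → ∀ z → z ∈ p ⇔ (∀ y → y ∈ z → y ∈ a)
    infinity       : ∃ λ a →
                     (∃ λ e → (∀ z → ¬ z ∈ e) × e ∈ a) ×
                     (∀ x → x ∈ a →
                        ∃ λ s → (∀ z → z ∈ s ⇔ (z ∈ x ⊎ z ≡ x)) × s ∈ a)
    separation     : ∀ {n} (φ : Formula (1 ℕ.+ n)) (ρ : Vec V n) a →
                     ∃ λ b → ∀ x → x ∈ b ⇔ (x ∈ a × x ∷ ρ ⊨ φ)
    replacement    : ∀ {n} (φ : Formula (2 ℕ.+ n)) (ρ : Vec V n) a →
                     (∀ x y y′ → x ∈ a →
                        y ∷ x ∷ ρ ⊨ φ → y′ ∷ x ∷ ρ ⊨ φ → y ≡ y′) →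
                     ∃ λ b → ∀ y → y ∈ b ⇔ (∃ λ x → x ∈ a × y ∷ x ∷ ρ ⊨ φ)

------------------------------------------------------------------------
-- Mathematics inside a model.  All sets, functions, numbers and spaces
-- below are objects of the model.

module _ {ℓ} (M : ZFModel ℓ) where
  open ZFModel M

  AxiomOfChoice : Set ℓ
  AxiomOfChoice =
    ∀ Z → ∃ (λ X → X ∈ Z) →
    (∀ X → X ∈ Z → ∃ λ x → x ∈ X) →
    (∀ X Y → X ∈ Z → Y ∈ Z → X ≢ Y → ¬ (∃ λ x → x ∈ X × x ∈ Y)) →
    ∃ λ A → ∀ X → X ∈ Z → ∃! _≡_ λ x → x ∈ A × x ∈ X

module Internal {ℓ} (M : ZFModel ℓ) where
  open ZFModel M

  upair : V → V → V
  upair x y = proj₁ (pairing x y)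

  -- Kuratowski pairs
  ⟨_,_⟩ : V → V → V
  ⟨ x , y ⟩ = upair (upair x x) (upair x y)

  Class : Set (suc ℓ)
  Class = Pred V ℓ

  El : Class → Set ℓ
  El C = Σ V C

  infix 4 _≈_
  _≈_ : {C : Class} → Rel (El C) ℓ
  _≈_ = _≡_ on proj₁

  set : V → Class
  set a x = x ∈ a

  _⊠_ : V → V → Class
  (a ⊠ b) p = ∃₂ λ x y → x ∈ a × y ∈ b × p ≡ ⟨ x , y ⟩

  -- Functions are sets of ordered pairs, hence elements of V; the
  -- domain and codomain are given by their membership predicates only
  -- to avoid choosing a set for products and real intervals.
  record Map (C D : Class) : Set ℓ where
    field
      graph  : V
      graph⊆ : ∀ {p} → p ∈ graph → ∃₂ λ x y → C x × D y × p ≡ ⟨ x , y ⟩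
      total! : ∀ {x} → C x → ∃! _≡_ λ y → D y × ⟨ x , y ⟩ ∈ graph

    apply : El C → El D
    apply (x , x∈C) with total! x∈C
    ... | y , (y∈D , _) , _ = y , y∈D

  apply₂ : ∀ {a b c} → Map (a ⊠ b) (set c) →
           El (set a) → El (set b) → El (set c)
  apply₂ f (x , x∈a) (y , y∈b) =
    Map.apply f (⟨ x , y ⟩ , x , y , x∈a , y∈b , refl)

  Image : ∀ {C D} → Map C D → Pred (El D) ℓ
  Image f y = ∃ λ x → Map.apply f x ≈ y

  -- The real numbers: a Dedekind-complete ordered field in the model.
  -- The negation -_ is uniquely determined by isCommutativeRing.
  record RealNumbers : Set ℓ where
    infix  4 _≤_
    infixl 6 _+_
    infixl 7 _*_
    infix  8 -_
    field
      carrier : V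

    ℝ : Set ℓ
    ℝ = El (set carrier)

    field
      addition       : Map (carrier ⊠ carrier) (set carrier)
      multiplication : Map (carrier ⊠ carrier) (set carrier)
      order          : V
      0# 1#          : ℝ
      -_             : Op₁ ℝ

    _+_ : Op₂ ℝ
    x + y = apply₂ addition x y

    _*_ : Op₂ ℝ
    x * y = apply₂ multiplication x y

    _≤_ : Rel ℝ ℓ
    x ≤ y = ⟨ proj₁ x , proj₁ y ⟩ ∈ order

    UpperBound : V → Pred ℝ ℓ
    UpperBound A b = ∀ x → proj₁ x ∈ A → x ≤ b

    field
      isCommutativeRing : IsCommutativeRing _≈_ _+_ _*_ -_ 0# 1#
      0≉1               : ¬ 0# ≈ 1#
      invertible        : ∀ x → ¬ x ≈ 0# → ∃ λ y → x * y ≈ 1#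
      isTotalOrder      : IsTotalOrder _≈_ _≤_
      +-monoˡ-≤         : ∀ x y z → x ≤ y → x + z ≤ y + z
      *-nonNegative     : ∀ x y → 0# ≤ x → 0# ≤ y → 0# ≤ x * y
      complete          : ∀ A → (∀ x → x ∈ A → x ∈ carrier) →
                          ∃ (λ x → x ∈ A) → ∃ (UpperBound A) →
                          ∃ λ s → UpperBound A s ×
                                  (∀ b → UpperBound A b → s ≤ b)

    open IsTotalOrder isTotalOrder public using (total)

    ∣_∣ : Op₁ ℝ
    ∣ x ∣ = [ (λ _ → x) , (λ _ → - x) ]′ (total 0# x)

    -- The natural numbers of the model (possibly nonstandard), inside
    -- ℝ: the elements of every inductive set.
    IsNatural : Pred ℝ ℓ
    IsNatural n = ∀ A → proj₁ 0# ∈ A →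
                  (∀ (x : ℝ) → proj₁ x ∈ A → proj₁ (x + 1#) ∈ A) →
                  proj₁ n ∈ A

    IsInfimum : Pred ℝ ℓ → Pred ℝ ℓ
    IsInfimum P r = LowerBound r × (∀ b → LowerBound b → b ≤ r)
      where
      LowerBound : Pred ℝ ℓ
      LowerBound b = ∀ x → P x → b ≤ x

    Interval : ℝ → ℝ → Class
    Interval a b t = ∃ λ (t∈ℝ : t ∈ carrier) →
                     a ≤ (t , t∈ℝ) × (t , t∈ℝ) ≤ b

  module Geometry (𝓡 : RealNumbers) where
    open RealNumbers 𝓡

    record MetricSpace : Set ℓ where
      field
        points   : V
        distance : Map (points ⊠ points) (set carrier)

      Point : Set ℓ
      Point = El (set points)

      d : Point → Point → ℝ
      d = apply₂ distance

      field
        isMetric : IsGeneralMetric _≈_ _≈_ _≤_ 0# _+_ d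

      -- The closed p-neighbourhood of J.  If J is empty then the set of
      -- distances has no infimum in ℝ, so B J p is empty, in agreement
      -- with d(x,∅) = +∞.
      B : Pred Point ℓ → ℝ → Pred Point ℓ
      B J p x = ∃ λ r → IsInfimum (λ s → ∃ λ j → J j × s ≈ d x j) r × r ≤ p

      record Segment (x y : Point) : Set ℓ where
        toℝ : El (Interval 0# (d x y)) → ℝ
        toℝ (t , t∈ℝ , _) = t , t∈ℝ

        field
          ρ         : Map (Interval 0# (d x y)) (set points)
          isometric : ∀ s t → d (Map.apply ρ s) (Map.apply ρ t) ≈
                              ∣ toℝ s + - toℝ t ∣
          start     : ⟨ proj₁ 0# , proj₁ x ⟩ ∈ Map.graph ρ
          end       : ⟨ proj₁ (d x y) , proj₁ y ⟩ ∈ Map.graph ρ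

        segment : Pred Point ℓ
        segment = Image ρ

      open Segment public using (segment)

      Geodesic : Set ℓ
      Geodesic = ∀ x y → Segment x y

      DeltaHyperbolic : Pred ℝ ℓ
      DeltaHyperbolic δ =
        ∀ x y z (xy : Segment x y) (xz : Segment x z) (yz : Segment y z) →
        ∀ p → segment xy p → B (segment xz ∪ segment yz) δ p

      Hyperbolic : Set ℓ
      Hyperbolic = Geodesic × (∃ λ δ → 0# ≤ δ × DeltaHyperbolic δ)

    open MetricSpace using (points; Point; B; Hyperbolic)

    record IsQuasiIsometry (S T : MetricSpace)
                           (f : Map (set (points S)) (set (points T))) :
                           Set ℓ where
      open MetricSpace S using () renaming (d to dS)
      open MetricSpace T using () renaming (d to dT)
      field
        N N⁻¹      : ℝ
        natural    : IsNatural N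
        1≤N        : 1# ≤ N
        inverse    : N * N⁻¹ ≈ 1#
        surjective : ∀ y → B T (Image f) N y
        lower      : ∀ x y → N⁻¹ * dS x y + - N ≤
                             dT (Map.apply f x) (Map.apply f y)
        upper      : ∀ x y → dT (Map.apply f x) (Map.apply f y) ≤
                             N * dS x y + N

    QuasiIsometric : Rel MetricSpace ℓ
    QuasiIsometric S T = ∃ (IsQuasiIsometry S T)

module _ {ℓ} (M : ZFModel ℓ) where
  open Internal M

  -- Since ZF proves that a complete ordered field exists and is unique
  -- up to isomorphism, quantifying over all of them is the same as
  -- fixing one.
  SQHS : Set ℓ
  SQHS = ∀ (𝓡 : RealNumbers) → let open Geometry 𝓡 in
         ∀ (S T : MetricSpace) →
         MetricSpace.Hyperbolic S → MetricSpace.Hyperbolic T →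
         QuasiIsometric S T → QuasiIsometric T S

module Submission where

-- For a family Z of nonempty sets let S(Z) be the cone over the disjoint union, over X ∈ Z, of the complete bipartite
-- graphs on two copies of X. A point of S(Z) other than the apex lies over an edge of one of these graphs, and since
-- the edges are oriented it determines an element of X, although no element of X is distinguished. Replacing every X
-- by the singleton {X} gives a quasi-isometry from S(Z) onto T = S({{X} | X ∈ Z}). Both cones are geodesic, and they
-- are hyperbolic because their metrics differ by at most 2 from that of a tree, which satisfies the four-point condition.
-- Given a quasi-isometry T → S(Z) and a large height H₀, for every Y ∈ Z there is exactly one ray X of T with a point
-- that is mapped to a height near H₀ over Y; the infimum of the heights of such points on this ray is again mapped to a
-- point over Y away from the apex, and this point singles out an element of Y.
--
-- Since SQHS quantifies over the complete ordered fields of the model, one of them has to be constructed: positive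
-- integers (by recursion on ω), positive fractions, upper cuts of fractions as nonnegative reals, differences of cuts.
-- As separation is first-order, every set that is formed needs a definition by a formula; hence the calculus of
-- definable predicates and terms.

-- The obstacle is that Σ-types with excluded middle choose freely, whereas ZF does not. A witness
-- extracted outside the model may enter a set only as one of finitely many fixed parameters;
-- whatever varies with Y ∈ Z has to be described uniquely by a formula. This dictates the base of
-- the cone over X: it must be connected, bounded, defined from X without preferring an element, and
-- each of its points must name one element. A complete graph on X would fail, since the midpoint of
-- an edge names neither endpoint; two copies of X give the edges a direction. The inverse
-- quasi-isometry is a single set and so may be a parameter, but it is controlled only coarsely:
-- many heights on the right ray are mapped near H₀, and nothing singles one out except their
-- infimum. The infimum need not be such a height, but it lies within 1 of one, and H₀ leaves room
-- for this error. The size of H₀ also keeps two rays from serving the same Y: their points would be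
-- close to the apex of T, and such points are mapped to bounded height.

open import Level using (Level)
open import Data.Product.Base using (_,_; proj₁; proj₂)
open import Defs
open import Axiom.ExcludedMiddle using (ExcludedMiddle)

-- Semirings without zero, ordered by their addition.

module PositiveSemirings where

  open import Level using (Level; _⊔_) renaming (suc to lsuc)
  open import Algebra.Bundles using (CommutativeSemiring)
  open import Algebra.Structures.Biased using (isCommutativeSemiringˡ)
  open import Data.Maybe.Base using (Maybe; just; nothing)
  open import Data.Maybe.Relation.Binary.Pointwise as Pointwise using (Pointwise; just; nothing)
  open import Data.Product.Base using (∃; _,_)
  open import Data.Sum.Base using (_⊎_; inj₁; inj₂)
  open import Relation.Binary using (IsEquivalence; Rel)
  open import Relation.Nullary using (¬_; contradiction)
  import Algebra.Solver.Ring.NaturalCoefficients.Default as DefaultSolver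

  -- Positive integers and positive fractions are the two instances. In the absence of zero,
  -- multiplication is strictly monotone and cancellative without side conditions, and the order
  -- comes from addition: x < y means that the difference exists.
  record PositiveSemiring c e : Set (lsuc (c ⊔ e)) where
    infix 4 _≈_
    infixl 6 _+_
    infixl 7 _*_
    field
      Carrier : Set c
      _≈_ : Rel Carrier e
      _+_ _*_ : Carrier → Carrier → Carrier
      1# : Carrier
      isEquivalence : IsEquivalence _≈_
      +-cong : ∀ {x y u v} → x ≈ y → u ≈ v → (x + u) ≈ (y + v)
      *-cong : ∀ {x y u v} → x ≈ y → u ≈ v → (x * u) ≈ (y * v)
      +-assoc : ∀ x y z → ((x + y) + z) ≈ (x + (y + z))
      +-comm : ∀ x y → (x + y) ≈ (y + x)
      *-assoc : ∀ x y z → ((x * y) * z) ≈ (x * (y * z))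
      *-comm : ∀ x y → (x * y) ≈ (y * x)
      *-identityˡ : ∀ x → (1# * x) ≈ x
      distribʳ : ∀ x y z → ((y + z) * x) ≈ ((y * x) + (z * x))
      irreflexive : ∀ x k → ¬ ((x + k) ≈ x)
      trichotomy : ∀ x y → x ≈ y ⊎ (∃ λ k → (x + k) ≈ y) ⊎ (∃ λ k → (y + k) ≈ x)

  module PositiveSemiringProperties {c e} (S : PositiveSemiring c e) where
    open PositiveSemiring S
    open IsEquivalence isEquivalence renaming (refl to ≈-refl; sym to ≈-sym; trans to ≈-trans) public

    private
      Carrier₀ = Maybe Carrier
      _+₀_ _*₀_ : Carrier₀ → Carrier₀ → Carrier₀
      nothing +₀ y = y
      just x  +₀ nothing = just x
      just x  +₀ just y  = just (x + y)
      nothing *₀ _ = nothing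
      just x  *₀ nothing = nothing
      just x  *₀ just y  = just (x * y)

      _≈₀_ : Rel Carrier₀ _
      _≈₀_ = Pointwise _≈_

      refl₀ : ∀ {x} → x ≈₀ x
      refl₀ = Pointwise.refl ≈-refl

      +₀-cong : ∀ {x y u v} → x ≈₀ y → u ≈₀ v → (x +₀ u) ≈₀ (y +₀ v)
      +₀-cong nothing  q        = q
      +₀-cong (just p) nothing  = just p
      +₀-cong (just p) (just q) = just (+-cong p q)

      *₀-cong : ∀ {x y u v} → x ≈₀ y → u ≈₀ v → (x *₀ u) ≈₀ (y *₀ v)
      *₀-cong nothing  q        = nothing
      *₀-cong (just p) nothing  = nothing
      *₀-cong (just p) (just q) = just (*-cong p q)

      +₀-assoc : ∀ x y z → ((x +₀ y) +₀ z) ≈₀ (x +₀ (y +₀ z))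
      +₀-assoc nothing y z = refl₀
      +₀-assoc (just x) nothing z = refl₀
      +₀-assoc (just x) (just y) nothing = refl₀
      +₀-assoc (just x) (just y) (just z) = just (+-assoc x y z)

      +₀-comm : ∀ x y → (x +₀ y) ≈₀ (y +₀ x)
      +₀-comm nothing nothing = refl₀
      +₀-comm nothing (just x) = refl₀
      +₀-comm (just x) nothing = refl₀
      +₀-comm (just x) (just y) = just (+-comm x y)

      *₀-assoc : ∀ x y z → ((x *₀ y) *₀ z) ≈₀ (x *₀ (y *₀ z))
      *₀-assoc nothing y z = refl₀
      *₀-assoc (just x) nothing z = refl₀
      *₀-assoc (just x) (just y) nothing = refl₀
      *₀-assoc (just x) (just y) (just z) = just (*-assoc x y z)

      *₀-comm : ∀ x y → (x *₀ y) ≈₀ (y *₀ x)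
      *₀-comm nothing nothing = refl₀
      *₀-comm nothing (just x) = refl₀
      *₀-comm (just x) nothing = refl₀
      *₀-comm (just x) (just y) = just (*-comm x y)

      *₀-identityˡ : ∀ x → (just 1# *₀ x) ≈₀ x
      *₀-identityˡ nothing = refl₀
      *₀-identityˡ (just x) = just (*-identityˡ x)

      distribʳ₀ : ∀ x y z → ((y +₀ z) *₀ x) ≈₀ ((y *₀ x) +₀ (z *₀ x))
      distribʳ₀ x nothing z = refl₀
      distribʳ₀ nothing (just y) nothing = refl₀
      distribʳ₀ (just x) (just y) nothing = refl₀
      distribʳ₀ nothing (just y) (just z) = refl₀
      distribʳ₀ (just x) (just y) (just z) = just (distribʳ x y z)

      isEquivalence₀ : IsEquivalence _≈₀_
      isEquivalence₀ = Pointwise.isEquivalence isEquivalence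

    -- Adjoining a zero makes the semiring solver available.
    commutativeSemiring : CommutativeSemiring c (c ⊔ e)
    commutativeSemiring = record
      { Carrier = Carrier₀ ; _≈_ = _≈₀_ ; _+_ = _+₀_ ; _*_ = _*₀_ ; 0# = nothing ; 1# = just 1#
      ; isCommutativeSemiring = isCommutativeSemiringˡ record
        { +-isCommutativeMonoid = record
          { isMonoid = record
            { isSemigroup = record
              { isMagma = record { isEquivalence = isEquivalence₀ ; ∙-cong = +₀-cong }
              ; assoc = +₀-assoc }
            ; identity = (λ _ → refl₀) , (λ x → IsEquivalence.trans isEquivalence₀ (+₀-comm x nothing) refl₀) }
          ; comm = +₀-comm }
        ; *-isCommutativeMonoid = record
          { isMonoid = record
            { isSemigroup = record
              { isMagma = record { isEquivalence = isEquivalence₀ ; ∙-cong = *₀-cong }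
              ; assoc = *₀-assoc }
            ; identity = *₀-identityˡ , (λ x → IsEquivalence.trans isEquivalence₀ (*₀-comm x (just 1#)) (*₀-identityˡ x)) }
          ; comm = *₀-comm }
        ; distribʳ = distribʳ₀
        ; zeroˡ = λ _ → refl₀ } }

    module Solver = DefaultSolver commutativeSemiring

    commutativeSemiringRefl : ∀ {x} → x ≈₀ x
    commutativeSemiringRefl = refl₀

    unjust : ∀ {x y} → just x ≈₀ just y → x ≈ y
    unjust (just p) = p

    infix 4 _<_ _≤_
    -- `_<_` carries the difference as its witness, so subtraction is read off from it. `_≤_` is a
    -- negation; `trichotomy` turns it back into `<` or `≈`.
    _<_ _≤_ : Rel Carrier _
    x < y = ∃ λ k → x + k ≈ y
    x ≤ y = ¬ y < x

    opaque
      +-congˡ : ∀ {x y z} → x ≈ y → z + x ≈ z + y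
      +-congˡ p = +-cong ≈-refl p
      +-congʳ : ∀ {x y z} → x ≈ y → x + z ≈ y + z
      +-congʳ p = +-cong p ≈-refl

      <-trans : ∀ {x y z} → x < y → y < z → x < z
      <-trans (k , p) (l , q) = k + l , ≈-trans (≈-sym (+-assoc _ k l)) (≈-trans (+-congʳ p) q)

      <-irrefl : ∀ {x y} → x ≈ y → ¬ x < y
      <-irrefl p (k , q) = irreflexive _ k (≈-trans q (≈-sym p))

      <-respˡ : ∀ {x y z} → x ≈ y → x < z → y < z
      <-respˡ p (k , q) = k , ≈-trans (+-congʳ (≈-sym p)) q
      <-respʳ : ∀ {x y z} → y ≈ z → x < y → x < z
      <-respʳ p (k , q) = k , ≈-trans q p

      <⇒≤ : ∀ {x y} → x < y → x ≤ y
      <⇒≤ p q = <-irrefl ≈-refl (<-trans p q)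

      ≈⇒≤ : ∀ {x y} → x ≈ y → x ≤ y
      ≈⇒≤ p = <-irrefl (≈-sym p)

      ≤⇒<⊎≈ : ∀ {x y} → x ≤ y → x < y ⊎ x ≈ y
      ≤⇒<⊎≈ {x} {y} p with trichotomy x y
      ... | inj₁ e = inj₂ e
      ... | inj₂ (inj₁ q) = inj₁ q
      ... | inj₂ (inj₂ q) = contradiction q p

      <-≤-trans : ∀ {x y z} → x < y → y ≤ z → x < z
      <-≤-trans p q with ≤⇒<⊎≈ q
      ... | inj₁ r = <-trans p r
      ... | inj₂ e = <-respʳ e p

      ≤-<-trans : ∀ {x y z} → x ≤ y → y < z → x < z
      ≤-<-trans p q with ≤⇒<⊎≈ p
      ... | inj₁ r = <-trans r q
      ... | inj₂ e = <-respˡ (≈-sym e) q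

      ≤-refl : ∀ {x} → x ≤ x
      ≤-refl = ≈⇒≤ ≈-refl

      ≤-trans : ∀ {x y z} → x ≤ y → y ≤ z → x ≤ z
      ≤-trans p q r = q (<-≤-trans r p)

      ≤-total : ∀ x y → x ≤ y ⊎ y ≤ x
      ≤-total x y with trichotomy x y
      ... | inj₁ e = inj₁ (≈⇒≤ e)
      ... | inj₂ (inj₁ q) = inj₁ (<⇒≤ q)
      ... | inj₂ (inj₂ q) = inj₂ (<⇒≤ q)

      ≤⊎> : ∀ x y → x ≤ y ⊎ y < x
      ≤⊎> x y with trichotomy x y
      ... | inj₁ e = inj₁ (≈⇒≤ e)
      ... | inj₂ (inj₁ q) = inj₁ (<⇒≤ q)
      ... | inj₂ (inj₂ q) = inj₂ q

      x<x+k : ∀ x k → x < x + k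
      x<x+k x k = k , ≈-refl

      +-monoʳ-< : ∀ z {x y} → x < y → z + x < z + y
      +-monoʳ-< z (k , p) = k , ≈-trans (+-assoc z _ k) (+-congˡ p)
      +-monoˡ-< : ∀ z {x y} → x < y → x + z < y + z
      +-monoˡ-< z p = <-respˡ (+-comm z _) (<-respʳ (+-comm z _) (+-monoʳ-< z p))
      *-monoˡ-< : ∀ z {x y} → x < y → x * z < y * z
      *-monoˡ-< z (k , p) = k * z , ≈-trans (≈-sym (distribʳ z _ k)) (*-cong p ≈-refl)
      *-monoʳ-< : ∀ z {x y} → x < y → z * x < z * y
      *-monoʳ-< z p = <-respˡ (*-comm _ z) (<-respʳ (*-comm _ z) (*-monoˡ-< z p))

      private
        mono : (f : Carrier → Carrier) → (∀ {x y} → x < y → f x < f y) → (∀ {x y} → x ≈ y → f x ≈ f y) →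
               ∀ {x y} → x ≤ y → f x ≤ f y
        mono f m g p with ≤⇒<⊎≈ p
        ... | inj₁ q = <⇒≤ (m q)
        ... | inj₂ e = ≈⇒≤ (g e)

      +-mono-≤ : ∀ {x y u v} → x ≤ y → u ≤ v → x + u ≤ y + v
      +-mono-≤ {x} {y} {u} {v} p q = ≤-trans (mono (_+ u) (+-monoˡ-< u) +-congʳ p) (mono (y +_) (+-monoʳ-< y) +-congˡ q)
      *-mono-≤ : ∀ {x y u v} → x ≤ y → u ≤ v → x * u ≤ y * v
      *-mono-≤ {x} {y} {u} {v} p q = ≤-trans (mono (_* u) (*-monoˡ-< u) (λ e → *-cong e ≈-refl) p)
                                             (mono (y *_) (*-monoʳ-< y) (*-cong ≈-refl) q)

      -- Trichotomy replaces an inverse of `z`: either strict inequality would survive the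
      -- multiplication.
      *-cancelʳ-≈ : ∀ z {x y} → x * z ≈ y * z → x ≈ y
      *-cancelʳ-≈ z {x} {y} p with trichotomy x y
      ... | inj₁ e = e
      ... | inj₂ (inj₁ q) = contradiction (*-monoˡ-< z q) (<-irrefl p)
      ... | inj₂ (inj₂ q) = contradiction (*-monoˡ-< z q) (<-irrefl (≈-sym p))

      *-cancelʳ-< : ∀ z {x y} → x * z < y * z → x < y
      *-cancelʳ-< z {x} {y} p with trichotomy x y
      ... | inj₁ e = contradiction p (<-irrefl (*-cong e ≈-refl))
      ... | inj₂ (inj₁ q) = q
      ... | inj₂ (inj₂ q) = contradiction (<-trans p (*-monoˡ-< z q)) (<-irrefl ≈-refl)

-- The ring of formal differences of a cancellative semiring.

module DifferenceRings where

  open import Level using (Level; _⊔_) renaming (suc to lsuc)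
  open import Algebra.Bundles using (CommutativeSemiring)
  open import Algebra.Structures using (IsCommutativeRing)
  open import Data.Product.Base using (_×_; _,_; proj₁; proj₂)
  open import Relation.Binary using (IsEquivalence)
  import Algebra.Solver.Ring.NaturalCoefficients.Default as DefaultSolver

  module Differences {c e} (R : CommutativeSemiring c e)
    (cancelʳ : ∀ x y z → CommutativeSemiring._≈_ R (CommutativeSemiring._+_ R x z) (CommutativeSemiring._+_ R y z) →
               CommutativeSemiring._≈_ R x y) where
    open CommutativeSemiring R
    open DefaultSolver R using (solve; _:=_; _:+_; _:*_; con)

    Pair : Set c
    Pair = Carrier × Carrier

    infix 4 _~_
    record _~_ (p q : Pair) : Set e where
      constructor pair~
      field cross : (proj₁ p + proj₂ q) ≈ (proj₁ q + proj₂ p)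
    open _~_ public

    infixl 6 _⊞_
    infixl 7 _⊠_
    _⊞_ _⊠_ : Pair → Pair → Pair
    (a , b) ⊞ (c , d) = a + c , b + d
    (a , b) ⊠ (c , d) = a * c + b * d , a * d + b * c
    ⊟_ : Pair → Pair
    ⊟ (a , b) = b , a
    0ₚ 1ₚ : Pair
    0ₚ = 0# , 0#
    1ₚ = 1# , 0#

    opaque
      -- A pair (a , b) stands for a - b. Cancellation enters through transitivity: the desired
      -- equation first holds with d added on both sides.
      ~-isEquivalence : IsEquivalence _~_
      ~-isEquivalence = record
        { refl = pair~ refl
        ; sym = λ (pair~ p) → pair~ (sym p)
        ; trans = λ { {a , b} {c , d} {e , f} (pair~ p) (pair~ q) → pair~ (cancelʳ _ _ d
            (trans (solve 3 (λ a f d → (a :+ f) :+ d := (a :+ d) :+ f) refl a f d)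
            (trans (+-congʳ p)
            (trans (solve 3 (λ c b f → (c :+ b) :+ f := (c :+ f) :+ b) refl c b f)
            (trans (+-congʳ q) (solve 3 (λ e d b → (e :+ d) :+ b := (e :+ b) :+ d) refl e d b)))))) }
        }

      ⊞-cong : ∀ {p p′ q q′} → p ~ p′ → q ~ q′ → p ⊞ q ~ p′ ⊞ q′
      ⊞-cong {a , b} {a′ , b′} {c , d} {c′ , d′} (pair~ p) (pair~ q) = pair~
        (trans (solve 4 (λ a c b d → (a :+ c) :+ (b :+ d) := (a :+ b) :+ (c :+ d)) refl a c b′ d′)
        (trans (+-cong p q) (solve 4 (λ a c b d → (a :+ b) :+ (c :+ d) := (a :+ c) :+ (b :+ d)) refl a′ c′ b d)))

      ⊠-comm : ∀ p q → p ⊠ q ~ q ⊠ p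
      ⊠-comm (a , b) (c , d) = pair~ (solve 4 (λ a b c d →
        (a :* c :+ b :* d) :+ (c :* b :+ d :* a) := (c :* a :+ d :* b) :+ (a :* d :+ b :* c)) refl a b c d)

      ⊠-cong : ∀ {p p′ q q′} → p ~ p′ → q ~ q′ → p ⊠ q ~ p′ ⊠ q′
      -- Commutativity reduces the claim to a change of the left factor.
      ⊠-cong {p} {p′} {q} {q′} e f = E.trans (congˡ e q) (E.trans (⊠-comm p′ q) (E.trans (congˡ f p′) (⊠-comm q′ p′)))
        where
        module E = IsEquivalence ~-isEquivalence
        congˡ : ∀ {p p′} → p ~ p′ → ∀ q → p ⊠ q ~ p′ ⊠ q
        congˡ {a , b} {a′ , b′} (pair~ p) (c , d) = pair~
          (trans (solve 6 (λ a b a′ b′ c d → (a :* c :+ b :* d) :+ (a′ :* d :+ b′ :* c) :=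
                                             (a :+ b′) :* c :+ (a′ :+ b) :* d) refl a b a′ b′ c d)
          (trans (+-cong (*-congʳ p) (*-congʳ (sym p)))
            (solve 6 (λ a b a′ b′ c d → (a′ :+ b) :* c :+ (a :+ b′) :* d :=
                                        (a′ :* c :+ b′ :* d) :+ (a :* d :+ b :* c)) refl a b a′ b′ c d)))

      isCommutativeRing : IsCommutativeRing _~_ _⊞_ _⊠_ ⊟_ 0ₚ 1ₚ
      isCommutativeRing = record
        { isRing = record
          { +-isAbelianGroup = record
            { isGroup = record
              { isMonoid = record
                { isSemigroup = record
                  { isMagma = record { isEquivalence = ~-isEquivalence ; ∙-cong = ⊞-cong }
                  ; assoc = λ (a , b) (c , d) (e , f) → pair~ (solve 6 (λ a b c d e f →
                      ((a :+ c) :+ e) :+ (b :+ (d :+ f)) := (a :+ (c :+ e)) :+ ((b :+ d) :+ f)) refl a b c d e f) }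
                ; identity = (λ (a , b) → pair~ (solve 2 (λ a b → (con 0 :+ a) :+ b := a :+ (con 0 :+ b)) refl a b))
                           , (λ (a , b) → pair~ (solve 2 (λ a b → (a :+ con 0) :+ b := a :+ (b :+ con 0)) refl a b)) }
              ; inverse = (λ (a , b) → pair~ (solve 2 (λ a b → (b :+ a) :+ con 0 := con 0 :+ (a :+ b)) refl a b))
                        , (λ (a , b) → pair~ (solve 2 (λ a b → (a :+ b) :+ con 0 := con 0 :+ (b :+ a)) refl a b))
              ; ⁻¹-cong = λ {(a , b)} {(c , d)} (pair~ p) → pair~ (trans (+-comm b c) (trans (sym p) (+-comm a d))) }
            ; comm = λ (a , b) (c , d) → pair~ (solve 4 (λ a b c d → (a :+ c) :+ (d :+ b) := (c :+ a) :+ (b :+ d)) refl a b c d) }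
          ; *-cong = ⊠-cong
          ; *-assoc = λ (a , b) (c , d) (e , f) → pair~ (solve 6 (λ a b c d e f →
              ((a :* c :+ b :* d) :* e :+ (a :* d :+ b :* c) :* f) :+ (a :* (c :* f :+ d :* e) :+ b :* (c :* e :+ d :* f)) :=
              (a :* (c :* e :+ d :* f) :+ b :* (c :* f :+ d :* e)) :+ ((a :* c :+ b :* d) :* f :+ (a :* d :+ b :* c) :* e))
              refl a b c d e f)
          ; *-identity = (λ (a , b) → pair~ (solve 2 (λ a b →
                (con 1 :* a :+ con 0 :* b) :+ b := a :+ (con 1 :* b :+ con 0 :* a)) refl a b))
                       , (λ (a , b) → pair~ (solve 2 (λ a b →
                (a :* con 1 :+ b :* con 0) :+ b := a :+ (a :* con 0 :+ b :* con 1)) refl a b))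
          ; distrib = (λ (a , b) (c , d) (e , f) → pair~ (solve 6 (λ a b c d e f →
                (a :* (c :+ e) :+ b :* (d :+ f)) :+ ((a :* d :+ b :* c) :+ (a :* f :+ b :* e)) :=
                ((a :* c :+ b :* d) :+ (a :* e :+ b :* f)) :+ (a :* (d :+ f) :+ b :* (c :+ e))) refl a b c d e f))
                    , (λ (a , b) (c , d) (e , f) → pair~ (solve 6 (λ a b c d e f →
                ((c :+ e) :* a :+ (d :+ f) :* b) :+ ((c :* b :+ d :* a) :+ (e :* b :+ f :* a)) :=
                ((c :* a :+ d :* b) :+ (e :* a :+ f :* b)) :+ ((c :+ e) :* b :+ (d :+ f) :* a)) refl a b c d e f))
          }
        ; *-comm = ⊠-comm
        }

-- Automation for linear inequalities in ordered abelian groups.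

module LinearInequalities where

  open import Level using (Level; _⊔_) renaming (suc to lsuc)
  open import Algebra.Structures using (IsAbelianGroup)
  open import Algebra.Bundles using (AbelianGroup)
  import Algebra.Solver.CommutativeMonoid as MonoidSolver
  open import Data.Bool.Base using (Bool; true; false; T; _∧_; _∨_)
  open import Data.Empty using (⊥-elim)
  open import Data.Fin.Base using (Fin; zero; suc)
  open import Data.Integer.Base as ℤ using (ℤ; +_; -[1+_])
  open import Data.List.Base as List using (List; []; _∷_; _++_; map; concatMap)
  open import Data.Nat.Base as ℕ using (ℕ; zero; suc; _≡ᵇ_)
  open import Data.Product.Base using (_×_; _,_; proj₁)
  open import Data.Sum.Base using (inj₁; inj₂)
  open import Data.Unit.Polymorphic.Base using (⊤; tt)
  open import Data.Vec.Base as Vec using (Vec; []; _∷_; lookup; zipWith; replicate; tabulate)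
  open import Data.Vec.N-ary using (N-ary; _$ⁿ_)
  open import Relation.Binary.Core using (Rel)
  open import Relation.Binary.PropositionalEquality as ≡ using (_≡_)
  open import Relation.Binary.Structures using (IsTotalOrder)
  open import Relation.Nullary using (¬_; Dec; yes; no)

  record OrderedAbelianGroup c ℓ : Set (lsuc (c ⊔ ℓ)) where
    infix 4 _≈_ _≤_
    infixl 6 _+_
    infix 8 -_
    field
      Carrier        : Set c
      _≈_ _≤_        : Rel Carrier ℓ
      _+_            : Carrier → Carrier → Carrier
      -_             : Carrier → Carrier
      0#             : Carrier
      isAbelianGroup : IsAbelianGroup _≈_ _+_ 0# -_
      isTotalOrder   : IsTotalOrder _≈_ _≤_
      +-monoˡ-≤      : ∀ x y z → x ≤ y → x + z ≤ y + z
      _≤?_           : ∀ x y → Dec (x ≤ y)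

  -- Linear arithmetic over an ordered abelian group: a Farkas certificate is found by
  -- Fourier-Motzkin elimination and then checked; only the check is proved correct.
  module LinearArithmetic {c ℓ} (G : OrderedAbelianGroup c ℓ) where
    open OrderedAbelianGroup G
    open IsTotalOrder isTotalOrder using (total; antisym)
      renaming (refl to ≤-refl; trans to ≤-trans; reflexive to ≤-reflexive; module Eq to ≈)
    private
      group : AbelianGroup c ℓ
      group = record { isAbelianGroup = isAbelianGroup }
      open AbelianGroup group using (commutativeMonoid; ∙-cong; assoc; comm; identityˡ; identityʳ; inverseˡ; inverseʳ)
        renaming (refl to ≈-refl; sym to ≈-sym; trans to ≈-trans)
      open MonoidSolver commutativeMonoid using (prove; _⊕_; var) renaming (Expr to MExpr)

    infix 4 _<_
    _<_ : Rel Carrier ℓ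
    x < y = ¬ y ≤ x

    infixl 6 _:+_ _:-_
    infix 8 :-_
    data Expr (n : ℕ) : Set where
      :var      : Fin n → Expr n
      _:+_ _:-_ : Expr n → Expr n → Expr n
      :-_       : Expr n → Expr n
      :0        : Expr n

    infix 4 _:≤_ _:<_ _:≈_
    data Atom (n : ℕ) : Set where
      _:≤_ _:<_ _:≈_ : Expr n → Expr n → Atom n

    infix 2 _⊢_
    data Sequent (n : ℕ) : Set where
      _⊢_ : List (Atom n) → Atom n → Sequent n

    ⟦_⟧ : ∀ {n} → Expr n → Vec Carrier n → Carrier
    ⟦ :var i ⟧ ρ = lookup ρ i
    ⟦ e :+ f ⟧ ρ = ⟦ e ⟧ ρ + ⟦ f ⟧ ρ
    ⟦ e :- f ⟧ ρ = ⟦ e ⟧ ρ + - ⟦ f ⟧ ρ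
    ⟦ :- e ⟧ ρ = - ⟦ e ⟧ ρ
    ⟦ :0 ⟧ ρ = 0#

    Holds : ∀ {n} → Vec Carrier n → Atom n → Set ℓ
    Holds ρ (e :≤ f) = ⟦ e ⟧ ρ ≤ ⟦ f ⟧ ρ
    Holds ρ (e :< f) = ⟦ e ⟧ ρ < ⟦ f ⟧ ρ
    Holds ρ (e :≈ f) = ⟦ e ⟧ ρ ≈ ⟦ f ⟧ ρ

    AllHold : ∀ {n} → Vec Carrier n → List (Atom n) → Set ℓ
    AllHold ρ [] = ⊤
    AllHold ρ (a ∷ as) = Holds ρ a × AllHold ρ as

    private
      infixr 7 _×_′
      _×_′ : ℕ → Carrier → Carrier
      zero  × x ′ = 0#
      suc n × x ′ = x + n × x ′

      ×-+ : ∀ m n x → (m ℕ.+ n) × x ′ ≈ m × x ′ + n × x ′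
      ×-+ zero n x = ≈-sym (identityˡ _)
      ×-+ (suc m) n x = ≈-trans (∙-cong ≈-refl (×-+ m n x)) (≈-sym (assoc _ _ _))

      ⟪_⟫ : ∀ {n} → Vec ℕ n → Vec Carrier n → Carrier
      ⟪ [] ⟫ [] = 0#
      ⟪ k ∷ ks ⟫ (x ∷ ρ) = k × x ′ + ⟪ ks ⟫ ρ

      _⊞_ : ∀ {n} → Vec ℕ n → Vec ℕ n → Vec ℕ n
      _⊞_ = zipWith ℕ._+_
      𝟘 : ∀ {n} → Vec ℕ n
      𝟘 = replicate _ 0

      interchange : ∀ a b c d → (a + b) + (c + d) ≈ (a + c) + (b + d)
      interchange a b c d = prove 4 ((v₀ ⊕ v₁) ⊕ (v₂ ⊕ v₃)) ((v₀ ⊕ v₂) ⊕ (v₁ ⊕ v₃)) (a ∷ b ∷ c ∷ d ∷ [])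
        where
        v₀ v₁ v₂ v₃ : MExpr 4
        v₀ = var zero
        v₁ = var (suc zero)
        v₂ = var (suc (suc zero))
        v₃ = var (suc (suc (suc zero)))

      ⟪⊞⟫ : ∀ {n} (k l : Vec ℕ n) ρ → ⟪ k ⊞ l ⟫ ρ ≈ ⟪ k ⟫ ρ + ⟪ l ⟫ ρ
      ⟪⊞⟫ [] [] [] = ≈-sym (identityˡ _)
      ⟪⊞⟫ (k ∷ ks) (l ∷ ls) (x ∷ ρ) = ≈-trans (∙-cong (×-+ k l x) (⟪⊞⟫ ks ls ρ)) (interchange _ _ _ _)

      ⟪𝟘⟫ : ∀ {n} (ρ : Vec Carrier n) → ⟪ 𝟘 ⟫ ρ ≈ 0#
      ⟪𝟘⟫ [] = ≈-refl
      ⟪𝟘⟫ (x ∷ ρ) = ≈-trans (identityˡ _) (⟪𝟘⟫ ρ)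

      unit : ∀ {n} → Fin n → Vec ℕ n
      unit zero    = 1 ∷ 𝟘
      unit (suc i) = 0 ∷ unit i

      ⟪unit⟫ : ∀ {n} (i : Fin n) ρ → ⟪ unit i ⟫ ρ ≈ lookup ρ i
      ⟪unit⟫ zero (x ∷ ρ) = ≈-trans (∙-cong (identityʳ x) (⟪𝟘⟫ ρ)) (identityʳ x)
      ⟪unit⟫ (suc i) (x ∷ ρ) = ≈-trans (identityˡ _) (⟪unit⟫ i ρ)

      -- Positive and negative coefficients are kept apart, linked by e + minus e = plus e, so that
      -- the group only ever sees natural multiples.
      plus minus : ∀ {n} → Expr n → Vec ℕ n
      plus (:var i) = unit i
      plus (e :+ f) = plus e ⊞ plus f
      plus (e :- f) = plus e ⊞ minus f
      plus (:- e)   = minus e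
      plus :0       = 𝟘
      minus (:var i) = 𝟘
      minus (e :+ f) = minus e ⊞ minus f
      minus (e :- f) = minus e ⊞ plus f
      minus (:- e)   = plus e
      minus :0       = 𝟘

      neg-lemma : ∀ {x a b} → x + a ≈ b → - x + b ≈ a
      neg-lemma {x} {a} h = ≈-trans (∙-cong ≈-refl (≈-sym h)) (≈-trans (≈-sym (assoc _ _ _))
        (≈-trans (∙-cong (inverseˡ x) ≈-refl) (identityˡ a)))

      normal : ∀ {n} (e : Expr n) ρ → ⟦ e ⟧ ρ + ⟪ minus e ⟫ ρ ≈ ⟪ plus e ⟫ ρ
      normal (:var i) ρ = ≈-trans (∙-cong ≈-refl (⟪𝟘⟫ ρ)) (≈-trans (identityʳ _) (≈-sym (⟪unit⟫ i ρ)))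
      normal (e :+ f) ρ = ≈-trans (∙-cong ≈-refl (⟪⊞⟫ (minus e) (minus f) ρ)) (≈-trans (interchange _ _ _ _)
        (≈-trans (∙-cong (normal e ρ) (normal f ρ)) (≈-sym (⟪⊞⟫ (plus e) (plus f) ρ))))
      normal (e :- f) ρ = ≈-trans (∙-cong ≈-refl (⟪⊞⟫ (minus e) (plus f) ρ)) (≈-trans (interchange _ _ _ _)
        (≈-trans (∙-cong (normal e ρ) (neg-lemma (normal f ρ))) (≈-sym (⟪⊞⟫ (plus e) (minus f) ρ))))
      normal (:- e) ρ = neg-lemma (normal e ρ)
      normal :0 ρ = ≈-trans (identityˡ _) (≈-refl)

      +-monoʳ : ∀ z {x y} → x ≤ y → z + x ≤ z + y
      +-monoʳ z h = ≤-trans (≤-reflexive (comm _ _)) (≤-trans (+-monoˡ-≤ _ _ z h) (≤-reflexive (comm _ _)))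

      +-cancel : ∀ z {x y} → x + z ≤ y + z → x ≤ y
      +-cancel z {x} {y} h = ≤-trans (≤-reflexive (≈-sym (drop x))) (≤-trans (+-monoˡ-≤ _ _ (- z) h) (≤-reflexive (drop y)))
        where
        drop : ∀ x → (x + z) + - z ≈ x
        drop x = ≈-trans (assoc _ _ _) (≈-trans (∙-cong ≈-refl (inverseʳ z)) (identityʳ x))

      -- Adding `minus e` and `minus f` to both sides of e ≤ f leaves only natural coefficients.
      lhs rhs : ∀ {n} → Expr n → Expr n → Vec ℕ n
      lhs e f = plus e ⊞ minus f
      rhs e f = plus f ⊞ minus e

      lhs-≈ : ∀ {n} (e f : Expr n) ρ → ⟪ lhs e f ⟫ ρ ≈ ⟦ e ⟧ ρ + (⟪ minus e ⟫ ρ + ⟪ minus f ⟫ ρ)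
      lhs-≈ e f ρ = ≈-trans (⟪⊞⟫ (plus e) (minus f) ρ) (≈-trans (∙-cong (≈-sym (normal e ρ)) ≈-refl) (assoc _ _ _))

      rhs-≈ : ∀ {n} (e f : Expr n) ρ → ⟪ rhs e f ⟫ ρ ≈ ⟦ f ⟧ ρ + (⟪ minus e ⟫ ρ + ⟪ minus f ⟫ ρ)
      rhs-≈ e f ρ = ≈-trans (lhs-≈ f e ρ) (∙-cong ≈-refl (comm _ _))

      record Ineq (n : ℕ) : Set where
        constructor ineq
        field
          strict : Bool
          small large : Vec ℕ n

      Valid : ∀ {n} → Vec Carrier n → Ineq n → Set ℓ
      Valid ρ (ineq false l r) = ⟪ l ⟫ ρ ≤ ⟪ r ⟫ ρ
      Valid ρ (ineq true  l r) = ⟪ l ⟫ ρ < ⟪ r ⟫ ρ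

      AllValid : ∀ {n} → Vec Carrier n → List (Ineq n) → Set ℓ
      AllValid ρ [] = ⊤
      AllValid ρ (i ∷ is) = Valid ρ i × AllValid ρ is

      ineqs : ∀ {n} → Atom n → List (Ineq n)
      ineqs (e :≤ f) = ineq false (lhs e f) (rhs e f) ∷ []
      ineqs (e :< f) = ineq true (lhs e f) (rhs e f) ∷ []
      ineqs (e :≈ f) = ineq false (lhs e f) (rhs e f) ∷ ineq false (lhs f e) (rhs f e) ∷ []

      valid-≤ : ∀ {n} (e f : Expr n) ρ → ⟦ e ⟧ ρ ≤ ⟦ f ⟧ ρ → ⟪ lhs e f ⟫ ρ ≤ ⟪ rhs e f ⟫ ρ
      valid-≤ e f ρ h = ≤-trans (≤-reflexive (lhs-≈ e f ρ)) (≤-trans (+-monoˡ-≤ _ _ _ h) (≤-reflexive (≈-sym (rhs-≈ e f ρ))))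

      valid-< : ∀ {n} (e f : Expr n) ρ → ⟦ e ⟧ ρ < ⟦ f ⟧ ρ → ⟪ lhs e f ⟫ ρ < ⟪ rhs e f ⟫ ρ
      valid-< e f ρ h k = h (+-cancel _ (≤-trans (≤-reflexive (≈-sym (rhs-≈ e f ρ))) (≤-trans k (≤-reflexive (lhs-≈ e f ρ)))))

      allIneqs : ∀ {n} → List (Atom n) → List (Ineq n)
      allIneqs [] = []
      allIneqs (a ∷ as) = ineqs a ++ allIneqs as

      allValid : ∀ {n} (ρ : Vec Carrier n) as → AllHold ρ as → AllValid ρ (allIneqs as)
      allValid ρ [] _ = tt
      allValid ρ ((e :≤ f) ∷ as) (h , hs) = valid-≤ e f ρ h , allValid ρ as hs
      allValid ρ ((e :< f) ∷ as) (h , hs) = valid-< e f ρ h , allValid ρ as hs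
      allValid ρ ((e :≈ f) ∷ as) (h , hs) =
        valid-≤ e f ρ (≤-reflexive h) , valid-≤ f e ρ (≤-reflexive (≈-sym h)) , allValid ρ as hs

      addIneq : ∀ {n} → Ineq n → Ineq n → Ineq n
      addIneq (ineq s l r) (ineq s′ l′ r′) = ineq (s ∨ s′) (l ⊞ l′) (r ⊞ r′)

      add-≤ : ∀ {a b c d} → a ≤ b → c ≤ d → a + c ≤ b + d
      add-≤ h k = ≤-trans (+-monoˡ-≤ _ _ _ h) (+-monoʳ _ k)

      add-< : ∀ {a b c d} → a < b → c ≤ d → a + c < b + d
      add-< {c = c} h k m = h (+-cancel c (≤-trans (+-monoʳ _ k) m))

      <⇒≤ : ∀ {a b} → a < b → a ≤ b
      <⇒≤ {a} {b} h with total a b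
      ... | inj₁ le = le
      ... | inj₂ ge = ⊥-elim (h ge)

      resp-≤ : ∀ {a b c d} → a ≈ c → b ≈ d → c ≤ d → a ≤ b
      resp-≤ p q h = ≤-trans (≤-reflexive p) (≤-trans h (≤-reflexive (≈-sym q)))

      add-valid : ∀ {n} ρ (i j : Ineq n) → Valid ρ i → Valid ρ j → Valid ρ (addIneq i j)
      add-valid ρ (ineq false l r) (ineq false l′ r′) p q = resp-≤ (⟪⊞⟫ l l′ ρ) (⟪⊞⟫ r r′ ρ) (add-≤ p q)
      add-valid ρ (ineq true l r) (ineq false l′ r′) p q m =
        add-< p q (resp-≤ (≈-sym (⟪⊞⟫ r r′ ρ)) (≈-sym (⟪⊞⟫ l l′ ρ)) m)
      add-valid ρ (ineq true l r) (ineq true l′ r′) p q m =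
        add-< p (<⇒≤ q) (resp-≤ (≈-sym (⟪⊞⟫ r r′ ρ)) (≈-sym (⟪⊞⟫ l l′ ρ)) m)
      add-valid ρ (ineq false l r) (ineq true l′ r′) p q m =
        add-< q p (resp-≤ (≈-trans (comm _ _) (≈-sym (⟪⊞⟫ r r′ ρ))) (≈-trans (comm _ _) (≈-sym (⟪⊞⟫ l l′ ρ))) m)

      addTimes : ∀ {n} → ℕ → Ineq n → Ineq n → Ineq n
      addTimes zero i acc = acc
      addTimes (suc k) i acc = addIneq i (addTimes k i acc)

      combine : ∀ {n} → List ℕ → List (Ineq n) → Ineq n
      combine (k ∷ ks) (i ∷ is) = addTimes k i (combine ks is)
      combine _ _ = ineq false 𝟘 𝟘

      combine-valid : ∀ {n} (ρ : Vec Carrier n) ks is → AllValid ρ is → Valid ρ (combine ks is)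
      combine-valid ρ [] is _ = ≤-refl
      combine-valid ρ (k ∷ ks) [] _ = ≤-refl
      combine-valid ρ (k ∷ ks) (i ∷ is) (v , vs) = go k
        where
        go : ∀ k → Valid ρ (addTimes k i (combine ks is))
        go zero = combine-valid ρ ks is vs
        go (suc k) = add-valid ρ i _ v (go k)

      same? : ∀ {n} → Vec ℕ n → Vec ℕ n → Bool
      same? [] [] = true
      same? (k ∷ ks) (l ∷ ls) = (k ≡ᵇ l) ∧ same? ks ls

      ≡ᵇ-sound : ∀ k l → T (k ≡ᵇ l) → k ≡ l
      ≡ᵇ-sound zero zero _ = ≡.refl
      ≡ᵇ-sound (suc k) (suc l) t = ≡.cong suc (≡ᵇ-sound k l t)

      ∧-split : ∀ {a b} → T (a ∧ b) → T a × T b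
      ∧-split {true} t = _ , t

      same?-sound : ∀ {n} (k l : Vec ℕ n) → T (same? k l) → k ≡ l
      same?-sound [] [] _ = ≡.refl
      same?-sound (k ∷ ks) (l ∷ ls) t with ∧-split {k ≡ᵇ l} t
      ... | p , q = ≡.cong₂ _∷_ (≡ᵇ-sound k l p) (same?-sound ks ls q)

      -- A certificate is accepted when the combination reads x < x with literally equal
      -- coefficients; hence at least one strict inequality must take part in it.
      refutes : ∀ {n} → Ineq n → Bool
      refutes (ineq s l r) = s ∧ same? l r

      refutes-sound : ∀ {n} (ρ : Vec Carrier n) i → T (refutes i) → ¬ Valid ρ i
      refutes-sound ρ (ineq true l r) t v with same?-sound l r t
      ... | ≡.refl = v ≤-refl

      -- An inequality 0 ≤ Σ kᵢ xᵢ (or <) together with the multipliers that produced it.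
      Row : ℕ → Set
      Row n = Bool × Vec ℤ n × List ℕ

      scaleℤ : ∀ {n} → ℕ → Vec ℤ n → Vec ℤ n
      scaleℤ k = Vec.map (λ z → + k ℤ.* z)
      addList : List ℕ → List ℕ → List ℕ
      addList [] l = l
      addList (k ∷ ks) [] = k ∷ ks
      addList (k ∷ ks) (l ∷ ls) = (k ℕ.+ l) ∷ addList ks ls

      rows : ∀ {n} → ℕ → List (Ineq n) → List (Row n)
      rows k [] = []
      rows k (ineq s l r ∷ is) =
        (s , zipWith (λ a b → + b ℤ.- + a) l r , List.replicate k 0 ++ (1 ∷ [])) ∷ rows (suc k) is

      data Sign : Set where
        neg nul pos : Sign
      sign : ∀ {n} → Row (suc n) → Sign
      sign (_ , (+ zero) ∷ _ , _) = nul
      sign (_ , (+ suc _) ∷ _ , _) = pos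
      sign (_ , -[1+ _ ] ∷ _ , _) = neg

      filterSign : ∀ {n} → Sign → List (Row (suc n)) → List (Row (suc n))
      filterSign s [] = []
      filterSign s (r ∷ rs) with s | sign r
      ... | neg | neg = r ∷ filterSign s rs
      ... | nul | nul = r ∷ filterSign s rs
      ... | pos | pos = r ∷ filterSign s rs
      ... | _ | _ = filterSign s rs

      dropHead : ∀ {n} → Row (suc n) → Row n
      dropHead (s , _ ∷ v , m) = s , v , m

      -- The first row has a positive and the second a negative leading coefficient; scaling each by
      -- the absolute value of the other makes them cancel. The multipliers record the same
      -- combination.
      resolve : ∀ {n} → Row (suc n) → Row (suc n) → Row n
      resolve (s , a ∷ v , m) (s′ , b ∷ w , m′) =
        s ∨ s′ , zipWith ℤ._+_ (scaleℤ ∣b∣ v) (scaleℤ ∣a∣ w) , addList (List.map (∣b∣ ℕ.*_) m) (List.map (∣a∣ ℕ.*_) m′)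
        where
        ∣a∣ ∣b∣ : ℕ
        ∣a∣ = ℤ.∣ a ∣
        ∣b∣ = ℤ.∣ b ∣

      -- Once all variables are gone, a strict row reads 0 < 0 and its multipliers are the
      -- certificate. If there is none, the empty certificate combines to 0 ≤ 0, which `refutes`
      -- rejects.
      eliminate : ∀ {n} → List (Row n) → List ℕ
      eliminate {zero} [] = []
      eliminate {zero} ((true , _ , m) ∷ rs) = m
      eliminate {zero} ((false , _ , m) ∷ rs) = eliminate rs
      eliminate {suc n} rs = eliminate (List.map dropHead (filterSign nul rs) ++
        concatMap (λ p → List.map (resolve p) (filterSign neg rs)) (filterSign pos rs))

      refutable : ∀ {n} → List (Ineq n) → Bool
      refutable is = refutes (combine (eliminate (rows 0 is)) is)

      refutable-sound : ∀ {n} (ρ : Vec Carrier n) is → T (refutable is) → ¬ AllValid ρ is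
      refutable-sound ρ is t vs = refutes-sound ρ (combine (eliminate (rows 0 is)) is) t (combine-valid ρ (eliminate (rows 0 is)) is vs)

      -- Goals are proved by contradiction; an equation has two strict alternatives, each refuted
      -- separately before `antisym` joins the results.
      negations : ∀ {n} → Atom n → List (Atom n)
      negations (e :≤ f) = (f :< e) ∷ []
      negations (e :< f) = (f :≤ e) ∷ []
      negations (e :≈ f) = (f :< e) ∷ (e :< f) ∷ []

      allRefutable : ∀ {n} → List (Ineq n) → List (Atom n) → Bool
      allRefutable is [] = true
      allRefutable is (a ∷ as) = refutable (ineqs a ++ is) ∧ allRefutable is as

    provable : ∀ {n} → Sequent n → Bool
    provable (hs ⊢ a) = allRefutable (allIneqs hs) (negations a)

    Entails : ∀ {n} → Vec Carrier n → Sequent n → Set ℓ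
    Entails ρ (hs ⊢ a) = AllHold ρ hs → Holds ρ a

    private
      prove-≤ : ∀ {n} (ρ : Vec Carrier n) hs e f → T (refutable (ineqs (f :< e) ++ allIneqs hs)) → AllHold ρ hs → ⟦ e ⟧ ρ ≤ ⟦ f ⟧ ρ
      prove-≤ ρ hs e f t vs with ⟦ e ⟧ ρ ≤? ⟦ f ⟧ ρ
      ... | yes p = p
      ... | no ¬p = ⊥-elim (refutable-sound ρ _ t (valid-< f e ρ ¬p , allValid ρ hs vs))

    opaque
      linarith-sound : ∀ {n} (ρ : Vec Carrier n) s → T (provable s) → Entails ρ s
      linarith-sound ρ (hs ⊢ (e :≤ f)) t vs = prove-≤ ρ hs e f (proj₁ (∧-split {refutable (ineqs (f :< e) ++ allIneqs hs)} t)) vs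
      linarith-sound ρ (hs ⊢ (e :< f)) t vs p =
        refutable-sound ρ _ (proj₁ (∧-split {refutable (ineqs (f :≤ e) ++ allIneqs hs)} t)) (valid-≤ f e ρ p , allValid ρ hs vs)
      linarith-sound ρ (hs ⊢ (e :≈ f)) t vs with ∧-split {refutable (ineqs (f :< e) ++ allIneqs hs)} t
      ... | p , q = antisym (prove-≤ ρ hs e f p vs) (prove-≤ ρ hs f e (proj₁ (∧-split {refutable (ineqs (e :< f) ++ allIneqs hs)} q)) vs)

    -- The hidden argument reduces to the unit type when the search for a certificate succeeds, so
    -- it is filled in by evaluation. The hypotheses are passed as a tuple ending in `tt`.
    linarith : ∀ {n} (ρ : Vec Carrier n) (f : N-ary n (Expr n) (Sequent n)) →
               {T (provable (f $ⁿ tabulate :var))} → Entails ρ (f $ⁿ tabulate :var)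
    linarith ρ f {t} = linarith-sound ρ (f $ⁿ tabulate :var) t

-- The metric of a cone over bipartite graphs, in coordinates.

module ConeGeometry where

  open import Level using (Level; _⊔_)
  open import Data.Product.Base using (∃; _×_; _,_; proj₁; proj₂)
  open import Data.Sum.Base as Sum using (_⊎_; inj₁; inj₂; [_,_]′)
  open import Data.Unit.Polymorphic.Base using (tt)
  open import Data.Vec.Base using (Vec; []; _∷_)
  open import Data.List.Base using ([]; _∷_)
  open import Function.Base using (_∘_)
  open import Relation.Binary.Definitions using (DecidableEquality)
  open import Relation.Binary.PropositionalEquality as ≡ using (_≡_; _≢_; refl)
  open import Relation.Binary.Structures using (IsTotalOrder)
  open import Relation.Nullary using (¬_; Dec; yes; no; contradiction)
  open LinearInequalities

  -- The cone over the disjoint union, over X, of the complete bipartite graphs on two copies of X: the point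
  -- (X, x, y, u, h) lies at height h over the point at distance u from x on the edge from x to y.
  module BipartiteCone {κ ℓ} (G : OrderedAbelianGroup κ ℓ) (1# : OrderedAbelianGroup.Carrier G)
    (0≤1 : OrderedAbelianGroup._≤_ G (OrderedAbelianGroup.0# G) 1#)
    {L : Set κ} (_≟_ : DecidableEquality L) where
    open OrderedAbelianGroup G public
    open LinearArithmetic G
    open IsTotalOrder isTotalOrder public using (total; antisym; module Eq)
      renaming (refl to ≤-refl; trans to ≤-trans; reflexive to ≤-reflexive)

    private
      K : Set κ
      K = Carrier

    -- All case distinctions in the metric go through this function, so that a formula can imitate
    -- them later.
    pick : ∀ {a} {P : Set a} → Dec P → K → K → K
    pick (yes _) x y = x
    pick (no _)  x y = y

    record Raw : Set κ where
      constructor raw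
      field
        X x y : L
        u h : K

    record Ok (p : Raw) : Set ℓ where
      constructor ok
      open Raw p
      field
        0≤u : 0# ≤ u
        u≤1 : u ≤ 1#
        0≤h : 0# ≤ h

    opaque
      gap : K → K → K
      gap a b = pick (a ≤? b) (b + - a) (a + - b)

      -- `α` is the metric of a star whose legs are indexed by x and meet at u = 1, `β` that of a
      -- star whose legs are indexed by y and meet at u = 0. Their sum minus |u - u′| is the path
      -- metric of the bipartite graph, as the four cases of equal or distinct x and y show. `τ` is
      -- the metric of the tree of rays joined at the apex. `δ` is the shorter of the direct route
      -- over one X, height difference plus `D`, and the route through the apex; the graph is not
      -- rescaled with the height, since only the coarse shape matters.
      α β D τ δ : Raw → Raw → K
      α (raw _ x _ u _) (raw _ x′ _ u′ _) = pick (x ≟ x′) (gap u u′) ((1# + 1#) + - (u + u′))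
      β (raw _ _ y u _) (raw _ _ y′ u′ _) = pick (y ≟ y′) (gap u u′) (u + u′)
      D p q = (α p q + β p q) + - gap (Raw.u p) (Raw.u q)
      τ (raw X _ _ _ h) (raw X′ _ _ _ h′) = pick (X ≟ X′) (gap h h′) (h + h′)
      δ p q = pick (Raw.X p ≟ Raw.X q)
        (pick ((gap (Raw.h p) (Raw.h q) + D p q) ≤? (Raw.h p + Raw.h q)) (gap (Raw.h p) (Raw.h q) + D p q) (Raw.h p + Raw.h q))
        (Raw.h p + Raw.h q)

    <⇒≤ : ∀ {a b} → ¬ b ≤ a → a ≤ b
    <⇒≤ {a} {b} h = [ (λ p → p) , (λ p → contradiction p h) ]′ (total a b)

    add-mono : ∀ {a b c d} → a ≤ b → c ≤ d → a + c ≤ b + d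
    add-mono {a} {b} {c} {d} p q = linarith (a ∷ b ∷ c ∷ d ∷ []) (λ a b c d → (a :≤ b) ∷ (c :≤ d) ∷ [] ⊢ a :+ c :≤ b :+ d) (p , q , tt)

    opaque
      unfolding δ

      gap-spec : ∀ a b → (a ≤ b × gap a b ≈ b + - a) ⊎ (b ≤ a × gap a b ≈ a + - b)
      gap-spec a b with a ≤? b
      ... | yes p = inj₁ (p , Eq.refl)
      ... | no ¬p = inj₂ (<⇒≤ ¬p , Eq.refl)

      gap-≤ : ∀ {a b c} → a + - b ≤ c → b + - a ≤ c → gap a b ≤ c
      gap-≤ {a} {b} p q with a ≤? b
      ... | yes _ = q
      ... | no  _ = p

      gap-≥ˡ : ∀ a b → a + - b ≤ gap a b
      gap-≥ˡ a b = [ (λ (p , e) → linarith (a ∷ b ∷ gap a b ∷ []) (λ a b g → (a :≤ b) ∷ (g :≈ b :- a) ∷ [] ⊢ a :- b :≤ g) (p , e , tt))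
                   , (λ (p , e) → ≤-reflexive (Eq.sym e)) ]′ (gap-spec a b)

      gap-≥ʳ : ∀ a b → b + - a ≤ gap a b
      gap-≥ʳ a b = [ (λ (p , e) → ≤-reflexive (Eq.sym e))
                   , (λ (p , e) → linarith (a ∷ b ∷ gap a b ∷ []) (λ a b g → (b :≤ a) ∷ (g :≈ a :- b) ∷ [] ⊢ b :- a :≤ g) (p , e , tt)) ]′ (gap-spec a b)

      gap-sym : ∀ a b → gap a b ≤ gap b a
      gap-sym a b = gap-≤ (gap-≥ʳ b a) (gap-≥ˡ b a)

      gap-self : ∀ a → gap a a ≈ 0#
      gap-self a = [ f , f ]′ (gap-spec a a)
        where
        f : a ≤ a × gap a a ≈ a + - a → gap a a ≈ 0#
        f (_ , e) = linarith (a ∷ gap a a ∷ []) (λ a g → (g :≈ a :- a) ∷ [] ⊢ g :≈ :0) (e , tt)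

      gap-nonNeg : ∀ a b → 0# ≤ gap a b
      gap-nonNeg a b = linarith (a ∷ b ∷ gap a b ∷ []) (λ a b g → (a :- b :≤ g) ∷ (b :- a :≤ g) ∷ [] ⊢ :0 :≤ g) (gap-≥ˡ a b , gap-≥ʳ a b , tt)

      gap-triangle : ∀ a b c → gap a c ≤ gap a b + gap b c
      gap-triangle a b c = gap-≤
        (linarith (a ∷ b ∷ c ∷ gap a b ∷ gap b c ∷ []) (λ a b c g g′ → (a :- b :≤ g) ∷ (b :- c :≤ g′) ∷ [] ⊢ a :- c :≤ g :+ g′)
          (gap-≥ˡ a b , gap-≥ˡ b c , tt))
        (linarith (a ∷ b ∷ c ∷ gap a b ∷ gap b c ∷ []) (λ a b c g g′ → (b :- a :≤ g) ∷ (c :- b :≤ g′) ∷ [] ⊢ c :- a :≤ g :+ g′)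
          (gap-≥ʳ a b , gap-≥ʳ b c , tt))

      gap-≤-+ : ∀ {a b} → 0# ≤ a → 0# ≤ b → gap a b ≤ a + b
      gap-≤-+ {a} {b} p q = gap-≤
        (linarith (a ∷ b ∷ []) (λ a b → (:0 :≤ b) ∷ [] ⊢ a :- b :≤ a :+ b) (q , tt))
        (linarith (a ∷ b ∷ []) (λ a b → (:0 :≤ a) ∷ [] ⊢ b :- a :≤ a :+ b) (p , tt))

    branch : ∀ (x x′ : L) g s → (x ≡ x′ × pick (x ≟ x′) g s ≈ g) ⊎ (x ≢ x′ × pick (x ≟ x′) g s ≈ s)
    branch x x′ g s with x ≟ x′
    ... | yes p = inj₁ (p , Eq.refl)
    ... | no ¬p = inj₂ (¬p , Eq.refl)

    apart : ∀ {x z : L} y → x ≢ z → x ≢ y ⊎ y ≢ z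
    apart {x} y n with x ≟ y
    ... | yes refl = inj₂ n
    ... | no ¬p = inj₁ ¬p

    opaque
      unfolding δ

      α-eq : ∀ p q → Raw.x p ≡ Raw.x q → α p q ≈ gap (Raw.u p) (Raw.u q)
      α-eq p q e = [ proj₂ , (λ (n , _) → contradiction e n) ]′ (branch (Raw.x p) (Raw.x q) _ _)
      α-neq : ∀ p q → Raw.x p ≢ Raw.x q → α p q ≈ (1# + 1#) + - (Raw.u p + Raw.u q)
      α-neq p q n = [ (λ (e , _) → contradiction e n) , proj₂ ]′ (branch (Raw.x p) (Raw.x q) _ _)
      β-eq : ∀ p q → Raw.y p ≡ Raw.y q → β p q ≈ gap (Raw.u p) (Raw.u q)
      β-eq p q e = [ proj₂ , (λ (n , _) → contradiction e n) ]′ (branch (Raw.y p) (Raw.y q) _ _)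
      β-neq : ∀ p q → Raw.y p ≢ Raw.y q → β p q ≈ Raw.u p + Raw.u q
      β-neq p q n = [ (λ (e , _) → contradiction e n) , proj₂ ]′ (branch (Raw.y p) (Raw.y q) _ _)
      τ-eq : ∀ p q → Raw.X p ≡ Raw.X q → τ p q ≈ gap (Raw.h p) (Raw.h q)
      τ-eq p q e = [ proj₂ , (λ (n , _) → contradiction e n) ]′ (branch (Raw.X p) (Raw.X q) _ _)
      τ-neq : ∀ p q → Raw.X p ≢ Raw.X q → τ p q ≈ Raw.h p + Raw.h q
      τ-neq p q n = [ (λ (e , _) → contradiction e n) , proj₂ ]′ (branch (Raw.X p) (Raw.X q) _ _)

      eq? : ∀ {a} {A : Set a} (x x′ : L) → (x ≡ x′ → A) → (x ≢ x′ → A) → A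
      eq? x x′ f g with x ≟ x′
      ... | yes p = f p
      ... | no ¬p = g ¬p

      α≥gap : ∀ {p q} → Ok p → Ok q → gap (Raw.u p) (Raw.u q) ≤ α p q
      α≥gap {p} {q} (ok a b _) (ok a′ b′ _) = eq? (Raw.x p) (Raw.x q) (λ e → ≤-reflexive (Eq.sym (α-eq p q e)))
        (λ n → gap-≤ (linarith (Raw.u p ∷ Raw.u q ∷ 1# ∷ α p q ∷ []) (λ u v o a → (u :≤ o) ∷ (a :≈ o :+ o :- (u :+ v)) ∷ [] ⊢ u :- v :≤ a) (b , α-neq p q n , tt))
                     (linarith (Raw.u p ∷ Raw.u q ∷ 1# ∷ α p q ∷ []) (λ u v o a → (v :≤ o) ∷ (a :≈ o :+ o :- (u :+ v)) ∷ [] ⊢ v :- u :≤ a) (b′ , α-neq p q n , tt)))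

      β≥gap : ∀ {p q} → Ok p → Ok q → gap (Raw.u p) (Raw.u q) ≤ β p q
      β≥gap {p} {q} (ok a b _) (ok a′ b′ _) = eq? (Raw.y p) (Raw.y q) (λ e → ≤-reflexive (Eq.sym (β-eq p q e)))
        (λ n → ≤-trans (gap-≤-+ a a′) (≤-reflexive (Eq.sym (β-neq p q n))))

      -- If the outer points are on different legs, the middle one is on another leg than one of
      -- them. That distance passes through the centre, and the other is at least the difference of
      -- parameters.
      α-triangle : ∀ {p q r} → Ok p → Ok q → Ok r → α p r ≤ α p q + α q r
      α-triangle {p} {q} {r} op oq or = eq? (Raw.x p) (Raw.x r)
        (λ e → linarith (α p r ∷ gap (Raw.u p) (Raw.u r) ∷ gap (Raw.u p) (Raw.u q) ∷ gap (Raw.u q) (Raw.u r) ∷ α p q ∷ α q r ∷ [])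
          (λ a g₁₃ g₁₂ g₂₃ a₁₂ a₂₃ → (a :≈ g₁₃) ∷ (g₁₃ :≤ g₁₂ :+ g₂₃) ∷ (g₁₂ :≤ a₁₂) ∷ (g₂₃ :≤ a₂₃) ∷ [] ⊢ a :≤ a₁₂ :+ a₂₃)
          (α-eq p r e , gap-triangle _ _ _ , α≥gap op oq , α≥gap oq or , tt))
        (λ n → [ (λ m → linarith (α p r ∷ α p q ∷ α q r ∷ gap (Raw.u q) (Raw.u r) ∷ Raw.u p ∷ Raw.u q ∷ Raw.u r ∷ 1# ∷ [])
                   (λ a a₁₂ a₂₃ g u v w o → (a :≈ o :+ o :- (u :+ w)) ∷ (a₁₂ :≈ o :+ o :- (u :+ v)) ∷ (g :≤ a₂₃) ∷ (v :- w :≤ g) ∷ [] ⊢ a :≤ a₁₂ :+ a₂₃)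
                   (α-neq p r n , α-neq p q m , α≥gap oq or , gap-≥ˡ _ _ , tt))
               , (λ m → linarith (α p r ∷ α p q ∷ α q r ∷ gap (Raw.u p) (Raw.u q) ∷ Raw.u p ∷ Raw.u q ∷ Raw.u r ∷ 1# ∷ [])
                   (λ a a₁₂ a₂₃ g u v w o → (a :≈ o :+ o :- (u :+ w)) ∷ (a₂₃ :≈ o :+ o :- (v :+ w)) ∷ (g :≤ a₁₂) ∷ (v :- u :≤ g) ∷ [] ⊢ a :≤ a₁₂ :+ a₂₃)
                   (α-neq p r n , α-neq q r m , α≥gap op oq , gap-≥ʳ _ _ , tt)) ]′ (apart (Raw.x q) n))

      β-triangle : ∀ {p q r} → Ok p → Ok q → Ok r → β p r ≤ β p q + β q r
      β-triangle {p} {q} {r} op oq or = eq? (Raw.y p) (Raw.y r)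
        (λ e → linarith (β p r ∷ gap (Raw.u p) (Raw.u r) ∷ gap (Raw.u p) (Raw.u q) ∷ gap (Raw.u q) (Raw.u r) ∷ β p q ∷ β q r ∷ [])
          (λ a g₁₃ g₁₂ g₂₃ a₁₂ a₂₃ → (a :≈ g₁₃) ∷ (g₁₃ :≤ g₁₂ :+ g₂₃) ∷ (g₁₂ :≤ a₁₂) ∷ (g₂₃ :≤ a₂₃) ∷ [] ⊢ a :≤ a₁₂ :+ a₂₃)
          (β-eq p r e , gap-triangle _ _ _ , β≥gap op oq , β≥gap oq or , tt))
        (λ n → [ (λ m → linarith (β p r ∷ β p q ∷ β q r ∷ gap (Raw.u q) (Raw.u r) ∷ Raw.u p ∷ Raw.u q ∷ Raw.u r ∷ [])
                   (λ a a₁₂ a₂₃ g u v w → (a :≈ u :+ w) ∷ (a₁₂ :≈ u :+ v) ∷ (g :≤ a₂₃) ∷ (w :- v :≤ g) ∷ [] ⊢ a :≤ a₁₂ :+ a₂₃)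
                   (β-neq p r n , β-neq p q m , β≥gap oq or , gap-≥ʳ _ _ , tt))
               , (λ m → linarith (β p r ∷ β p q ∷ β q r ∷ gap (Raw.u p) (Raw.u q) ∷ Raw.u p ∷ Raw.u q ∷ Raw.u r ∷ [])
                   (λ a a₁₂ a₂₃ g u v w → (a :≈ u :+ w) ∷ (a₂₃ :≈ v :+ w) ∷ (g :≤ a₁₂) ∷ (u :- v :≤ g) ∷ [] ⊢ a :≤ a₁₂ :+ a₂₃)
                   (β-neq p r n , β-neq q r m , β≥gap op oq , gap-≥ˡ _ _ , tt)) ]′ (apart (Raw.y q) n))

      -- If u₂ exceeds u₁ and u₃, then β − gap, which is twice the minimum of the two parameters on different
      -- legs, satisfies the triangle inequality; and dually for α.
      β-excess : ∀ {p q r} → Ok p → Ok q → Ok r → Raw.u p ≤ Raw.u q → Raw.u r ≤ Raw.u q →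
                 β p r + (gap (Raw.u p) (Raw.u q) + gap (Raw.u q) (Raw.u r)) ≤ (β p q + β q r) + gap (Raw.u p) (Raw.u r)
      β-excess {p} {q} {r} op oq or h k = eq? (Raw.y p) (Raw.y r)
        (λ e → linarith (β p r ∷ gap (Raw.u p) (Raw.u r) ∷ gap (Raw.u p) (Raw.u q) ∷ gap (Raw.u q) (Raw.u r) ∷ β p q ∷ β q r ∷ [])
          (λ a g₁₃ g₁₂ g₂₃ a₁₂ a₂₃ → (a :≈ g₁₃) ∷ (g₁₂ :≤ a₁₂) ∷ (g₂₃ :≤ a₂₃) ∷ [] ⊢ a :+ (g₁₂ :+ g₂₃) :≤ a₁₂ :+ a₂₃ :+ g₁₃)
          (β-eq p r e , β≥gap op oq , β≥gap oq or , tt))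
        (λ n → [ (λ m → linarith (β p r ∷ β p q ∷ β q r ∷ gap (Raw.u p) (Raw.u r) ∷ gap (Raw.u p) (Raw.u q) ∷ gap (Raw.u q) (Raw.u r) ∷ Raw.u p ∷ Raw.u q ∷ Raw.u r ∷ [])
                   (λ a a₁₂ a₂₃ g₁₃ g₁₂ g₂₃ u v w → (a :≈ u :+ w) ∷ (a₁₂ :≈ u :+ v) ∷ (g₂₃ :≤ a₂₃) ∷ (g₁₂ :≤ v :- u) ∷ (w :- u :≤ g₁₃) ∷ [] ⊢
                         a :+ (g₁₂ :+ g₂₃) :≤ a₁₂ :+ a₂₃ :+ g₁₃)
                   (β-neq p r n , β-neq p q m , β≥gap oq or , up , gap-≥ʳ _ _ , tt))
               , (λ m → linarith (β p r ∷ β p q ∷ β q r ∷ gap (Raw.u p) (Raw.u r) ∷ gap (Raw.u p) (Raw.u q) ∷ gap (Raw.u q) (Raw.u r) ∷ Raw.u p ∷ Raw.u q ∷ Raw.u r ∷ [])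
                   (λ a a₁₂ a₂₃ g₁₃ g₁₂ g₂₃ u v w → (a :≈ u :+ w) ∷ (a₂₃ :≈ v :+ w) ∷ (g₁₂ :≤ a₁₂) ∷ (g₂₃ :≤ v :- w) ∷ (u :- w :≤ g₁₃) ∷ [] ⊢
                         a :+ (g₁₂ :+ g₂₃) :≤ a₁₂ :+ a₂₃ :+ g₁₃)
                   (β-neq p r n , β-neq q r m , β≥gap op oq , down , gap-≥ˡ _ _ , tt)) ]′ (apart (Raw.y q) n))
        where
        up : gap (Raw.u p) (Raw.u q) ≤ Raw.u q + - Raw.u p
        up = gap-≤ (linarith (Raw.u p ∷ Raw.u q ∷ []) (λ u v → (u :≤ v) ∷ [] ⊢ u :- v :≤ v :- u) (h , tt)) ≤-refl
        down : gap (Raw.u q) (Raw.u r) ≤ Raw.u q + - Raw.u r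
        down = gap-≤ ≤-refl (linarith (Raw.u r ∷ Raw.u q ∷ []) (λ u v → (u :≤ v) ∷ [] ⊢ u :- v :≤ v :- u) (k , tt))

      α-excess : ∀ {p q r} → Ok p → Ok q → Ok r → Raw.u q ≤ Raw.u p → Raw.u q ≤ Raw.u r →
                 α p r + (gap (Raw.u p) (Raw.u q) + gap (Raw.u q) (Raw.u r)) ≤ (α p q + α q r) + gap (Raw.u p) (Raw.u r)
      α-excess {p} {q} {r} op oq or h k = eq? (Raw.x p) (Raw.x r)
        (λ e → linarith (α p r ∷ gap (Raw.u p) (Raw.u r) ∷ gap (Raw.u p) (Raw.u q) ∷ gap (Raw.u q) (Raw.u r) ∷ α p q ∷ α q r ∷ [])
          (λ a g₁₃ g₁₂ g₂₃ a₁₂ a₂₃ → (a :≈ g₁₃) ∷ (g₁₂ :≤ a₁₂) ∷ (g₂₃ :≤ a₂₃) ∷ [] ⊢ a :+ (g₁₂ :+ g₂₃) :≤ a₁₂ :+ a₂₃ :+ g₁₃)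
          (α-eq p r e , α≥gap op oq , α≥gap oq or , tt))
        (λ n → [ (λ m → linarith (α p r ∷ α p q ∷ α q r ∷ gap (Raw.u p) (Raw.u r) ∷ gap (Raw.u p) (Raw.u q) ∷ gap (Raw.u q) (Raw.u r) ∷ Raw.u p ∷ Raw.u q ∷ Raw.u r ∷ 1# ∷ [])
                   (λ a a₁₂ a₂₃ g₁₃ g₁₂ g₂₃ u v w o → (a :≈ o :+ o :- (u :+ w)) ∷ (a₁₂ :≈ o :+ o :- (u :+ v)) ∷ (g₂₃ :≤ a₂₃) ∷ (g₁₂ :≤ u :- v) ∷ (u :- w :≤ g₁₃) ∷ [] ⊢
                         a :+ (g₁₂ :+ g₂₃) :≤ a₁₂ :+ a₂₃ :+ g₁₃)
                   (α-neq p r n , α-neq p q m , α≥gap oq or , down , gap-≥ˡ _ _ , tt))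
               , (λ m → linarith (α p r ∷ α p q ∷ α q r ∷ gap (Raw.u p) (Raw.u r) ∷ gap (Raw.u p) (Raw.u q) ∷ gap (Raw.u q) (Raw.u r) ∷ Raw.u p ∷ Raw.u q ∷ Raw.u r ∷ 1# ∷ [])
                   (λ a a₁₂ a₂₃ g₁₃ g₁₂ g₂₃ u v w o → (a :≈ o :+ o :- (u :+ w)) ∷ (a₂₃ :≈ o :+ o :- (v :+ w)) ∷ (g₁₂ :≤ a₁₂) ∷ (g₂₃ :≤ w :- v) ∷ (w :- u :≤ g₁₃) ∷ [] ⊢
                         a :+ (g₁₂ :+ g₂₃) :≤ a₁₂ :+ a₂₃ :+ g₁₃)
                   (α-neq p r n , α-neq q r m , α≥gap op oq , up , gap-≥ʳ _ _ , tt)) ]′ (apart (Raw.x q) n))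
        where
        down : gap (Raw.u p) (Raw.u q) ≤ Raw.u p + - Raw.u q
        down = gap-≤ ≤-refl (linarith (Raw.u q ∷ Raw.u p ∷ []) (λ u v → (u :≤ v) ∷ [] ⊢ u :- v :≤ v :- u) (h , tt))
        up : gap (Raw.u q) (Raw.u r) ≤ Raw.u r + - Raw.u q
        up = gap-≤ (linarith (Raw.u q ∷ Raw.u r ∷ []) (λ u v → (u :≤ v) ∷ [] ⊢ u :- v :≤ v :- u) (k , tt)) ≤-refl

      -- If u₂ lies between u₁ and u₃, then the gaps add up.
      D-triangle : ∀ {p q r} → Ok p → Ok q → Ok r → D p r ≤ D p q + D q r
      D-triangle {p} {q} {r} op oq or = go (total (Raw.u p) (Raw.u q)) (total (Raw.u q) (Raw.u r))
        where
        ρ : Vec K 9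
        ρ = α p r ∷ α p q ∷ α q r ∷ β p r ∷ β p q ∷ β q r ∷ gap (Raw.u p) (Raw.u r) ∷ gap (Raw.u p) (Raw.u q) ∷ gap (Raw.u q) (Raw.u r) ∷ []
        between : gap (Raw.u p) (Raw.u q) + gap (Raw.u q) (Raw.u r) ≤ gap (Raw.u p) (Raw.u r) → D p r ≤ D p q + D q r
        between b = linarith ρ (λ a a₁ a₂ b b₁ b₂ g g₁ g₂ → (a :≤ a₁ :+ a₂) ∷ (b :≤ b₁ :+ b₂) ∷ (g₁ :+ g₂ :≤ g) ∷ [] ⊢
               a :+ b :- g :≤ (a₁ :+ b₁ :- g₁) :+ (a₂ :+ b₂ :- g₂)) (α-triangle op oq or , β-triangle op oq or , b , tt)
        go : Raw.u p ≤ Raw.u q ⊎ Raw.u q ≤ Raw.u p → Raw.u q ≤ Raw.u r ⊎ Raw.u r ≤ Raw.u q → D p r ≤ D p q + D q r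
        go (inj₁ h) (inj₁ k) = between (≤-trans (add-mono
            (gap-≤ {c = Raw.u q + - Raw.u p} (linarith (Raw.u p ∷ Raw.u q ∷ []) (λ u v → (u :≤ v) ∷ [] ⊢ u :- v :≤ v :- u) (h , tt)) ≤-refl)
            (gap-≤ {c = Raw.u r + - Raw.u q} (linarith (Raw.u q ∷ Raw.u r ∷ []) (λ u v → (u :≤ v) ∷ [] ⊢ u :- v :≤ v :- u) (k , tt)) ≤-refl))
          (linarith (Raw.u p ∷ Raw.u q ∷ Raw.u r ∷ gap (Raw.u p) (Raw.u r) ∷ []) (λ u v w g → (w :- u :≤ g) ∷ [] ⊢ (v :- u) :+ (w :- v) :≤ g) (gap-≥ʳ _ _ , tt)))
        go (inj₂ h) (inj₂ k) = between (≤-trans (add-mono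
            (gap-≤ {c = Raw.u p + - Raw.u q} ≤-refl (linarith (Raw.u q ∷ Raw.u p ∷ []) (λ u v → (u :≤ v) ∷ [] ⊢ u :- v :≤ v :- u) (h , tt)))
            (gap-≤ {c = Raw.u q + - Raw.u r} ≤-refl (linarith (Raw.u r ∷ Raw.u q ∷ []) (λ u v → (u :≤ v) ∷ [] ⊢ u :- v :≤ v :- u) (k , tt))))
          (linarith (Raw.u p ∷ Raw.u q ∷ Raw.u r ∷ gap (Raw.u p) (Raw.u r) ∷ []) (λ u v w g → (u :- w :≤ g) ∷ [] ⊢ (u :- v) :+ (v :- w) :≤ g) (gap-≥ˡ _ _ , tt)))
        -- The middle point has the largest parameter, so the gaps do not add up and the excess of
        -- `β` pays for the defect; in the next case it has the smallest and `α` pays.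
        go (inj₁ h) (inj₂ k) = linarith ρ (λ a a₁ a₂ b b₁ b₂ g g₁ g₂ → (a :≤ a₁ :+ a₂) ∷ (b :+ (g₁ :+ g₂) :≤ b₁ :+ b₂ :+ g) ∷ [] ⊢
               a :+ b :- g :≤ (a₁ :+ b₁ :- g₁) :+ (a₂ :+ b₂ :- g₂)) (α-triangle op oq or , β-excess op oq or h k , tt)
        go (inj₂ h) (inj₁ k) = linarith ρ (λ a a₁ a₂ b b₁ b₂ g g₁ g₂ → (b :≤ b₁ :+ b₂) ∷ (a :+ (g₁ :+ g₂) :≤ a₁ :+ a₂ :+ g) ∷ [] ⊢
               a :+ b :- g :≤ (a₁ :+ b₁ :- g₁) :+ (a₂ :+ b₂ :- g₂)) (β-triangle op oq or , α-excess op oq or h k , tt)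

      D-self : ∀ p → D p p ≈ 0#
      D-self p = linarith (α p p ∷ β p p ∷ gap (Raw.u p) (Raw.u p) ∷ []) (λ a b g → (a :≈ g) ∷ (b :≈ g) ∷ (g :≈ :0) ∷ [] ⊢ a :+ b :- g :≈ :0)
        (α-eq p p refl , β-eq p p refl , gap-self _ , tt)

      D-nonNeg : ∀ {p q} → Ok p → Ok q → 0# ≤ D p q
      D-nonNeg {p} {q} op oq = linarith (α p q ∷ β p q ∷ gap (Raw.u p) (Raw.u q) ∷ [])
        (λ a b g → (g :≤ a) ∷ (g :≤ b) ∷ (:0 :≤ g) ∷ [] ⊢ :0 :≤ a :+ b :- g) (α≥gap op oq , β≥gap op oq , gap-nonNeg _ _ , tt)

      D≥gap : ∀ {p q} → Ok p → Ok q → gap (Raw.u p) (Raw.u q) ≤ D p q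
      D≥gap {p} {q} op oq = linarith (α p q ∷ β p q ∷ gap (Raw.u p) (Raw.u q) ∷ [])
        (λ a b g → (g :≤ a) ∷ (g :≤ b) ∷ [] ⊢ g :≤ a :+ b :- g) (α≥gap op oq , β≥gap op oq , tt)

      D≥α : ∀ {p q} → Ok p → Ok q → α p q ≤ D p q
      D≥α {p} {q} op oq = linarith (α p q ∷ β p q ∷ gap (Raw.u p) (Raw.u q) ∷ [])
        (λ a b g → (g :≤ b) ∷ [] ⊢ a :≤ a :+ b :- g) (β≥gap op oq , tt)

      D≥β : ∀ {p q} → Ok p → Ok q → β p q ≤ D p q
      D≥β {p} {q} op oq = linarith (α p q ∷ β p q ∷ gap (Raw.u p) (Raw.u q) ∷ [])
        (λ a b g → (g :≤ a) ∷ [] ⊢ b :≤ a :+ b :- g) (α≥gap op oq , tt)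

      D-same : ∀ p q → Raw.x p ≡ Raw.x q → Raw.y p ≡ Raw.y q → D p q ≈ gap (Raw.u p) (Raw.u q)
      D-same p q e f = linarith (α p q ∷ β p q ∷ gap (Raw.u p) (Raw.u q) ∷ [])
        (λ a b g → (a :≈ g) ∷ (b :≈ g) ∷ [] ⊢ a :+ b :- g :≈ g) (α-eq p q e , β-eq p q f , tt)

      D≤2 : ∀ {p q} → Ok p → Ok q → D p q ≤ 1# + 1#
      D≤2 {p} {q} (ok a b _) (ok a′ b′ _) = eq? (Raw.x p) (Raw.x q)
          (λ e → eq? (Raw.y p) (Raw.y q) (λ f → go (inj₁ (α-eq p q e)) (inj₁ (β-eq p q f))) (λ f → go (inj₁ (α-eq p q e)) (inj₂ (β-neq p q f))))
          (λ e → eq? (Raw.y p) (Raw.y q) (λ f → go (inj₂ (α-neq p q e)) (inj₁ (β-eq p q f))) (λ f → go (inj₂ (α-neq p q e)) (inj₂ (β-neq p q f))))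
        where
        u v g : K
        u = Raw.u p
        v = Raw.u q
        g = gap u v
        ρ : Vec K 6
        ρ = α p q ∷ β p q ∷ g ∷ u ∷ v ∷ 1# ∷ []
        g≤1 : g ≤ 1#
        g≤1 = gap-≤ (linarith (u ∷ v ∷ 1# ∷ []) (λ u v o → (u :≤ o) ∷ (:0 :≤ v) ∷ [] ⊢ u :- v :≤ o) (b , a′ , tt))
                    (linarith (u ∷ v ∷ 1# ∷ []) (λ u v o → (v :≤ o) ∷ (:0 :≤ u) ∷ [] ⊢ v :- u :≤ o) (b′ , a , tt))
        go : α p q ≈ g ⊎ α p q ≈ (1# + 1#) + - (u + v) → β p q ≈ g ⊎ β p q ≈ u + v → D p q ≤ 1# + 1#
        go (inj₁ e) (inj₁ f) = linarith ρ (λ α β g u v o → (α :≈ g) ∷ (β :≈ g) ∷ (g :≤ o) ∷ (:0 :≤ o) ∷ [] ⊢ α :+ β :- g :≤ o :+ o)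
          (e , f , g≤1 , 0≤1 , tt)
        go (inj₁ e) (inj₂ f) = linarith ρ (λ α β g u v o → (α :≈ g) ∷ (β :≈ u :+ v) ∷ (u :≤ o) ∷ (v :≤ o) ∷ [] ⊢ α :+ β :- g :≤ o :+ o)
          (e , f , b , b′ , tt)
        go (inj₂ e) (inj₁ f) = linarith ρ (λ α β g u v o → (α :≈ o :+ o :- (u :+ v)) ∷ (β :≈ g) ∷ (:0 :≤ u) ∷ (:0 :≤ v) ∷ [] ⊢ α :+ β :- g :≤ o :+ o)
          (e , f , a , a′ , tt)
        go (inj₂ e) (inj₂ f) = linarith ρ (λ α β g u v o → (α :≈ o :+ o :- (u :+ v)) ∷ (β :≈ u :+ v) ∷ (:0 :≤ g) ∷ [] ⊢ α :+ β :- g :≤ o :+ o)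
          (e , f , gap-nonNeg u v , tt)

      D-sym : ∀ p q → D p q ≤ D q p
      D-sym p q = linarith (α p q ∷ β p q ∷ gap (Raw.u p) (Raw.u q) ∷ α q p ∷ β q p ∷ gap (Raw.u q) (Raw.u p) ∷ [])
        (λ a b g a′ b′ g′ → (a :≤ a′) ∷ (b :≤ b′) ∷ (g′ :≤ g) ∷ [] ⊢ a :+ b :- g :≤ a′ :+ b′ :- g′) (α-sym , β-sym , gap-sym _ _ , tt)
        where
        α-sym : α p q ≤ α q p
        α-sym = eq? (Raw.x p) (Raw.x q)
          (λ e → ≤-trans (≤-reflexive (α-eq p q e)) (≤-trans (gap-sym _ _) (≤-reflexive (Eq.sym (α-eq q p (≡.sym e))))))
          (λ n → linarith (α p q ∷ α q p ∷ Raw.u p ∷ Raw.u q ∷ 1# ∷ []) (λ a b u v o → (a :≈ o :+ o :- (u :+ v)) ∷ (b :≈ o :+ o :- (v :+ u)) ∷ [] ⊢ a :≤ b)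
                   (α-neq p q n , α-neq q p (n ∘ ≡.sym) , tt))
        β-sym : β p q ≤ β q p
        β-sym = eq? (Raw.y p) (Raw.y q)
          (λ e → ≤-trans (≤-reflexive (β-eq p q e)) (≤-trans (gap-sym _ _) (≤-reflexive (Eq.sym (β-eq q p (≡.sym e))))))
          (λ n → linarith (β p q ∷ β q p ∷ Raw.u p ∷ Raw.u q ∷ []) (λ a b u v → (a :≈ u :+ v) ∷ (b :≈ v :+ u) ∷ [] ⊢ a :≤ b)
                   (β-neq p q n , β-neq q p (n ∘ ≡.sym) , tt))

      δ-direct : ∀ p q → Raw.X p ≡ Raw.X q → δ p q ≤ gap (Raw.h p) (Raw.h q) + D p q
      δ-direct p q e with Raw.X p ≟ Raw.X q
      ... | no n = contradiction e n
      ... | yes _ with (gap (Raw.h p) (Raw.h q) + D p q) ≤? (Raw.h p + Raw.h q)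
      ...   | yes _ = ≤-refl
      ...   | no n = <⇒≤ n

      δ-base : ∀ p q → δ p q ≤ Raw.h p + Raw.h q
      δ-base p q with Raw.X p ≟ Raw.X q
      ... | no n = ≤-refl
      ... | yes _ with (gap (Raw.h p) (Raw.h q) + D p q) ≤? (Raw.h p + Raw.h q)
      ...   | yes h = h
      ...   | no n = ≤-refl

      δ-spec : ∀ p q → (Raw.X p ≡ Raw.X q × δ p q ≈ gap (Raw.h p) (Raw.h q) + D p q) ⊎ (δ p q ≈ Raw.h p + Raw.h q)
      δ-spec p q with Raw.X p ≟ Raw.X q
      ... | no n = inj₂ Eq.refl
      ... | yes e with (gap (Raw.h p) (Raw.h q) + D p q) ≤? (Raw.h p + Raw.h q)
      ...   | yes _ = inj₁ (e , Eq.refl)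
      ...   | no _  = inj₂ Eq.refl

      δ-apart : ∀ p q → Raw.X p ≢ Raw.X q → δ p q ≈ Raw.h p + Raw.h q
      δ-apart p q n = [ (λ (e , _) → contradiction e n) , (λ e → e) ]′ (δ-spec p q)

      δ≥gap : ∀ {p q} → Ok p → Ok q → gap (Raw.h p) (Raw.h q) ≤ δ p q
      δ≥gap {p} {q} op oq = [ (λ (_ , e) → linarith (gap (Raw.h p) (Raw.h q) ∷ δ p q ∷ D p q ∷ [])
                                  (λ g d D → (d :≈ g :+ D) ∷ (:0 :≤ D) ∷ [] ⊢ g :≤ d) (e , D-nonNeg op oq , tt))
                            , (λ e → ≤-trans (gap-≤-+ (Ok.0≤h op) (Ok.0≤h oq)) (≤-reflexive (Eq.sym e))) ]′ (δ-spec p q)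

      δ-nonNeg : ∀ {p q} → Ok p → Ok q → 0# ≤ δ p q
      δ-nonNeg op oq = ≤-trans (gap-nonNeg _ _) (δ≥gap op oq)

      δ-self : ∀ {p} → Ok p → δ p p ≈ 0#
      δ-self {p} op = antisym (≤-trans (δ-direct p p refl) (linarith (gap (Raw.h p) (Raw.h p) ∷ D p p ∷ [])
          (λ g D → (g :≈ :0) ∷ (D :≈ :0) ∷ [] ⊢ g :+ D :≤ :0) (gap-self _ , D-self p , tt))) (δ-nonNeg op op)

      δ-sym : ∀ p q → δ p q ≤ δ q p
      δ-sym p q = [ (λ (e , f) → ≤-trans (δ-direct p q (≡.sym e)) (linarith (gap (Raw.h p) (Raw.h q) ∷ D p q ∷ gap (Raw.h q) (Raw.h p) ∷ D q p ∷ δ q p ∷ [])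
                          (λ g D g′ D′ d → (d :≈ g′ :+ D′) ∷ (g :≤ g′) ∷ (D :≤ D′) ∷ [] ⊢ g :+ D :≤ d) (f , gap-sym _ _ , D-sym p q , tt)))
                  , (λ e → ≤-trans (δ-base p q) (linarith (Raw.h p ∷ Raw.h q ∷ δ q p ∷ []) (λ h h′ d → (d :≈ h′ :+ h) ∷ [] ⊢ h :+ h′ :≤ d) (e , tt))) ]′ (δ-spec q p)

      -- If both distances are realised directly, height differences and graph distances are
      -- estimated separately. If one of them runs through the apex, the other is at least the
      -- difference of heights, so the route through the apex between the ends is short enough.
      δ-triangle : ∀ {p q r} → Ok p → Ok q → Ok r → δ p r ≤ δ p q + δ q r
      δ-triangle {p} {q} {r} op oq or = go (δ-spec p q) (δ-spec q r)
        where
        h₁ h₂ h₃ : K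
        h₁ = Raw.h p
        h₂ = Raw.h q
        h₃ = Raw.h r
        go : (Raw.X p ≡ Raw.X q × δ p q ≈ gap h₁ h₂ + D p q) ⊎ (δ p q ≈ h₁ + h₂) →
             (Raw.X q ≡ Raw.X r × δ q r ≈ gap h₂ h₃ + D q r) ⊎ (δ q r ≈ h₂ + h₃) → δ p r ≤ δ p q + δ q r
        go (inj₁ (e , f)) (inj₁ (e′ , f′)) = ≤-trans (δ-direct p r (≡.trans e e′))
          (linarith (gap h₁ h₃ ∷ gap h₁ h₂ ∷ gap h₂ h₃ ∷ D p r ∷ D p q ∷ D q r ∷ δ p q ∷ δ q r ∷ [])
            (λ g g₁ g₂ D D₁ D₂ d₁ d₂ → (g :≤ g₁ :+ g₂) ∷ (D :≤ D₁ :+ D₂) ∷ (d₁ :≈ g₁ :+ D₁) ∷ (d₂ :≈ g₂ :+ D₂) ∷ [] ⊢ g :+ D :≤ d₁ :+ d₂)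
            (gap-triangle _ _ _ , D-triangle op oq or , f , f′ , tt))
        go (inj₂ f) _ = ≤-trans (δ-base p r) (linarith (h₁ ∷ h₂ ∷ h₃ ∷ δ p q ∷ δ q r ∷ gap h₂ h₃ ∷ [])
            (λ h₁ h₂ h₃ d₁ d₂ g → (d₁ :≈ h₁ :+ h₂) ∷ (g :≤ d₂) ∷ (h₃ :- h₂ :≤ g) ∷ [] ⊢ h₁ :+ h₃ :≤ d₁ :+ d₂) (f , δ≥gap oq or , gap-≥ʳ _ _ , tt))
        go (inj₁ _) (inj₂ f) = ≤-trans (δ-base p r) (linarith (h₁ ∷ h₂ ∷ h₃ ∷ δ p q ∷ δ q r ∷ gap h₁ h₂ ∷ [])
            (λ h₁ h₂ h₃ d₁ d₂ g → (d₂ :≈ h₂ :+ h₃) ∷ (g :≤ d₁) ∷ (h₁ :- h₂ :≤ g) ∷ [] ⊢ h₁ :+ h₃ :≤ d₁ :+ d₂) (f , δ≥gap op oq , gap-≥ˡ _ _ , tt))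

      τ≤δ : ∀ {p q} → Ok p → Ok q → τ p q ≤ δ p q
      τ≤δ {p} {q} op oq = eq? (Raw.X p) (Raw.X q)
        (λ e → ≤-trans (≤-reflexive (τ-eq p q e)) (δ≥gap op oq))
        (λ n → ≤-reflexive (Eq.trans (τ-neq p q n) (Eq.sym (δ-apart p q n))))

      δ≤τ+2 : ∀ {p q} → Ok p → Ok q → δ p q ≤ τ p q + (1# + 1#)
      δ≤τ+2 {p} {q} op oq = eq? (Raw.X p) (Raw.X q)
        (λ e → ≤-trans (δ-direct p q e) (linarith (τ p q ∷ gap (Raw.h p) (Raw.h q) ∷ D p q ∷ 1# ∷ [])
                  (λ t g D o → (t :≈ g) ∷ (D :≤ o :+ o) ∷ [] ⊢ g :+ D :≤ t :+ (o :+ o)) (τ-eq p q e , D≤2 op oq , tt)))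
        (λ n → linarith (τ p q ∷ δ p q ∷ Raw.h p ∷ Raw.h q ∷ 1# ∷ []) (λ t d h k o → (t :≈ h :+ k) ∷ (d :≈ h :+ k) ∷ (:0 :≤ o) ∷ [] ⊢ d :≤ t :+ (o :+ o))
                  (τ-neq p q n , δ-apart p q n , 0≤1 , tt))

      -- τ p q = h + h′ − 2 m(p , q), where m = min(h , h′) on one leg and m = 0 on different legs; the four-point
      -- condition is that of the ultrametric similarity m.
      m-spec : ∀ {p q} → Ok p → Ok q → ∃ λ m → τ p q ≈ (Raw.h p + Raw.h q) + - (m + m) × 0# ≤ m × m ≤ Raw.h p × m ≤ Raw.h q
               × ((Raw.X p ≢ Raw.X q × m ≈ 0#) ⊎ (Raw.X p ≡ Raw.X q × (m ≈ Raw.h p ⊎ m ≈ Raw.h q)))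
      m-spec {p} {q} op oq = eq? (Raw.X p) (Raw.X q)
        (λ e → [ (λ (le , f) → h , linarith (τ p q ∷ gap h k ∷ h ∷ k ∷ []) (λ t g h k → (t :≈ g) ∷ (g :≈ k :- h) ∷ [] ⊢ t :≈ h :+ k :- (h :+ h)) (τ-eq p q e , f , tt) ,
                                 Ok.0≤h op , ≤-refl , le , inj₂ (e , inj₁ Eq.refl))
               , (λ (le , f) → k , linarith (τ p q ∷ gap h k ∷ h ∷ k ∷ []) (λ t g h k → (t :≈ g) ∷ (g :≈ h :- k) ∷ [] ⊢ t :≈ h :+ k :- (k :+ k)) (τ-eq p q e , f , tt) ,
                                 Ok.0≤h oq , le , ≤-refl , inj₂ (e , inj₂ Eq.refl)) ]′ (gap-spec h k))
        (λ n → 0# , linarith (τ p q ∷ h ∷ k ∷ []) (λ t h k → (t :≈ h :+ k) ∷ [] ⊢ t :≈ h :+ k :- (:0 :+ :0)) (τ-neq p q n , tt) ,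
               ≤-refl , Ok.0≤h op , Ok.0≤h oq , inj₁ (n , Eq.refl))
        where
        h k : K
        h = Raw.h p
        k = Raw.h q

      sim : ∀ {p q} → Ok p → Ok q → K
      sim op oq = proj₁ (m-spec op oq)

      -- A similarity that vanishes settles the claim. Otherwise all three points lie on one ray,
      -- the similarity of p and r is the height of one of them, and this height dominates the
      -- similarity in which that point takes part.
      sim-ultra : ∀ {p q r} (op : Ok p) (oq : Ok q) (or : Ok r) → sim op oq ≤ sim op or ⊎ sim oq or ≤ sim op or
      sim-ultra {p} {q} {r} op oq or with m-spec op oq | m-spec oq or | m-spec op or
      ... | a , _ , a0 , ap , aq , sa | b , _ , b0 , bq , br , sb | c , _ , c0 , cp , cr , sc = go sa sb sc
        where
        go : (Raw.X p ≢ Raw.X q × a ≈ 0#) ⊎ (Raw.X p ≡ Raw.X q × (a ≈ Raw.h p ⊎ a ≈ Raw.h q)) →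
             (Raw.X q ≢ Raw.X r × b ≈ 0#) ⊎ (Raw.X q ≡ Raw.X r × (b ≈ Raw.h q ⊎ b ≈ Raw.h r)) →
             (Raw.X p ≢ Raw.X r × c ≈ 0#) ⊎ (Raw.X p ≡ Raw.X r × (c ≈ Raw.h p ⊎ c ≈ Raw.h r)) → a ≤ c ⊎ b ≤ c
        go (inj₁ (_ , z)) _ _ = inj₁ (≤-trans (≤-reflexive z) c0)
        go _ (inj₁ (_ , z)) _ = inj₂ (≤-trans (≤-reflexive z) c0)
        go (inj₂ (e , _)) (inj₂ (f , _)) (inj₁ (n , _)) = contradiction (≡.trans e f) n
        go _ _ (inj₂ (_ , inj₁ z)) = inj₁ (≤-trans ap (≤-reflexive (Eq.sym z)))
        go _ _ (inj₂ (_ , inj₂ z)) = inj₂ (≤-trans br (≤-reflexive (Eq.sym z)))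

      sim-sym : ∀ {p q} (op : Ok p) (oq : Ok q) → sim op oq ≤ sim oq op
      sim-sym {p} {q} op oq with m-spec op oq | m-spec oq op
      ... | a , _ , a0 , ap , aq , sa | b , _ , b0 , bq , bp , inj₂ (_ , inj₁ z) = ≤-trans aq (≤-reflexive (Eq.sym z))
      ... | a , _ , a0 , ap , aq , sa | b , _ , b0 , bq , bp , inj₂ (_ , inj₂ z) = ≤-trans ap (≤-reflexive (Eq.sym z))
      ... | a , _ , a0 , ap , aq , inj₁ (_ , z) | b , _ , b0 , bq , bp , inj₁ _ = ≤-trans (≤-reflexive z) b0
      ... | a , _ , a0 , ap , aq , inj₂ (e , _) | b , _ , b0 , bq , bp , inj₁ (n , _) = contradiction (≡.sym e) n

      sim-≥ : ∀ {p q r k} (op : Ok p) (oq : Ok q) (or : Ok r) → k ≤ sim op oq → k ≤ sim oq or → k ≤ sim op or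
      sim-≥ op oq or f g = [ ≤-trans f , ≤-trans g ]′ (sim-ultra op oq or)

      -- Consider the largest of the four similarities between {x , y} and {z , p}, say m(x , z).
      -- Passing through it, m(x , y) ≥ m(y , z) and m(z , p) ≥ m(x , p), which gives the second
      -- alternative; the other three cases are symmetric.
      τ-four : ∀ {x y z p} → Ok x → Ok y → Ok z → Ok p →
               (τ x y + τ z p ≤ τ x z + τ y p) ⊎ (τ x y + τ z p ≤ τ x p + τ y z)
      τ-four {x} {y} {z} {p} ox oy oz op = Sum.map first second
          (go (total a b) (total c d))
        where
        a b c d : K
        a = sim ox oz
        b = sim oy op
        c = sim ox op
        d = sim oy oz
        flip : ∀ {p q k} (op : Ok p) (oq : Ok q) → k ≤ sim op oq → k ≤ sim oq op
        flip op oq h = ≤-trans h (sim-sym op oq)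
        Bound : K → K → Set ℓ
        Bound e f = (e ≤ sim ox oy × f ≤ sim oz op)
        a-max : c ≤ a → d ≤ a → Bound d c
        a-max h k = sim-≥ ox oz oy k (flip oy oz ≤-refl) , sim-≥ oz ox op (flip ox oz h) ≤-refl
        b-max : c ≤ b → d ≤ b → Bound c d
        b-max h k = sim-≥ ox op oy ≤-refl (flip oy op h) , sim-≥ oz oy op (flip oy oz ≤-refl) k
        c-max : a ≤ c → b ≤ c → Bound b a
        c-max h k = sim-≥ ox op oy k (flip oy op ≤-refl) , sim-≥ oz ox op (flip ox oz ≤-refl) h
        d-max : a ≤ d → b ≤ d → Bound a b
        d-max h k = sim-≥ ox oz oy ≤-refl (flip oy oz h) , sim-≥ oz oy op (flip oy oz k) ≤-refl
        swap : ∀ {e f s t} → e ≤ s × f ≤ t → f + e ≤ s + t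
        swap {e} {f} {s} {t} (p , q) = linarith (e ∷ f ∷ s ∷ t ∷ []) (λ e f s t → (e :≤ s) ∷ (f :≤ t) ∷ [] ⊢ f :+ e :≤ s :+ t) (p , q , tt)
        keep : ∀ {e f s t} → e ≤ s × f ≤ t → e + f ≤ s + t
        keep (p , q) = add-mono p q
        go : a ≤ b ⊎ b ≤ a → c ≤ d ⊎ d ≤ c → (a + b ≤ sim ox oy + sim oz op) ⊎ (c + d ≤ sim ox oy + sim oz op)
        go (inj₁ ab) (inj₁ cd) = [ (λ h → inj₁ (keep (d-max (≤-trans ab h) h))) , (λ h → inj₂ (keep (b-max (≤-trans cd h) h))) ]′ (total b d)
        go (inj₁ ab) (inj₂ dc) = [ (λ h → inj₁ (swap (c-max (≤-trans ab h) h))) , (λ h → inj₂ (keep (b-max h (≤-trans dc h)))) ]′ (total b c)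
        go (inj₂ ba) (inj₁ cd) = [ (λ h → inj₁ (keep (d-max h (≤-trans ba h)))) , (λ h → inj₂ (swap (a-max (≤-trans cd h) h))) ]′ (total a d)
        go (inj₂ ba) (inj₂ dc) = [ (λ h → inj₁ (swap (c-max h (≤-trans ba h)))) , (λ h → inj₂ (swap (a-max h (≤-trans dc h)))) ]′ (total a c)
        τ-sim : ∀ {p q} (op : Ok p) (oq : Ok q) → τ p q ≈ (Raw.h p + Raw.h q) + - (sim op oq + sim op oq)
        τ-sim op oq = proj₁ (proj₂ (m-spec op oq))
        h₁ h₂ h₃ h₄ s t : K
        h₁ = Raw.h x
        h₂ = Raw.h y
        h₃ = Raw.h z
        h₄ = Raw.h p
        s = sim ox oy
        t = sim oz op
        first : a + b ≤ s + t → τ x y + τ z p ≤ τ x z + τ y p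
        first h = linarith (h₁ ∷ h₂ ∷ h₃ ∷ h₄ ∷ a ∷ b ∷ s ∷ t ∷ τ x y ∷ τ z p ∷ τ x z ∷ τ y p ∷ [])
          (λ h₁ h₂ h₃ h₄ a b s t τ₁ τ₂ τ₃ τ₄ → (τ₁ :≈ h₁ :+ h₂ :- (s :+ s)) ∷ (τ₂ :≈ h₃ :+ h₄ :- (t :+ t)) ∷
              (τ₃ :≈ h₁ :+ h₃ :- (a :+ a)) ∷ (τ₄ :≈ h₂ :+ h₄ :- (b :+ b)) ∷ (a :+ b :≤ s :+ t) ∷ [] ⊢ τ₁ :+ τ₂ :≤ τ₃ :+ τ₄)
          (τ-sim ox oy , τ-sim oz op , τ-sim ox oz , τ-sim oy op , h , tt)
        second : c + d ≤ s + t → τ x y + τ z p ≤ τ x p + τ y z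
        second h = linarith (h₁ ∷ h₂ ∷ h₃ ∷ h₄ ∷ c ∷ d ∷ s ∷ t ∷ τ x y ∷ τ z p ∷ τ x p ∷ τ y z ∷ [])
          (λ h₁ h₂ h₃ h₄ a b s t τ₁ τ₂ τ₃ τ₄ → (τ₁ :≈ h₁ :+ h₂ :- (s :+ s)) ∷ (τ₂ :≈ h₃ :+ h₄ :- (t :+ t)) ∷
              (τ₃ :≈ h₁ :+ h₄ :- (a :+ a)) ∷ (τ₄ :≈ h₂ :+ h₃ :- (b :+ b)) ∷ (a :+ b :≤ s :+ t) ∷ [] ⊢ τ₁ :+ τ₂ :≤ τ₃ :+ τ₄)
          (τ-sim ox oy , τ-sim oz op , τ-sim ox op , τ-sim oy oz , h , tt)

      -- Replacing `δ` by `τ` costs 2 for each of the two distances on the left and nothing on the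
      -- right, whence the error 4.
      δ-four : ∀ {x y z p} → Ok x → Ok y → Ok z → Ok p →
               (δ x y + δ z p ≤ (δ x z + δ y p) + ((1# + 1#) + (1# + 1#))) ⊎
               (δ x y + δ z p ≤ (δ x p + δ y z) + ((1# + 1#) + (1# + 1#)))
      δ-four {x} {y} {z} {p} ox oy oz op = Sum.map
          (λ h → step h (δ≤τ+2 ox oy) (δ≤τ+2 oz op) (τ≤δ ox oz) (τ≤δ oy op))
          (λ h → step h (δ≤τ+2 ox oy) (δ≤τ+2 oz op) (τ≤δ ox op) (τ≤δ oy oz)) (τ-four ox oy oz op)
        where
        step : ∀ {a b c d a′ b′ c′ d′} → a + b ≤ c + d → a′ ≤ a + (1# + 1#) → b′ ≤ b + (1# + 1#) → c ≤ c′ → d ≤ d′ →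
               a′ + b′ ≤ (c′ + d′) + ((1# + 1#) + (1# + 1#))
        step {a} {b} {c} {d} {a′} {b′} {c′} {d′} p q r s t = linarith (a ∷ b ∷ c ∷ d ∷ a′ ∷ b′ ∷ c′ ∷ d′ ∷ 1# ∷ [])
          (λ a b c d a′ b′ c′ d′ o → (a :+ b :≤ c :+ d) ∷ (a′ :≤ a :+ (o :+ o)) ∷ (b′ :≤ b :+ (o :+ o)) ∷ (c :≤ c′) ∷ (d :≤ d′) ∷ [] ⊢
             a′ :+ b′ :≤ c′ :+ d′ :+ ((o :+ o) :+ (o :+ o))) (p , q , r , s , t , tt)

      move-u : ∀ X x y u u′ h → δ (raw X x y u h) (raw X x y u′ h) ≤ gap u u′
      move-u X x y u u′ h = ≤-trans (δ-direct p q refl) (linarith (gap h h ∷ α p q ∷ β p q ∷ gap u u′ ∷ [])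
          (λ z a b g → (z :≈ :0) ∷ (a :≈ g) ∷ (b :≈ g) ∷ [] ⊢ z :+ (a :+ b :- g) :≤ g) (gap-self h , α-eq p q refl , β-eq p q refl , tt))
        where
        p q : Raw
        p = raw X x y u h
        q = raw X x y u′ h

      move-h : ∀ X x y u h h′ → δ (raw X x y u h) (raw X x y u h′) ≤ gap h h′
      move-h X x y u h h′ = ≤-trans (δ-direct p q refl) (linarith (gap h h′ ∷ D p q ∷ [])
          (λ g d → (d :≈ :0) ∷ [] ⊢ g :+ d :≤ g) (D-self p , tt))
        where
        p q : Raw
        p = raw X x y u h
        q = raw X x y u h′

      glue-y : ∀ X x y y′ h → δ (raw X x y 0# h) (raw X x y′ 0# h) ≤ 0#
      glue-y X x y y′ h = ≤-trans (δ-direct p q refl) (linarith (gap h h ∷ α p q ∷ β p q ∷ gap 0# 0# ∷ [])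
          (λ z a b g → (z :≈ :0) ∷ (a :≈ g) ∷ (b :≤ :0) ∷ (g :≈ :0) ∷ [] ⊢ z :+ (a :+ b :- g) :≤ :0)
          (gap-self h , α-eq p q refl , b≤0 , gap-self 0# , tt))
        where
        p q : Raw
        p = raw X x y 0# h
        q = raw X x y′ 0# h
        b≤0 : β p q ≤ 0#
        b≤0 = eq? y y′ (λ e → ≤-reflexive (Eq.trans (β-eq p q e) (gap-self 0#)))
          (λ n → ≤-trans (≤-reflexive (β-neq p q n)) (linarith {n = 0} [] ([] ⊢ :0 :+ :0 :≤ :0) tt))

      glue-x : ∀ X x x′ y h → δ (raw X x y 1# h) (raw X x′ y 1# h) ≤ 0#
      glue-x X x x′ y h = ≤-trans (δ-direct p q refl) (linarith (gap h h ∷ α p q ∷ β p q ∷ gap 1# 1# ∷ [])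
          (λ z a b g → (z :≈ :0) ∷ (b :≈ g) ∷ (a :≤ :0) ∷ (g :≈ :0) ∷ [] ⊢ z :+ (a :+ b :- g) :≤ :0)
          (gap-self h , β-eq p q refl , a≤0 , gap-self 1# , tt))
        where
        p q : Raw
        p = raw X x y 1# h
        q = raw X x′ y 1# h
        a≤0 : α p q ≤ 0#
        a≤0 = eq? x x′ (λ e → ≤-reflexive (Eq.trans (α-eq p q e) (gap-self 1#)))
          (λ n → ≤-trans (≤-reflexive (α-neq p q n)) (linarith (1# ∷ []) (λ o → [] ⊢ o :+ o :- (o :+ o) :≤ :0) tt))

    module Chains {i} (In : L → L → Set i) where

      record Valid (p : Raw) : Set (ℓ ⊔ i) where
        constructor valid
        open Raw p
        field
          isOk : Ok p
          x∈X  : In x X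
          y∈X  : In y X
      open Valid public

      -- A chain is a recipe for a path of the stated length: new coordinates for the same point, or
      -- motion of a single coordinate. Geodesics are found here by finite bookkeeping, and only
      -- these few moves have to be realised as sets of the model.
      data Chain : Raw → Raw → K → Set (κ ⊔ ℓ ⊔ i) where
        glue  : ∀ {p q} → Valid p → Valid q → δ p q ≤ 0# → Chain p q 0#
        moveU : ∀ {X x y u u′ h} → Valid (raw X x y u h) → Valid (raw X x y u′ h) → Chain (raw X x y u h) (raw X x y u′ h) (gap u u′)
        moveH : ∀ {X x y u h h′} → Valid (raw X x y u h) → Valid (raw X x y u h′) → Chain (raw X x y u h) (raw X x y u h′) (gap h h′)
        _⟫_   : ∀ {p q r a b} → Chain p q a → Chain q r b → Chain p r (a + b)

      -- Lengths of chains are literal sums and therefore match distances only up to `≈`.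
      Linked : Raw → Raw → K → Set (κ ⊔ ℓ ⊔ i)
      Linked p q l = ∃ λ k → k ≈ l × Chain p q k

      private
        infixr 5 _then_
        _then_ : ∀ {p q r a b} → Linked p q a → Linked q r b → Linked p r (a + b)
        (k , e , c) then (k′ , e′ , c′) = k + k′ ,
          linarith (k ∷ k′ ∷ _ ∷ _ ∷ []) (λ k k′ a b → (k :≈ a) ∷ (k′ :≈ b) ∷ [] ⊢ k :+ k′ :≈ a :+ b) (e , e′ , tt) , c ⟫ c′
        retarget : ∀ {p q a b} → Linked p q a → a ≈ b → Linked p q b
        retarget (k , e , c) f = k , Eq.trans e f , c
        link : ∀ {p q k} → Chain p q k → Linked p q k
        link c = _ , Eq.refl , c

        gap-up : ∀ {a b} → a ≤ b → gap a b ≈ b + - a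
        gap-up {a} {b} h = antisym (gap-≤ (linarith (a ∷ b ∷ []) (λ u v → (u :≤ v) ∷ [] ⊢ u :- v :≤ v :- u) (h , tt)) ≤-refl) (gap-≥ʳ a b)
        gap-down : ∀ {a b} → b ≤ a → gap a b ≈ a + - b
        gap-down {a} {b} h = antisym (gap-≤ ≤-refl (linarith (b ∷ a ∷ []) (λ u v → (u :≤ v) ∷ [] ⊢ u :- v :≤ v :- u) (h , tt))) (gap-≥ˡ a b)

        module AtHeight {X : L} {h : K} (0≤h : 0# ≤ h) where
          point : L → L → K → Raw
          point x y u = raw X x y u h

          U : K → Set ℓ
          U u = 0# ≤ u × u ≤ 1#

          move : ∀ {x y} u u′ → In x X → In y X → U u → U u′ → Linked (point x y u) (point x y u′) (gap u u′)
          move u u′ x∈ y∈ (a , b) (a′ , b′) = link (moveU (valid (ok a b 0≤h) x∈ y∈) (valid (ok a′ b′ 0≤h) x∈ y∈))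

          lo : U 0#
          lo = ≤-refl , 0≤1
          hi : U 1#
          hi = 0≤1 , ≤-refl

          change-y : ∀ {x y y′} → In x X → In y X → In y′ X → Linked (point x y 0#) (point x y′ 0#) 0#
          change-y {x} {y} {y′} x∈ y∈ y′∈ = link (glue (valid (ok (proj₁ lo) (proj₂ lo) 0≤h) x∈ y∈) (valid (ok (proj₁ lo) (proj₂ lo) 0≤h) x∈ y′∈) (glue-y X x y y′ h))
          change-x : ∀ {x x′ y} → In x X → In x′ X → In y X → Linked (point x y 1#) (point x′ y 1#) 0#
          change-x {x} {x′} {y} x∈ x′∈ y∈ = link (glue (valid (ok (proj₁ hi) (proj₂ hi) 0≤h) x∈ y∈) (valid (ok (proj₁ hi) (proj₂ hi) 0≤h) x′∈ y∈) (glue-x X x x′ y h))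

          opaque
            unfolding δ

            -- With x and y both changing there are two candidate routes, along the edge (x , y′) or
            -- along (x′ , y); the comparison of u and u′ tells which has length 2 - |u - u′|. A
            -- common vertex gives the route directly.
            across : ∀ {x y x′ y′ u u′} → In x X → In y X → In x′ X → In y′ X → U u → U u′ →
                     Linked (point x y u) (point x′ y′ u′) (D (point x y u) (point x′ y′ u′))
            across {x} {y} {x′} {y′} {u} {u′} x∈ y∈ x′∈ y′∈ Uu Uu′ = eq? x x′
                (λ { refl → eq? y y′ (λ { refl → same }) same-x })
                (λ n → eq? y y′ (λ { refl → same-y n }) (λ m → [ up n m , down n m ]′ (total u u′)))
              where
              p q : Raw
              p = point x y u
              q = point x′ y′ u′
              same : Linked (point x y u) (point x y u′) (D (point x y u) (point x y u′))
              same = retarget (move u u′ x∈ y∈ Uu Uu′) (linarith (α (point x y u) (point x y u′) ∷ β (point x y u) (point x y u′) ∷ gap u u′ ∷ [])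
                (λ a b g → (a :≈ g) ∷ (b :≈ g) ∷ [] ⊢ g :≈ a :+ b :- g) (α-eq (point x y u) (point x y u′) refl , β-eq (point x y u) (point x y u′) refl , tt))
              same-x : y ≢ y′ → Linked (point x y u) (point x y′ u′) (D (point x y u) (point x y′ u′))
              same-x m = retarget (move u 0# x∈ y∈ Uu lo then change-y x∈ y∈ y′∈ then move 0# u′ x∈ y′∈ lo Uu′)
                (linarith (gap u 0# ∷ gap 0# u′ ∷ gap u u′ ∷ α (point x y u) (point x y′ u′) ∷ β (point x y u) (point x y′ u′) ∷ u ∷ u′ ∷ [])
                  (λ g₁ g₂ g a b u u′ → (g₁ :≈ u :- :0) ∷ (g₂ :≈ u′ :- :0) ∷ (a :≈ g) ∷ (b :≈ u :+ u′) ∷ [] ⊢ g₁ :+ (:0 :+ g₂) :≈ a :+ b :- g)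
                  (gap-down (proj₁ Uu) , gap-up (proj₁ Uu′) , α-eq (point x y u) (point x y′ u′) refl , β-neq (point x y u) (point x y′ u′) m , tt))
              same-y : x ≢ x′ → Linked (point x y u) (point x′ y u′) (D (point x y u) (point x′ y u′))
              same-y n = retarget (move u 1# x∈ y∈ Uu hi then change-x x∈ x′∈ y∈ then move 1# u′ x′∈ y∈ hi Uu′)
                (linarith (gap u 1# ∷ gap 1# u′ ∷ gap u u′ ∷ α (point x y u) (point x′ y u′) ∷ β (point x y u) (point x′ y u′) ∷ u ∷ u′ ∷ 1# ∷ [])
                  (λ g₁ g₂ g a b u u′ o → (g₁ :≈ o :- u) ∷ (g₂ :≈ o :- u′) ∷ (b :≈ g) ∷ (a :≈ o :+ o :- (u :+ u′)) ∷ [] ⊢ g₁ :+ (:0 :+ g₂) :≈ a :+ b :- g)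
                  (gap-up (proj₂ Uu) , gap-down (proj₂ Uu′) , β-eq (point x y u) (point x′ y u′) refl , α-neq (point x y u) (point x′ y u′) n , tt))
              up : x ≢ x′ → y ≢ y′ → u ≤ u′ → Linked p q (D p q)
              up n m h = retarget (move u 0# x∈ y∈ Uu lo then change-y x∈ y∈ y′∈ then move 0# 1# x∈ y′∈ lo hi
                                   then change-x x∈ x′∈ y′∈ then move 1# u′ x′∈ y′∈ hi Uu′)
                (linarith (gap u 0# ∷ gap 0# 1# ∷ gap 1# u′ ∷ gap u u′ ∷ α p q ∷ β p q ∷ u ∷ u′ ∷ 1# ∷ [])
                  (λ g₁ g₂ g₃ g a b u u′ o → (g₁ :≈ u :- :0) ∷ (g₂ :≈ o :- :0) ∷ (g₃ :≈ o :- u′) ∷ (g :≈ u′ :- u) ∷ (b :≈ u :+ u′) ∷ (a :≈ o :+ o :- (u :+ u′)) ∷ [] ⊢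
                     g₁ :+ (:0 :+ (g₂ :+ (:0 :+ g₃))) :≈ a :+ b :- g)
                  (gap-down (proj₁ Uu) , gap-up 0≤1 , gap-down (proj₂ Uu′) , gap-up h , β-neq p q m , α-neq p q n , tt))
              down : x ≢ x′ → y ≢ y′ → u′ ≤ u → Linked p q (D p q)
              down n m h = retarget (move u 1# x∈ y∈ Uu hi then change-x x∈ x′∈ y∈ then move 1# 0# x′∈ y∈ hi lo
                                   then change-y x′∈ y∈ y′∈ then move 0# u′ x′∈ y′∈ lo Uu′)
                (linarith (gap u 1# ∷ gap 1# 0# ∷ gap 0# u′ ∷ gap u u′ ∷ α p q ∷ β p q ∷ u ∷ u′ ∷ 1# ∷ [])
                  (λ g₁ g₂ g₃ g a b u u′ o → (g₁ :≈ o :- u) ∷ (g₂ :≈ o :- :0) ∷ (g₃ :≈ u′ :- :0) ∷ (g :≈ u :- u′) ∷ (b :≈ u :+ u′) ∷ (a :≈ o :+ o :- (u :+ u′)) ∷ [] ⊢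
                     g₁ :+ (:0 :+ (g₂ :+ (:0 :+ g₃))) :≈ a :+ b :- g)
                  (gap-up (proj₂ Uu) , gap-down 0≤1 , gap-up (proj₁ Uu′) , gap-down h , β-neq p q m , α-neq p q n , tt))

      opaque
        unfolding δ

        -- The minimum in the definition of `δ` names the geodesic: down to the apex and up again,
        -- or a vertical piece together with a horizontal one at the lower of the two heights.
        linked : ∀ {p q} → Valid p → Valid q → Linked p q (δ p q)
        linked {p@(raw X x y u h)} {q@(raw X′ x′ y′ u′ h′)} vp@(valid (ok a b c) x∈ y∈) vq@(valid (ok a′ b′ c′) x′∈ y′∈) =
            [ direct , via-base ]′ (δ-spec p q)
          where
          base : ∀ {X x y u h} → Valid (raw X x y u h) → Valid (raw X x y u 0#)
          base (valid (ok a b _) x∈ y∈) = valid (ok a b ≤-refl) x∈ y∈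
          via-base : δ p q ≈ h + h′ → Linked p q (δ p q)
          via-base e = retarget (link (moveH vp (base vp)) then
              link (glue (base vp) (base vq) (≤-trans (δ-base (raw X x y u 0#) (raw X′ x′ y′ u′ 0#)) (linarith {n = 0} [] ([] ⊢ :0 :+ :0 :≤ :0) tt)))
              then link (moveH (base vq) vq))
            (linarith (gap h 0# ∷ gap 0# h′ ∷ h ∷ h′ ∷ δ p q ∷ []) (λ g g′ h h′ d → (g :≈ h :- :0) ∷ (g′ :≈ h′ :- :0) ∷ (d :≈ h :+ h′) ∷ [] ⊢
               g :+ (:0 :+ g′) :≈ d) (gap-down c , gap-up c′ , e , tt))
          direct : X ≡ X′ × δ p q ≈ gap h h′ + D p q → Linked p q (δ p q)
          direct (refl , e) = [ (λ _ → retarget (AtHeight.across c x∈ y∈ x′∈ y′∈ (a , b) (a′ , b′) then link (moveH (valid (ok a′ b′ c) x′∈ y′∈) vq))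
                                  (linarith (gap h h′ ∷ D p q ∷ δ p q ∷ []) (λ g D d → (d :≈ g :+ D) ∷ [] ⊢ D :+ g :≈ d) (e , tt)))
                              , (λ _ → retarget (link (moveH vp (valid (ok a b c′) x∈ y∈)) then AtHeight.across c′ x∈ y∈ x′∈ y′∈ (a , b) (a′ , b′)) (Eq.sym e)) ]′
                              (total h h′)

-- First-order definability of predicates and functions in the model.

module DefinablePredicates {ℓ : Level} (em : ExcludedMiddle ℓ) (M : ZFModel ℓ) where

  open import Data.Nat.Base as ℕ using (ℕ; suc)
  open import Data.Fin.Base using (Fin; zero; suc; _↑ˡ_; _↑ʳ_; splitAt)
  open import Data.Vec.Base using (Vec; []; _∷_; lookup; _++_; tail)
  open import Data.Vec.Properties using (lookup-splitAt; lookup-++ˡ; lookup-++ʳ)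
  open import Data.Product.Base using (Σ; ∃; _×_; _,_; proj₁; proj₂; map₂)
  open import Data.Sum.Base as Sum using (_⊎_; inj₁; inj₂; [_,_]′)
  open import Function.Base using (_∘_; id)
  open import Function.Bundles using (_⇔_; mk⇔; Equivalence)
  open import Relation.Binary.PropositionalEquality
  open import Relation.Nullary using (¬_; yes; no; contradiction)

  open ZFModel M public
  open Internal M using (upair; ⟨_,_⟩) public
  open Equivalence using (to; from) public


  head : ∀ {n} → Vec V (suc n) → V
  head v = lookup v zero

  rename : ∀ {m n} → (Fin m → Fin n) → Formula m → Formula n
  lift : ∀ {m n} → (Fin m → Fin n) → Fin (suc m) → Fin (suc n)
  lift f zero    = zero
  lift f (suc i) = suc (f i)
  rename f (i ∈′ j) = f i ∈′ f j
  rename f (i ≡′ j) = f i ≡′ f j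
  rename f (¬′ φ)   = ¬′ rename f φ
  rename f (φ ∧′ ψ) = rename f φ ∧′ rename f ψ
  rename f (φ ∨′ ψ) = rename f φ ∨′ rename f ψ
  rename f (φ ⇒′ ψ) = rename f φ ⇒′ rename f ψ
  rename f (∀′ φ)   = ∀′ rename (lift f) φ
  rename f (∃′ φ)   = ∃′ rename (lift f) φ

  Renames : ∀ {m n} → (Fin m → Fin n) → Vec V m → Vec V n → Set ℓ
  Renames f ρ σ = ∀ i → lookup σ (f i) ≡ lookup ρ i

  lift-Renames : ∀ {m n} {f : Fin m → Fin n} {ρ σ} → Renames f ρ σ →
                 ∀ x → Renames (lift f) (x ∷ ρ) (x ∷ σ)
  lift-Renames r x zero    = refl
  lift-Renames r x (suc i) = r i

  rename-⊨ : ∀ {m n} {f : Fin m → Fin n} {ρ σ} (φ : Formula m) → Renames f ρ σ →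
             (ρ ⊨ φ → σ ⊨ rename f φ) × (σ ⊨ rename f φ → ρ ⊨ φ)
  rename-⊨ (i ∈′ j) r = subst₂ _∈_ (sym (r i)) (sym (r j)) , subst₂ _∈_ (r i) (r j)
  rename-⊨ (i ≡′ j) r = subst₂ _≡_ (sym (r i)) (sym (r j)) , subst₂ _≡_ (r i) (r j)
  rename-⊨ (¬′ φ) r = (λ h → h ∘ proj₂ (rename-⊨ φ r)) , (λ h → h ∘ proj₁ (rename-⊨ φ r))
  rename-⊨ (φ ∧′ ψ) r with rename-⊨ φ r | rename-⊨ ψ r
  ... | f , g | f′ , g′ = (λ (a , b) → f a , f′ b) , (λ (a , b) → g a , g′ b)
  rename-⊨ (φ ∨′ ψ) r with rename-⊨ φ r | rename-⊨ ψ r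
  ... | f , g | f′ , g′ = Sum.map f f′ , Sum.map g g′
  rename-⊨ (φ ⇒′ ψ) r with rename-⊨ φ r | rename-⊨ ψ r
  ... | f , g | f′ , g′ = (λ h → f′ ∘ h ∘ g) , (λ h → g′ ∘ h ∘ f)
  rename-⊨ (∀′ φ) r = (λ h x → proj₁ (rename-⊨ φ (lift-Renames r x)) (h x))
                    , (λ h x → proj₂ (rename-⊨ φ (lift-Renames r x)) (h x))
  rename-⊨ (∃′ φ) r = map₂ (λ {x} → proj₁ (rename-⊨ φ (lift-Renames r x)))
                    , map₂ (λ {x} → proj₂ (rename-⊨ φ (lift-Renames r x)))

  -- Certifies that the Agda predicate `P` agrees in the model with a first-order formula whose
  -- remaining variables are filled by `params`. Separation is applied to such predicates only; the
  -- combinators build the certificate along the definition of `P`.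
  record Def {n} (P : Vec V n → Set ℓ) : Set ℓ where
    constructor def
    field
      {m}     : ℕ
      formula : Formula (n ℕ.+ m)
      params  : Vec V m
      sound   : ∀ v → (P v → (v ++ params) ⊨ formula) × ((v ++ params) ⊨ formula → P v)
  open Def

  ⊎-map-Fin : ∀ {a b a′ b′} → (Fin a → Fin a′) → (Fin b → Fin b′) →
              Fin (a ℕ.+ b) → Fin (a′ ℕ.+ b′)
  ⊎-map-Fin {a} {b} {a′} {b′} f g i = [ (λ j → f j ↑ˡ b′) , (λ j → a′ ↑ʳ g j) ]′ (splitAt a i)

  Renames-++ : ∀ {a b a′ b′} {f : Fin a → Fin a′} {g : Fin b → Fin b′} {ρ σ ρ′ σ′} →
               Renames f ρ σ → Renames g ρ′ σ′ → Renames (⊎-map-Fin f g) (ρ ++ ρ′) (σ ++ σ′)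
  Renames-++ {a} {ρ = ρ} {σ} {ρ′} {σ′} r s i with splitAt a i | lookup-splitAt a ρ ρ′ i
  ... | inj₁ j | eq = trans (lookup-++ˡ σ σ′ _) (trans (r j) (sym eq))
  ... | inj₂ j | eq = trans (lookup-++ʳ σ σ′ _) (trans (s j) (sym eq))

  -- Here `f` and `g` say where the old variables and parameters are found in a new context. In this
  -- way two formulas can be joined over the concatenation of their parameters.
  reformula : ∀ {n k} {P : Vec V n → Set ℓ} (d : Def P) {m′} (ρ′ : Vec V m′)
              (f : Fin n → Fin k) (g : Fin (m d) → Fin m′) → Renames g (params d) ρ′ →
              (s : Vec V k → Vec V n) → (∀ v → Renames f (s v) v) →
              Σ (Formula (k ℕ.+ m′)) λ φ →
              ∀ v → (P (s v) → (v ++ ρ′) ⊨ φ) × ((v ++ ρ′) ⊨ φ → P (s v))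
  reformula d ρ′ f g r s t = rename (⊎-map-Fin f g) (formula d) , λ v →
    let q = rename-⊨ (formula d) (Renames-++ {f = f} {g} {s v} {v} {params d} {ρ′} (t v) r)
    in (proj₁ q ∘ proj₁ (sound d (s v))) , (proj₂ (sound d (s v)) ∘ proj₂ q)

  renᵈ : ∀ {n k} {P : Vec V n → Set ℓ} (f : Fin n → Fin k) (s : Vec V k → Vec V n) →
         (∀ v → Renames f (s v) v) → Def P → Def (P ∘ s)
  renᵈ f s t d with reformula d (params d) f id (λ _ → refl) s t
  ... | φ , h = def φ (params d) h

  private
    left : ∀ {n} {P : Vec V n → Set ℓ} (d : Def P) {m′} (ρ′ : Vec V m′) →
           Σ (Formula (n ℕ.+ (m d ℕ.+ m′))) λ φ →
           ∀ v → (P v → (v ++ (params d ++ ρ′)) ⊨ φ) × ((v ++ (params d ++ ρ′)) ⊨ φ → P v)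
    left d ρ′ = reformula d (params d ++ ρ′) id (_↑ˡ _) (lookup-++ˡ (params d) ρ′) id (λ _ _ → refl)

    right : ∀ {n} {P : Vec V n → Set ℓ} (d : Def P) {m′} (ρ′ : Vec V m′) →
           Σ (Formula (n ℕ.+ (m′ ℕ.+ m d))) λ φ →
           ∀ v → (P v → (v ++ (ρ′ ++ params d)) ⊨ φ) × ((v ++ (ρ′ ++ params d)) ⊨ φ → P v)
    right d ρ′ = reformula d (ρ′ ++ params d) id (_ ↑ʳ_) (lookup-++ʳ ρ′ (params d)) id (λ _ _ → refl)

  infixr 5 _×ᵈ_
  infixr 4 _⊎ᵈ_
  infixr 3 _→ᵈ_

  opaque
    _×ᵈ_ : ∀ {n} {P Q : Vec V n → Set ℓ} → Def P → Def Q → Def (λ v → P v × Q v)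
    p ×ᵈ q with left p (params q) | right q (params p)
    ... | φ , f | ψ , g = def (φ ∧′ ψ) (params p ++ params q) λ v →
      (λ (a , b) → proj₁ (f v) a , proj₁ (g v) b) , (λ (a , b) → proj₂ (f v) a , proj₂ (g v) b)

    _⊎ᵈ_ : ∀ {n} {P Q : Vec V n → Set ℓ} → Def P → Def Q → Def (λ v → P v ⊎ Q v)
    p ⊎ᵈ q with left p (params q) | right q (params p)
    ... | φ , f | ψ , g = def (φ ∨′ ψ) (params p ++ params q) λ v →
      Sum.map (proj₁ (f v)) (proj₁ (g v)) , Sum.map (proj₂ (f v)) (proj₂ (g v))

    _→ᵈ_ : ∀ {n} {P Q : Vec V n → Set ℓ} → Def P → Def Q → Def (λ v → P v → Q v)
    p →ᵈ q with left p (params q) | right q (params p)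
    ... | φ , f | ψ , g = def (φ ⇒′ ψ) (params p ++ params q) λ v →
      (λ h → proj₁ (g v) ∘ h ∘ proj₂ (f v)) , (λ h → proj₂ (g v) ∘ h ∘ proj₁ (f v))

    ¬ᵈ_ : ∀ {n} {P : Vec V n → Set ℓ} → Def P → Def (λ v → ¬ P v)
    ¬ᵈ def φ ρ f = def (¬′ φ) ρ λ v → (_∘ proj₂ (f v)) , (_∘ proj₁ (f v))

    ∀ᵈ : ∀ {n} {P : Vec V (suc n) → Set ℓ} → Def P → Def (λ v → ∀ x → P (x ∷ v))
    ∀ᵈ (def φ ρ f) = def (∀′ φ) ρ λ v → (λ h x → proj₁ (f (x ∷ v)) (h x)) , (λ h x → proj₂ (f (x ∷ v)) (h x))

    ∃ᵈ : ∀ {n} {P : Vec V (suc n) → Set ℓ} → Def P → Def (λ v → ∃ λ x → P (x ∷ v))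
    ∃ᵈ (def φ ρ f) = def (∃′ φ) ρ λ v → map₂ (λ {x} → proj₁ (f (x ∷ v))) , map₂ (λ {x} → proj₂ (f (x ∷ v)))

    iffᵈ : ∀ {n} {P Q : Vec V n → Set ℓ} → (∀ v → P v ⇔ Q v) → Def P → Def Q
    iffᵈ e (def φ ρ f) = def φ ρ λ v → (proj₁ (f v) ∘ from (e v)) , (to (e v) ∘ proj₂ (f v))

    wkᵈ : ∀ {n} {P : Vec V n → Set ℓ} → Def P → Def (λ v → P (tail v))
    wkᵈ = renᵈ suc tail λ { (_ ∷ _) i → refl }

  -- The language has no function symbols, so a definable term is given by its graph, with variable
  -- 0 as the value.
  record DefT {n} (F : Vec V n → V) : Set ℓ where
    constructor term
    field graphᵈ : Def (λ v → head v ≡ F (tail v))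
  open DefT public

  opaque
    var : ∀ {n} (i : Fin n) → DefT (λ v → lookup v i)
    var {n} i = term (def {m = 0} (zero ≡′ suc (i ↑ˡ 0)) [] λ { (x ∷ v) →
      (λ e → trans e (sym (lookup-++ˡ v [] i))) , (λ e → trans e (lookup-++ˡ v [] i)) })

    cst : ∀ {n} c → DefT {n} (λ _ → c)
    cst {n} c = term (def {m = 1} (zero ≡′ suc (n ↑ʳ zero)) (c ∷ []) λ { (x ∷ v) →
      (λ e → trans e (sym (lookup-++ʳ v (c ∷ []) zero))) , (λ e → trans e (lookup-++ʳ v (c ∷ []) zero)) })

    wkT : ∀ {n} {F : Vec V n → V} → DefT F → DefT (λ v → F (tail v))
    wkT {F = F} (term d) = term (renᵈ (λ { zero → zero ; (suc i) → suc (suc i) }) (λ v → head v ∷ tail (tail v))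
            (λ { (_ ∷ _ ∷ _) zero → refl ; (_ ∷ _ ∷ _) (suc i) → refl }) d)

    -- Substitution of a term is expressed as ∃ x (x = F v ∧ P x).
    letᵈ : ∀ {n} {F : Vec V n → V} {P : Vec V (suc n) → Set ℓ} →
           DefT F → Def P → Def (λ v → P (F v ∷ v))
    letᵈ {F = F} {P} t p = iffᵈ (λ v → mk⇔ (λ { (x , refl , y) → y }) (λ y → F v , refl , y)) (∃ᵈ (graphᵈ t ×ᵈ p))

    def₁ : ∀ {n} {F : Vec V n → V} {P : Vec V 1 → Set ℓ} → Def P →
           DefT F → Def (λ v → P (F v ∷ []))
    def₁ p t = letᵈ t (renᵈ {n = 1} (λ _ → zero) (λ v → head v ∷ []) (λ { (_ ∷ _) zero → refl }) p)

    def₂ : ∀ {n} {F G : Vec V n → V} {P : Vec V 2 → Set ℓ} → Def P →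
           DefT F → DefT G → Def (λ v → P (F v ∷ G v ∷ []))
    def₂ p t u = letᵈ t (letᵈ (wkT u) (renᵈ {n = 2} (λ { zero → suc zero ; (suc _) → zero })
      (λ v → head (tail v) ∷ head v ∷ []) (λ { (_ ∷ _ ∷ _) zero → refl ; (_ ∷ _ ∷ _) (suc zero) → refl }) p))

    def₃ : ∀ {n} {F G H : Vec V n → V} {P : Vec V 3 → Set ℓ} → Def P →
           DefT F → DefT G → DefT H → Def (λ v → P (F v ∷ G v ∷ H v ∷ []))
    def₃ p t u w = letᵈ t (letᵈ (wkT u) (letᵈ (wkT (wkT w))
      (renᵈ {n = 3} (λ { zero → suc (suc zero) ; (suc zero) → suc zero ; (suc (suc _)) → zero })
      (λ v → head (tail (tail v)) ∷ head (tail v) ∷ head v ∷ [])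
      (λ { (_ ∷ _ ∷ _ ∷ _) zero → refl ; (_ ∷ _ ∷ _ ∷ _) (suc zero) → refl ; (_ ∷ _ ∷ _ ∷ _) (suc (suc zero)) → refl }) p)))

    infix 8 _∈ᵈ_ _≡ᵈ_
    _∈ᵈ_ : ∀ {n} {F G : Vec V n → V} → DefT F → DefT G → Def (λ v → F v ∈ G v)
    _∈ᵈ_ = def₂ {P = λ v → head v ∈ head (tail v)}
                (def {m = 0} (zero ∈′ suc zero) [] λ { (_ ∷ _ ∷ []) → id , id })

    _≡ᵈ_ : ∀ {n} {F G : Vec V n → V} → DefT F → DefT G → Def (λ v → F v ≡ G v)
    _≡ᵈ_ = def₂ {P = λ v → head v ≡ head (tail v)}
                (def {m = 0} (zero ≡′ suc zero) [] λ { (_ ∷ _ ∷ []) → id , id })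

    app₁ : ∀ {n} {f : V → V} {F : Vec V n → V} → DefT {1} (λ v → f (head v)) → DefT F → DefT (λ v → f (F v))
    app₁ {f = f} (term d) t = term (def₂ (renᵈ {P = λ v → head v ≡ f (head (tail v))} id (λ v → head v ∷ head (tail v) ∷ [])
       (λ { (_ ∷ _ ∷ []) zero → refl ; (_ ∷ _ ∷ []) (suc zero) → refl }) d) (var zero) (wkT t))

    app₂ : ∀ {n} {f : V → V → V} {F G : Vec V n → V} → DefT {2} (λ v → f (head v) (lookup v (suc zero))) →
           DefT F → DefT G → DefT (λ v → f (F v) (G v))
    app₂ {f = f} (term d) t u = term (def₃ (renᵈ {P = λ v → head v ≡ f (head (tail v)) (lookup (tail v) (suc zero))} id
       (λ v → head v ∷ head (tail v) ∷ lookup (tail v) (suc zero) ∷ [])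
       (λ { (_ ∷ _ ∷ _ ∷ []) zero → refl ; (_ ∷ _ ∷ _ ∷ []) (suc zero) → refl ; (_ ∷ _ ∷ _ ∷ []) (suc (suc zero)) → refl }) d)
       (var zero) (wkT t) (wkT u))

    ∀∈ : ∀ {n} {A : Vec V n → V} {P : Vec V (suc n) → Set ℓ} → DefT A → Def P →
         Def (λ v → ∀ x → x ∈ A v → P (x ∷ v))
    ∀∈ a p = ∀ᵈ ((var zero ∈ᵈ wkT a) →ᵈ p)

    ∃∈ : ∀ {n} {A : Vec V n → V} {P : Vec V (suc n) → Set ℓ} → DefT A → Def P →
         Def (λ v → ∃ λ x → x ∈ A v × P (x ∷ v))
    ∃∈ a p = ∃ᵈ ((var zero ∈ᵈ wkT a) ×ᵈ p)

    infixr 3 _⇔ᵈ_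
    _⇔ᵈ_ : ∀ {n} {P Q : Vec V n → Set ℓ} → Def P → Def Q → Def (λ v → P v ⇔ Q v)
    p ⇔ᵈ q = iffᵈ (λ v → mk⇔ (λ (f , g) → mk⇔ f g) (λ e → to e , from e)) ((p →ᵈ q) ×ᵈ (q →ᵈ p))

  -- By excluded middle a proposition that does not depend on the variables agrees with a true or a
  -- false sentence. This lets an induction inside the model prove an arbitrary fixed goal.
  constᵈ : ∀ {n} (P : Set ℓ) → Def {n} (λ _ → P)
  constᵈ P with em {P}
  ... | yes p = def {m = 0} (∃′ (zero ≡′ zero)) [] λ v → (λ _ → proj₁ infinity , refl) , (λ _ → p)
  ... | no ¬p = def {m = 0} (¬′ (∃′ (zero ≡′ zero))) [] λ v → (λ p → contradiction p ¬p) , (λ h → contradiction (proj₁ infinity , refl) h)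

-- Set-theoretic operations as definable terms.

module Sets {ℓ : Level} (em : ExcludedMiddle ℓ) (M : ZFModel ℓ) where

  open import Data.Nat.Base as ℕ using (ℕ; suc)
  open import Data.Fin.Base using (zero; suc)
  open import Data.Fin using (#_)
  open import Data.Vec.Base using (Vec; []; _∷_; lookup; tail)
  open import Data.Product.Base using (∃; _×_; _,_; proj₁; proj₂; map₂)
  open import Data.Sum.Base using (_⊎_; inj₁; inj₂; [_,_]′)
  open import Function.Base using (_∘_; id)
  open import Function.Bundles using (_⇔_; mk⇔)
  open import Relation.Binary.PropositionalEquality
  open import Relation.Nullary using (¬_; Dec; yes; no; contradiction)
  open DefinablePredicates em M
  open Internal M using (Map; set; _⊠_; El; Class)


  ext : ∀ {x y} → (∀ z → z ∈ x → z ∈ y) → (∀ z → z ∈ y → z ∈ x) → x ≡ y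
  ext f g = extensionality λ z → mk⇔ (f z) (g z)

  opaque
    -- The parameters `v` stay an argument instead of being absorbed into the formula, so that a
    -- comprehension is itself a definable term in them.
    comp : ∀ {n} {P : Vec V (suc n) → Set ℓ} → Def P → V → Vec V n → V
    ∈comp : ∀ {n} {P : Vec V (suc n) → Set ℓ} (p : Def P) {a v} z →
            z ∈ comp p a v ⇔ (z ∈ a × P (z ∷ v))

    private
      closed : ∀ {n} {P : Vec V (suc n) → Set ℓ} → Def P → (v : Vec V n) → Def {1} (λ w → P (head w ∷ v))
      closed {ℕ.zero} p [] = iffᵈ (λ { (x ∷ []) → mk⇔ id id }) p
      closed {suc n} {P} p (x ∷ v) = closed {P = λ w → P (head w ∷ x ∷ tail w)}
        (iffᵈ (λ { (_ ∷ _) → mk⇔ id id }) (letᵈ (cst x) (renᵈ {P = P}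
          (λ { zero → suc zero ; (suc zero) → zero ; (suc (suc i)) → suc (suc i) })
          (λ w → head (tail w) ∷ head w ∷ tail (tail w))
          (λ { (_ ∷ _ ∷ _) zero → refl ; (_ ∷ _ ∷ _) (suc zero) → refl ; (_ ∷ _ ∷ _) (suc (suc i)) → refl }) p))) v

      sep₁ : {P : Vec V 1 → Set ℓ} (p : Def P) (a : V) →
             ∃ λ b → ∀ z → z ∈ b ⇔ (z ∈ a × P (z ∷ []))
      sep₁ (def φ ρ f) a with separation φ ρ a
      ... | b , g = b , λ z → mk⇔ (map₂ (proj₂ (f (z ∷ []))) ∘ to (g z)) (from (g z) ∘ map₂ (proj₁ (f (z ∷ []))))

    comp p a v = proj₁ (sep₁ (closed p v) a)
    ∈comp p {a} {v} z = proj₂ (sep₁ (closed p v) a) z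

  opaque
    comp₁ᵈ : ∀ {n} {P : Vec V 2 → Set ℓ} {A F : Vec V n → V} (p : Def P) → DefT A → DefT F →
             DefT (λ v → comp p (A v) (F v ∷ []))
    comp₁ᵈ {P = P} p a t = term (iffᵈ (λ v → mk⇔
        (λ h → ext (λ z → from (∈comp p z) ∘ to (h z)) (λ z → from (h z) ∘ to (∈comp p z)))
        (λ e z → subst (λ q → z ∈ q ⇔ _) (sym e) (∈comp p z)))
      (∀ᵈ ((var (# 0) ∈ᵈ var (# 1)) ⇔ᵈ ((var (# 0) ∈ᵈ wkT (wkT a)) ×ᵈ def₂ {P = P} p (var (# 0)) (wkT (wkT t))))))

    comp₂ᵈ : ∀ {n} {P : Vec V 3 → Set ℓ} {A F G : Vec V n → V} (p : Def P) → DefT A → DefT F → DefT G →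
             DefT (λ v → comp p (A v) (F v ∷ G v ∷ []))
    comp₂ᵈ {P = P} p a t u = term (iffᵈ (λ v → mk⇔
        (λ h → ext (λ z → from (∈comp p z) ∘ to (h z)) (λ z → from (h z) ∘ to (∈comp p z)))
        (λ e z → subst (λ q → z ∈ q ⇔ _) (sym e) (∈comp p z)))
      (∀ᵈ ((var (# 0) ∈ᵈ var (# 1)) ⇔ᵈ
           ((var (# 0) ∈ᵈ wkT (wkT a)) ×ᵈ def₃ {P = P} p (var (# 0)) (wkT (wkT t)) (wkT (wkT u))))))

  ⟪_⟫ : {P : Set ℓ} → Dec P → V → V → V
  ⟪ yes _ ⟫ x y = x
  ⟪ no  _ ⟫ x y = y

  opaque
    iteᵈ : ∀ {n} {P : Vec V n → Set ℓ} {F G : Vec V n → V} → Def P → DefT F → DefT G →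
           DefT (λ v → ⟪ em {P v} ⟫ (F v) (G v))
    iteᵈ {P = P} {F} {G} p t u = term (iffᵈ e ((wkᵈ p ×ᵈ graphᵈ t) ⊎ᵈ (¬ᵈ wkᵈ p ×ᵈ graphᵈ u)))
      where
      e : ∀ v → (P (tail v) × head v ≡ F (tail v) ⊎ ¬ P (tail v) × head v ≡ G (tail v)) ⇔
                (head v ≡ ⟪ em {P (tail v)} ⟫ (F (tail v)) (G (tail v)))
      e v with em {P (tail v)}
      ... | yes q = mk⇔ [ proj₂ , (λ (¬q , _) → contradiction q ¬q) ]′ (λ h → inj₁ (q , h))
      ... | no ¬q = mk⇔ [ (λ (q , _) → contradiction q ¬q) , proj₂ ]′ (λ h → inj₂ (¬q , h))

    ⋃ : V → V
    ⋃ a = proj₁ (union a)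
    ∈⋃ : ∀ {a} z → z ∈ ⋃ a ⇔ (∃ λ y → y ∈ a × z ∈ y)
    ∈⋃ {a} = proj₂ (union a)

    𝒫 : V → V
    𝒫 a = proj₁ (powerset a)
    ∈𝒫 : ∀ {a} z → z ∈ 𝒫 a ⇔ (∀ y → y ∈ z → y ∈ a)
    ∈𝒫 {a} = proj₂ (powerset a)

    ∈upair : ∀ {x y} z → z ∈ upair x y ⇔ (z ≡ x ⊎ z ≡ y)
    ∈upair {x} {y} = proj₂ (pairing x y)

    upairᵈ : ∀ {n} {F G : Vec V n → V} → DefT F → DefT G → DefT (λ v → upair (F v) (G v))
    upairᵈ t u = term (iffᵈ (λ v → mk⇔
        (λ h → ext (λ z → from (∈upair z) ∘ to (h z)) (λ z → from (h z) ∘ to (∈upair z)))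
        (λ e z → subst (λ q → z ∈ q ⇔ _) (sym e) (∈upair z)))
      (∀ᵈ ((var (# 0) ∈ᵈ var (# 1)) ⇔ᵈ ((var (# 0) ≡ᵈ wkT (wkT t)) ⊎ᵈ (var (# 0) ≡ᵈ wkT (wkT u))))))

    pairᵈ : ∀ {n} {F G : Vec V n → V} → DefT F → DefT G → DefT (λ v → ⟨ F v , G v ⟩)
    pairᵈ t u = upairᵈ (upairᵈ t t) (upairᵈ t u)

    ⋃ᵈ : ∀ {n} {F : Vec V n → V} → DefT F → DefT (λ v → ⋃ (F v))
    ⋃ᵈ t = term (iffᵈ (λ v → mk⇔
        (λ h → ext (λ z → from (∈⋃ z) ∘ to (h z)) (λ z → from (h z) ∘ to (∈⋃ z)))
        (λ e z → subst (λ q → z ∈ q ⇔ _) (sym e) (∈⋃ z)))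
      (∀ᵈ ((var (# 0) ∈ᵈ var (# 1)) ⇔ᵈ ∃∈ (wkT (wkT t)) (var (# 1) ∈ᵈ var (# 0)))))

    upair-injˡ : ∀ {x y} → upair x x ≡ upair y y → x ≡ y
    upair-injˡ {x} {y} e with to (∈upair x) (subst (x ∈_) e (from (∈upair x) (inj₁ refl)))
    ... | inj₁ p = p
    ... | inj₂ p = p

    upair-injᵐ : ∀ {x y z} → upair x x ≡ upair y z → y ≡ x × z ≡ x
    upair-injᵐ {x} {y} {z} e =
      [ id , id ]′ (to (∈upair y) (subst (y ∈_) (sym e) (from (∈upair y) (inj₁ refl)))) ,
      [ id , id ]′ (to (∈upair z) (subst (z ∈_) (sym e) (from (∈upair z) (inj₂ refl))))

    upair-injʳ : ∀ {x y z} → upair x y ≡ upair x z → y ≡ z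
    upair-injʳ {x} {y} {z} e with to (∈upair y) (subst (y ∈_) e (from (∈upair y) (inj₂ refl)))
                                | to (∈upair z) (subst (z ∈_) (sym e) (from (∈upair z) (inj₂ refl)))
    ... | inj₂ p | _      = p
    ... | inj₁ p | inj₁ q = trans p (sym q)
    ... | inj₁ p | inj₂ q = sym q

    pair-inj₁ : ∀ {a b c d} → ⟨ a , b ⟩ ≡ ⟨ c , d ⟩ → a ≡ c
    pair-inj₁ {a} {b} {c} {d} e with to (∈upair _) (subst (upair a a ∈_) e (from (∈upair _) (inj₁ refl)))
    ... | inj₁ p = upair-injˡ p
    ... | inj₂ p = sym (proj₁ (upair-injᵐ p))

    pair-inj₂ : ∀ {a b c d} → ⟨ a , b ⟩ ≡ ⟨ c , d ⟩ → b ≡ d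
    pair-inj₂ {a} {b} {c} {d} e with pair-inj₁ e
    ... | refl = upair-injʳ (upair-injʳ e)

  -- Definite description: the union of a singleton is its element, so an object that is described
  -- uniquely becomes a definable term.
  ⋃-single : ∀ {a x} → (∀ z → z ∈ a ⇔ z ≡ x) → ⋃ a ≡ x
  ⋃-single {a} {x} h = ext
    (λ z m → let (y , y∈a , z∈y) = to (∈⋃ z) m in subst (z ∈_) (to (h y) y∈a) z∈y)
    (λ z z∈x → from (∈⋃ z) (x , from (h x) refl , z∈x))

  pair-∈⋃⋃ : ∀ {x y a} → ⟨ x , y ⟩ ∈ a → x ∈ ⋃ (⋃ a) × y ∈ ⋃ (⋃ a)
  pair-∈⋃⋃ {x} {y} {a} m = inn x (inj₁ refl) , inn y (inj₂ refl)
    where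
    inn : ∀ z → z ≡ x ⊎ z ≡ y → z ∈ ⋃ (⋃ a)
    inn z e = from (∈⋃ z) (upair x y , from (∈⋃ _) (_ , m , from (∈upair _) (inj₂ refl)) , from (∈upair z) e)

  infixl 9 _‵_
  private
    apDef : Def {3} (λ v → ⟨ lookup v (# 1) , lookup v (# 0) ⟩ ∈ lookup v (# 2))
    apDef = pairᵈ (var (# 1)) (var (# 0)) ∈ᵈ var (# 2)

    fstDef : Def {2} (λ v → ∃ λ y → lookup v (# 1) ≡ ⟨ lookup v (# 0) , y ⟩)
    fstDef = ∃ᵈ (var (# 2) ≡ᵈ pairᵈ (var (# 1)) (var (# 0)))

    sndDef : Def {2} (λ v → ∃ λ y → lookup v (# 1) ≡ ⟨ y , lookup v (# 0) ⟩)
    sndDef = ∃ᵈ (var (# 2) ≡ᵈ pairᵈ (var (# 0)) (var (# 1)))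

  opaque
    -- Application is total on `V` and hence a term. The value is sought in ⋃ (⋃ f), where the
    -- components of Kuratowski pairs live, and is meaningful only where f has exactly one value.
    _‵_ : V → V → V
    f ‵ x = ⋃ (comp apDef (⋃ (⋃ f)) (x ∷ f ∷ []))

    ‵ᵈ : ∀ {n} {F G : Vec V n → V} → DefT F → DefT G → DefT (λ v → F v ‵ G v)
    ‵ᵈ t u = ⋃ᵈ (comp₂ᵈ apDef (⋃ᵈ (⋃ᵈ t)) u t)

    ‵-unique : ∀ {f x y} → ⟨ x , y ⟩ ∈ f → (∀ z → ⟨ x , z ⟩ ∈ f → z ≡ y) → f ‵ x ≡ y
    ‵-unique m u = ⋃-single λ z → mk⇔ (λ q → u z (proj₂ (to (∈comp apDef z) q)))
      λ { refl → from (∈comp apDef z) (proj₂ (pair-∈⋃⋃ m) , m) }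

    fst snd : V → V
    fst p = ⋃ (comp fstDef (⋃ p) (p ∷ []))
    snd p = ⋃ (comp sndDef (⋃ p) (p ∷ []))

    fstᵈ : ∀ {n} {F : Vec V n → V} → DefT F → DefT (λ v → fst (F v))
    fstᵈ t = ⋃ᵈ (comp₁ᵈ fstDef (⋃ᵈ t) t)
    sndᵈ : ∀ {n} {F : Vec V n → V} → DefT F → DefT (λ v → snd (F v))
    sndᵈ t = ⋃ᵈ (comp₁ᵈ sndDef (⋃ᵈ t) t)

    private
      ∈⋃pair : ∀ {x y} z → z ≡ x ⊎ z ≡ y → z ∈ ⋃ ⟨ x , y ⟩
      ∈⋃pair z e = from (∈⋃ z) (_ , from (∈upair _) (inj₂ refl) , from (∈upair z) e)

    fst-β : ∀ x y → fst ⟨ x , y ⟩ ≡ x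
    fst-β x y = ⋃-single λ z → mk⇔ (λ q → sym (pair-inj₁ (proj₂ (proj₂ (to (∈comp fstDef z) q)))))
      λ { refl → from (∈comp fstDef z) (∈⋃pair z (inj₁ refl) , y , refl) }
    snd-β : ∀ x y → snd ⟨ x , y ⟩ ≡ y
    snd-β x y = ⋃-single λ z → mk⇔ (λ q → sym (pair-inj₂ (proj₂ (proj₂ (to (∈comp sndDef z) q)))))
      λ { refl → from (∈comp sndDef z) (∈⋃pair z (inj₂ refl) , x , refl) }

  infixr 7 _×ˢ_
  private
    prodDef : Def {3} (λ v → ∃ λ x → x ∈ lookup v (# 1) × ∃ λ y → y ∈ lookup v (# 2) × lookup v (# 0) ≡ ⟨ x , y ⟩)
    prodDef = ∃∈ (var (# 1)) (∃∈ (var (# 3)) (var (# 2) ≡ᵈ pairᵈ (var (# 1)) (var (# 0))))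

  opaque
    _×ˢ_ : V → V → V
    a ×ˢ b = comp prodDef (𝒫 (𝒫 (⋃ (upair a b)))) (a ∷ b ∷ [])

    ∈× : ∀ {a b} p → p ∈ a ×ˢ b ⇔ (∃ λ x → x ∈ a × ∃ λ y → y ∈ b × p ≡ ⟨ x , y ⟩)
    ∈× {a} {b} p = mk⇔ (λ q → proj₂ (to (∈comp prodDef p) q)) λ { h@(x , x∈a , y , y∈b , refl) →
      from (∈comp prodDef p) (from (∈𝒫 _) (λ s s∈p → from (∈𝒫 s) λ t t∈s → from (∈⋃ t)
        (case s t (to (∈upair s) s∈p) t∈s x∈a y∈b)) , h) }
      where
      case : ∀ {x y} s t → s ≡ upair x x ⊎ s ≡ upair x y → t ∈ s → x ∈ a → y ∈ b →
             ∃ λ c → c ∈ upair a b × t ∈ c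
      case s t (inj₁ refl) t∈s x∈a y∈b with to (∈upair t) t∈s
      ... | inj₁ refl = a , from (∈upair a) (inj₁ refl) , x∈a
      ... | inj₂ refl = a , from (∈upair a) (inj₁ refl) , x∈a
      case s t (inj₂ refl) t∈s x∈a y∈b with to (∈upair t) t∈s
      ... | inj₁ refl = a , from (∈upair a) (inj₁ refl) , x∈a
      ... | inj₂ refl = b , from (∈upair b) (inj₂ refl) , y∈b

  pair∈× : ∀ {a b x y} → x ∈ a → y ∈ b → ⟨ x , y ⟩ ∈ a ×ˢ b
  pair∈× x∈a y∈b = from (∈× _) (_ , x∈a , _ , y∈b , refl)

  fst-∈ : ∀ {a b p} → p ∈ a ×ˢ b → fst p ∈ a
  fst-∈ {a} m with to (∈× _) m
  ... | x , x∈ , y , _ , refl = subst (_∈ a) (sym (fst-β x y)) x∈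
  snd-∈ : ∀ {a b p} → p ∈ a ×ˢ b → snd p ∈ b
  snd-∈ {b = b} m with to (∈× _) m
  ... | x , x∈ , y , y∈ , refl = subst (_∈ b) (sym (snd-β x y)) y∈
  pair-η : ∀ {a b p} → p ∈ a ×ˢ b → p ≡ ⟨ fst p , snd p ⟩
  pair-η m with to (∈× _) m
  ... | x , x∈ , y , y∈ , refl = sym (cong₂ ⟨_,_⟩ (fst-β x y) (snd-β x y))

  module _ (F : V → V) (t : DefT {1} (λ v → F (head v))) (A B : V) where
    private
      lamDef : Def {1} (λ v → ∃ λ x → x ∈ A × lookup v (# 0) ≡ ⟨ x , F x ⟩)
      lamDef = ∃∈ (cst A) (var (# 1) ≡ᵈ pairᵈ (var (# 0)) (app₁ t (var (# 0))))

    opaque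
      lam : V
      lam = comp lamDef (A ×ˢ B) []

      ∈lam : ∀ p → p ∈ lam → ∃ λ x → x ∈ A × p ≡ ⟨ x , F x ⟩
      ∈lam p m = proj₂ (to (∈comp lamDef p) m)

      lam-∈ : ∀ {x} → x ∈ A → F x ∈ B → ⟨ x , F x ⟩ ∈ lam
      lam-∈ x∈ y∈ = from (∈comp lamDef _) (pair∈× x∈ y∈ , _ , x∈ , refl)

    lam-value : ∀ {x y} → ⟨ x , y ⟩ ∈ lam → F x ≡ y
    lam-value m with ∈lam _ m
    ... | x′ , _ , e = trans (cong F (pair-inj₁ e)) (sym (pair-inj₂ e))

    -- `C` and `D` may be classes such as products and intervals; `A` is a set with the elements of
    -- `C`, and `B` a set that contains `D`, because the graph is separated from A × B.
    lamMap : {C D : Class} → (∀ {x} → C x → x ∈ A) → (∀ {x} → x ∈ A → C x) → (∀ {x} → D x → x ∈ B) →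
             (∀ {x} → C x → D (F x)) → Map C D
    lamMap ca ac db fd = record
      { graph  = lam
      ; graph⊆ = λ m → let (x , x∈ , e) = ∈lam _ m in x , F x , ac x∈ , fd (ac x∈) , e
      ; total! = λ {x} c → F x , (fd c , lam-∈ (ca c) (db (fd c))) , λ (_ , m) → lam-value m }

  module MapProperties {C D : Class} (f : Map C D) where
    open Map f
    graph-∈ : ∀ {x} (c : C x) → ⟨ x , proj₁ (apply (x , c)) ⟩ ∈ graph
    graph-∈ c with total! c
    ... | y , (_ , m) , _ = m
    graph-unique : ∀ {x y} (c : C x) → D y → ⟨ x , y ⟩ ∈ graph → proj₁ (apply (x , c)) ≡ y
    graph-unique c d m with total! c
    ... | y , _ , u = u (d , m)
    graph-unique′ : ∀ {x y} (c : C x) → ⟨ x , y ⟩ ∈ graph → proj₁ (apply (x , c)) ≡ y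
    graph-unique′ c m with graph⊆ m
    ... | x , y , _ , d , e = graph-unique c (subst D (sym (pair-inj₂ e)) d) m
    apply-‵ : ∀ {x} (c : C x) → graph ‵ x ≡ proj₁ (apply (x , c))
    apply-‵ c = ‵-unique (graph-∈ c) λ z m → sym (graph-unique′ c m)

-- Arithmetic of the positive integers on ω.

module Naturals {ℓ : Level} (em : ExcludedMiddle ℓ) (M : ZFModel ℓ) where

  open import Data.Nat.Base as ℕ using (ℕ)
  open import Data.Fin.Base using (zero; suc)
  open import Data.Fin using (#_)
  open import Data.Vec.Base using (Vec; []; _∷_; lookup)
  open import Data.Product.Base using (∃; _×_; _,_; proj₁; proj₂)
  open import Data.Sum.Base using (_⊎_; inj₁; inj₂; [_,_]′)
  open import Data.Empty using (⊥-elim)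
  open import Function.Base using (_∘_; id)
  open import Function.Bundles using (_⇔_; mk⇔)
  open import Relation.Binary.PropositionalEquality
  open import Relation.Nullary using (¬_)
  open DefinablePredicates em M
  open Sets em M
  open Internal M using (set; El)


  -- ∅ is read as the number 1, so that ω is the semiring (without zero) of positive integers.
  one : V
  one = proj₁ (proj₁ (proj₂ infinity))

  ∉one : ∀ z → ¬ z ∈ one
  ∉one = proj₁ (proj₂ (proj₁ (proj₂ infinity)))

  sc : V → V
  sc x = ⋃ (upair x (upair x x))

  ∈sc : ∀ {x} z → z ∈ sc x ⇔ (z ∈ x ⊎ z ≡ x)
  ∈sc {x} z = mk⇔ f g
    where
    f : z ∈ sc x → z ∈ x ⊎ z ≡ x
    f m with to (∈⋃ z) m
    ... | y , y∈ , z∈ with to (∈upair y) y∈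
    ...   | inj₁ refl = inj₁ z∈
    ...   | inj₂ refl = inj₂ ([ id , id ]′ (to (∈upair z) z∈))
    g : z ∈ x ⊎ z ≡ x → z ∈ sc x
    g (inj₁ m) = from (∈⋃ z) (x , from (∈upair x) (inj₁ refl) , m)
    g (inj₂ e) = from (∈⋃ z) (upair x x , from (∈upair _) (inj₂ refl) , from (∈upair z) (inj₁ e))

  scᵈ : ∀ {n} {F : Vec V n → V} → DefT F → DefT (λ v → sc (F v))
  scᵈ t = ⋃ᵈ (upairᵈ t (upairᵈ t t))

  sc≢one : ∀ {x} → sc x ≢ one
  sc≢one {x} e = ∉one x (subst (x ∈_) e (from (∈sc x) (inj₂ refl)))

  ∈-asym : ∀ {x y} → x ∈ y → y ∈ x → ∀ {A : Set ℓ} → A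
  ∈-asym {x} {y} xy yx with foundation (upair x y) (x , from (∈upair x) (inj₁ refl))
  ... | z , z∈ , h with to (∈upair z) z∈
  ...   | inj₁ refl = ⊥-elim (h (y , yx , from (∈upair y) (inj₂ refl)))
  ...   | inj₂ refl = ⊥-elim (h (x , xy , from (∈upair x) (inj₁ refl)))

  sc-injective : ∀ {x y} → sc x ≡ sc y → x ≡ y
  sc-injective {x} {y} e with to (∈sc x) (subst (x ∈_) e (from (∈sc x) (inj₂ refl)))
                            | to (∈sc y) (subst (y ∈_) (sym e) (from (∈sc y) (inj₂ refl)))
  ... | inj₂ p | _      = p
  ... | inj₁ _ | inj₂ q = sym q
  ... | inj₁ p | inj₁ q = ∈-asym p q

  Inductive : V → Set ℓ
  Inductive A = one ∈ A × (∀ x → x ∈ A → sc x ∈ A)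

  private
    ωDef : Def {1} (λ v → ∀ A → Inductive A → lookup v (# 0) ∈ A)
    ωDef = ∀ᵈ (((cst one ∈ᵈ var (# 0)) ×ᵈ ∀∈ (var (# 0)) (scᵈ (var (# 0)) ∈ᵈ var (# 1))) →ᵈ (var (# 1) ∈ᵈ var (# 0)))

    I : V
    I = proj₁ infinity
    I-inductive : Inductive I
    I-inductive = proj₂ (proj₂ (proj₁ (proj₂ infinity))) , λ x x∈I →
      let (s , h , s∈I) = proj₂ (proj₂ infinity) x x∈I
      in subst (_∈ I) (extensionality λ z → mk⇔ (from (∈sc z) ∘ to (h z)) (from (h z) ∘ to (∈sc z))) s∈I

  opaque
    ω : V
    ω = comp ωDef I []

    one∈ω : one ∈ ω
    one∈ω = from (∈comp ωDef one) (proj₁ I-inductive , λ A → proj₁)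

    sc∈ω : ∀ {n} → n ∈ ω → sc n ∈ ω
    sc∈ω n∈ω with to (∈comp ωDef _) n∈ω
    ... | n∈I , h = from (∈comp ωDef _) (proj₂ I-inductive _ n∈I , λ A ind → proj₂ ind _ (h A ind))

    -- Definability is what makes the elements with property `P` a set, to which the minimality of ω
    -- applies.
    ω-induction : {P : Vec V 1 → Set ℓ} → Def P → P (one ∷ []) →
                  (∀ n → n ∈ ω → P (n ∷ []) → P (sc n ∷ [])) → ∀ n → n ∈ ω → P (n ∷ [])
    ω-induction {P} p base step n n∈ω = proj₂ (to (∈comp p n) (proj₂ (to (∈comp ωDef n) n∈ω) (comp p ω [])
      ( from (∈comp p one) (one∈ω , base)
      , λ x m → let (x∈ω , px) = to (∈comp p x) m in from (∈comp p _) (sc∈ω x∈ω , step x x∈ω px))))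

  ω-cases : ∀ n → n ∈ ω → n ≡ one ⊎ (∃ λ m → m ∈ ω × n ≡ sc m)
  ω-cases = ω-induction ((var (# 0) ≡ᵈ cst one) ⊎ᵈ ∃∈ (cst ω) (var (# 1) ≡ᵈ scᵈ (var (# 0))))
    (inj₁ refl) (λ n n∈ω _ → inj₂ (n , n∈ω , refl))

  -- Recursion with a parameter m ∈ P, initial value B m and step G m. The graph is the intersection
  -- of all relations closed under both rules.
  module Recursion (P A : V) (B : V → V) (Bᵈ : DefT {1} (λ v → B (head v)))
                   (G : V → V → V) (Gᵈ : DefT {2} (λ v → G (head v) (lookup v (# 1))))
                   (B-∈ : ∀ {m} → m ∈ P → B m ∈ A) (G-∈ : ∀ {m k} → m ∈ P → k ∈ A → G m k ∈ A) where

    private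
      T : V
      T = (P ×ˢ ω) ×ˢ A

      Closed : V → Set ℓ
      Closed R = (∀ m → m ∈ P → ⟨ ⟨ m , one ⟩ , B m ⟩ ∈ R) ×
                 (∀ m → m ∈ P → ∀ n → n ∈ ω → ∀ k → k ∈ A → ⟨ ⟨ m , n ⟩ , k ⟩ ∈ R → ⟨ ⟨ m , sc n ⟩ , G m k ⟩ ∈ R)

      closedᵈ : ∀ {n} → Def (λ (v : Vec V (ℕ.suc n)) → Closed (lookup v zero))
      closedᵈ = ∀∈ (cst P) (pairᵈ (pairᵈ (var (# 0)) (cst one)) (app₁ Bᵈ (var (# 0))) ∈ᵈ var (# 1))
        ×ᵈ ∀∈ (cst P) (∀∈ (cst ω) (∀∈ (cst A)
             ((pairᵈ (pairᵈ (var (# 2)) (var (# 1))) (var (# 0)) ∈ᵈ var (# 3)) →ᵈ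
              (pairᵈ (pairᵈ (var (# 2)) (scᵈ (var (# 1)))) (app₂ Gᵈ (var (# 2)) (var (# 0))) ∈ᵈ var (# 3)))))

      graphDef : Def {1} (λ v → ∀ R → Closed R → lookup v (# 0) ∈ R)
      graphDef = ∀ᵈ (closedᵈ →ᵈ (var (# 1) ∈ᵈ var (# 0)))

      Step : V → V → Set ℓ
      Step g t = (∃ λ m → m ∈ P × t ≡ ⟨ ⟨ m , one ⟩ , B m ⟩) ⊎
                 (∃ λ m → m ∈ P × ∃ λ n → n ∈ ω × ∃ λ k → k ∈ A × ⟨ ⟨ m , n ⟩ , k ⟩ ∈ g × t ≡ ⟨ ⟨ m , sc n ⟩ , G m k ⟩)

      stepDef : Def {2} (λ v → Step (lookup v (# 1)) (lookup v (# 0)))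
      stepDef = ∃∈ (cst P) (var (# 1) ≡ᵈ pairᵈ (pairᵈ (var (# 0)) (cst one)) (app₁ Bᵈ (var (# 0))))
        ⊎ᵈ ∃∈ (cst P) (∃∈ (cst ω) (∃∈ (cst A)
             ((pairᵈ (pairᵈ (var (# 2)) (var (# 1))) (var (# 0)) ∈ᵈ var (# 4)) ×ᵈ
              (var (# 3) ≡ᵈ pairᵈ (pairᵈ (var (# 2)) (scᵈ (var (# 1)))) (app₂ Gᵈ (var (# 2)) (var (# 0)))))))

      graph : V
      graph = comp graphDef T []

      graph-closed : Closed graph
      graph-closed =
        (λ m m∈P → from (∈comp graphDef _) (pair∈× (pair∈× m∈P one∈ω) (B-∈ m∈P) , λ R c → proj₁ c m m∈P)) ,
        (λ m m∈P n n∈ω k k∈A t∈ → from (∈comp graphDef _)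
           (pair∈× (pair∈× m∈P (sc∈ω n∈ω)) (G-∈ m∈P k∈A) ,
            λ R c → proj₂ c m m∈P n n∈ω k k∈A (proj₂ (to (∈comp graphDef _) t∈) R c)))

      stepped : V
      stepped = comp stepDef graph (graph ∷ [])

      stepped-closed : Closed stepped
      stepped-closed =
        (λ m m∈P → from (∈comp stepDef _) (proj₁ graph-closed m m∈P , inj₁ (m , m∈P , refl))) ,
        (λ m m∈P n n∈ω k k∈A t∈ → let t∈g = proj₁ (to (∈comp stepDef _) t∈) in
          from (∈comp stepDef _) (proj₂ graph-closed m m∈P n n∈ω k k∈A t∈g ,
            inj₂ (m , m∈P , n , n∈ω , k , k∈A , t∈g , refl)))

      -- The triples of `graph` produced by one of the rules already form a closed relation, so by
      -- minimality there are no others.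
      inversion : ∀ {t} → t ∈ graph → Step graph t
      inversion t∈ = proj₂ (to (∈comp stepDef _) (proj₂ (to (∈comp graphDef _) t∈) stepped stepped-closed))

      Value : V → V → V → Set ℓ
      Value m n k = k ∈ A × ⟨ ⟨ m , n ⟩ , k ⟩ ∈ graph × (∀ k′ → ⟨ ⟨ m , n ⟩ , k′ ⟩ ∈ graph → k′ ≡ k)

      base-unique : ∀ {m k} → ⟨ ⟨ m , one ⟩ , k ⟩ ∈ graph → k ≡ B m
      base-unique t∈ with inversion t∈
      ... | inj₁ (m , _ , e) = trans (pair-inj₂ e) (cong B (sym (pair-inj₁ (pair-inj₁ e))))
      ... | inj₂ (_ , _ , _ , _ , _ , _ , _ , e) = ⊥-elim (sc≢one (sym (pair-inj₂ (pair-inj₁ e))))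

      step-unique : ∀ {m n k k′} → (∀ k″ → ⟨ ⟨ m , n ⟩ , k″ ⟩ ∈ graph → k″ ≡ k) →
                    ⟨ ⟨ m , sc n ⟩ , k′ ⟩ ∈ graph → k′ ≡ G m k
      step-unique {m} {n} {k} {k′} u t∈ with inversion t∈
      ... | inj₁ (_ , _ , e) = ⊥-elim (sc≢one (pair-inj₂ (pair-inj₁ e)))
      ... | inj₂ (_ , _ , _ , _ , k″ , _ , s∈ , e) = trans (pair-inj₂ e) (cong₂ G (sym em₁) (u k″
             (subst₂ (λ a b → ⟨ ⟨ a , b ⟩ , k″ ⟩ ∈ graph) (sym em₁) (sym en) s∈)))
        where
        em₁ = pair-inj₁ (pair-inj₁ e)
        en = sc-injective (pair-inj₂ (pair-inj₁ e))

      value : ∀ {m} → m ∈ P → ∀ n → n ∈ ω → ∃ λ k → Value m n k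
      value {m} m∈P = ω-induction
        (∃ᵈ ((var (# 0) ∈ᵈ cst A) ×ᵈ (pairᵈ (pairᵈ (cst m) (var (# 1))) (var (# 0)) ∈ᵈ cst graph) ×ᵈ
             ∀ᵈ ((pairᵈ (pairᵈ (cst m) (var (# 2))) (var (# 0)) ∈ᵈ cst graph) →ᵈ (var (# 0) ≡ᵈ var (# 1)))))
        (B m , B-∈ m∈P , proj₁ graph-closed m m∈P , λ _ → base-unique)
        (λ { n n∈ω (k , k∈A , t∈ , u) → G m k , G-∈ m∈P k∈A , proj₂ graph-closed m m∈P n n∈ω k k∈A t∈ , λ _ → step-unique u })

    opaque
      rec : V → V → V
      rec m n = graph ‵ ⟨ m , n ⟩

      recᵈ : ∀ {n} {F H : Vec V n → V} → DefT F → DefT H → DefT (λ v → rec (F v) (H v))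
      recᵈ t u = ‵ᵈ (cst graph) (pairᵈ t u)

      private
        rec-value : ∀ {m n k} → Value m n k → rec m n ≡ k
        rec-value (_ , t∈ , u) = ‵-unique t∈ u

      rec-∈ : ∀ {m n} → m ∈ P → n ∈ ω → rec m n ∈ A
      rec-∈ m∈P n∈ω with value m∈P _ n∈ω
      ... | k , v = subst (_∈ A) (sym (rec-value v)) (proj₁ v)

      rec-one : ∀ {m} → m ∈ P → rec m one ≡ B m
      rec-one m∈P with value m∈P _ one∈ω
      ... | k , v = trans (rec-value v) (sym (proj₂ (proj₂ v) _ (proj₁ graph-closed _ m∈P)))

      rec-sc : ∀ {m n} → m ∈ P → n ∈ ω → rec m (sc n) ≡ G m (rec m n)
      rec-sc {m} {n} m∈P n∈ω with value m∈P _ n∈ω | value m∈P _ (sc∈ω n∈ω)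
      ... | k , v | k′ , v′ = trans (rec-value v′) (trans (sym (proj₂ (proj₂ v′) _
               (proj₂ graph-closed _ m∈P _ n∈ω _ (proj₁ v) (proj₁ (proj₂ v))))) (cong (G m) (sym (rec-value v))))

  module Plus = Recursion ω ω sc (scᵈ (var (# 0))) (λ _ → sc) (scᵈ (var (# 1))) sc∈ω (λ _ → sc∈ω)
  open Plus public using () renaming (rec to plus; recᵈ to plusᵈ; rec-∈ to plus-∈)

  module Times = Recursion ω ω id (var (# 0)) (λ m k → plus k m) (plusᵈ (var (# 1)) (var (# 0))) id (λ m k → plus-∈ k m)
  open Times public using () renaming (rec to times; recᵈ to timesᵈ; rec-∈ to times-∈)

  plus-assoc : ∀ {l m} → l ∈ ω → m ∈ ω → ∀ n → n ∈ ω → plus (plus l m) n ≡ plus l (plus m n)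
  plus-assoc {l} {m} l∈ m∈ = ω-induction
    (plusᵈ (cst (plus l m)) (var (# 0)) ≡ᵈ plusᵈ (cst l) (plusᵈ (cst m) (var (# 0))))
    (trans (Plus.rec-one (plus-∈ l∈ m∈)) (trans (sym (Plus.rec-sc l∈ m∈)) (cong (plus l) (sym (Plus.rec-one m∈)))))
    (λ n n∈ ih → trans (Plus.rec-sc (plus-∈ l∈ m∈) n∈) (trans (cong sc ih)
       (trans (sym (Plus.rec-sc l∈ (plus-∈ m∈ n∈))) (cong (plus l) (sym (Plus.rec-sc m∈ n∈))))))

  plus-oneˡ : ∀ n → n ∈ ω → plus one n ≡ sc n
  plus-oneˡ = ω-induction (plusᵈ (cst one) (var (# 0)) ≡ᵈ scᵈ (var (# 0)))
    (Plus.rec-one one∈ω) (λ n n∈ ih → trans (Plus.rec-sc one∈ω n∈) (cong sc ih))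

  plus-scˡ : ∀ {m n} → m ∈ ω → n ∈ ω → plus (sc m) n ≡ sc (plus m n)
  plus-scˡ {m} {n} m∈ n∈ = begin
    plus (sc m) n         ≡⟨ cong (λ z → plus z n) (Plus.rec-one m∈) ⟨
    plus (plus m one) n   ≡⟨ plus-assoc m∈ one∈ω n n∈ ⟩
    plus m (plus one n)   ≡⟨ cong (plus m) (plus-oneˡ n n∈) ⟩
    plus m (sc n)         ≡⟨ Plus.rec-sc m∈ n∈ ⟩
    sc (plus m n)         ∎
    where open ≡-Reasoning

  plus-comm : ∀ {m} → m ∈ ω → ∀ n → n ∈ ω → plus m n ≡ plus n m
  plus-comm {m} m∈ = ω-induction (plusᵈ (cst m) (var (# 0)) ≡ᵈ plusᵈ (var (# 0)) (cst m))
    (trans (Plus.rec-one m∈) (sym (plus-oneˡ m m∈)))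
    (λ n n∈ ih → trans (Plus.rec-sc m∈ n∈) (trans (cong sc ih) (sym (plus-scˡ n∈ m∈))))

  times-distribˡ : ∀ {l m} → l ∈ ω → m ∈ ω → ∀ n → n ∈ ω → times l (plus m n) ≡ plus (times l m) (times l n)
  times-distribˡ {l} {m} l∈ m∈ = ω-induction
    (timesᵈ (cst l) (plusᵈ (cst m) (var (# 0))) ≡ᵈ plusᵈ (cst (times l m)) (timesᵈ (cst l) (var (# 0))))
    (trans (cong (times l) (Plus.rec-one m∈)) (trans (Times.rec-sc l∈ m∈) (cong (plus (times l m)) (sym (Times.rec-one l∈)))))
    (λ n n∈ ih → begin
      times l (plus m (sc n))                 ≡⟨ cong (times l) (Plus.rec-sc m∈ n∈) ⟩
      times l (sc (plus m n))                 ≡⟨ Times.rec-sc l∈ (plus-∈ m∈ n∈) ⟩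
      plus (times l (plus m n)) l             ≡⟨ cong (λ z → plus z l) ih ⟩
      plus (plus (times l m) (times l n)) l   ≡⟨ plus-assoc (times-∈ l∈ m∈) (times-∈ l∈ n∈) l l∈ ⟩
      plus (times l m) (plus (times l n) l)   ≡⟨ cong (plus (times l m)) (Times.rec-sc l∈ n∈) ⟨
      plus (times l m) (times l (sc n))       ∎)
    where open ≡-Reasoning

  times-assoc : ∀ {l m} → l ∈ ω → m ∈ ω → ∀ n → n ∈ ω → times (times l m) n ≡ times l (times m n)
  times-assoc {l} {m} l∈ m∈ = ω-induction
    (timesᵈ (cst (times l m)) (var (# 0)) ≡ᵈ timesᵈ (cst l) (timesᵈ (cst m) (var (# 0))))
    (trans (Times.rec-one (times-∈ l∈ m∈)) (cong (times l) (sym (Times.rec-one m∈))))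
    (λ n n∈ ih → begin
      times (times l m) (sc n)                  ≡⟨ Times.rec-sc (times-∈ l∈ m∈) n∈ ⟩
      plus (times (times l m) n) (times l m)    ≡⟨ cong (λ z → plus z (times l m)) ih ⟩
      plus (times l (times m n)) (times l m)    ≡⟨ times-distribˡ l∈ (times-∈ m∈ n∈) m m∈ ⟨
      times l (plus (times m n) m)              ≡⟨ cong (times l) (Times.rec-sc m∈ n∈) ⟨
      times l (times m (sc n))                  ∎)
    where open ≡-Reasoning

  times-oneˡ : ∀ n → n ∈ ω → times one n ≡ n
  times-oneˡ = ω-induction (timesᵈ (cst one) (var (# 0)) ≡ᵈ var (# 0)) (Times.rec-one one∈ω)
    (λ n n∈ ih → trans (Times.rec-sc one∈ω n∈) (trans (cong (λ z → plus z one) ih) (Plus.rec-one n∈)))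

  plus-interchange : ∀ {a b c d} → a ∈ ω → b ∈ ω → c ∈ ω → d ∈ ω →
                     plus (plus a b) (plus c d) ≡ plus (plus a c) (plus b d)
  plus-interchange {a} {b} {c} {d} a∈ b∈ c∈ d∈ = begin
    plus (plus a b) (plus c d)   ≡⟨ plus-assoc a∈ b∈ _ (plus-∈ c∈ d∈) ⟩
    plus a (plus b (plus c d))   ≡⟨ cong (plus a) (plus-assoc b∈ c∈ d d∈) ⟨
    plus a (plus (plus b c) d)   ≡⟨ cong (λ z → plus a (plus z d)) (plus-comm b∈ c c∈) ⟩
    plus a (plus (plus c b) d)   ≡⟨ cong (plus a) (plus-assoc c∈ b∈ d d∈) ⟩
    plus a (plus c (plus b d))   ≡⟨ plus-assoc a∈ c∈ _ (plus-∈ b∈ d∈) ⟨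
    plus (plus a c) (plus b d)   ∎
    where open ≡-Reasoning

  times-distribʳ : ∀ {l m} → l ∈ ω → m ∈ ω → ∀ n → n ∈ ω → times (plus l m) n ≡ plus (times l n) (times m n)
  times-distribʳ {l} {m} l∈ m∈ = ω-induction
    (timesᵈ (cst (plus l m)) (var (# 0)) ≡ᵈ plusᵈ (timesᵈ (cst l) (var (# 0))) (timesᵈ (cst m) (var (# 0))))
    (trans (Times.rec-one (plus-∈ l∈ m∈)) (sym (cong₂ plus (Times.rec-one l∈) (Times.rec-one m∈))))
    (λ n n∈ ih → begin
      times (plus l m) (sc n)                       ≡⟨ Times.rec-sc (plus-∈ l∈ m∈) n∈ ⟩
      plus (times (plus l m) n) (plus l m)          ≡⟨ cong (λ z → plus z (plus l m)) ih ⟩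
      plus (plus (times l n) (times m n)) (plus l m) ≡⟨ plus-interchange (times-∈ l∈ n∈) (times-∈ m∈ n∈) l∈ m∈ ⟩
      plus (plus (times l n) l) (plus (times m n) m) ≡⟨ cong₂ plus (Times.rec-sc l∈ n∈) (Times.rec-sc m∈ n∈) ⟨
      plus (times l (sc n)) (times m (sc n))        ∎)
    where open ≡-Reasoning

  times-comm : ∀ {m} → m ∈ ω → ∀ n → n ∈ ω → times m n ≡ times n m
  times-comm {m} m∈ = ω-induction (timesᵈ (cst m) (var (# 0)) ≡ᵈ timesᵈ (var (# 0)) (cst m))
    (trans (Times.rec-one m∈) (sym (times-oneˡ m m∈)))
    (λ n n∈ ih → begin
      times m (sc n)                 ≡⟨ Times.rec-sc m∈ n∈ ⟩
      plus (times m n) m             ≡⟨ cong₂ plus ih (sym (times-oneˡ m m∈)) ⟩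
      plus (times n m) (times one m) ≡⟨ times-distribʳ n∈ one∈ω m m∈ ⟨
      times (plus n one) m           ≡⟨ cong (λ z → times z m) (Plus.rec-one n∈) ⟩
      times (sc n) m                 ∎)
    where open ≡-Reasoning

  plus≢ : ∀ {k} → k ∈ ω → ∀ m → m ∈ ω → plus m k ≢ m
  plus≢ {k} k∈ = ω-induction (¬ᵈ (plusᵈ (var (# 0)) (cst k) ≡ᵈ var (# 0)))
    (λ e → sc≢one (trans (sym (plus-oneˡ k k∈)) e))
    (λ m m∈ ih e → ih (sc-injective (trans (sym (plus-scˡ m∈ k∈)) e)))

  infix 4 _<ᵛ_
  _<ᵛ_ : V → V → Set ℓ
  m <ᵛ n = ∃ λ k → k ∈ ω × plus m k ≡ n

  <ᵛᵈ : ∀ {n} {F G : Vec V n → V} → DefT F → DefT G → Def (λ v → F v <ᵛ G v)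
  <ᵛᵈ t u = ∃∈ (cst ω) (plusᵈ (wkT t) (var (# 0)) ≡ᵈ wkT u)

  trichotomy : ∀ {m} → m ∈ ω → ∀ n → n ∈ ω → m ≡ n ⊎ m <ᵛ n ⊎ n <ᵛ m
  trichotomy {m} m∈ = ω-induction
    ((cst m ≡ᵈ var (# 0)) ⊎ᵈ <ᵛᵈ (cst m) (var (# 0)) ⊎ᵈ <ᵛᵈ (var (# 0)) (cst m)) base step
    where
    base : m ≡ one ⊎ m <ᵛ one ⊎ one <ᵛ m
    base with ω-cases m m∈
    ... | inj₁ e = inj₁ e
    ... | inj₂ (k , k∈ , e) = inj₂ (inj₂ (k , k∈ , trans (plus-oneˡ k k∈) (sym e)))
    step : ∀ n → n ∈ ω → m ≡ n ⊎ m <ᵛ n ⊎ n <ᵛ m → m ≡ sc n ⊎ m <ᵛ sc n ⊎ sc n <ᵛ m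
    step n n∈ (inj₁ refl) = inj₂ (inj₁ (one , one∈ω , Plus.rec-one m∈))
    step n n∈ (inj₂ (inj₁ (k , k∈ , e))) = inj₂ (inj₁ (sc k , sc∈ω k∈ , trans (Plus.rec-sc m∈ k∈) (cong sc e)))
    step n n∈ (inj₂ (inj₂ (k , k∈ , e))) with ω-cases k k∈
    -- The difference m - n is 1, so m is the successor of n.
    ... | inj₁ refl = inj₁ (trans (sym e) (Plus.rec-one n∈))
    ... | inj₂ (j , j∈ , refl) = inj₂ (inj₂ (j , j∈ , trans (plus-scˡ n∈ j∈) (trans (sym (Plus.rec-sc n∈ j∈)) e)))

-- Positive fractions and their Archimedean property.

module PositiveRationals {ℓ : Level} (em : ExcludedMiddle ℓ) (M : ZFModel ℓ) where

  open import Data.Fin using (#_)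
  open import Data.Vec.Base using (Vec; lookup)
  open import Data.Maybe.Base using (just)
  open import Data.Product.Base using (∃; _×_; _,_; proj₁; proj₂)
  open import Data.Sum.Base as Sum using (_⊎_; inj₁; inj₂)
  open import Function.Bundles using (_⇔_; mk⇔)
  open import Relation.Binary.PropositionalEquality using (_≡_; refl; sym; trans; cong; cong₂)
  open import Relation.Binary.Structures using (IsEquivalence)
  open import Relation.Nullary using (¬_; yes; no)
  open PositiveSemirings
  open DefinablePredicates em M
  open Sets em M
  open Naturals em M
  open Internal M using (set; El)

  -- Equality of underlying sets, wrapped in a record so that its arguments can be inferred.
  record Same {A : V} (x y : El (set A)) : Set ℓ where
    constructor same
    field unwrap : proj₁ x ≡ proj₁ y
  open Same public

  Same-isEquivalence : ∀ {A} → IsEquivalence (Same {A})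
  Same-isEquivalence = record
    { refl = same refl ; sym = λ (same p) → same (sym p) ; trans = λ (same p) (same q) → same (trans p q) }

  ℕ⁺-semiring : PositiveSemiring ℓ ℓ
  ℕ⁺-semiring = record
    { Carrier = El (set ω)
    ; _≈_ = Same
    ; _+_ = λ (x , x∈) (y , y∈) → plus x y , plus-∈ x∈ y∈
    ; _*_ = λ (x , x∈) (y , y∈) → times x y , times-∈ x∈ y∈
    ; 1# = one , one∈ω
    ; isEquivalence = Same-isEquivalence
    ; +-cong = λ (same p) (same q) → same (cong₂ plus p q)
    ; *-cong = λ (same p) (same q) → same (cong₂ times p q)
    ; +-assoc = λ (x , x∈) (y , y∈) (z , z∈) → same (plus-assoc x∈ y∈ z z∈)
    ; +-comm = λ (x , x∈) (y , y∈) → same (plus-comm x∈ y y∈)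
    ; *-assoc = λ (x , x∈) (y , y∈) (z , z∈) → same (times-assoc x∈ y∈ z z∈)
    ; *-comm = λ (x , x∈) (y , y∈) → same (times-comm x∈ y y∈)
    ; *-identityˡ = λ (x , x∈) → same (times-oneˡ x x∈)
    ; distribʳ = λ (x , x∈) (y , y∈) (z , z∈) → same (times-distribʳ y∈ z∈ x x∈)
    ; irreflexive = λ (x , x∈) (k , k∈) (same p) → plus≢ k∈ x x∈ p
    ; trichotomy = λ (x , x∈) (y , y∈) → Sum.map same (Sum.map (λ (k , k∈ , e) → (k , k∈) , same e) (λ (k , k∈ , e) → (k , k∈) , same e))
        (trichotomy x∈ y y∈)
    }

  private
    module N  = PositiveSemiring ℕ⁺-semiring
    module NP = PositiveSemiringProperties ℕ⁺-semiring

  ℕ⁺ : Set ℓ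
  ℕ⁺ = N.Carrier

  open N using () renaming (_+_ to infixl 6 _+_; _*_ to infixl 7 _*_; _≈_ to infix 4 _≈_; *-cong to *-cong-N; +-cong to +-cong-N)
  open NP.Solver using (solve; _:=_; _:+_; _:*_; con)

  -- Fractions are arbitrary pairs, neither reduced nor grouped into classes; `_≃_` compares them.
  -- Cuts are closed upwards and so do not see the difference between equal fractions.
  Qˢ : V
  Qˢ = ω ×ˢ ω

  ℚ⁺ : Set ℓ
  ℚ⁺ = El (set Qˢ)

  num den : ℚ⁺ → ℕ⁺
  num (p , p∈) = fst p , fst-∈ p∈
  den (p , p∈) = snd p , snd-∈ p∈

  opaque
    /-∈ : ∀ {a b} → a ∈ ω → b ∈ ω → ⟨ a , b ⟩ ∈ Qˢ
    /-∈ = pair∈×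

  infix 8 _/_
  _/_ : ℕ⁺ → ℕ⁺ → ℚ⁺
  (a , a∈) / (b , b∈) = ⟨ a , b ⟩ , /-∈ a∈ b∈

  num-/ : ∀ a b → num (a / b) ≈ a
  num-/ (a , _) (b , _) = same (fst-β a b)
  den-/ : ∀ a b → den (a / b) ≈ b
  den-/ (a , _) (b , _) = same (snd-β a b)

  opaque
    addQ mulQ : V → V → V
    addQ p q = ⟨ plus (times (fst p) (snd q)) (times (fst q) (snd p)) , times (snd p) (snd q) ⟩
    mulQ p q = ⟨ times (fst p) (fst q) , times (snd p) (snd q) ⟩

    addQᵈ : ∀ {n} {F G : Vec V n → V} → DefT F → DefT G → DefT (λ v → addQ (F v) (G v))
    addQᵈ t u = pairᵈ (plusᵈ (timesᵈ (fstᵈ t) (sndᵈ u)) (timesᵈ (fstᵈ u) (sndᵈ t))) (timesᵈ (sndᵈ t) (sndᵈ u))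
    mulQᵈ : ∀ {n} {F G : Vec V n → V} → DefT F → DefT G → DefT (λ v → mulQ (F v) (G v))
    mulQᵈ t u = pairᵈ (timesᵈ (fstᵈ t) (fstᵈ u)) (timesᵈ (sndᵈ t) (sndᵈ u))

    addQ-/ : ∀ (p q : ℚ⁺) → addQ (proj₁ p) (proj₁ q) ≡ proj₁ ((num p * den q + num q * den p) / (den p * den q))
    addQ-/ p q = refl
    mulQ-/ : ∀ (p q : ℚ⁺) → mulQ (proj₁ p) (proj₁ q) ≡ proj₁ ((num p * num q) / (den p * den q))
    mulQ-/ p q = refl

    ⊕-∈ : ∀ (p q : ℚ⁺) → addQ (proj₁ p) (proj₁ q) ∈ Qˢ
    ⊕-∈ p q = proj₂ ((num p * den q + num q * den p) / (den p * den q))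
    ⊗-∈ : ∀ (p q : ℚ⁺) → mulQ (proj₁ p) (proj₁ q) ∈ Qˢ
    ⊗-∈ p q = proj₂ ((num p * num q) / (den p * den q))

  eqQ : V → V → Set ℓ
  eqQ p q = times (fst p) (snd q) ≡ times (fst q) (snd p)

  eqQᵈ : ∀ {n} {F G : Vec V n → V} → DefT F → DefT G → Def (λ v → eqQ (F v) (G v))
  eqQᵈ t u = timesᵈ (fstᵈ t) (sndᵈ u) ≡ᵈ timesᵈ (fstᵈ u) (sndᵈ t)

  infix 4 _≃_
  record _≃_ (p q : ℚ⁺) : Set ℓ where
    constructor frac
    field cross : num p * den q ≈ num q * den p
  open _≃_ public

  infixl 6 _⊕_
  infixl 7 _⊗_
  _⊕_ _⊗_ : ℚ⁺ → ℚ⁺ → ℚ⁺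
  p ⊕ q = addQ (proj₁ p) (proj₁ q) , ⊕-∈ p q
  p ⊗ q = mulQ (proj₁ p) (proj₁ q) , ⊗-∈ p q

  num-⊕ : ∀ p q → num (p ⊕ q) ≈ num p * den q + num q * den p
  num-⊕ p q = same (trans (cong fst (addQ-/ p q)) (fst-β _ _))
  den-⊕ : ∀ p q → den (p ⊕ q) ≈ den p * den q
  den-⊕ p q = same (trans (cong snd (addQ-/ p q)) (snd-β _ _))
  num-⊗ : ∀ p q → num (p ⊗ q) ≈ num p * num q
  num-⊗ p q = same (trans (cong fst (mulQ-/ p q)) (fst-β _ _))
  den-⊗ : ∀ p q → den (p ⊗ q) ≈ den p * den q
  den-⊗ p q = same (trans (cong snd (mulQ-/ p q)) (snd-β _ _))

  private
    infixr 5 _⟫_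
    _⟫_ : ∀ {x y z : ℕ⁺} → x ≈ y → y ≈ z → x ≈ z
    _⟫_ = NP.≈-trans
    infixl 7 _⟨*⟩_
    infixl 6 _⟨+⟩_
    _⟨*⟩_ : ∀ {x y u v : ℕ⁺} → x ≈ y → u ≈ v → x * u ≈ y * v
    _⟨*⟩_ = N.*-cong
    _⟨+⟩_ : ∀ {x y u v : ℕ⁺} → x ≈ y → u ≈ v → x + u ≈ y + v
    _⟨+⟩_ = N.+-cong
    rfl : ∀ {x : ℕ⁺} → x ≈ x
    rfl = NP.≈-refl

  ≃-by : ∀ p q {a b c d : ℕ⁺} → num p ≈ a → den p ≈ b → num q ≈ c → den q ≈ d → a * d ≈ c * b → p ≃ q
  ≃-by p q e f g h k = frac (e ⟨*⟩ h ⟫ k ⟫ NP.≈-sym (g ⟨*⟩ f))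

  opaque
    ≃-isEquivalence : IsEquivalence _≃_
    ≃-isEquivalence = record
      { refl = frac rfl ; sym = λ (frac e) → frac (NP.≈-sym e) ; trans = λ {p} {q} {r} → ≃-trans p q r }
      where
      ≃-trans : ∀ p q r → p ≃ q → q ≃ r → p ≃ r
      ≃-trans p q r (frac e) (frac f) = frac (NP.*-cancelʳ-≈ (den q) {num p * den r} {num r * den p}
        (NP.unjust (solve 3 (λ a b c → a :* b :* c := a :* c :* b) NP.commutativeSemiringRefl (just (num p)) (just (den r)) (just (den q)))
         ⟫ e ⟨*⟩ rfl {den r}
         ⟫ NP.unjust (solve 3 (λ a b c → a :* b :* c := a :* c :* b) NP.commutativeSemiringRefl (just (num q)) (just (den p)) (just (den r)))
         ⟫ f ⟨*⟩ rfl {den p}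
         ⟫ NP.unjust (solve 3 (λ a b c → a :* b :* c := a :* c :* b) NP.commutativeSemiringRefl (just (num r)) (just (den q)) (just (den p)))))

    ⊕-cong : ∀ p p′ q q′ → p ≃ p′ → q ≃ q′ → p ⊕ q ≃ p′ ⊕ q′
    ⊕-cong p p′ q q′ (frac e) (frac f) = ≃-by (p ⊕ q) (p′ ⊕ q′) (num-⊕ p q) (den-⊕ p q) (num-⊕ p′ q′) (den-⊕ p′ q′)
      (NP.unjust (solve 6 (λ a b c d b′ d′ → (a :* d :+ c :* b) :* (b′ :* d′) := (a :* b′) :* (d :* d′) :+ (c :* d′) :* (b :* b′))
          NP.commutativeSemiringRefl (just (num p)) (just (den p)) (just (num q)) (just (den q)) (just (den p′)) (just (den q′)))
       ⟫ (e ⟨*⟩ rfl {den q * den q′}) ⟨+⟩ (f ⟨*⟩ rfl {den p * den p′})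
       ⟫ NP.unjust (solve 6 (λ a′ b c′ d b′ d′ → (a′ :* b) :* (d :* d′) :+ (c′ :* d) :* (b :* b′) := (a′ :* d′ :+ c′ :* b′) :* (b :* d))
          NP.commutativeSemiringRefl (just (num p′)) (just (den p)) (just (num q′)) (just (den q)) (just (den p′)) (just (den q′))))

    ⊗-cong : ∀ p p′ q q′ → p ≃ p′ → q ≃ q′ → p ⊗ q ≃ p′ ⊗ q′
    ⊗-cong p p′ q q′ (frac e) (frac f) = ≃-by (p ⊗ q) (p′ ⊗ q′) (num-⊗ p q) (den-⊗ p q) (num-⊗ p′ q′) (den-⊗ p′ q′)
      (NP.unjust (solve 4 (λ a b c d → (a :* c) :* (b :* d) := (a :* b) :* (c :* d))
          NP.commutativeSemiringRefl (just (num p)) (just (den p′)) (just (num q)) (just (den q′)))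
       ⟫ e ⟨*⟩ f
       ⟫ NP.unjust (solve 4 (λ a b c d → (a :* b) :* (c :* d) := (a :* c) :* (b :* d))
          NP.commutativeSemiringRefl (just (num p′)) (just (den p)) (just (num q′)) (just (den q))))

    ⊕-assoc : ∀ p q r → (p ⊕ q) ⊕ r ≃ p ⊕ (q ⊕ r)
    ⊕-assoc p q r = ≃-by ((p ⊕ q) ⊕ r) (p ⊕ (q ⊕ r))
      (num-⊕ (p ⊕ q) r ⟫ (num-⊕ p q ⟨*⟩ rfl {den r}) ⟨+⟩ (rfl {num r} ⟨*⟩ den-⊕ p q))
      (den-⊕ (p ⊕ q) r ⟫ den-⊕ p q ⟨*⟩ rfl {den r})
      (num-⊕ p (q ⊕ r) ⟫ (rfl {num p} ⟨*⟩ den-⊕ q r) ⟨+⟩ (num-⊕ q r ⟨*⟩ rfl {den p}))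
      (den-⊕ p (q ⊕ r) ⟫ rfl {den p} ⟨*⟩ den-⊕ q r)
      (NP.unjust (solve 6 (λ a b c d e f → ((a :* d :+ c :* b) :* f :+ e :* (b :* d)) :* (b :* (d :* f)) :=
                                           (a :* (d :* f) :+ (c :* f :+ e :* d) :* b) :* ((b :* d) :* f))
          NP.commutativeSemiringRefl (just (num p)) (just (den p)) (just (num q)) (just (den q)) (just (num r)) (just (den r))))

    ⊕-comm : ∀ p q → p ⊕ q ≃ q ⊕ p
    ⊕-comm p q = ≃-by (p ⊕ q) (q ⊕ p) (num-⊕ p q) (den-⊕ p q) (num-⊕ q p) (den-⊕ q p)
      (NP.unjust (solve 4 (λ a b c d → (a :* d :+ c :* b) :* (d :* b) := (c :* b :+ a :* d) :* (b :* d))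
          NP.commutativeSemiringRefl (just (num p)) (just (den p)) (just (num q)) (just (den q))))

    ⊗-assoc : ∀ p q r → (p ⊗ q) ⊗ r ≃ p ⊗ (q ⊗ r)
    ⊗-assoc p q r = ≃-by ((p ⊗ q) ⊗ r) (p ⊗ (q ⊗ r))
      (num-⊗ (p ⊗ q) r ⟫ num-⊗ p q ⟨*⟩ rfl {num r}) (den-⊗ (p ⊗ q) r ⟫ den-⊗ p q ⟨*⟩ rfl {den r})
      (num-⊗ p (q ⊗ r) ⟫ rfl {num p} ⟨*⟩ num-⊗ q r) (den-⊗ p (q ⊗ r) ⟫ rfl {den p} ⟨*⟩ den-⊗ q r)
      (NP.unjust (solve 6 (λ a b c d e f → ((a :* c) :* e) :* (b :* (d :* f)) := (a :* (c :* e)) :* ((b :* d) :* f))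
          NP.commutativeSemiringRefl (just (num p)) (just (den p)) (just (num q)) (just (den q)) (just (num r)) (just (den r))))

    ⊗-comm : ∀ p q → p ⊗ q ≃ q ⊗ p
    ⊗-comm p q = ≃-by (p ⊗ q) (q ⊗ p) (num-⊗ p q) (den-⊗ p q) (num-⊗ q p) (den-⊗ q p)
      (NP.unjust (solve 4 (λ a b c d → (a :* c) :* (d :* b) := (c :* a) :* (b :* d))
          NP.commutativeSemiringRefl (just (num p)) (just (den p)) (just (num q)) (just (den q))))

    distribʳ : ∀ p q r → (q ⊕ r) ⊗ p ≃ (q ⊗ p) ⊕ (r ⊗ p)
    distribʳ p q r = ≃-by ((q ⊕ r) ⊗ p) ((q ⊗ p) ⊕ (r ⊗ p))
      (num-⊗ (q ⊕ r) p ⟫ num-⊕ q r ⟨*⟩ rfl {num p}) (den-⊗ (q ⊕ r) p ⟫ den-⊕ q r ⟨*⟩ rfl {den p})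
      (num-⊕ (q ⊗ p) (r ⊗ p) ⟫ (num-⊗ q p ⟨*⟩ den-⊗ r p) ⟨+⟩ (num-⊗ r p ⟨*⟩ den-⊗ q p))
      (den-⊕ (q ⊗ p) (r ⊗ p) ⟫ den-⊗ q p ⟨*⟩ den-⊗ r p)
      (NP.unjust (solve 6 (λ a b c d e f → ((c :* f :+ e :* d) :* a) :* ((d :* b) :* (f :* b)) :=
                                           ((c :* a) :* (f :* b) :+ (e :* a) :* (d :* b)) :* ((d :* f) :* b))
          NP.commutativeSemiringRefl (just (num p)) (just (den p)) (just (num q)) (just (den q)) (just (num r)) (just (den r))))

  1ℚ : ℚ⁺
  1ℚ = N.1# / N.1#

  opaque
    ⊗-identityˡ : ∀ p → 1ℚ ⊗ p ≃ p
    ⊗-identityˡ p = ≃-by (1ℚ ⊗ p) p (num-⊗ 1ℚ p ⟫ num-/ N.1# N.1# ⟨*⟩ rfl {num p}) (den-⊗ 1ℚ p ⟫ den-/ N.1# N.1# ⟨*⟩ rfl {den p})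
      rfl rfl
      (NP.unjust (solve 2 (λ a b → (con 1 :* a) :* b := a :* (con 1 :* b)) NP.commutativeSemiringRefl (just (num p)) (just (den p))))

    irreflexive : ∀ p c → ¬ p ⊕ c ≃ p
    irreflexive p c (frac e) = N.irreflexive (num p * den c * den p) (num c * den p * den p)
      (NP.unjust (solve 4 (λ a b x y → a :* y :* b :+ x :* b :* b := (a :* y :+ x :* b) :* b)
           NP.commutativeSemiringRefl (just (num p)) (just (den p)) (just (num c)) (just (den c)))
       ⟫ NP.≈-sym (num-⊕ p c) ⟨*⟩ rfl {den p} ⟫ e ⟫ rfl {num p} ⟨*⟩ den-⊕ p c
       ⟫ NP.unjust (solve 3 (λ a b y → a :* (b :* y) := a :* y :* b)
           NP.commutativeSemiringRefl (just (num p)) (just (den p)) (just (den c))))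

    -- The difference q - p is that of the cross products over the product of the denominators.
    difference : ∀ p q (k : ℕ⁺) → num p * den q + k ≈ num q * den p → p ⊕ k / (den p * den q) ≃ q
    difference p q k e = ≃-by (p ⊕ c) q
      (num-⊕ p c ⟫ (rfl {num p} ⟨*⟩ den-/ k (den p * den q)) ⟨+⟩ (num-/ k (den p * den q) ⟨*⟩ rfl {den p}))
      (den-⊕ p c ⟫ rfl {den p} ⟨*⟩ den-/ k (den p * den q)) rfl rfl
      (NP.unjust (solve 4 (λ a b d k → (a :* (b :* d) :+ k :* b) :* d := (a :* d :+ k) :* (b :* d))
           NP.commutativeSemiringRefl (just (num p)) (just (den p)) (just (den q)) (just k))
       ⟫ e ⟨*⟩ rfl {den p * den q}
       ⟫ NP.unjust (solve 3 (λ c b d → (c :* b) :* (b :* d) := c :* (b :* (b :* d)))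
           NP.commutativeSemiringRefl (just (num q)) (just (den p)) (just (den q))))
      where
      c : ℚ⁺
      c = k / (den p * den q)

    trichotomyℚ : ∀ p q → p ≃ q ⊎ (∃ λ k → p ⊕ k ≃ q) ⊎ (∃ λ k → q ⊕ k ≃ p)
    trichotomyℚ p q = Sum.map frac (Sum.map (λ (k , e) → _ , difference p q k e) (λ (k , e) → _ , difference q p k e))
      (N.trichotomy (num p * den q) (num q * den p))

  ℚ⁺-semiring : PositiveSemiring ℓ ℓ
  ℚ⁺-semiring = record
    { Carrier = ℚ⁺ ; _≈_ = _≃_ ; _+_ = _⊕_ ; _*_ = _⊗_ ; 1# = 1ℚ
    ; isEquivalence = ≃-isEquivalence
    ; +-cong = λ {p} {p′} {q} {q′} → ⊕-cong p p′ q q′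
    ; *-cong = λ {p} {p′} {q} {q′} → ⊗-cong p p′ q q′
    ; +-assoc = ⊕-assoc ; +-comm = ⊕-comm ; *-assoc = ⊗-assoc ; *-comm = ⊗-comm
    ; *-identityˡ = ⊗-identityˡ ; distribʳ = distribʳ
    ; irreflexive = irreflexive ; trichotomy = trichotomyℚ
    }

  module QP = PositiveSemiringProperties ℚ⁺-semiring

  inv : ℚ⁺ → ℚ⁺
  inv p = den p / num p

  opaque
    inverseʳ : ∀ p → p ⊗ inv p ≃ 1ℚ
    inverseʳ p = ≃-by (p ⊗ inv p) 1ℚ
      (num-⊗ p (inv p) ⟫ rfl {num p} ⟨*⟩ num-/ (den p) (num p)) (den-⊗ p (inv p) ⟫ rfl {den p} ⟨*⟩ den-/ (den p) (num p))
      (num-/ N.1# N.1#) (den-/ N.1# N.1#)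
      (NP.unjust (solve 2 (λ a b → (a :* b) :* con 1 := con 1 :* (b :* a)) NP.commutativeSemiringRefl (just (num p)) (just (den p))))

    half : ∀ p → ∃ λ h → h ⊕ h ≃ p
    half p = h , ≃-by (h ⊕ h) p
      (num-⊕ h h ⟫ (num-/ (num p) d ⟨*⟩ den-/ (num p) d) ⟨+⟩ (num-/ (num p) d ⟨*⟩ den-/ (num p) d))
      (den-⊕ h h ⟫ den-/ (num p) d ⟨*⟩ den-/ (num p) d) rfl rfl
      (NP.unjust (solve 2 (λ a b → (a :* (b :+ b) :+ a :* (b :+ b)) :* b := a :* ((b :+ b) :* (b :+ b)))
        NP.commutativeSemiringRefl (just (num p)) (just (den p))))
      where
      d : ℕ⁺
      d = den p + den p
      h : ℚ⁺
      h = num p / d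

  -- The strict order on the underlying sets, in a form that formulas can express.
  ltQ : V → V → Set ℓ
  ltQ p q = ∃ λ c → c ∈ Qˢ × eqQ (addQ p c) q

  ltQᵈ : ∀ {n} {F G : Vec V n → V} → DefT F → DefT G → Def (λ v → ltQ (F v) (G v))
  ltQᵈ t u = ∃∈ (cst Qˢ) (eqQᵈ (addQᵈ (wkT t) (var (# 0))) (wkT u))

  ltQ⇔ : ∀ p q → ltQ (proj₁ p) (proj₁ q) ⇔ p QP.< q
  ltQ⇔ p q = mk⇔ (λ (c , c∈ , e) → (c , c∈) , frac (same e)) (λ ((c , c∈) , frac (same e)) → c , c∈ , e)

  opaque
    private
      m≤m*n : ∀ m n → m NP.≤ m * n
      m≤m*n (m , m∈) (n , n∈) with ω-cases n n∈
      ... | inj₁ refl = NP.≈⇒≤ (same (sym (Times.rec-one m∈)))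
      ... | inj₂ (k , k∈ , refl) = NP.<⇒≤ ((times m k , times-∈ m∈ k∈) ,
              same (trans (plus-comm m∈ _ (times-∈ m∈ k∈)) (sym (Times.rec-sc m∈ k∈))))

    ≤ℚ-from : ∀ p q → num p * den q NP.≤ num q * den p → p QP.≤ q
    ≤ℚ-from p q h (c , e) = h (NP.*-cancelʳ-< (den c) {num q * den p} {num p * den q}
      (num c * den q * den p ,
        (NP.unjust (solve 5 (λ a b x y d → (a :* d) :* y :+ (x :* b) :* d := (a :* y :+ x :* b) :* d)
           NP.commutativeSemiringRefl (just (num q)) (just (den q)) (just (num c)) (just (den c)) (just (den p)))
         ⟫ NP.≈-sym (num-⊕ q c) ⟨*⟩ rfl {den p} ⟫ cross e ⟫ rfl {num p} ⟨*⟩ den-⊕ q c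
         ⟫ NP.≈-sym (N.*-assoc (num p) (den q) (den c)))))

  module _ (U : V) (upper : ∀ (p q : ℚ⁺) → proj₁ p ∈ U → p QP.≤ q → proj₁ q ∈ U) where
    opaque

        -- Step through the multiples of ε until one of them lies in U.
        crossing : ∀ ε → (∃ λ (p : ℚ⁺) → proj₁ p ∈ U) →
                   ∃ λ (u : ℚ⁺) → proj₁ u ∈ U × (u QP.≤ ε ⊎ (∃ λ (u′ : ℚ⁺) → ¬ proj₁ u′ ∈ U × u ≃ u′ ⊕ ε))
        crossing ε (p , p∈U) = ω-induction
            {P = λ v → mulQ ⟨ lookup v (# 0) , one ⟩ (proj₁ ε) ∈ U → Goal}
            ((mulQᵈ (pairᵈ (var (# 0)) (cst one)) (cst (proj₁ ε)) ∈ᵈ cst U) →ᵈ constᵈ Goal)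
            (λ m → 1ℚ ⊗ ε , m , inj₁ (QP.≈⇒≤ (⊗-identityˡ ε)))
            step (proj₁ n) (proj₂ n) (upper p (n / N.1# ⊗ ε) p∈U large)
          where
          Goal : Set ℓ
          Goal = ∃ λ (u : ℚ⁺) → proj₁ u ∈ U × (u QP.≤ ε ⊎ (∃ λ (u′ : ℚ⁺) → ¬ proj₁ u′ ∈ U × u ≃ u′ ⊕ ε))
          n : ℕ⁺
          -- For p = a/b and ε = c/d this gives n ε = a c ≥ a/b, so the n-th multiple lies in `U`.
          n = num p * den ε
          step : ∀ m → m ∈ ω → (mulQ ⟨ m , one ⟩ (proj₁ ε) ∈ U → Goal) → mulQ ⟨ sc m , one ⟩ (proj₁ ε) ∈ U → Goal
          step m m∈ ih h with em {mulQ ⟨ m , one ⟩ (proj₁ ε) ∈ U}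
          ... | yes y = ih y
          ... | no ¬y = (sc m , sc∈ω m∈) / N.1# ⊗ ε , h , inj₂ ((m , m∈) / N.1# ⊗ ε , ¬y ,
              ≃-by (m+1 / N.1# ⊗ ε) (m′ / N.1# ⊗ ε ⊕ ε)
                (num-⊗ (m+1 / N.1#) ε ⟫ (num-/ m+1 N.1# ⟫ same (sym (Plus.rec-one m∈))) ⟨*⟩ rfl {num ε})
                (den-⊗ (m+1 / N.1#) ε ⟫ den-/ m+1 N.1# ⟨*⟩ rfl {den ε})
                (num-⊕ (m′ / N.1# ⊗ ε) ε ⟫ ((num-⊗ (m′ / N.1#) ε ⟫ num-/ m′ N.1# ⟨*⟩ rfl {num ε}) ⟨*⟩ rfl {den ε}) ⟨+⟩
                                              (rfl {num ε} ⟨*⟩ (den-⊗ (m′ / N.1#) ε ⟫ den-/ m′ N.1# ⟨*⟩ rfl {den ε})))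
                (den-⊕ (m′ / N.1# ⊗ ε) ε ⟫ (den-⊗ (m′ / N.1#) ε ⟫ den-/ m′ N.1# ⟨*⟩ rfl {den ε}) ⟨*⟩ rfl {den ε})
                (NP.unjust (solve 3 (λ m a b → ((m :+ con 1) :* a) :* ((con 1 :* b) :* b) :=
                                               ((m :* a) :* b :+ a :* (con 1 :* b)) :* (con 1 :* b))
                  NP.commutativeSemiringRefl (just m′) (just (num ε)) (just (den ε)))))
            where
            m′ m+1 : ℕ⁺
            m′ = m , m∈
            m+1 = sc m , sc∈ω m∈
          large : p QP.≤ n / N.1# ⊗ ε
          large = ≤ℚ-from p (n / N.1# ⊗ ε) (NP.≤-trans {_} {n} {_} (NP.≈⇒≤ {_} {n}
              (rfl {num p} ⟨*⟩ (den-⊗ (n / N.1#) ε ⟫ den-/ n N.1# ⟨*⟩ rfl {den ε} ⟫ N.*-identityˡ (den ε))))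
            (NP.≤-trans {n} {n * (num ε * den p)} {_} (m≤m*n n (num ε * den p))
              (NP.≈⇒≤ {n * (num ε * den p)} (NP.≈-sym (N.*-assoc n (num ε) (den p))
                 ⟫ NP.≈-sym (num-⊗ (n / N.1#) ε ⟫ num-/ n N.1# ⟨*⟩ rfl {num ε}) ⟨*⟩ rfl {den p}))))

-- Nonnegative reals as open upper cuts of fractions.

module DedekindCuts {ℓ : Level} (em : ExcludedMiddle ℓ) (M : ZFModel ℓ) where

  open import Algebra.Bundles using (CommutativeSemiring)
  open import Algebra.Structures.Biased using (isCommutativeSemiringˡ)
  open import Data.Fin using (#_)
  open import Data.Vec.Base using (Vec; []; _∷_; lookup)
  open import Data.Maybe.Base using (just)
  open import Data.Product.Base using (∃; ∃₂; _×_; _,_; proj₁; proj₂)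
  open import Data.Sum.Base using (_⊎_; inj₁; inj₂; [_,_]′)
  open import Function.Base using (_∘_; id; _|>′_)
  open import Function.Bundles using (_⇔_; mk⇔)
  open import Relation.Binary.PropositionalEquality using (refl; sym; trans; cong₂; subst)
  open import Relation.Nullary using (¬_; yes; no; contradiction)
  open import Relation.Nullary.Decidable using (decidable-stable)
  import Algebra.Solver.Ring.NaturalCoefficients.Default as DefaultSolver
  open PositiveSemirings
  open DefinablePredicates em M
  open Sets em M
  open Naturals em M
  open PositiveRationals em M
  open Internal M using (set; El)

  ¬∀⇒∃¬ : ∀ {A : Set ℓ} {P : A → Set ℓ} → ¬ (∀ x → P x) → ∃ λ x → ¬ P x
  ¬∀⇒∃¬ h = decidable-stable em λ k → h λ x → decidable-stable em λ ¬p → k (x , ¬p)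

  open QP using (_<_; _≤_; ≤-refl; ≤-trans; <⇒≤; ≈⇒≤; <-≤-trans; ≤-<-trans; <-trans; +-mono-≤; *-mono-≤; ≈-sym; ≈-trans; ≈-refl)
  open QP.Solver using (solve; _:=_; _:+_; _:*_; con)

  infix 4 _∈ᶜ_
  _∈ᶜ_ : ℚ⁺ → V → Set ℓ
  q ∈ᶜ U = proj₁ q ∈ U

  -- The cut U stands for the real number r ≥ 0 with U = {q | q > r}.
  record IsCut (U : V) : Set ℓ where
    field
      sub   : ∀ {z} → z ∈ U → z ∈ Qˢ
      inh   : ∃ λ q → q ∈ᶜ U
      upper : ∀ p q → p ∈ᶜ U → p ≤ q → q ∈ᶜ U
      isOpen : ∀ p → p ∈ᶜ U → ∃ λ q → q ∈ᶜ U × q < p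

    lower : ∀ p q → ¬ p ∈ᶜ U → q ∈ᶜ U → p < q
    lower p q p∉ q∈ with QP.≤⊎> q p
    ... | inj₁ q≤p = contradiction (upper q p q∈ q≤p) p∉
    ... | inj₂ p<q = p<q
  open IsCut

  private
    CutCode : V → Set ℓ
    CutCode U = (∃ λ z → z ∈ U) × (∀ z → z ∈ U → (∀ y → y ∈ Qˢ → ltQ z y → y ∈ U) × (∃ λ y → y ∈ U × ltQ y z))

    cutDef : Def {1} (λ v → CutCode (lookup v (# 0)))
    cutDef = ∃ᵈ (var (# 0) ∈ᵈ var (# 1)) ×ᵈ
      ∀∈ (var (# 0)) (∀∈ (cst Qˢ) (ltQᵈ (var (# 1)) (var (# 0)) →ᵈ (var (# 0) ∈ᵈ var (# 2)))
        ×ᵈ ∃∈ (var (# 1)) (ltQᵈ (var (# 0)) (var (# 1))))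

  opaque
    Cutˢ : V
    Cutˢ = comp cutDef (𝒫 Qˢ) []

    ∈Cutˢ : ∀ {U} → U ∈ Cutˢ → IsCut U
    ∈Cutˢ {U} U∈ = record
      { sub = λ {z} → s z
      ; inh = proj₁ c |>′ λ (z , z∈) →
                (z , s z z∈) , z∈
      ; upper = up
      ; isOpen = op
      }
      where
      s : ∀ z → z ∈ U → z ∈ Qˢ
      s = to (∈𝒫 U) (proj₁ (to (∈comp cutDef U) U∈))
      c : CutCode U
      c = proj₂ (to (∈comp cutDef U) U∈)
      op : ∀ p → p ∈ᶜ U → ∃ λ q → q ∈ᶜ U × q < p
      op p p∈ = proj₂ (proj₂ c _ p∈) |>′ λ (z , z∈ , lt) →
                  (z , s z z∈) , z∈ , to (ltQ⇔ _ p) lt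
      up : ∀ p q → p ∈ᶜ U → p ≤ q → q ∈ᶜ U
      up p q p∈ p≤q with op p p∈
      ... | r , r∈ , r<p = proj₁ (proj₂ c _ r∈) _ (proj₂ q) (from (ltQ⇔ r q) (<-≤-trans r<p p≤q))

    isCut-∈ : ∀ {U} → IsCut U → U ∈ Cutˢ
    isCut-∈ {U} c = from (∈comp cutDef U) (from (∈𝒫 U) (λ z → sub c) , (_ , proj₂ (inh c)) , λ z z∈ →
      (λ y y∈ lt → upper c (z , sub c z∈) (y , y∈) z∈ (<⇒≤ (to (ltQ⇔ _ (y , y∈)) lt))) ,
      (isOpen c (z , sub c z∈) z∈ |>′ λ (q , q∈ , lt) →
         _ , q∈ , from (ltQ⇔ q (z , sub c z∈)) lt))

  ℝ⁺ : Set ℓ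
  ℝ⁺ = El (set Cutˢ)

  cut : (U : ℝ⁺) → IsCut (proj₁ U)
  cut U = ∈Cutˢ (proj₂ U)

  fromCut : ∀ {U} → IsCut U → ℝ⁺
  fromCut {U} c = U , isCut-∈ c

  cut-ext : ∀ (U W : ℝ⁺) → (∀ q → q ∈ᶜ proj₁ U → q ∈ᶜ proj₁ W) → (∀ q → q ∈ᶜ proj₁ W → q ∈ᶜ proj₁ U) → Same U W
  cut-ext U W f g = same (ext (λ z z∈ → f (z , sub (cut U) z∈) z∈) (λ z z∈ → g (z , sub (cut W) z∈) z∈))

  opaque
    ⊗-cancel : ∀ q p → q ⊗ inv p ⊗ p ≃ q
    ⊗-cancel q p = ≈-trans (QP.unjust (solve 3 (λ a b c → a :* b :* c := (c :* b) :* a) QP.commutativeSemiringRefl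
                     (just q) (just (inv p)) (just p)))
                   (≈-trans (⊗-cong (p ⊗ inv p) 1ℚ q q (inverseʳ p) ≈-refl) (⊗-identityˡ q))

  density : ∀ {p q} → p < q → ∃ λ m → p < m × m < q
  density {p} {q} (c , e) with half c
  ... | h , f = p ⊕ h , (h , ≈-refl) , (h , ≈-trans (⊕-assoc p h h) (≈-trans (QP.+-congˡ f) e))

  private
    sumDef : Def {3} (λ v → ∃ λ u → u ∈ lookup v (# 1) × ∃ λ w → w ∈ lookup v (# 2) × ¬ ltQ (lookup v (# 0)) (addQ u w))
    sumDef = ∃∈ (var (# 1)) (∃∈ (var (# 3)) (¬ᵈ ltQᵈ (var (# 2)) (addQᵈ (var (# 1)) (var (# 0)))))

    prodDef : Def {3} (λ v → ∃ λ u → u ∈ lookup v (# 1) × ∃ λ w → w ∈ lookup v (# 2) × ¬ ltQ (lookup v (# 0)) (mulQ u w))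
    prodDef = ∃∈ (var (# 1)) (∃∈ (var (# 3)) (¬ᵈ ltQᵈ (var (# 2)) (mulQᵈ (var (# 1)) (var (# 0)))))

    diffDef : Def {3} (λ v → ∃ λ w → w ∈ Qˢ × ltQ w (lookup v (# 0)) ×
                             ∀ u → u ∈ lookup v (# 2) → addQ u w ∈ lookup v (# 1))
    diffDef = ∃∈ (cst Qˢ) (ltQᵈ (var (# 0)) (var (# 1)) ×ᵈ
                           ∀∈ (var (# 3)) (addQᵈ (var (# 0)) (var (# 1)) ∈ᵈ var (# 3)))

    oneDef : Def {1} (λ v → ltQ (proj₁ 1ℚ) (lookup v (# 0)))
    oneDef = ltQᵈ (cst (proj₁ 1ℚ)) (var (# 0))

  opaque
    -- Sums and products of members are closed upwards, with ≤ written as a negated `ltQ`. `subR` is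
    -- subtraction truncated at zero: adding w to any member of W gives a member of U, and the
    -- strict w < q makes the result open.
    addR mulR subR : V → V → V
    addR U W = comp sumDef Qˢ (U ∷ W ∷ [])
    mulR U W = comp prodDef Qˢ (U ∷ W ∷ [])
    subR U W = comp diffDef Qˢ (U ∷ W ∷ [])
    oneR : V
    oneR = comp oneDef Qˢ []

    addRᵈ : ∀ {n} {F G : Vec V n → V} → DefT F → DefT G → DefT (λ v → addR (F v) (G v))
    addRᵈ = comp₂ᵈ sumDef (cst Qˢ)
    mulRᵈ : ∀ {n} {F G : Vec V n → V} → DefT F → DefT G → DefT (λ v → mulR (F v) (G v))
    mulRᵈ = comp₂ᵈ prodDef (cst Qˢ)
    subRᵈ : ∀ {n} {F G : Vec V n → V} → DefT F → DefT G → DefT (λ v → subR (F v) (G v))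
    subRᵈ = comp₂ᵈ diffDef (cst Qˢ)

    private
      sums : ∀ {U W z} → z ∈ addR U W → z ∈ Qˢ
      sums z∈ = proj₁ (to (∈comp sumDef _) z∈)
      prods : ∀ {U W z} → z ∈ mulR U W → z ∈ Qˢ
      prods z∈ = proj₁ (to (∈comp prodDef _) z∈)
      diffs : ∀ {U W z} → z ∈ subR U W → z ∈ Qˢ
      diffs z∈ = proj₁ (to (∈comp diffDef _) z∈)
      ones : ∀ {z} → z ∈ oneR → z ∈ Qˢ
      ones z∈ = proj₁ (to (∈comp oneDef _) z∈)

    ∈add : ∀ (U W : ℝ⁺) q → q ∈ᶜ addR (proj₁ U) (proj₁ W) ⇔ (∃₂ λ u w → u ∈ᶜ proj₁ U × w ∈ᶜ proj₁ W × u ⊕ w ≤ q)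
    ∈add U W q = mk⇔
      (λ q∈ → to (∈comp sumDef _) q∈ |>′ λ (_ , u , u∈ , w , w∈ , le) →
         (u , sub (cut U) u∈) , (w , sub (cut W) w∈) , u∈ , w∈ ,
         le ∘ from (ltQ⇔ q ((u , sub (cut U) u∈) ⊕ (w , sub (cut W) w∈))))
      (λ (u , w , u∈ , w∈ , le) → from (∈comp sumDef _) (proj₂ q , _ , u∈ , _ , w∈ , le ∘ to (ltQ⇔ q (u ⊕ w))))

    ∈mul : ∀ (U W : ℝ⁺) q → q ∈ᶜ mulR (proj₁ U) (proj₁ W) ⇔ (∃₂ λ u w → u ∈ᶜ proj₁ U × w ∈ᶜ proj₁ W × u ⊗ w ≤ q)
    ∈mul U W q = mk⇔
      (λ q∈ → to (∈comp prodDef _) q∈ |>′ λ (_ , u , u∈ , w , w∈ , le) →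
         (u , sub (cut U) u∈) , (w , sub (cut W) w∈) , u∈ , w∈ ,
         le ∘ from (ltQ⇔ q ((u , sub (cut U) u∈) ⊗ (w , sub (cut W) w∈))))
      (λ (u , w , u∈ , w∈ , le) → from (∈comp prodDef _) (proj₂ q , _ , u∈ , _ , w∈ , le ∘ to (ltQ⇔ q (u ⊗ w))))

    ∈sub : ∀ (U W : ℝ⁺) q → q ∈ᶜ subR (proj₁ U) (proj₁ W) ⇔ (∃ λ w → w < q × (∀ u → u ∈ᶜ proj₁ W → (u ⊕ w) ∈ᶜ proj₁ U))
    ∈sub U W q = mk⇔
      (λ q∈ → to (∈comp diffDef _) q∈ |>′ λ (_ , w , w∈ , lt , h) →
                (w , w∈) , to (ltQ⇔ (w , w∈) q) lt , λ u u∈ → h (proj₁ u) u∈)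
      (λ (w , lt , h) → from (∈comp diffDef _) (proj₂ q , proj₁ w , proj₂ w , from (ltQ⇔ w q) lt ,
                          λ u u∈ → h (u , sub (cut W) u∈) u∈))

    ∈one : ∀ q → q ∈ᶜ oneR ⇔ 1ℚ < q
    ∈one q = mk⇔ (λ q∈ → to (ltQ⇔ 1ℚ q) (proj₂ (to (∈comp oneDef _) q∈)))
                 (λ lt → from (∈comp oneDef _) (proj₂ q , from (ltQ⇔ 1ℚ q) lt))

    add-isCut : ∀ (U W : ℝ⁺) → IsCut (addR (proj₁ U) (proj₁ W))
    add-isCut U W = record
      { sub = sums
      ; inh = inh (cut U) |>′ λ (u , u∈) →
                inh (cut W) |>′ λ (w , w∈) →
                u ⊕ w , from (∈add U W _) (u , w , u∈ , w∈ , ≤-refl)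
      ; upper = λ p q p∈ p≤q → to (∈add U W p) p∈ |>′ λ (u , w , u∈ , w∈ , le) →
                                 from (∈add U W q) (u , w , u∈ , w∈ , ≤-trans le p≤q)
      ; isOpen = λ p p∈ → to (∈add U W p) p∈ |>′ λ (u , w , u∈ , w∈ , le) →
                            isOpen (cut U) u u∈ |>′ λ (u′ , u′∈ , lt) →
                            u′ ⊕ w , from (∈add U W _) (u′ , w , u′∈ , w∈ , ≤-refl) , <-≤-trans (QP.+-monoˡ-< w lt) le
      }

    mul-isCut : ∀ (U W : ℝ⁺) → IsCut (mulR (proj₁ U) (proj₁ W))
    mul-isCut U W = record
      { sub = prods
      ; inh = inh (cut U) |>′ λ (u , u∈) →
                inh (cut W) |>′ λ (w , w∈) →
                u ⊗ w , from (∈mul U W _) (u , w , u∈ , w∈ , ≤-refl)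
      ; upper = λ p q p∈ p≤q → to (∈mul U W p) p∈ |>′ λ (u , w , u∈ , w∈ , le) →
                                 from (∈mul U W q) (u , w , u∈ , w∈ , ≤-trans le p≤q)
      ; isOpen = λ p p∈ → to (∈mul U W p) p∈ |>′ λ (u , w , u∈ , w∈ , le) →
                            isOpen (cut U) u u∈ |>′ λ (u′ , u′∈ , lt) →
                            u′ ⊗ w , from (∈mul U W _) (u′ , w , u′∈ , w∈ , ≤-refl) , <-≤-trans (QP.*-monoˡ-< w lt) le
      }

    sub-isCut : ∀ (U W : ℝ⁺) → IsCut (subR (proj₁ U) (proj₁ W))
    sub-isCut U W = record
      { sub = diffs
      ; inh = inh (cut U) |>′ λ (u , u∈) →
                u ⊕ u , from (∈sub U W _) (u , (u , ≈-refl) , λ w w∈ →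
                   upper (cut U) u (w ⊕ u) u∈ (<⇒≤ (QP.<-respʳ (⊕-comm u w) (QP.x<x+k u w))))
      ; upper = λ p q p∈ p≤q → to (∈sub U W p) p∈ |>′ λ (w , lt , h) →
                                 from (∈sub U W q) (w , <-≤-trans lt p≤q , h)
      ; isOpen = λ p p∈ → to (∈sub U W p) p∈ |>′ λ (w , lt , h) →
                            density lt |>′ λ (m , lt₁ , lt₂) →
                            m , from (∈sub U W m) (w , lt₁ , h) , lt₂
      }

    one-isCut : IsCut oneR
    one-isCut = record
      { sub = ones
      ; inh = 1ℚ ⊕ 1ℚ , from (∈one _) (QP.x<x+k 1ℚ 1ℚ)
      ; upper = λ p q p∈ p≤q → from (∈one q) (<-≤-trans (to (∈one p) p∈) p≤q)
      ; isOpen = λ p p∈ → density (to (∈one p) p∈) |>′ λ (m , lt₁ , lt₂) →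
                            m , from (∈one m) lt₁ , lt₂
      }

  opaque
    zero-isCut : IsCut Qˢ
    zero-isCut = record
      { sub = id
      ; inh = 1ℚ , proj₂ 1ℚ
      ; upper = λ _ q _ _ → proj₂ q
      ; isOpen = λ p _ → half p |>′ λ (h , e) →
                           h , proj₂ h , (h , e)
      }

  infixl 6 _+_ _∸_
  infixl 7 _*_
  infix 4 _⊑_
  opaque
    _+_ _*_ _∸_ : ℝ⁺ → ℝ⁺ → ℝ⁺
    U + W = fromCut (add-isCut U W)
    U * W = fromCut (mul-isCut U W)
    U ∸ W = fromCut (sub-isCut U W)

  0ᶜ 1ᶜ : ℝ⁺
  0ᶜ = fromCut zero-isCut
  1ᶜ = fromCut one-isCut

  -- A larger number has fewer fractions above it, so the order is reverse inclusion.
  _⊑_ : ℝ⁺ → ℝ⁺ → Set ℓ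
  U ⊑ W = ∀ q → q ∈ᶜ proj₁ W → q ∈ᶜ proj₁ U

  ⊑-refl : ∀ {U} → U ⊑ U
  ⊑-refl q q∈ = q∈
  ⊑-trans : ∀ {U W X} → U ⊑ W → W ⊑ X → U ⊑ X
  ⊑-trans f g q = f q ∘ g q
  ⊑-antisym : ∀ {U W} → U ⊑ W → W ⊑ U → Same U W
  ⊑-antisym {U} {W} f g = cut-ext U W g f
  ⊑-reflexive : ∀ {U W} → Same U W → U ⊑ W
  ⊑-reflexive (same e) q = subst (proj₁ q ∈_) (sym e)

  ⊑-total : ∀ U W → U ⊑ W ⊎ W ⊑ U
  ⊑-total U W with em {U ⊑ W}
  ... | yes h = inj₁ h
  ... | no ¬h with ¬∀⇒∃¬ ¬h
  ...   | q , k = inj₂ λ p p∈ → upper (cut W) q p q∈W (<⇒≤ (lower (cut U) q p q∉U p∈))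
    where
    q∈W = decidable-stable em λ n → k λ m → contradiction m n
    q∉U : ¬ q ∈ᶜ proj₁ U
    q∉U m = k λ _ → m

  opaque
    unfolding _+_

    +-mono : ∀ {U U′ W W′} → U ⊑ U′ → W ⊑ W′ → U + W ⊑ U′ + W′
    +-mono {U} {U′} {W} {W′} f g q q∈ = to (∈add U′ W′ q) q∈ |>′ λ (u , w , u∈ , w∈ , le) →
                                          from (∈add U W q) (u , w , f u u∈ , g w w∈ , le)

    +-cong : ∀ {U U′ W W′} → Same U U′ → Same W W′ → Same (U + W) (U′ + W′)
    +-cong (same p) (same q) = same (cong₂ addR p q)
    *-cong : ∀ {U U′ W W′} → Same U U′ → Same W W′ → Same (U * W) (U′ * W′)
    *-cong (same p) (same q) = same (cong₂ mulR p q)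
    private
      +-comm⊑ : ∀ U W → U + W ⊑ W + U
      +-comm⊑ U W q q∈ = to (∈add W U q) q∈ |>′ λ (w , u , w∈ , u∈ , le) →
                           from (∈add U W q) (u , w , u∈ , w∈ , ≤-trans (≈⇒≤ (⊕-comm u w)) le)
      *-comm⊑ : ∀ U W → U * W ⊑ W * U
      *-comm⊑ U W q q∈ = to (∈mul W U q) q∈ |>′ λ (w , u , w∈ , u∈ , le) →
                           from (∈mul U W q) (u , w , u∈ , w∈ , ≤-trans (≈⇒≤ (⊗-comm u w)) le)

    +-comm : ∀ U W → Same (U + W) (W + U)
    +-comm U W = ⊑-antisym {U + W} {W + U} (+-comm⊑ U W) (+-comm⊑ W U)
    *-comm : ∀ U W → Same (U * W) (W * U)
    *-comm U W = ⊑-antisym {U * W} {W * U} (*-comm⊑ U W) (*-comm⊑ W U)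

    +-assoc : ∀ U W X → Same ((U + W) + X) (U + (W + X))
    +-assoc U W X = cut-ext ((U + W) + X) (U + (W + X))
      (λ q q∈ → to (∈add (U + W) X q) q∈ |>′ λ (p , x , p∈ , x∈ , le) →
                  to (∈add U W p) p∈ |>′ λ (u , w , u∈ , w∈ , le′) →
                  from (∈add U (W + X) q) (u , w ⊕ x , u∈ , from (∈add W X _) (w , x , w∈ , x∈ , ≤-refl) ,
           ≤-trans (≈⇒≤ (≈-sym (⊕-assoc u w x))) (≤-trans (+-mono-≤ le′ ≤-refl) le)))
      (λ q q∈ → to (∈add U (W + X) q) q∈ |>′ λ (u , p , u∈ , p∈ , le) →
                  to (∈add W X p) p∈ |>′ λ (w , x , w∈ , x∈ , le′) →
                  from (∈add (U + W) X q) (u ⊕ w , x , from (∈add U W _) (u , w , u∈ , w∈ , ≤-refl) , x∈ ,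
           ≤-trans (≈⇒≤ (⊕-assoc u w x)) (≤-trans (+-mono-≤ ≤-refl le′) le)))

    *-assoc : ∀ U W X → Same ((U * W) * X) (U * (W * X))
    *-assoc U W X = cut-ext ((U * W) * X) (U * (W * X))
      (λ q q∈ → to (∈mul (U * W) X q) q∈ |>′ λ (p , x , p∈ , x∈ , le) →
                  to (∈mul U W p) p∈ |>′ λ (u , w , u∈ , w∈ , le′) →
                  from (∈mul U (W * X) q) (u , w ⊗ x , u∈ , from (∈mul W X _) (w , x , w∈ , x∈ , ≤-refl) ,
           ≤-trans (≈⇒≤ (≈-sym (⊗-assoc u w x))) (≤-trans (*-mono-≤ le′ ≤-refl) le)))
      (λ q q∈ → to (∈mul U (W * X) q) q∈ |>′ λ (u , p , u∈ , p∈ , le) →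
                  to (∈mul W X p) p∈ |>′ λ (w , x , w∈ , x∈ , le′) →
                  from (∈mul (U * W) X q) (u ⊗ w , x , from (∈mul U W _) (u , w , u∈ , w∈ , ≤-refl) , x∈ ,
           ≤-trans (≈⇒≤ (⊗-assoc u w x)) (≤-trans (*-mono-≤ ≤-refl le′) le)))

    *-distribʳ : ∀ X U W → Same ((U + W) * X) ((U * X) + (W * X))
    *-distribʳ X U W = cut-ext ((U + W) * X) ((U * X) + (W * X))
      (λ q q∈ → to (∈mul (U + W) X q) q∈ |>′ λ (p , x , p∈ , x∈ , le) →
                  to (∈add U W p) p∈ |>′ λ (u , w , u∈ , w∈ , le′) →
                  from (∈add (U * X) (W * X) q) (u ⊗ x , w ⊗ x ,
             from (∈mul U X _) (u , x , u∈ , x∈ , ≤-refl) , from (∈mul W X _) (w , x , w∈ , x∈ , ≤-refl) ,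
             ≤-trans (≈⇒≤ (≈-sym (distribʳ x u w))) (≤-trans (*-mono-≤ le′ ≤-refl) le)))
      (λ q q∈ → to (∈add (U * X) (W * X) q) q∈ |>′ λ (a , b , a∈ , b∈ , le) →
                  to (∈mul U X a) a∈ |>′ λ (u , x , u∈ , x∈ , la) →
                  to (∈mul W X b) b∈ |>′ λ (w , y , w∈ , y∈ , lb) →
                  -- The two products use different members x and y of X; the smaller one serves
                  -- both.
                  min x y x∈ y∈ |>′ λ (m , m∈ , m≤x , m≤y) →
                  from (∈mul (U + W) X q) (u ⊕ w , m , from (∈add U W _) (u , w , u∈ , w∈ , ≤-refl) , m∈ ,
             ≤-trans (≈⇒≤ (distribʳ m u w)) (≤-trans (+-mono-≤ (≤-trans (*-mono-≤ ≤-refl m≤x) la)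
                                                                (≤-trans (*-mono-≤ ≤-refl m≤y) lb)) le)))
      where
      min : ∀ x y → x ∈ᶜ proj₁ X → y ∈ᶜ proj₁ X → ∃ λ m → m ∈ᶜ proj₁ X × m ≤ x × m ≤ y
      min x y x∈ y∈ with QP.≤-total x y
      ... | inj₁ le = x , x∈ , ≤-refl , le
      ... | inj₂ le = y , y∈ , le , ≤-refl

    +-identityˡ : ∀ U → Same (0ᶜ + U) U
    +-identityˡ U = cut-ext (0ᶜ + U) U
      (λ q q∈ → to (∈add 0ᶜ U q) q∈ |>′ λ (a , u , _ , u∈ , le) →
                  upper (cut U) u q u∈ (≤-trans (<⇒≤ (QP.<-respʳ (⊕-comm u a) (QP.x<x+k u a))) le))
      (λ q q∈ → isOpen (cut U) q q∈ |>′ λ (p , p∈ , (c , e)) →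
                  from (∈add 0ᶜ U q) (c , p , proj₂ c , p∈ , ≈⇒≤ (≈-trans (⊕-comm c p) e)))

    *-identityˡ : ∀ U → Same (1ᶜ * U) U
    *-identityˡ U = cut-ext (1ᶜ * U) U
      (λ q q∈ → to (∈mul 1ᶜ U q) q∈ |>′ λ (a , u , a∈ , u∈ , le) →
                  upper (cut U) u q u∈ (≤-trans (≤-trans (≈⇒≤ (≈-sym (⊗-identityˡ u)))
             (*-mono-≤ {1ℚ} {a} {u} {u} (<⇒≤ (to (∈one a) a∈)) ≤-refl)) le))
      (λ q q∈ → isOpen (cut U) q q∈ |>′ λ (p , p∈ , lt) →
                  from (∈mul 1ᶜ U q) (q ⊗ inv p , p ,
             from (∈one _) (QP.<-respˡ (inverseʳ p) (QP.*-monoˡ-< (inv p) lt)) , p∈ , ≈⇒≤ (⊗-cancel q p)))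

    *-zeroˡ : ∀ U → Same (0ᶜ * U) 0ᶜ
    *-zeroˡ U = cut-ext (0ᶜ * U) 0ᶜ (λ q _ → proj₂ q)
      (λ q _ → inh (cut U) |>′ λ (u , u∈) →
                 from (∈mul 0ᶜ U q) (q ⊗ inv u , u , proj₂ (q ⊗ inv u) , u∈ , ≈⇒≤ (⊗-cancel q u)))

  ≈-reflᶜ : ∀ {U : ℝ⁺} → Same U U
  ≈-reflᶜ = same refl

  infixr 5 _⟫_
  _⟫_ : ∀ {U W X : ℝ⁺} → Same U W → Same W X → Same U X
  same p ⟫ same q = same (trans p q)
  ≈-symᶜ : ∀ {U W : ℝ⁺} → Same U W → Same W U
  ≈-symᶜ (same p) = same (sym p)

  ℝ⁺-semiring : CommutativeSemiring ℓ ℓ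
  ℝ⁺-semiring = record
    { Carrier = ℝ⁺ ; _≈_ = Same ; _+_ = _+_ ; _*_ = _*_ ; 0# = 0ᶜ ; 1# = 1ᶜ
    ; isCommutativeSemiring = isCommutativeSemiringˡ record
      { +-isCommutativeMonoid = record
        { isMonoid = record
          { isSemigroup = record
            { isMagma = record { isEquivalence = Same-isEquivalence ; ∙-cong = +-cong }
            ; assoc = +-assoc }
          ; identity = +-identityˡ , (λ U → +-comm U 0ᶜ ⟫ +-identityˡ U) }
        ; comm = +-comm }
      ; *-isCommutativeMonoid = record
        { isMonoid = record
          { isSemigroup = record
            { isMagma = record { isEquivalence = Same-isEquivalence ; ∙-cong = *-cong }
            ; assoc = *-assoc }
          ; identity = *-identityˡ , (λ U → *-comm U 1ᶜ ⟫ *-identityˡ U) }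
        ; comm = *-comm }
      ; distribʳ = *-distribʳ
      ; zeroˡ = *-zeroˡ } }

  module RSolver = DefaultSolver ℝ⁺-semiring

  opaque
    unfolding _+_

    0⊑ : ∀ U → 0ᶜ ⊑ U
    0⊑ U q q∈ = proj₂ q

    ∸-⊑ : ∀ U W → U ⊑ W → Same (U ∸ W) 0ᶜ
    ∸-⊑ U W le = cut-ext (U ∸ W) 0ᶜ (λ q _ → proj₂ q) λ q _ → half q |>′ λ (h , e) →
                                                                    from (∈sub U W q) (h , (h , e) , λ u u∈ → upper (cut U) u (u ⊕ h) (le u u∈) (<⇒≤ (QP.x<x+k u h)))

    -- The harder inclusion splits a member v of U. Take a member v′ < v, let ε be half of v - v′,
    -- and let u = u′ + ε cross the boundary of W; then v = (v′ - u′ + ε) + u, and v′ - u′ is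
    -- admissible for the difference. If W contains some u ≤ ε, then v′ takes the place of v′ - u′.
    ∸-+ : ∀ U W → W ⊑ U → Same ((U ∸ W) + W) U
    ∸-+ U W W⊑U = cut-ext ((U ∸ W) + W) U
      (λ q q∈ → to (∈add (U ∸ W) W q) q∈ |>′ λ (w , u , w∈ , u∈ , le) →
                  to (∈sub U W w) w∈ |>′ λ (w′ , lt , h) →
                  upper (cut U) (u ⊕ w′) q (h u u∈) (≤-trans (<⇒≤ (QP.+-monoʳ-< u lt)) (≤-trans (≈⇒≤ (⊕-comm u w)) le)))
      back
      where
      back : ∀ v → v ∈ᶜ proj₁ U → v ∈ᶜ proj₁ ((U ∸ W) + W)
      back v v∈ with isOpen (cut U) v v∈
      ... | v′ , v′∈ , (c , v′+c) with half c
      ...   | ε , ε+ε with crossing (proj₁ W) (upper (cut W)) ε (inh (cut W))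
      ...     | u , u∈ , inj₁ u≤ε = from (∈add (U ∸ W) W v) (v′ ⊕ ε , u ,
                  from (∈sub U W _) (v′ , (ε , ≈-refl) , λ u₁ _ → upper (cut U) v′ (u₁ ⊕ v′) v′∈
                     (<⇒≤ (QP.<-respʳ (⊕-comm v′ u₁) (QP.x<x+k v′ u₁)))) , u∈ ,
                  ≤-trans (+-mono-≤ {v′ ⊕ ε} ≤-refl u≤ε) (≈⇒≤ (≈-trans (⊕-assoc v′ ε ε) (≈-trans (QP.+-congˡ ε+ε) v′+c))))
      ...     | u , u∈ , inj₂ (u′ , u′∉ , u≃) with lower (cut W) u′ v′ u′∉ (W⊑U v′ v′∈)
      ...       | w′ , u′+w′ = from (∈add (U ∸ W) W v) (w′ ⊕ ε , u ,
                  from (∈sub U W _) (w′ , (ε , ≈-refl) , λ u₁ u₁∈ → upper (cut U) v′ (u₁ ⊕ w′) v′∈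
                     (<⇒≤ (QP.<-respˡ u′+w′ (QP.+-monoˡ-< w′ (lower (cut W) u′ u₁ u′∉ u₁∈))))) , u∈ ,
                  ≈⇒≤ (≈-trans (QP.+-congˡ u≃)
                      (≈-trans (QP.unjust (solve 3 (λ a b c → (a :+ b) :+ (c :+ b) := (c :+ a) :+ (b :+ b))
                                  QP.commutativeSemiringRefl (just w′) (just ε) (just u′)))
                      (≈-trans (⊕-cong (u′ ⊕ w′) v′ (ε ⊕ ε) c u′+w′ ε+ε) v′+c))))

    -- If q is missing from D, step through E by q: some u = u′ + q lies in E = E + D while u′ does
    -- not lie in E. Then u ≥ e₁ + d with e₁ > u′ and d > q, a contradiction. If the crossing occurs
    -- at once, u ≤ q contradicts u > d > q.
    +-absorb : ∀ E D → Same E (E + D) → Same D 0ᶜ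
    +-absorb E D (same e) with em {0ᶜ ⊑ D × D ⊑ 0ᶜ}
    ... | yes (_ , h) = ⊑-antisym {D} {0ᶜ} h (0⊑ D)
    ... | no ¬h with ¬∀⇒∃¬ (λ k → ¬h (0⊑ D , k))
    ...   | q , k with crossing (proj₁ E) (upper (cut E)) q (inh (cut E))
    ...     | u , u∈ , alt with to (∈add E D u) (subst (proj₁ u ∈_) e u∈)
    ...       | e₁ , d , e₁∈ , d∈ , le = [ a , b ]′ alt
      where
      q<d : q < d
      q<d = lower (cut D) q d (λ m → k λ _ → m) d∈
      a : u ≤ q → Same D 0ᶜ
      a u≤q = contradiction (<-trans q<d (QP.<-respʳ (⊕-comm d e₁) (QP.x<x+k d e₁))) (≤-trans le u≤q)
      b : (∃ λ u′ → ¬ u′ ∈ᶜ proj₁ E × u ≃ u′ ⊕ q) → Same D 0ᶜ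
      b (u′ , u′∉ , u≃) = contradiction
        (<-trans (QP.+-monoˡ-< q (lower (cut E) u′ e₁ u′∉ e₁∈)) (QP.+-monoʳ-< e₁ q<d)) (≤-trans le (≈⇒≤ u≃))

    +-cancelʳ : ∀ U W X → Same (U + X) (W + X) → Same U W
    +-cancelʳ U W X e = [ (λ le → ≈-symᶜ (half-cancel W U le (≈-symᶜ e))) , (λ le → half-cancel U W le e) ]′ (⊑-total U W)
      where
      open RSolver using () renaming (solve to rsolve; _:=_ to _≔_; _:+_ to _⊞_)
      half-cancel : ∀ U W → W ⊑ U → Same (U + X) (W + X) → Same U W
      half-cancel U W W⊑U e = ≈-symᶜ (∸-+ U W W⊑U) ⟫ +-cong D≈0 (≈-reflᶜ {W}) ⟫ +-identityˡ W
        where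
        D : ℝ⁺
        D = U ∸ W
        D≈0 : Same D 0ᶜ
        D≈0 = +-absorb (W + X) D (≈-symᶜ e ⟫ +-cong (≈-symᶜ (∸-+ U W W⊑U)) (≈-reflᶜ {X})
                ⟫ rsolve 3 (λ d w x → (d ⊞ w) ⊞ x ≔ (w ⊞ x) ⊞ d) (≈-reflᶜ) D W X)

    private
      invDef : (U : V) → Def {1} (λ v → ∃ λ w → w ∈ Qˢ × ltQ w (lookup v (# 0)) ×
                                  ∀ u → u ∈ U → ¬ ltQ (mulQ u w) (proj₁ 1ℚ))
      invDef U = ∃∈ (cst Qˢ) (ltQᵈ (var (# 0)) (var (# 1)) ×ᵈ
                   ∀∈ (cst U) (¬ᵈ ltQᵈ (mulQᵈ (var (# 0)) (var (# 1))) (cst (proj₁ 1ℚ))))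

    -- A nonzero cut misses a fraction l, which bounds it away from zero; this makes the set W of
    -- upper approximations to the reciprocal inhabited.
    inverse : ∀ U → ¬ Same U 0ᶜ → ∃ λ W → Same (U * W) 1ᶜ
    inverse U U≉0 with ¬∀⇒∃¬ {A = ℚ⁺} {P = λ q → q ∈ᶜ proj₁ U} (λ h → U≉0 (cut-ext U 0ᶜ (λ q _ → proj₂ q) (λ q _ → h q)))
    ... | l , l∉ = fromCut W-isCut , cut-ext (U * fromCut W-isCut) 1ᶜ forth back
      where
      W : V
      W = comp (invDef (proj₁ U)) Qˢ []
      ∈W : ∀ q → q ∈ᶜ W ⇔ (∃ λ w → w < q × (∀ u → u ∈ᶜ proj₁ U → 1ℚ ≤ u ⊗ w))
      ∈W q = mk⇔
        (λ q∈ → to (∈comp (invDef (proj₁ U)) _) q∈ |>′ λ (_ , w , w∈ , lt , h) →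
                  (w , w∈) , to (ltQ⇔ (w , w∈) q) lt , λ u u∈ → h (proj₁ u) u∈ ∘ from (ltQ⇔ (u ⊗ (w , w∈)) 1ℚ))
        (λ (w , lt , h) → from (∈comp (invDef (proj₁ U)) _) (proj₂ q , proj₁ w , proj₂ w , from (ltQ⇔ w q) lt ,
            λ u u∈ → h (u , sub (cut U) u∈) u∈ ∘ to (ltQ⇔ ((u , sub (cut U) u∈) ⊗ w) 1ℚ)))

      inv-bound : ∀ p → ¬ p ∈ᶜ proj₁ U → ∀ u → u ∈ᶜ proj₁ U → 1ℚ ≤ u ⊗ inv p
      inv-bound p p∉ u u∈ = <⇒≤ (QP.<-respˡ (inverseʳ p) (QP.*-monoˡ-< (inv p) (lower (cut U) p u p∉ u∈)))

      W-isCut : IsCut W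
      W-isCut = record
        { sub = λ z∈ → proj₁ (to (∈comp (invDef (proj₁ U)) _) z∈)
        ; inh = inv l ⊕ inv l , from (∈W _) (inv l , (inv l , ≈-refl) , inv-bound l l∉)
        ; upper = λ p q p∈ p≤q → to (∈W p) p∈ |>′ λ (w , lt , h) →
                                   from (∈W q) (w , <-≤-trans lt p≤q , h)
        ; isOpen = λ p p∈ → to (∈W p) p∈ |>′ λ (w , lt , h) →
                              density lt |>′ λ (m , lt₁ , lt₂) →
                              m , from (∈W m) (w , lt₁ , h) , lt₂
        }

      forth : ∀ q → q ∈ᶜ proj₁ (U * fromCut W-isCut) → q ∈ᶜ proj₁ 1ᶜ
      forth q q∈ = to (∈mul U (fromCut W-isCut) q) q∈ |>′ λ (u , w , u∈ , w∈ , le) →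
                     to (∈W w) w∈ |>′ λ (w′ , lt , h) →
                     from (∈one q) (≤-<-trans (h u u∈) (<-≤-trans (QP.*-monoʳ-< u lt) le))

      clamp : ∀ θ → ∃ λ θ′ → θ′ ≤ θ × θ′ ≤ 1ℚ
      clamp θ = [ (λ le → θ , ≤-refl , le) , (λ le → 1ℚ , le , ≤-refl) ]′ (QP.≤-total θ 1ℚ)

      back : ∀ q → q ∈ᶜ proj₁ 1ᶜ → q ∈ᶜ proj₁ (U * fromCut W-isCut)
      back q q∈ with to (∈one q) q∈
      ... | η , 1+η with half η | half l
      ...   | θ , θ+θ | h , h+h with clamp θ
      ...     | θ′ , θ′≤θ , θ′≤1 with crossing (proj₁ U) (upper (cut U)) (h ⊗ θ′) (inh (cut U))
      ...       | u , u∈ , alt = [ a , b ]′ alt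
        where
        -- With h = l/2 and θ′ ≤ 1 the step ε = h θ′ is at most h, which rules out the first
        -- alternative of `crossing` and gives u′ ≥ h; hence ε/u′ ≤ θ′.
        ε : ℚ⁺
        ε = h ⊗ θ′
        ε≤h : ε ≤ h
        ε≤h = ≤-trans (*-mono-≤ (≤-refl {h}) θ′≤1) (≈⇒≤ (≈-trans (⊗-comm h 1ℚ) (⊗-identityˡ h)))
        l<u : l < u
        l<u = lower (cut U) l u l∉ u∈
        a : u ≤ ε → q ∈ᶜ proj₁ (U * fromCut W-isCut)
        a u≤ε = contradiction (<-trans (h , h+h) l<u) (≤-trans u≤ε ε≤h)
        b : (∃ λ u′ → ¬ u′ ∈ᶜ proj₁ U × u ≃ u′ ⊕ ε) → q ∈ᶜ proj₁ (U * fromCut W-isCut)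
        b (u′ , u′∉ , u≃) = from (∈mul U (fromCut W-isCut) q) (u , w , u∈ ,
            from (∈W w) (inv u′ , (θ ⊗ inv u , ≈-refl) , inv-bound u′ u′∉) , u⊗w≤q)
          where
          w : ℚ⁺
          w = inv u′ ⊕ θ ⊗ inv u
          h≤u′ : h ≤ u′
          h≤u′ u′<h = <⇒≤ l<u (<-≤-trans (QP.<-respˡ (≈-sym u≃) (QP.+-monoˡ-< ε u′<h))
                         (≤-trans (+-mono-≤ (≤-refl {h}) ε≤h) (≈⇒≤ h+h)))
          -- u w = (u′ + ε)/u′ + θ ≤ 1 + θ′ + θ ≤ 1 + η
          small : ε ⊗ inv u′ ≤ θ
          small = ≤-trans (*-mono-≤ (*-mono-≤ h≤u′ (≤-refl {θ′})) (≤-refl {inv u′}))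
            (≤-trans (≈⇒≤ (≈-trans (QP.unjust (solve 3 (λ x y z → x :* y :* z := (x :* z) :* y)
                  QP.commutativeSemiringRefl (just u′) (just θ′) (just (inv u′))))
              (≈-trans (⊗-cong (u′ ⊗ inv u′) 1ℚ θ′ θ′ (inverseʳ u′) ≈-refl) (⊗-identityˡ θ′)))) θ′≤θ)
          expand : u ⊗ w ≃ (1ℚ ⊕ ε ⊗ inv u′) ⊕ θ
          expand = ≈-trans (QP.unjust (solve 4 (λ x y t z → x :* (y :+ t :* z) := x :* y :+ (x :* z) :* t)
                     QP.commutativeSemiringRefl (just u) (just (inv u′)) (just θ) (just (inv u))))
                   (⊕-cong _ _ _ _ (≈-trans (⊗-cong u (u′ ⊕ ε) (inv u′) (inv u′) u≃ ≈-refl)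
                       (≈-trans (distribʳ (inv u′) u′ ε) (⊕-cong _ _ _ _ (inverseʳ u′) ≈-refl)))
                     (≈-trans (⊗-cong (u ⊗ inv u) 1ℚ θ θ (inverseʳ u) ≈-refl) (⊗-identityˡ θ)))
          u⊗w≤q : u ⊗ w ≤ q
          u⊗w≤q = ≤-trans (≈⇒≤ expand) (≤-trans (+-mono-≤ (+-mono-≤ (≤-refl {1ℚ}) small) (≤-refl {θ}))
                    (≈⇒≤ (≈-trans (⊕-assoc 1ℚ θ θ) (≈-trans (QP.+-congˡ θ+θ) 1+η))))

    -- Since cuts consist of upper fractions, the infimum is the union.
    infimum : ∀ A → (∀ U → U ∈ A → U ∈ Cutˢ) → (∃ λ U → U ∈ A) →
              ∃ λ (I : ℝ⁺) → (∀ (U : ℝ⁺) → proj₁ U ∈ A → I ⊑ U) × (∀ L → (∀ (U : ℝ⁺) → proj₁ U ∈ A → L ⊑ U) → L ⊑ I)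
    infimum A A⊆ (U₀ , U₀∈) = fromCut ⋃-isCut ,
      (λ U U∈ q q∈ → from (∈⋃ _) (_ , U∈ , q∈)) ,
      (λ L h q q∈ → to (∈⋃ _) q∈ |>′ λ (U , U∈ , q∈U) →
                      h (U , A⊆ U U∈) U∈ q q∈U)
      where
      ⋃-isCut : IsCut (⋃ A)
      ⋃-isCut = record
        { sub = λ z∈ → to (∈⋃ _) z∈ |>′ λ (U , U∈ , z∈U) →
                         sub (∈Cutˢ (A⊆ U U∈)) z∈U
        ; inh = inh (∈Cutˢ (A⊆ U₀ U₀∈)) |>′ λ (q , q∈) →
                  q , from (∈⋃ _) (U₀ , U₀∈ , q∈)
        ; upper = λ p q p∈ le → to (∈⋃ _) p∈ |>′ λ (U , U∈ , p∈U) →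
                                  from (∈⋃ _) (U , U∈ , upper (∈Cutˢ (A⊆ U U∈)) p q p∈U le)
        ; isOpen = λ p p∈ → to (∈⋃ _) p∈ |>′ λ (U , U∈ , p∈U) →
                              isOpen (∈Cutˢ (A⊆ U U∈)) p p∈U |>′ λ (q , q∈ , lt) →
                              q , from (∈⋃ _) (U , U∈ , q∈) , lt
        }

-- The complete ordered field built from differences of cuts.

module RealNumberField {ℓ : Level} (em : ExcludedMiddle ℓ) (M : ZFModel ℓ) where

  open import Algebra.Structures using (IsCommutativeRing)
  open import Algebra.Bundles.Raw using (RawRing)
  open import Algebra.Morphism.Structures using (IsRingMonomorphism)
  import Algebra.Morphism.RingMonomorphism as RingMonomorphism
  open import Data.Fin using (#_)
  open import Data.Vec.Base using (Vec; []; lookup)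
  open import Data.Product.Base using (∃; _×_; _,_; proj₁; proj₂)
  open import Data.Sum.Base as Sum using (_⊎_; inj₁; inj₂; [_,_]′)
  open import Function.Base using (id; _|>′_)
  open import Function.Bundles using (_⇔_; mk⇔)
  open import Relation.Binary.PropositionalEquality using (_≡_; refl; sym; trans; cong; cong₂; subst; subst₂)
  open import Relation.Binary.Structures using (IsEquivalence; IsTotalOrder)
  open import Relation.Nullary using (¬_)
  open DifferenceRings
  open DefinablePredicates em M
  open Sets em M
  open Naturals em M
  open PositiveRationals em M
  open DedekindCuts em M
  open Internal M using (set; El; _≈_; Map; _⊠_; RealNumbers; apply₂)

  open Differences ℝ⁺-semiring +-cancelʳ using (Pair; _~_; pair~; cross; ~-isEquivalence)
    renaming (_⊞_ to _+ₚ_; _⊠_ to _*ₚ_; ⊟_ to -ₚ_; 0ₚ to 0ₚ; 1ₚ to 1ₚ; isCommutativeRing to isCommutativeRingₚ;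
              ⊞-cong to +ₚ-cong; ⊠-cong to *ₚ-cong)
  open RSolver using (solve; _:=_; _:+_; _:*_; con)
  private module ~ = IsEquivalence ~-isEquivalence

  private
    -- A real number is a difference a − b of cuts one of which is zero (and Qˢ is the zero cut).
    lineDef : Def {1} (λ v → fst (lookup v (# 0)) ≡ Qˢ ⊎ snd (lookup v (# 0)) ≡ Qˢ)
    lineDef = (fstᵈ (var (# 0)) ≡ᵈ cst Qˢ) ⊎ᵈ (sndᵈ (var (# 0)) ≡ᵈ cst Qˢ)

  opaque
    Lineˢ : V
    Lineˢ = comp lineDef (Cutˢ ×ˢ Cutˢ) []

    ∈Line : ∀ z → z ∈ Lineˢ ⇔ (z ∈ Cutˢ ×ˢ Cutˢ × (fst z ≡ Qˢ ⊎ snd z ≡ Qˢ))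
    ∈Line z = ∈comp lineDef z

  Line : Set ℓ
  Line = El (set Lineˢ)

  opaque
    pos-∈ : ∀ {z} → z ∈ Lineˢ → fst z ∈ Cutˢ
    pos-∈ z∈ = fst-∈ (proj₁ (to (∈Line _) z∈))
    neg-∈ : ∀ {z} → z ∈ Lineˢ → snd z ∈ Cutˢ
    neg-∈ z∈ = snd-∈ (proj₁ (to (∈Line _) z∈))

  ι : Line → Pair
  ι (z , z∈) = (fst z , pos-∈ z∈) , (snd z , neg-∈ z∈)

  -- One of the two truncated differences is zero, so this is the normal form of a - b.
  nfᵛ : V → V → V
  nfᵛ a b = ⟨ subR a b , subR b a ⟩

  private
    flip : ∀ {U W : ℝ⁺} → Same U W → Same W U
    flip = ≈-symᶜ
    rfl : ∀ {U : ℝ⁺} → Same U U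
    rfl = same refl

  opaque
    unfolding _+_

    nf-∈ : ((a , b) : Pair) → nfᵛ (proj₁ a) (proj₁ b) ∈ Lineˢ
    nf-∈ (a , b) = from (∈Line _) (pair∈× (proj₂ (a ∸ b)) (proj₂ (b ∸ a)) ,
      [ (λ le → inj₁ (trans (fst-β _ _) (unwrap (∸-⊑ a b le)))) ,
        (λ le → inj₂ (trans (snd-β _ _) (unwrap (∸-⊑ b a le)))) ]′ (⊑-total a b))

  nf : Pair → Line
  nf p = nfᵛ (proj₁ (proj₁ p)) (proj₁ (proj₂ p)) , nf-∈ p

  opaque
    unfolding _+_

    nf~ : ∀ p → ι (nf p) ~ p
    nf~ p@(a , b) = pair~ (+-cong first (rfl {b}) ⟫
        [ (λ le → +-cong (∸-⊑ a b le) (rfl {b}) ⟫ +-identityˡ b ⟫ flip (+-comm a (b ∸ a) ⟫ ∸-+ b a le)) ,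
          (λ le → ∸-+ a b le ⟫ flip (+-identityˡ a) ⟫ +-comm 0ᶜ a ⟫ +-cong (rfl {a}) (flip (∸-⊑ b a le))) ]′ (⊑-total a b)
        ⟫ +-cong (rfl {a}) (flip second))
      where
      first : Same (proj₁ (ι (nf p))) (a ∸ b)
      first = same (fst-β _ _)
      second : Same (proj₂ (ι (nf p))) (b ∸ a)
      second = same (snd-β _ _)

  opaque
    zero-sum : ∀ a b → Same (a + b) 0ᶜ → Same a 0ᶜ
    zero-sum a b e = ⊑-antisym {a} {0ᶜ} (⊑-trans {a} {a + b} {0ᶜ}
      (⊑-trans {a} {a + 0ᶜ} {a + b} (⊑-reflexive {a} {a + 0ᶜ} (flip (+-identityˡ a) ⟫ +-comm 0ᶜ a))
        (+-mono {a} {a} {0ᶜ} {b} (⊑-refl {a}) (0⊑ b))) (⊑-reflexive {a + b} {0ᶜ} e)) (0⊑ a)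

    ι-zero : ∀ x → Same (proj₁ (ι x)) 0ᶜ ⊎ Same (proj₂ (ι x)) 0ᶜ
    ι-zero (z , z∈) = Sum.map same same (proj₂ (to (∈Line z) z∈))

    -- Normal forms are unique. If the zero components are on the same side, the equation compares
    -- the others; if they are on opposite sides, a sum of nonnegative cuts is zero and everything
    -- vanishes. The ring laws can therefore be pulled back from formal differences.
    ι-injective : ∀ x y → ι x ~ ι y → x ≈ y
    ι-injective x y (pair~ e) = trans (pair-η (proj₁ (to (∈Line _) (proj₂ x))))
      (trans (cong₂ ⟨_,_⟩ (unwrap (proj₁ eq)) (unwrap (proj₂ eq))) (sym (pair-η (proj₁ (to (∈Line _) (proj₂ y))))))
      where
      a b c d : ℝ⁺
      a = proj₁ (ι x)
      b = proj₂ (ι x)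
      c = proj₁ (ι y)
      d = proj₂ (ι y)
      0+ : ∀ {u w} → Same u 0ᶜ → Same (u + w) w
      0+ {u} {w} p = +-cong p (rfl {w}) ⟫ +-identityˡ w
      +0 : ∀ {u w} → Same w 0ᶜ → Same (u + w) u
      +0 {u} {w} p = +-comm u w ⟫ 0+ p
      eq : Same a c × Same b d
      eq with ι-zero x | ι-zero y
      ... | inj₁ p | inj₁ q = (p ⟫ flip q) , flip (flip (0+ {a} {d} p) ⟫ e ⟫ 0+ {c} {b} q)
      ... | inj₂ p | inj₂ q = (flip (+0 {a} {d} q) ⟫ e ⟫ +0 {c} {b} p) , (p ⟫ flip q)
      ... | inj₁ p | inj₂ q = (p ⟫ flip (zero-sum c b s)) , (zero-sum b c (+-comm b c ⟫ s) ⟫ flip q)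
        where
        s : Same (c + b) 0ᶜ
        s = flip e ⟫ 0+ {a} {d} p ⟫ q
      ... | inj₂ p | inj₁ q = (zero-sum a d s ⟫ flip q) , (p ⟫ flip (zero-sum d a (+-comm d a ⟫ s)))
        where
        s : Same (a + d) 0ᶜ
        s = e ⟫ 0+ {c} {b} q ⟫ p

    ι-cong : ∀ x y → x ≈ y → ι x ~ ι y
    ι-cong x y e = pair~ (+-cong (same (cong fst e)) (same (cong snd (sym e))))

  addᵛ mulᵛ : V → V → V
  addᵛ p q = nfᵛ (addR (fst p) (fst q)) (addR (snd p) (snd q))
  mulᵛ p q = nfᵛ (addR (mulR (fst p) (fst q)) (mulR (snd p) (snd q))) (addR (mulR (fst p) (snd q)) (mulR (snd p) (fst q)))

  nfᵈ : ∀ {n} {F G : Vec V n → V} → DefT F → DefT G → DefT (λ v → nfᵛ (F v) (G v))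
  nfᵈ t u = pairᵈ (subRᵈ t u) (subRᵈ u t)

  private
    addDef : DefT {1} (λ v → addᵛ (fst (head v)) (snd (head v)))
    addDef = nfᵈ (addRᵈ (fstᵈ (fstᵈ (var (# 0)))) (fstᵈ (sndᵈ (var (# 0)))))
                 (addRᵈ (sndᵈ (fstᵈ (var (# 0)))) (sndᵈ (sndᵈ (var (# 0)))))
    mulDef : DefT {1} (λ v → mulᵛ (fst (head v)) (snd (head v)))
    mulDef = nfᵈ (addRᵈ (mulRᵈ (fstᵈ p) (fstᵈ q)) (mulRᵈ (sndᵈ p) (sndᵈ q)))
                 (addRᵈ (mulRᵈ (fstᵈ p) (sndᵈ q)) (mulRᵈ (sndᵈ p) (fstᵈ q)))
      where
      p : DefT {1} (λ v → fst (head v))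
      p = fstᵈ (var (# 0))
      q : DefT {1} (λ v → snd (head v))
      q = sndᵈ (var (# 0))

    binaryMap : (op : V → V → V) → DefT {1} (λ v → op (fst (head v)) (snd (head v))) →
                (∀ {x y} → x ∈ Lineˢ → y ∈ Lineˢ → op x y ∈ Lineˢ) → Map (Lineˢ ⊠ Lineˢ) (set Lineˢ)
    binaryMap op opᵈ closed = lamMap (λ p → op (fst p) (snd p)) opᵈ (Lineˢ ×ˢ Lineˢ) Lineˢ
      (λ { (x , y , x∈ , y∈ , refl) → pair∈× x∈ y∈ })
      (λ p∈ → let (x , x∈ , y , y∈ , e) = to (∈× _) p∈ in x , y , x∈ , y∈ , e)
      id
      (λ { (x , y , x∈ , y∈ , refl) → subst₂ (λ a b → op a b ∈ Lineˢ) (sym (fst-β x y)) (sym (snd-β x y)) (closed x∈ y∈) })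

  opaque
    unfolding _+_

    addᵛ-∈ : ∀ {x y} → x ∈ Lineˢ → y ∈ Lineˢ → addᵛ x y ∈ Lineˢ
    addᵛ-∈ x∈ y∈ = nf-∈ (ι (_ , x∈) +ₚ ι (_ , y∈))
    mulᵛ-∈ : ∀ {x y} → x ∈ Lineˢ → y ∈ Lineˢ → mulᵛ x y ∈ Lineˢ
    mulᵛ-∈ x∈ y∈ = nf-∈ (ι (_ , x∈) *ₚ ι (_ , y∈))

    addᵛ-nf : ∀ x y → addᵛ (proj₁ x) (proj₁ y) ≡ proj₁ (nf (ι x +ₚ ι y))
    addᵛ-nf x y = refl
    mulᵛ-nf : ∀ x y → mulᵛ (proj₁ x) (proj₁ y) ≡ proj₁ (nf (ι x *ₚ ι y))
    mulᵛ-nf x y = refl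

  addition multiplication : Map (Lineˢ ⊠ Lineˢ) (set Lineˢ)
  addition = binaryMap addᵛ addDef addᵛ-∈
  multiplication = binaryMap mulᵛ mulDef mulᵛ-∈

  infixl 6 _⊹_
  infixl 7 _⋆_
  _⊹_ _⋆_ : Line → Line → Line
  _⊹_ = apply₂ addition
  _⋆_ = apply₂ multiplication

  opaque
    -∈ : ∀ (x : Line) → ⟨ snd (proj₁ x) , fst (proj₁ x) ⟩ ∈ Lineˢ
    -∈ x = from (∈Line _) (pair∈× (neg-∈ (proj₂ x)) (pos-∈ (proj₂ x)) ,
      [ (λ p → inj₂ (trans (snd-β _ _) (unwrap p))) , (λ p → inj₁ (trans (fst-β _ _) (unwrap p))) ]′ (ι-zero x))

  ⊖_ : Line → Line
  ⊖ x = ⟨ snd (proj₁ x) , fst (proj₁ x) ⟩ , -∈ x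

  0ᴿ 1ᴿ : Line
  0ᴿ = nf 0ₚ
  1ᴿ = nf 1ₚ

  opaque
    ι-+ : ∀ x y → ι (x ⊹ y) ~ ι x +ₚ ι y
    ι-+ x y = ~.trans (ι-cong (x ⊹ y) (nf (ι x +ₚ ι y)) (trans (cong₂ addᵛ (fst-β _ _) (snd-β _ _)) (addᵛ-nf x y))) (nf~ _)
    ι-* : ∀ x y → ι (x ⋆ y) ~ ι x *ₚ ι y
    ι-* x y = ~.trans (ι-cong (x ⋆ y) (nf (ι x *ₚ ι y)) (trans (cong₂ mulᵛ (fst-β _ _) (snd-β _ _)) (mulᵛ-nf x y))) (nf~ _)
    ι-- : ∀ x → ι (⊖ x) ~ -ₚ ι x
    ι-- x = pair~ (+-cong (same (fst-β _ _)) (same (sym (snd-β _ _))))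

    isCommutativeRing : IsCommutativeRing _≈_ _⊹_ _⋆_ ⊖_ 0ᴿ 1ᴿ
    isCommutativeRing = RingMonomorphism.isCommutativeRing mono isCommutativeRingₚ
      where
      R₁ : RawRing ℓ ℓ
      R₁ = record { Carrier = Line ; _≈_ = _≈_ ; _+_ = _⊹_ ; _*_ = _⋆_ ; -_ = ⊖_ ; 0# = 0ᴿ ; 1# = 1ᴿ }
      R₂ : RawRing ℓ ℓ
      R₂ = record { Carrier = Pair ; _≈_ = _~_ ; _+_ = _+ₚ_ ; _*_ = _*ₚ_ ; -_ = -ₚ_ ; 0# = 0ₚ ; 1# = 1ₚ }
      mono : IsRingMonomorphism R₁ R₂ ι
      mono = record
        { isRingHomomorphism = record
          { isSemiringHomomorphism = record
            { isNearSemiringHomomorphism = record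
              { +-isMonoidHomomorphism = record
                { isMagmaHomomorphism = record
                  { isRelHomomorphism = record { cong = λ {x} {y} → ι-cong x y }
                  ; homo = ι-+ }
                ; ε-homo = nf~ 0ₚ }
              ; *-homo = ι-* }
            ; 1#-homo = nf~ 1ₚ }
          ; -‿homo = ι-- }
        ; injective = λ {x} {y} → ι-injective x y }

  infix 4 _≤ₚ_
  record _≤ₚ_ (p q : Pair) : Set ℓ where
    constructor le
    field unle : (proj₁ p + proj₂ q) ⊑ (proj₁ q + proj₂ p)
  open _≤ₚ_

  opaque
    +-cancel-⊑ : ∀ U W X → U + X ⊑ W + X → U ⊑ W
    +-cancel-⊑ U W X h = [ id , (λ W⊑U → ⊑-reflexive {U} {W} (+-cancelʳ U W X
        (⊑-antisym {U + X} {W + X} h (+-mono {W} {U} {X} {X} W⊑U (⊑-refl {X}))))) ]′ (⊑-total U W)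

    ⊑-resp : ∀ {U U′ W W′} → Same U U′ → Same W W′ → U ⊑ W → U′ ⊑ W′
    ⊑-resp (same refl) (same refl) h = h

    ≤ₚ-trans : ∀ {p q r} → p ≤ₚ q → q ≤ₚ r → p ≤ₚ r
    ≤ₚ-trans {a , b} {c , d} {e , f} (le g) (le h) = le (+-cancel-⊑ (a + f) (e + b) (c + d)
      (⊑-resp (solve 4 (λ a d c f → (a :+ d) :+ (c :+ f) := (a :+ f) :+ (c :+ d)) rfl a d c f)
              (solve 4 (λ c b e d → (c :+ b) :+ (e :+ d) := (e :+ b) :+ (c :+ d)) rfl c b e d)
              (+-mono {a + d} {c + b} {c + f} {e + d} g h)))

    ≤ₚ-reflexive : ∀ {p q} → p ~ q → p ≤ₚ q
    ≤ₚ-reflexive {a , b} {c , d} (pair~ e) = le (⊑-reflexive {a + d} {c + b} e)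

    ≤ₚ-antisym : ∀ {p q} → p ≤ₚ q → q ≤ₚ p → p ~ q
    ≤ₚ-antisym {a , b} {c , d} (le g) (le h) = pair~ (⊑-antisym {a + d} {c + b} g h)

    ≤ₚ-total : ∀ p q → p ≤ₚ q ⊎ q ≤ₚ p
    ≤ₚ-total (a , b) (c , d) = Sum.map le le (⊑-total (a + d) (c + b))

    ≤ₚ-resp : ∀ {p p′ q q′} → p ~ p′ → q ~ q′ → p ≤ₚ q → p′ ≤ₚ q′
    ≤ₚ-resp e f h = ≤ₚ-trans (≤ₚ-reflexive (~.sym e)) (≤ₚ-trans h (≤ₚ-reflexive f))

    +ₚ-mono : ∀ {p q} r → p ≤ₚ q → p +ₚ r ≤ₚ q +ₚ r
    +ₚ-mono {a , b} {c , d} (e , f) (le h) = le (⊑-resp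
      (solve 4 (λ a d e f → (a :+ d) :+ (e :+ f) := (a :+ e) :+ (d :+ f)) rfl a d e f)
      (solve 4 (λ c b e f → (c :+ b) :+ (e :+ f) := (c :+ e) :+ (b :+ f)) rfl c b e f)
      (+-mono {a + d} {c + b} {e + f} {e + f} h (⊑-refl {e + f})))

    nonNegative-form : ∀ x → 0ₚ ≤ₚ ι x → ∃ λ a → ι x ~ (a , 0ᶜ)
    nonNegative-form x (le h) = [ case₁ , case₂ ]′ (ι-zero x)
      where
      a b : ℝ⁺
      a = proj₁ (ι x)
      b = proj₂ (ι x)
      case₁ : Same a 0ᶜ → ∃ λ a → ι x ~ (a , 0ᶜ)
      case₁ e = 0ᶜ , pair~ (+-cong e (rfl {0ᶜ}) ⟫ flip (+-cong (rfl {0ᶜ}) b≈0))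
        where
        b≈0 : Same b 0ᶜ
        b≈0 = ⊑-antisym {b} {0ᶜ} (⊑-resp (+-identityˡ b) (+-comm a 0ᶜ ⟫ +-identityˡ a ⟫ e) h) (0⊑ b)
      case₂ : Same b 0ᶜ → ∃ λ a → ι x ~ (a , 0ᶜ)
      case₂ e = a , pair~ (+-cong (rfl {a}) (flip e))

    *ₚ-nonNegative : ∀ a c → 0ₚ ≤ₚ (a , 0ᶜ) *ₚ (c , 0ᶜ)
    *ₚ-nonNegative a c = le (⊑-resp left right (0⊑ (a * c)))
      where
      left : Same 0ᶜ (0ᶜ + (a * 0ᶜ + 0ᶜ * c))
      left = solve 2 (λ a c → con 0 := con 0 :+ (a :* con 0 :+ con 0 :* c)) rfl a c
      right : Same (a * c) ((a * c + 0ᶜ * 0ᶜ) + 0ᶜ)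
      right = solve 2 (λ a c → a :* c := (a :* c :+ con 0 :* con 0) :+ con 0) rfl a c

  orderᵛ : V → V → Set ℓ
  orderᵛ x y = ∀ q → q ∈ addR (fst y) (snd x) → q ∈ addR (fst x) (snd y)

  private
    orderDef : Def {1} (λ v → orderᵛ (fst (lookup v (# 0))) (snd (lookup v (# 0))))
    orderDef = ∀∈ (addRᵈ (fstᵈ (sndᵈ (var (# 0)))) (sndᵈ (fstᵈ (var (# 0)))))
                  (var (# 0) ∈ᵈ addRᵈ (fstᵈ (fstᵈ (var (# 1)))) (sndᵈ (sndᵈ (var (# 1)))))

  opaque
    order : V
    order = comp orderDef (Lineˢ ×ˢ Lineˢ) []

  opaque
    unfolding _+_ order

    ∈order : ∀ x y → ⟨ proj₁ x , proj₁ y ⟩ ∈ order ⇔ (ι x ≤ₚ ι y)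
    ∈order x y = mk⇔
      (λ m → le λ q q∈ → subst₂ (λ a b → proj₁ q ∈ addR (fst a) (snd b)) (fst-β _ _) (snd-β _ _)
         (proj₂ (to (∈comp orderDef _) m) (proj₁ q)
           (subst₂ (λ a b → proj₁ q ∈ addR (fst a) (snd b)) (sym (snd-β _ _)) (sym (fst-β _ _)) q∈)))
      (λ (le h) → from (∈comp orderDef _) (pair∈× (proj₂ x) (proj₂ y) , λ q q∈ →
         subst₂ (λ a b → q ∈ addR (fst a) (snd b)) (sym (fst-β _ _)) (sym (snd-β _ _))
           (let q∈′ = subst₂ (λ a b → q ∈ addR (fst a) (snd b)) (snd-β _ _) (fst-β _ _) q∈
            in h (q , IsCut.sub (cut (proj₁ (ι y) + proj₂ (ι x))) q∈′) q∈′)))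

  infix 4 _≼_
  _≼_ : Line → Line → Set ℓ
  x ≼ y = ⟨ proj₁ x , proj₁ y ⟩ ∈ order

  opaque
    isTotalOrder : IsTotalOrder _≈_ _≼_
    isTotalOrder = record
      { isPartialOrder = record
        { isPreorder = record
          { isEquivalence = record { refl = refl ; sym = sym ; trans = trans }
          ; reflexive = λ {x} {y} e → from (∈order x y) (≤ₚ-reflexive (ι-cong x y e))
          ; trans = λ {x} {y} {z} p q → from (∈order x z) (≤ₚ-trans (to (∈order x y) p) (to (∈order y z) q)) }
        ; antisym = λ {x} {y} p q → ι-injective x y (≤ₚ-antisym (to (∈order x y) p) (to (∈order y x) q)) }
      ; total = λ x y → Sum.map (from (∈order x y)) (from (∈order y x)) (≤ₚ-total (ι x) (ι y)) }

    +-monoˡ-≼ : ∀ x y z → x ≼ y → x ⊹ z ≼ y ⊹ z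
    +-monoˡ-≼ x y z h = from (∈order _ _) (≤ₚ-resp (~.sym (ι-+ x z)) (~.sym (ι-+ y z)) (+ₚ-mono (ι z) (to (∈order x y) h)))

    *-nonNegative : ∀ x y → 0ᴿ ≼ x → 0ᴿ ≼ y → 0ᴿ ≼ x ⋆ y
    *-nonNegative x y p q with nonNegative-form x (≤ₚ-resp (nf~ 0ₚ) ~.refl (to (∈order 0ᴿ x) p))
                             | nonNegative-form y (≤ₚ-resp (nf~ 0ₚ) ~.refl (to (∈order 0ᴿ y) q))
    ... | a , e | c , f = from (∈order _ _) (≤ₚ-resp (~.sym (nf~ 0ₚ))
           (~.sym (~.trans (ι-* x y) (*ₚ-cong e f))) (*ₚ-nonNegative a c))

    0≉1 : ¬ 0ᴿ ≈ 1ᴿ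
    0≉1 e = QP.<-irrefl QP.≈-refl (to (∈one 1ℚ) (subst (proj₁ 1ℚ ∈_) (unwrap q) (proj₂ 1ℚ)))
      where
      q : Same 0ᶜ 1ᶜ
      q = flip (+-identityˡ 0ᶜ) ⟫ cross (~.trans (~.sym (nf~ 0ₚ)) (~.trans (ι-cong 0ᴿ 1ᴿ e) (nf~ 1ₚ)))
            ⟫ +-comm 1ᶜ 0ᶜ ⟫ +-identityˡ 1ᶜ

    -- The reciprocal is that of the component which does not vanish, placed on the same side.
    invertible : ∀ x → ¬ x ≈ 0ᴿ → ∃ λ y → x ⋆ y ≈ 1ᴿ
    invertible x x≉0 with ι-zero x
    ... | inj₂ b≈0 = inverse a a≉0 |>′ λ (W , e) → nf (W , 0ᶜ) , ι-injective _ _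
          (~.trans (ι-* x _) (~.trans (*ₚ-cong (~.refl {ι x}) (nf~ (W , 0ᶜ))) (~.trans (pair~
            (solve 3 (λ a b w → (a :* w :+ b :* con 0) :+ con 0 := a :* w) rfl a b W ⟫ e ⟫
             flip (+-cong (rfl {1ᶜ}) (+-cong (rfl {a * 0ᶜ}) (*-cong b≈0 (rfl {W})))
                   ⟫ solve 2 (λ a w → con 1 :+ (a :* con 0 :+ con 0 :* w) := con 1) rfl a W))) (~.sym (nf~ 1ₚ)))))
      where
      a b : ℝ⁺
      a = proj₁ (ι x)
      b = proj₂ (ι x)
      a≉0 : ¬ Same a 0ᶜ
      a≉0 a≈0 = x≉0 (ι-injective x 0ᴿ (~.trans (pair~ (+-cong a≈0 (flip b≈0))) (~.sym (nf~ 0ₚ))))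
    ... | inj₁ a≈0 = inverse b b≉0 |>′ λ (W , e) → nf (0ᶜ , W) , ι-injective _ _
          (~.trans (ι-* x _) (~.trans (*ₚ-cong (~.refl {ι x}) (nf~ (0ᶜ , W))) (~.trans (pair~
            (solve 3 (λ a b w → (a :* con 0 :+ b :* w) :+ con 0 := b :* w) rfl a b W ⟫ e ⟫
             flip (+-cong (rfl {1ᶜ}) (+-cong (*-cong a≈0 (rfl {W})) (rfl {b * 0ᶜ}))
                   ⟫ solve 2 (λ b w → con 1 :+ (con 0 :* w :+ b :* con 0) := con 1) rfl b W))) (~.sym (nf~ 1ₚ)))))
      where
      a b : ℝ⁺
      a = proj₁ (ι x)
      b = proj₂ (ι x)
      b≉0 : ¬ Same b 0ᶜ
      b≉0 b≈0 = x≉0 (ι-injective x 0ᴿ (~.trans (pair~ (+-cong a≈0 (flip b≈0))) (~.sym (nf~ 0ₚ))))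

  private
    boundDef : ∀ A p₀ n₀ → Def {1} (λ v → ∀ α → α ∈ A →
                 ∀ q → q ∈ addR (addR p₀ (lookup v (# 0))) (snd α) → q ∈ addR (fst α) n₀)
    boundDef A p₀ n₀ = ∀∈ (cst A) (∀∈ (addRᵈ (addRᵈ (cst p₀) (var (# 1))) (sndᵈ (var (# 0))))
                         (var (# 0) ∈ᵈ addRᵈ (fstᵈ (var (# 1))) (cst n₀)))

  opaque
    unfolding _+_

    Bounds : V → ℝ⁺ → ℝ⁺ → V
    Bounds A p₀ n₀ = comp (boundDef A (proj₁ p₀) (proj₁ n₀)) Cutˢ []

    Bounds-⊆ : ∀ A p₀ n₀ U → U ∈ Bounds A p₀ n₀ → U ∈ Cutˢ
    Bounds-⊆ A p₀ n₀ U U∈ = proj₁ (to (∈comp (boundDef A (proj₁ p₀) (proj₁ n₀)) _) U∈)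

    ∈Bounds : ∀ A → (∀ x → x ∈ A → x ∈ Lineˢ) → ∀ p₀ n₀ c →
              proj₁ c ∈ Bounds A p₀ n₀ ⇔ (∀ (x : Line) → proj₁ x ∈ A → ι x ≤ₚ (p₀ + c , n₀))
    ∈Bounds A A⊆ p₀ n₀ c = mk⇔
      (λ m x x∈ → le λ q q∈ → proj₂ (to (∈comp (boundDef A (proj₁ p₀) (proj₁ n₀)) _) m) (proj₁ x) x∈ (proj₁ q) q∈)
      (λ h → from (∈comp (boundDef A (proj₁ p₀) (proj₁ n₀)) _) (proj₂ c , λ α α∈ q q∈ →
         unle (h (α , A⊆ α α∈) α∈) (q , IsCut.sub (cut ((p₀ + c) + proj₂ (ι (α , A⊆ α α∈)))) q∈) q∈))

  -- Given x₀ ∈ A, the supremum of A is x₀ + c, where c ≥ 0 is the least cut such that x₀ + c bounds A from above.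
  complete : ∀ A → (∀ x → x ∈ A → x ∈ Lineˢ) → ∃ (λ x → x ∈ A) →
             ∃ (λ b → ∀ (x : Line) → proj₁ x ∈ A → x ≼ b) →
             ∃ λ s → (∀ (x : Line) → proj₁ x ∈ A → x ≼ s) × (∀ b → (∀ (x : Line) → proj₁ x ∈ A → x ≼ b) → s ≼ b)
  complete A A⊆ (z₀ , z₀∈) (b₀ , b₀-ub) =
      nf (p₀ + c , n₀) , (λ x x∈ → from (∈order _ _) (≤ₚ-resp ~.refl (~.sym (nf~ _)) (sup-ub x x∈))) ,
      λ b b-ub → from (∈order _ _) (≤ₚ-resp (~.sym (nf~ _)) ~.refl (sup-least b b-ub))
    where
    x₀ : Line
    x₀ = z₀ , A⊆ z₀ z₀∈
    p₀ n₀ : ℝ⁺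
    p₀ = proj₁ (ι x₀)
    n₀ = proj₂ (ι x₀)

    Bound : ℝ⁺ → Set ℓ
    Bound c = ∀ (x : Line) → proj₁ x ∈ A → ι x ≤ₚ (p₀ + c , n₀)

    I : V
    I = Bounds A p₀ n₀
    ∈I : ∀ c → proj₁ c ∈ I ⇔ Bound c
    ∈I = ∈Bounds A A⊆ p₀ n₀

    -- Every upper bound b is at least x₀ and so has the form x₀ + c with a cut c; the search for
    -- the least upper bound becomes a search among cuts.
    excess : ∀ b → (∀ (x : Line) → proj₁ x ∈ A → x ≼ b) → ∃ λ c → Bound c × (p₀ + c , n₀) ~ ι b
    excess b b-ub = c , (λ x x∈ → ≤ₚ-trans (to (∈order x b) (b-ub x x∈)) (≤ₚ-reflexive (~.sym c~))) , c~
      where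
      γ δ c : ℝ⁺
      γ = proj₁ (ι b)
      δ = proj₂ (ι b)
      c = (γ + n₀) ∸ (p₀ + δ)
      c~ : (p₀ + c , n₀) ~ ι b
      c~ = pair~ (solve 3 (λ p c d → (p :+ c) :+ d := c :+ (p :+ d)) rfl p₀ c δ ⟫
                  ∸-+ (γ + n₀) (p₀ + δ) (unle (to (∈order x₀ b) (b-ub x₀ z₀∈))))

    inf : ∃ λ (c : ℝ⁺) → (∀ (U : ℝ⁺) → proj₁ U ∈ I → c ⊑ U) × (∀ L → (∀ (U : ℝ⁺) → proj₁ U ∈ I → L ⊑ U) → L ⊑ c)
    inf = infimum I (Bounds-⊆ A p₀ n₀)
            (excess b₀ b₀-ub |>′ λ (c , h , _) → proj₁ c , from (∈I c) h)
    c : ℝ⁺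
    c = proj₁ inf

    -- If x exceeds x₀, then x - x₀ lies below every member of `I`, hence below their infimum c;
    -- otherwise c ≥ 0 suffices.
    sup-ub : Bound c
    sup-ub x x∈ = le ([ below , above ]′ (⊑-total (α + n₀) (p₀ + β)))
      where
      α β L : ℝ⁺
      α = proj₁ (ι x)
      β = proj₂ (ι x)
      L = (α + n₀) ∸ (p₀ + β)
      below : α + n₀ ⊑ p₀ + β → α + n₀ ⊑ (p₀ + c) + β
      below h = ⊑-resp (+-identityˡ (α + n₀)) (solve 3 (λ c p b → c :+ (p :+ b) := (p :+ c) :+ b) rfl c p₀ β)
                  (+-mono {0ᶜ} {c} {α + n₀} {p₀ + β} (0⊑ c) h)
      above : p₀ + β ⊑ α + n₀ → α + n₀ ⊑ (p₀ + c) + β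
      above h = ⊑-resp (∸-+ (α + n₀) (p₀ + β) h) (solve 3 (λ c p b → c :+ (p :+ b) := (p :+ c) :+ b) rfl c p₀ β)
                  (+-mono {L} {c} {p₀ + β} {p₀ + β} (proj₂ (proj₂ inf) L λ U U∈ → +-cancel-⊑ L U (p₀ + β)
                     (⊑-resp (flip (∸-+ (α + n₀) (p₀ + β) h)) (solve 3 (λ c p b → (p :+ c) :+ b := c :+ (p :+ b)) rfl U p₀ β)
                        (unle (to (∈I U) U∈ x x∈)))) (⊑-refl {p₀ + β}))

    sup-least : ∀ b → (∀ (x : Line) → proj₁ x ∈ A → x ≼ b) → (p₀ + c , n₀) ≤ₚ ι b
    sup-least b b-ub = excess b b-ub |>′ λ (e , h , e~) → ≤ₚ-trans
      (le (+-mono {p₀ + c} {p₀ + e} {n₀} {n₀} (+-mono {p₀} {p₀} {c} {e} (⊑-refl {p₀}) (proj₁ (proj₂ inf) e (from (∈I e) h))) (⊑-refl {n₀})))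
      (≤ₚ-reflexive e~)

  reals : RealNumbers
  reals = record
    { carrier = Lineˢ ; addition = addition ; multiplication = multiplication ; order = order
    ; 0# = 0ᴿ ; 1# = 1ᴿ ; -_ = ⊖_
    ; isCommutativeRing = isCommutativeRing ; 0≉1 = 0≉1 ; invertible = invertible ; isTotalOrder = isTotalOrder
    ; +-monoˡ-≤ = +-monoˡ-≼ ; *-nonNegative = *-nonNegative ; complete = complete }

-- Arithmetic and definability over an arbitrary complete ordered field.

module OrderedField {ℓ : Level} (em : ExcludedMiddle ℓ) (M : ZFModel ℓ) (𝓡 : Internal.RealNumbers M) where

  open import Algebra.Bundles using (CommutativeRing)
  import Algebra.Properties.Ring as RingProperties
  open import Data.Fin using (zero; #_)
  open import Data.Vec.Base using (Vec; []; _∷_; lookup; tail)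
  open import Data.List.Base using ([]; _∷_)
  open import Data.Product.Base using (∃; _×_; _,_; proj₁; proj₂)
  open import Data.Sum.Base as Sum using (_⊎_; inj₁; inj₂; [_,_]′)
  open import Data.Unit.Polymorphic.Base using (tt)
  open import Function.Bundles using (mk⇔)
  open import Relation.Binary.PropositionalEquality using (_≡_; refl; sym; trans; subst)
  open import Relation.Binary.Structures using (IsTotalOrder; IsEquivalence)
  open import Relation.Nullary using (yes; no; contradiction)
  open LinearInequalities
  open ConeGeometry
  open DefinablePredicates em M
  open Sets em M
  open Internal M using (set; El; Map; _⊠_; apply₂) renaming (_≈_ to _≈′_)
  open Internal.RealNumbers 𝓡 public
    using (carrier; ℝ; addition; order; 0#; 1#; -_; _+_; _*_; UpperBound; isCommutativeRing; 0≉1; invertible; isTotalOrder;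
           *-nonNegative; complete; ∣_∣; IsInfimum; Interval)
    renaming (_≤_ to _≤′_; +-monoˡ-≤ to +-monoˡ-≤′)

  private
    ring : CommutativeRing ℓ ℓ
    ring = record { isCommutativeRing = isCommutativeRing }
    module R = CommutativeRing ring
    module RP = RingProperties R.ring

  -- The relations of the real field, wrapped in records so that their arguments can be inferred.
  infix 4 _≈_ _≤_
  record _≈_ (x y : ℝ) : Set ℓ where
    constructor eq
    field uneq : x ≈′ y
  open _≈_ public

  record _≤_ (x y : ℝ) : Set ℓ where
    constructor le
    field unle : x ≤′ y
  open _≤_ public

  group : OrderedAbelianGroup ℓ ℓ
  group = record
    { Carrier = ℝ ; _≈_ = _≈_ ; _≤_ = _≤_ ; _+_ = _+_ ; -_ = -_ ; 0# = 0#
    ; isAbelianGroup = record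
      { isGroup = record
        { isMonoid = record
          { isSemigroup = record
            { isMagma = record { isEquivalence = isEquivalence ; ∙-cong = λ (eq p) (eq q) → eq (R.+-cong p q) }
            ; assoc = λ x y z → eq (R.+-assoc x y z) }
          ; identity = (λ x → eq (R.+-identityˡ x)) , (λ x → eq (R.+-identityʳ x)) }
        ; inverse = (λ x → eq (R.-‿inverseˡ x)) , (λ x → eq (R.-‿inverseʳ x))
        ; ⁻¹-cong = λ (eq p) → eq (R.-‿cong p) }
      ; comm = λ x y → eq (R.+-comm x y) }
    ; isTotalOrder = record
      { isPartialOrder = record
        { isPreorder = record
          { isEquivalence = isEquivalence
          ; reflexive = λ {x} {y} (eq p) → le (T.reflexive {x} {y} p)
          ; trans = λ {x} {y} {z} (le p) (le q) → le (T.trans {x} {y} {z} p q) }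
        ; antisym = λ {x} {y} (le p) (le q) → eq (T.antisym {x} {y} p q) }
      ; total = λ x y → Sum.map le le (T.total x y) }
    ; +-monoˡ-≤ = λ x y z (le p) → le (+-monoˡ-≤′ x y z p)
    ; _≤?_ = λ x y → em }
    where
    module T = IsTotalOrder isTotalOrder
    isEquivalence : IsEquivalence _≈_
    isEquivalence = record { refl = eq refl ; sym = λ (eq p) → eq (sym p) ; trans = λ (eq p) (eq q) → eq (trans p q) }

  opaque
    -- Otherwise -1 would be nonnegative, and 1 is its square.
    0≤1 : 0# ≤ 1#
    0≤1 = [ le , (λ h → le (IsTotalOrder.trans isTotalOrder {0#} { - 1# * - 1#} {1#} (*-nonNegative (- 1#) (- 1#) (neg h) (neg h)) (IsTotalOrder.reflexive isTotalOrder { - 1# * - 1#} {1#} square))) ]′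
            (IsTotalOrder.total isTotalOrder 0# 1#)
      where
      open LinearArithmetic group
      neg : 1# ≤′ 0# → 0# ≤′ - 1#
      neg h = unle (linarith (1# ∷ []) (λ o → (o :≤ :0) ∷ [] ⊢ :0 :≤ :- o) (le h , tt))
      square : - 1# * - 1# ≈′ 1#
      square = R.trans { - 1# * - 1#} { - (- 1#)} {1#} (RP.-1*x≈-x (- 1#)) (RP.-‿involutive 1#)

  open LinearArithmetic group public hiding (_<_; ⟦_⟧)
  open BipartiteCone group 1# 0≤1 {V} (λ _ _ → em) public
    using (module Eq; total; pick; gap; Raw; raw; Ok; ok; α; β; D; δ; antisym; ≤-refl; ≤-trans; ≤-reflexive; <⇒≤;
           add-mono; gap-spec; gap-≤; gap-≥ˡ; gap-≥ʳ; gap-sym; gap-nonNeg; gap-triangle; eq?; δ-direct; δ-base; δ-spec;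
           δ-apart; δ≥gap; δ-nonNeg; δ-self; δ-sym; δ-triangle; τ≤δ; δ≤τ+2; δ-four; move-u; move-h; D≥gap; D≥α; D≥β;
           D-same; τ-eq; τ-neq; α-neq; β-neq; module Chains)

  opaque
    *-monoʳ-≤ : ∀ {c a b} → 0# ≤ c → a ≤ b → c * a ≤ c * b
    *-monoʳ-≤ {c} {a} {b} (le p) h = linarith (c * a ∷ c * b ∷ c * (b + - a) ∷ []) (λ x y z → (z :≈ y :- x) ∷ (:0 :≤ z) ∷ [] ⊢ x :≤ y)
      ( eq (R.trans {c * (b + - a)} {c * b + c * - a} {c * b + - (c * a)} (R.distribˡ c b (- a)) (R.+-congˡ {c * b} (R.sym { - (c * a)} {c * - a} (RP.-‿distribʳ-* c a))))
      , le (*-nonNegative c (b + - a) p (unle (linarith (a ∷ b ∷ []) (λ a b → (a :≤ b) ∷ [] ⊢ :0 :≤ b :- a) (h , tt)))) , tt)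

    *-distribˡ-+ : ∀ c a b → c * (a + b) ≈ c * a + c * b
    *-distribˡ-+ c a b = eq (R.distribˡ c a b)

    1+1-* : ∀ a → (1# + 1#) * a ≈ a + a
    1+1-* a = eq (R.trans {(1# + 1#) * a} {1# * a + 1# * a} {a + a} (R.distribʳ a 1# 1#) (R.+-cong {1# * a} {a} {1# * a} {a} (R.*-identityˡ a) (R.*-identityˡ a)))

    *-cancel-inverse : ∀ {c c⁻¹} → c * c⁻¹ ≈ 1# → ∀ a → c * (c⁻¹ * a) ≈ a
    *-cancel-inverse {c} {c⁻¹} (eq e) a = eq (R.trans {c * (c⁻¹ * a)} {(c * c⁻¹) * a} {a} (R.sym {(c * c⁻¹) * a} {c * (c⁻¹ * a)} (R.*-assoc c c⁻¹ a))
      (R.trans {(c * c⁻¹) * a} {1# * a} {a} (R.*-congʳ {a} {c * c⁻¹} {1#} e) (R.*-identityˡ a)))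

    *-oneʳ : ∀ a → a * 1# ≈ a
    *-oneʳ a = eq (R.*-identityʳ a)

  opaque
    abs-≈ : ∀ x y → ∣ x + - y ∣ ≈ gap x y
    abs-≈ x y = antisym
      ([ (λ (_ , e) → ≤-trans (≤-reflexive e) (gap-≥ˡ x y))
       , (λ (_ , e) → ≤-trans (≤-reflexive e) (linarith (x ∷ y ∷ gap x y ∷ []) (λ x y g → (y :- x :≤ g) ∷ [] ⊢ :- (x :- y) :≤ g) (gap-≥ʳ x y , tt))) ]′ (spec (x + - y)))
      ([ (λ (p , e) → gap-≤ (≤-reflexive (Eq.sym e)) (linarith (x ∷ y ∷ ∣ x + - y ∣ ∷ []) (λ x y g → (:0 :≤ x :- y) ∷ (g :≈ x :- y) ∷ [] ⊢ y :- x :≤ g) (p , e , tt)))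
       , (λ (p , e) → gap-≤ (linarith (x ∷ y ∷ ∣ x + - y ∣ ∷ []) (λ x y g → (x :- y :≤ :0) ∷ (g :≈ :- (x :- y)) ∷ [] ⊢ x :- y :≤ g) (p , e , tt))
                            (linarith (x ∷ y ∷ ∣ x + - y ∣ ∷ []) (λ x y g → (g :≈ :- (x :- y)) ∷ [] ⊢ y :- x :≤ g) (e , tt))) ]′ (spec (x + - y)))
      where
      spec : ∀ z → (0# ≤ z × ∣ z ∣ ≈ z) ⊎ (z ≤ 0# × ∣ z ∣ ≈ - z)
      spec z with IsTotalOrder.total isTotalOrder 0# z
      ... | inj₁ h = inj₁ (le h , eq refl)
      ... | inj₂ h = inj₂ (le h , eq refl)


  -- Total extension of the coercion from elements of the carrier, with junk value 0.
  opaque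
    toR : V → ℝ
    toR x with em {x ∈ carrier}
    ... | yes p = x , p
    ... | no  _ = 0#

    toR-∈ : ∀ {x} → x ∈ carrier → proj₁ (toR x) ≡ x
    toR-∈ {x} x∈ with em {x ∈ carrier}
    ... | yes _ = refl
    ... | no  n = contradiction x∈ n

    toR-ℝ : ∀ (x : ℝ) → toR (proj₁ x) ≈ x
    toR-ℝ x = eq (toR-∈ (proj₂ x))

  record DefR {n} (F : Vec V n → ℝ) : Set ℓ where
    constructor real
    field termᵈ : DefT (λ v → proj₁ (F v))
  open DefR public

  opaque
    unfolding toR gap

    DefT-resp : ∀ {n} {F G : Vec V n → V} → (∀ v → F v ≡ G v) → DefT F → DefT G
    DefT-resp e (term d) = term (iffᵈ (λ v → mk⇔ (λ p → trans p (e (tail v))) (λ p → trans p (sym (e (tail v))))) d)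

    cstR : ∀ {n} r → DefR {n} (λ _ → r)
    cstR r = real (cst (proj₁ r))

    toRᵈ : ∀ {n} {F : Vec V n → V} → DefT F → DefR (λ v → toR (F v))
    toRᵈ {F = F} t = real (DefT-resp e (iteᵈ (t ∈ᵈ cst carrier) t (cst (proj₁ 0#))))
      where
      e : ∀ v → ⟪ em {F v ∈ carrier} ⟫ (F v) (proj₁ 0#) ≡ proj₁ (toR (F v))
      e v with em {F v ∈ carrier}
      ... | yes _ = refl
      ... | no  _ = refl

    infixl 6 _+ᵈ_ _-ᵈ_
    _+ᵈ_ : ∀ {n} {F G : Vec V n → ℝ} → DefR F → DefR G → DefR (λ v → F v + G v)
    real t +ᵈ real u = real (DefT-resp (λ v → MapProperties.apply-‵ addition _) (‵ᵈ (cst (Map.graph addition)) (pairᵈ t u)))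

    neg-unique : ∀ x y → x + y ≈ 0# → y ≈ - x
    neg-unique x y e = linarith (x ∷ y ∷ []) (λ x y → (x :+ y :≈ :0) ∷ [] ⊢ y :≈ :- x) (e , tt)

    -- Negation is an operation of Agda and not a set of the model, so it is defined inside as the
    -- unique y with x + y = 0.
    negᵈ : ∀ {n} {F : Vec V n → ℝ} → DefR F → DefR (λ v → - F v)
    negᵈ {F = F} (real t) = real (term (iffᵈ (λ v → mk⇔ (f v) (g v))
        ((var (# 0) ∈ᵈ cst carrier) ×ᵈ (‵ᵈ (cst (Map.graph addition)) (pairᵈ (wkT t) (var (# 0))) ≡ᵈ cst (proj₁ 0#)))))
      where
      value : ∀ x y → Map.graph addition ‵ ⟨ proj₁ x , proj₁ y ⟩ ≡ proj₁ (x + y)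
      value x y = MapProperties.apply-‵ addition _
      f : ∀ v → lookup v zero ∈ carrier × Map.graph addition ‵ ⟨ proj₁ (F (tail v)) , lookup v zero ⟩ ≡ proj₁ 0# →
          lookup v zero ≡ proj₁ (- F (tail v))
      f v (m , e) = uneq (neg-unique (F (tail v)) (lookup v zero , m) (eq (trans (sym (value (F (tail v)) (lookup v zero , m))) e)))
      g : ∀ v → lookup v zero ≡ proj₁ (- F (tail v)) →
          lookup v zero ∈ carrier × Map.graph addition ‵ ⟨ proj₁ (F (tail v)) , lookup v zero ⟩ ≡ proj₁ 0#
      g v e = subst (λ z → z ∈ carrier × Map.graph addition ‵ ⟨ proj₁ (F (tail v)) , z ⟩ ≡ proj₁ 0#) (sym e)
        (proj₂ (- F (tail v)) , trans (value (F (tail v)) (- F (tail v))) (R.-‿inverseʳ (F (tail v))))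

    _-ᵈ_ : ∀ {n} {F G : Vec V n → ℝ} → DefR F → DefR G → DefR (λ v → F v + - G v)
    t -ᵈ u = t +ᵈ negᵈ u

    pickᵈ : ∀ {n} {P : Vec V n → Set ℓ} {F G : Vec V n → ℝ} → Def P → DefR F → DefR G → DefR (λ v → pick (em {P v}) (F v) (G v))
    pickᵈ {P = P} {F} {G} p (real t) (real u) = real (DefT-resp e (iteᵈ p t u))
      where
      e : ∀ v → ⟪ em {P v} ⟫ (proj₁ (F v)) (proj₁ (G v)) ≡ proj₁ (pick (em {P v}) (F v) (G v))
      e v with em {P v}
      ... | yes _ = refl
      ... | no  _ = refl

    infix 8 _≤ᵈ_
    _≤ᵈ_ : ∀ {n} {F G : Vec V n → ℝ} → DefR F → DefR G → Def (λ v → F v ≤ G v)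
    real t ≤ᵈ real u = iffᵈ (λ v → mk⇔ le unle) (pairᵈ t u ∈ᵈ cst order)

    gapᵈ : ∀ {n} {F G : Vec V n → ℝ} → DefR F → DefR G → DefR (λ v → gap (F v) (G v))
    gapᵈ t u = pickᵈ (t ≤ᵈ u) (u -ᵈ t) (t -ᵈ u)


  opaque
    -- Obtained as the supremum of the lower bounds; completeness applies because a formula
    -- separates them as a set.
    infimum : ∀ {P : Vec V 1 → Set ℓ} → Def P → (b : ℝ) → (∀ (x : ℝ) → P (proj₁ x ∷ []) → b ≤ x) →
              (∃ λ (x : ℝ) → P (proj₁ x ∷ [])) → ∃ λ r → IsInfimum (λ x → P (proj₁ x ∷ [])) r
    infimum {P} p b b-lower (x₀ , px₀) = proj₁ sup , (λ x px → proj₂ (proj₂ sup) x λ y y∈ → proj₂ (to (∈comp lower _) y∈) x px) ,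
        λ c c-lower → proj₁ (proj₂ sup) c (from (∈comp lower _) (proj₂ c , λ x → c-lower x))
      where
      lower : Def {1} (λ v → ∀ (x : ℝ) → P (proj₁ x ∷ []) → ⟨ lookup v (# 0) , proj₁ x ⟩ ∈ order)
      lower = iffᵈ (λ v → mk⇔ (λ h x → h (proj₁ x) (proj₂ x)) (λ h x x∈ → h (x , x∈)))
        (∀∈ (cst carrier) (def₁ {P = P} p (var (# 0)) →ᵈ (pairᵈ (var (# 1)) (var (# 0)) ∈ᵈ cst order)))
      sup : ∃ λ s → UpperBound (comp lower carrier []) s × (∀ b → UpperBound (comp lower carrier []) b → s ≤′ b)
      sup = complete (comp lower carrier []) (λ x x∈ → proj₁ (to (∈comp lower _) x∈))
        (proj₁ b , from (∈comp lower _) (proj₂ b , λ x px → unle (b-lower x px)))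
        (x₀ , λ y y∈ → proj₂ (to (∈comp lower _) y∈) x₀ px₀)

-- Quotient metrics, geodesic segments, neighbourhoods and thin triangles.

module MetricSpaces {ℓ : Level} (em : ExcludedMiddle ℓ) (M : ZFModel ℓ) (𝓡 : Internal.RealNumbers M) where

  open import Data.Fin using (#_)
  open import Data.Vec.Base using (Vec; []; _∷_; lookup)
  open import Data.List.Base using ([]; _∷_)
  open import Data.Product.Base using (∃; _×_; _,_; proj₁; proj₂)
  open import Data.Sum.Base as Sum using (_⊎_; inj₁; inj₂; [_,_]′)
  open import Data.Unit.Polymorphic.Base using (tt)
  open import Function.Base using (id; _|>′_)
  open import Function.Bundles using (_⇔_; mk⇔)
  open import Function.Metric.Structures using (IsGeneralMetric)
  open import Relation.Binary.PropositionalEquality using (_≡_; refl; sym; trans; cong; cong₂; subst; subst₂)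
  open import Relation.Binary.Structures using (IsTotalOrder)
  open import Relation.Nullary using (¬_; yes; no; contradiction)
  open import Relation.Nullary.Decidable using (decidable-stable)
  open import Relation.Unary using (Pred; _∪_)
  open DefinablePredicates em M
  open Sets em M
  open OrderedField em M 𝓡
  open Internal M using (set; El; Map; _⊠_; apply₂; Image; module Geometry) renaming (_≈_ to _≈′_)
  open Geometry 𝓡 public

  1≰0 : ¬ 1# ≤ 0#
  1≰0 h = 0≉1 (uneq (antisym 0≤1 h))

  -- In the application `dist` is a pseudometric, as the apex and the vertices of the graphs have
  -- many codes. Points are classes of codes at distance zero, so no set depends on a selection of
  -- representatives.
  module Quotient (P : V) (dist : V → V → ℝ) (distDef : DefR (λ (v : Vec V 2) → dist (lookup v (# 0)) (lookup v (# 1))))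
    (dist-self : ∀ {p} → p ∈ P → dist p p ≈ 0#)
    (dist-nonNeg : ∀ {p q} → p ∈ P → q ∈ P → 0# ≤ dist p q)
    (dist-sym : ∀ {p q} → p ∈ P → q ∈ P → dist p q ≤ dist q p)
    (dist-triangle : ∀ {p q r} → p ∈ P → q ∈ P → r ∈ P → dist p r ≤ dist p q + dist q r) where

    opaque
      distᵈ : ∀ {n} {F G : Vec V n → V} → DefT F → DefT G → DefR (λ v → dist (F v) (G v))
      distᵈ t u = real (app₂ {f = λ a b → proj₁ (dist a b)} (termᵈ distDef) t u)

    private
      clsDef : Def {2} (λ v → dist (lookup v (# 1)) (lookup v (# 0)) ≤ 0#)
      clsDef = distᵈ (var (# 1)) (var (# 0)) ≤ᵈ cstR 0#

    opaque
      cls : V → V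
      cls p = comp clsDef P (p ∷ [])

      clsᵈ : ∀ {n} {F : Vec V n → V} → DefT F → DefT (λ v → cls (F v))
      clsᵈ t = comp₁ᵈ clsDef (cst P) t

      ∈cls : ∀ {p} q → q ∈ cls p ⇔ (q ∈ P × dist p q ≤ 0#)
      ∈cls q = ∈comp clsDef q

    private
      pointsDef : Def {1} (λ v → ∃ λ p → p ∈ P × lookup v (# 0) ≡ cls p)
      pointsDef = ∃∈ (cst P) (var (# 1) ≡ᵈ clsᵈ (var (# 0)))

      dDef : Def {3} (λ v → ∃ λ p → p ∈ lookup v (# 1) × ∃ λ q → q ∈ lookup v (# 2) × lookup v (# 0) ≡ proj₁ (dist p q))
      dDef = ∃∈ (var (# 1)) (∃∈ (var (# 3)) (var (# 2) ≡ᵈ termᵈ (distᵈ (var (# 1)) (var (# 0)))))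

    opaque
      pointSet : V
      pointSet = comp pointsDef (𝒫 P) []

      representative : ∀ {c} → c ∈ pointSet → ∃ λ p → p ∈ P × c ≡ cls p
      representative c∈ = proj₂ (to (∈comp pointsDef _) c∈)

      cls-∈ : ∀ {p} → p ∈ P → cls p ∈ pointSet
      cls-∈ {p} p∈ = from (∈comp pointsDef _) (from (∈𝒫 _) (λ q q∈ → proj₁ (to (∈cls q) q∈)) , p , p∈ , refl)

      -- All pairs of members of two classes have the same distance, so it is recovered by
      -- description.
      dval : V → V → V
      dval c c′ = ⋃ (comp dDef carrier (c ∷ c′ ∷ []))

      dvalᵈ : ∀ {n} {F G : Vec V n → V} → DefT F → DefT G → DefT (λ v → dval (F v) (G v))
      dvalᵈ t u = ⋃ᵈ (comp₂ᵈ dDef (cst carrier) t u)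

      dist-cong : ∀ {p p′ q q′} → p ∈ P → p′ ∈ P → q ∈ P → q′ ∈ P → dist p p′ ≤ 0# → dist q q′ ≤ 0# → dist p q ≈ dist p′ q′
      dist-cong {p} {p′} {q} {q′} p∈ p′∈ q∈ q′∈ h k = antisym
        (linarith (dist p q ∷ dist p p′ ∷ dist p′ q ∷ dist p′ q′ ∷ dist q′ q ∷ dist q q′ ∷ [])
          (λ a b c d e f → (a :≤ b :+ c) ∷ (c :≤ d :+ e) ∷ (e :≤ f) ∷ (b :≤ :0) ∷ (f :≤ :0) ∷ [] ⊢ a :≤ d)
          (dist-triangle p∈ p′∈ q∈ , dist-triangle p′∈ q′∈ q∈ , dist-sym q′∈ q∈ , h , k , tt))
        (linarith (dist p′ q′ ∷ dist p′ p ∷ dist p q′ ∷ dist p q ∷ dist q q′ ∷ dist p p′ ∷ [])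
          (λ a b c d e f → (a :≤ b :+ c) ∷ (c :≤ d :+ e) ∷ (b :≤ f) ∷ (f :≤ :0) ∷ (e :≤ :0) ∷ [] ⊢ a :≤ d)
          (dist-triangle p′∈ p∈ q′∈ , dist-triangle p∈ q∈ q′∈ , dist-sym p′∈ p∈ , h , k , tt))

      dval-cls : ∀ {p q} → p ∈ P → q ∈ P → dval (cls p) (cls q) ≡ proj₁ (dist p q)
      dval-cls {p} {q} p∈ q∈ = ⋃-single λ z → mk⇔
        (λ z∈ → proj₂ (to (∈comp dDef z) z∈) |>′ λ (p′ , p′∈ , q′ , q′∈ , e) → trans e
           (sym (uneq (dist-cong p∈ (proj₁ (to (∈cls p′) p′∈)) q∈ (proj₁ (to (∈cls q′) q′∈)) (proj₂ (to (∈cls p′) p′∈)) (proj₂ (to (∈cls q′) q′∈))))))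
        (λ e → from (∈comp dDef z) (subst (_∈ carrier) (sym e) (proj₂ (dist p q)) ,
           p , from (∈cls p) (p∈ , ≤-reflexive (dist-self p∈)) , q , from (∈cls q) (q∈ , ≤-reflexive (dist-self q∈)) , e))

      dval-∈ : ∀ {c c′} → c ∈ pointSet → c′ ∈ pointSet → dval c c′ ∈ carrier
      dval-∈ {c} {c′} c∈ c′∈ = representative c∈ |>′ λ (p , p∈ , e) → representative c′∈ |>′ λ (q , q∈ , f) →
        subst (_∈ carrier) (trans (sym (dval-cls p∈ q∈)) (sym (cong₂ dval e f))) (proj₂ (dist p q))

    private
      distance : Map (pointSet ⊠ pointSet) (set carrier)
      distance = lamMap (λ w → dval (fst w) (snd w)) (dvalᵈ (fstᵈ (var (# 0))) (sndᵈ (var (# 0)))) (pointSet ×ˢ pointSet) carrier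
        (λ { (x , y , x∈ , y∈ , refl) → pair∈× x∈ y∈ })
        (λ p∈ → to (∈× _) p∈ |>′ λ (x , x∈ , y , y∈ , e) → x , y , x∈ , y∈ , e)
        id
        (λ { (x , y , x∈ , y∈ , refl) → subst₂ (λ a b → dval a b ∈ carrier) (sym (fst-β x y)) (sym (snd-β x y)) (dval-∈ x∈ y∈) })

      d₀ : El (set pointSet) → El (set pointSet) → ℝ
      d₀ = apply₂ distance

    opaque
      d₀-rep : ∀ x y {p q} → p ∈ P → q ∈ P → proj₁ x ≡ cls p → proj₁ y ≡ cls q → d₀ x y ≈ dist p q
      d₀-rep x y p∈ q∈ e f = eq (trans (cong₂ dval (trans (fst-β _ _) e) (trans (snd-β _ _) f)) (dval-cls p∈ q∈))

      cls-≡ : ∀ {p q} → p ∈ P → q ∈ P → dist p q ≤ 0# → cls p ≡ cls q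
      cls-≡ {p} {q} p∈ q∈ h = ext
        (λ z z∈ → to (∈cls z) z∈ |>′ λ (z∈P , k) → from (∈cls z) (z∈P ,
           ≤-trans (≤-reflexive (Eq.sym (dist-cong p∈ q∈ z∈P z∈P h (≤-reflexive (dist-self z∈P))))) k))
        (λ z z∈ → to (∈cls z) z∈ |>′ λ (z∈P , k) → from (∈cls z) (z∈P ,
           ≤-trans (≤-reflexive (dist-cong p∈ q∈ z∈P z∈P h (≤-reflexive (dist-self z∈P)))) k))

    space : MetricSpace
    space = record
      { points = pointSet
      ; distance = distance
      ; isMetric = isMetric }
      where
      opaque
        rep : (x : El (set pointSet)) → ∃ λ p → p ∈ P × proj₁ x ≡ cls p
        rep x = representative (proj₂ x)

        isMetric : IsGeneralMetric (_≈′_ {set pointSet}) (_≈′_ {set carrier}) _≤′_ 0# _+_ d₀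
        isMetric = record
          { isSemiMetric = record
            { isQuasiSemiMetric = record
              { isPreMetric = record
                { isProtoMetric = record
                  { isPartialOrder = IsTotalOrder.isPartialOrder isTotalOrder
                  ; ≈-isEquivalence = record { refl = refl ; sym = sym ; trans = trans }
                  ; cong = λ {x} {y} {u} {v} e f → rep x |>′ λ (p , p∈ , a) → rep u |>′ λ (q , q∈ , b) →
                      uneq (Eq.trans (d₀-rep x u p∈ q∈ a b) (Eq.sym (d₀-rep y v p∈ q∈ (trans (sym e) a) (trans (sym f) b))))
                  ; nonNegative = λ {x} {y} → rep x |>′ λ (p , p∈ , a) → rep y |>′ λ (q , q∈ , b) →
                      unle (≤-trans (dist-nonNeg p∈ q∈) (≤-reflexive (Eq.sym (d₀-rep x y p∈ q∈ a b)))) }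
                ; ≈⇒0 = λ {x} {y} e → rep x |>′ λ (p , p∈ , a) →
                      uneq (Eq.trans (d₀-rep x y p∈ p∈ a (trans (sym e) a)) (dist-self p∈)) }
              ; 0⇒≈ = λ {x} {y} e → rep x |>′ λ (p , p∈ , a) → rep y |>′ λ (q , q∈ , b) →
                      trans a (trans (cls-≡ p∈ q∈ (≤-trans (≤-reflexive (Eq.sym (d₀-rep x y p∈ q∈ a b))) (≤-reflexive (eq e)))) (sym b)) }
            ; sym = λ x y → rep x |>′ λ (p , p∈ , a) → rep y |>′ λ (q , q∈ , b) →
                      uneq (Eq.trans (d₀-rep x y p∈ q∈ a b) (Eq.trans (antisym (dist-sym p∈ q∈) (dist-sym q∈ p∈)) (Eq.sym (d₀-rep y x q∈ p∈ b a)))) }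
          ; triangle = λ x y z → rep x |>′ λ (p , p∈ , a) → rep y |>′ λ (q , q∈ , b) → rep z |>′ λ (r , r∈ , c) →
                      unle (linarith (d₀ x z ∷ d₀ x y ∷ d₀ y z ∷ dist p r ∷ dist p q ∷ dist q r ∷ [])
                        (λ a b c a′ b′ c′ → (a :≈ a′) ∷ (b :≈ b′) ∷ (c :≈ c′) ∷ (a′ :≤ b′ :+ c′) ∷ [] ⊢ a :≤ b :+ c)
                        (d₀-rep x z p∈ r∈ a c , d₀-rep x y p∈ q∈ a b , d₀-rep y z q∈ r∈ b c , dist-triangle p∈ q∈ r∈ , tt)) }

    open MetricSpace space using (Point; d)

    point : ∀ {p} → p ∈ P → Point
    point {p} p∈ = cls p , cls-∈ p∈

    opaque
      d-rep : ∀ (x y : Point) {p q} → p ∈ P → q ∈ P → proj₁ x ≡ cls p → proj₁ y ≡ cls q → d x y ≈ dist p q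
      d-rep = d₀-rep

  module MetricProperties (S : MetricSpace) where
    open MetricSpace S
    private module I = IsGeneralMetric isMetric

    opaque
      d-cong : ∀ {x y u v : Point} → x ≈′ y → u ≈′ v → d x u ≈ d y v
      d-cong {x} {y} {u} {v} e f = eq (I.cong {x} {y} {u} {v} e f)
      d-nonNeg : ∀ {x y} → 0# ≤ d x y
      d-nonNeg {x} {y} = le (I.nonNegative {x} {y})
      d-zero : ∀ {x y} → x ≈′ y → d x y ≈ 0#
      d-zero {x} {y} e = eq (I.≈⇒0 {x} {y} e)
      d-sym : ∀ x y → d x y ≈ d y x
      d-sym x y = eq (I.sym x y)
      d-triangle : ∀ x y z → d x z ≤ d x y + d y z
      d-triangle x y z = le (I.triangle x y z)

    -- Curves are terms on all of `V`, meaningful only for real arguments in [0 , L], so that pieces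
    -- can be joined by a definable case distinction. Lipschitz constant 1 is all that is recorded;
    -- isometry follows when L is the distance of the ends.
    record Path (x y : Point) (L : ℝ) : Set ℓ where
      field
        f      : V → V
        fᵈ     : DefT {1} (λ v → f (head v))
        0≤L    : 0# ≤ L
        closed : ∀ t → 0# ≤ t → t ≤ L → f (proj₁ t) ∈ points
        lipschitz : ∀ s t (p : f (proj₁ s) ∈ points) (q : f (proj₁ t) ∈ points) → 0# ≤ s → s ≤ L → 0# ≤ t → t ≤ L →
                    d (_ , p) (_ , q) ≤ gap s t
        start  : f (proj₁ 0#) ≡ proj₁ x
        end    : f (proj₁ L) ≡ proj₁ y

    retarget : ∀ {x y L L′} → L ≈ L′ → Path x y L → Path x y L′
    retarget {L = L} {L′} (eq e) γ = record
      { f = f ; fᵈ = fᵈ ; 0≤L = ≤-trans 0≤L (≤-reflexive (eq e))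
      ; closed = λ t a b → closed t a (≤-trans b L′≤L)
      ; lipschitz = λ s t p q a b a′ b′ → lipschitz s t p q a (≤-trans b L′≤L) a′ (≤-trans b′ L′≤L)
      ; start = start ; end = trans (cong f (sym e)) end }
      where
      open Path γ
      L′≤L : L′ ≤ L
      L′≤L = ≤-reflexive (eq (sym e))

    constant : ∀ {x y : Point} → x ≈′ y → Path x y 0#
    constant {x} {y} e = record
      { f = λ _ → proj₁ x ; fᵈ = cst (proj₁ x) ; 0≤L = ≤-refl ; closed = λ _ _ _ → proj₂ x
      ; lipschitz = λ s t p q _ _ _ _ → ≤-trans (≤-reflexive (d-zero refl)) (gap-nonNeg s t)
      ; start = refl ; end = e }

    opaque
      concat : ∀ {x y z L L′} → Path x y L → Path y z L′ → Path x z (L + L′)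
      concat {x} {y} {z} {L} {L′} γ γ′ = record
        { f = f ; fᵈ = iteᵈ (toRᵈ (var (# 0)) ≤ᵈ cstR L) (app₁ {f = γ.f} γ.fᵈ (var (# 0))) (app₁ {f = γ′.f} γ′.fᵈ (termᵈ (toRᵈ (var (# 0)) -ᵈ cstR L)))
        ; 0≤L = linarith (L ∷ L′ ∷ []) (λ a b → (:0 :≤ a) ∷ (:0 :≤ b) ∷ [] ⊢ :0 :≤ a :+ b) (γ.0≤L , γ′.0≤L , tt)
        ; closed = closed
        ; lipschitz = lipschitz
        ; start = trans (left 0# γ.0≤L) γ.start
        ; end = end }
        where
        module γ = Path γ
        module γ′ = Path γ′
        f : V → V
        f t = ⟪ em {toR t ≤ L} ⟫ (γ.f t) (γ′.f (proj₁ (toR t + - L)))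

        left : ∀ (t : ℝ) → t ≤ L → f (proj₁ t) ≡ γ.f (proj₁ t)
        left t h with em {toR (proj₁ t) ≤ L}
        ... | yes _ = refl
        ... | no  n = contradiction (≤-trans (≤-reflexive (toR-ℝ t)) h) n

        shift : ∀ (t : ℝ) → toR (proj₁ t) + - L ≈ t + - L
        shift t = linarith (toR (proj₁ t) ∷ t ∷ L ∷ []) (λ a b c → (a :≈ b) ∷ [] ⊢ a :- c :≈ b :- c) (toR-ℝ t , tt)

        middle : γ.f (proj₁ L) ≡ γ′.f (proj₁ 0#)
        middle = trans γ.end (sym γ′.start)

        right : ∀ (t : ℝ) → L ≤ t → f (proj₁ t) ≡ γ′.f (proj₁ (t + - L))
        right t h with em {toR (proj₁ t) ≤ L}
        ... | no  _ = cong γ′.f (uneq (shift t))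
        ... | yes k = trans (cong γ.f (uneq t≈L)) (trans middle (cong γ′.f (uneq (linarith (t ∷ L ∷ []) (λ t l → (t :≈ l) ∷ [] ⊢ :0 :≈ t :- l) (t≈L , tt)))))
          where
          t≈L : t ≈ L
          t≈L = antisym (≤-trans (≤-reflexive (Eq.sym (toR-ℝ t))) k) h

        end : f (proj₁ (L + L′)) ≡ proj₁ z
        end = trans (right (L + L′) (linarith (L ∷ L′ ∷ []) (λ a b → (:0 :≤ b) ∷ [] ⊢ a :≤ a :+ b) (γ′.0≤L , tt)))
          (trans (cong γ′.f (uneq (linarith (L ∷ L′ ∷ []) (λ a b → [] ⊢ a :+ b :- a :≈ b) tt))) γ′.end)

        shift-≥ : ∀ t → L ≤ t → 0# ≤ t + - L
        shift-≥ t h = linarith (t ∷ L ∷ []) (λ t l → (l :≤ t) ∷ [] ⊢ :0 :≤ t :- l) (h , tt)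
        shift-≤ : ∀ t → t ≤ L + L′ → t + - L ≤ L′
        shift-≤ t h = linarith (t ∷ L ∷ L′ ∷ []) (λ t l m → (t :≤ l :+ m) ∷ [] ⊢ t :- l :≤ m) (h , tt)

        closed : ∀ t → 0# ≤ t → t ≤ L + L′ → f (proj₁ t) ∈ points
        closed t a b = [ (λ h → subst (_∈ points) (sym (left t h)) (γ.closed t a h))
                       , (λ h → subst (_∈ points) (sym (right t h)) (γ′.closed (t + - L) (shift-≥ t h) (shift-≤ t b))) ]′ (total t L)

        lip-left : ∀ s t (p : f (proj₁ s) ∈ points) (q : f (proj₁ t) ∈ points) → 0# ≤ s → s ≤ L → 0# ≤ t → t ≤ L → d (_ , p) (_ , q) ≤ gap s t
        lip-left s t p q a b a′ b′ = ≤-trans (≤-reflexive (d-cong {_} {_ , γ.closed s a b} {_} {_ , γ.closed t a′ b′} (left s b) (left t b′)))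
          (γ.lipschitz s t _ _ a b a′ b′)

        lip-right : ∀ s t (p : f (proj₁ s) ∈ points) (q : f (proj₁ t) ∈ points) → L ≤ s → s ≤ L + L′ → L ≤ t → t ≤ L + L′ → d (_ , p) (_ , q) ≤ gap s t
        lip-right s t p q a b a′ b′ = ≤-trans (≤-reflexive (d-cong {_} {_ , cs} {_} {_ , ct} (right s a) (right t a′)))
          (≤-trans (γ′.lipschitz (s + - L) (t + - L) cs ct (shift-≥ s a) (shift-≤ s b) (shift-≥ t a′) (shift-≤ t b′))
            (gap-≤ (linarith (s ∷ t ∷ L ∷ gap s t ∷ []) (λ s t l g → (s :- t :≤ g) ∷ [] ⊢ (s :- l) :- (t :- l) :≤ g) (gap-≥ˡ s t , tt))
                   (linarith (s ∷ t ∷ L ∷ gap s t ∷ []) (λ s t l g → (t :- s :≤ g) ∷ [] ⊢ (t :- l) :- (s :- l) :≤ g) (gap-≥ʳ s t , tt))))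
          where
          cs : γ′.f (proj₁ (s + - L)) ∈ points
          cs = γ′.closed (s + - L) (shift-≥ s a) (shift-≤ s b)
          ct : γ′.f (proj₁ (t + - L)) ∈ points
          ct = γ′.closed (t + - L) (shift-≥ t a′) (shift-≤ t b′)

        L≤ : L ≤ L + L′
        L≤ = linarith (L ∷ L′ ∷ []) (λ a b → (:0 :≤ b) ∷ [] ⊢ a :≤ a :+ b) (γ′.0≤L , tt)
        mid : f (proj₁ L) ∈ points
        mid = closed L γ.0≤L L≤

        across : ∀ s t (p : f (proj₁ s) ∈ points) (q : f (proj₁ t) ∈ points) → 0# ≤ s → s ≤ L → L ≤ t → t ≤ L + L′ → d (_ , p) (_ , q) ≤ gap s t
        across s t p q a b a′ b′ = ≤-trans (d-triangle (_ , p) (_ , mid) (_ , q))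
          (≤-trans (add-mono (lip-left s L p mid a b γ.0≤L ≤-refl) (lip-right L t mid q ≤-refl L≤ a′ b′))
            (≤-trans (add-mono (gap-≤ {c = L + - s} (linarith (s ∷ L ∷ []) (λ s l → (s :≤ l) ∷ [] ⊢ s :- l :≤ l :- s) (b , tt)) ≤-refl)
                               (gap-≤ {c = t + - L} (linarith (L ∷ t ∷ []) (λ s l → (s :≤ l) ∷ [] ⊢ s :- l :≤ l :- s) (a′ , tt)) ≤-refl))
              (linarith (s ∷ t ∷ L ∷ gap s t ∷ []) (λ s t l g → (t :- s :≤ g) ∷ [] ⊢ (l :- s) :+ (t :- l) :≤ g) (gap-≥ʳ s t , tt))))

        lipschitz : ∀ s t (p : f (proj₁ s) ∈ points) (q : f (proj₁ t) ∈ points) → 0# ≤ s → s ≤ L + L′ → 0# ≤ t → t ≤ L + L′ → d (_ , p) (_ , q) ≤ gap s t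
        lipschitz s t p q a b a′ b′ = cases (total s L) (total t L)
          where
          cases : s ≤ L ⊎ L ≤ s → t ≤ L ⊎ L ≤ t → d (_ , p) (_ , q) ≤ gap s t
          cases (inj₁ h) (inj₁ k) = lip-left s t p q a h a′ k
          cases (inj₂ h) (inj₂ k) = lip-right s t p q h b k b′
          cases (inj₁ h) (inj₂ k) = across s t p q a h k b′
          cases (inj₂ h) (inj₁ k) = ≤-trans (≤-reflexive (d-sym _ _)) (≤-trans (across t s q p a′ k h b) (gap-sym t s))

    private
      intervalDef : (L : ℝ) → Def {1} (λ v → 0# ≤ toR (lookup v (# 0)) × toR (lookup v (# 0)) ≤ L)
      intervalDef L = (cstR 0# ≤ᵈ toRᵈ (var (# 0))) ×ᵈ (toRᵈ (var (# 0)) ≤ᵈ cstR L)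

    -- For s ≤ t, L = d(x , y) ≤ d(x , f s) + d(f s , f t) + d(f t , y) ≤ s + d(f s , f t) + (L -
    -- t). Hence d(f s , f t) ≥ t - s.
    segmentOf : ∀ {x y} → Path x y (d x y) → Segment x y
    segmentOf {x} {y} γ = record { ρ = ρ ; isometric = isometric ; start = subst (λ z → ⟨ proj₁ 0# , z ⟩ ∈ Map.graph ρ) γ.start (in-graph 0# ≤-refl γ.0≤L)
        ; end = subst (λ z → ⟨ proj₁ (d x y) , z ⟩ ∈ Map.graph ρ) γ.end (in-graph (d x y) γ.0≤L ≤-refl) }
      where
      module γ = Path γ
      L : ℝ
      L = d x y
      J : V
      J = comp (intervalDef L) carrier []

      into : ∀ {t} → Interval 0# L t → t ∈ J
      into {t} (t∈ , a , b) = from (∈comp (intervalDef L) _) (t∈ , ≤-trans (le a) (≤-reflexive (Eq.sym (toR-ℝ (t , t∈)))) ,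
                                ≤-trans (≤-reflexive (toR-ℝ (t , t∈))) (le b))
      out : ∀ {t} → t ∈ J → Interval 0# L t
      out {t} m = to (∈comp (intervalDef L) _) m |>′ λ (t∈ , a , b) →
        t∈ , unle (≤-trans a (≤-reflexive (toR-ℝ (t , t∈)))) , unle (≤-trans (≤-reflexive (Eq.sym (toR-ℝ (t , t∈)))) b)

      ρ : Map (Interval 0# L) (set points)
      ρ = lamMap γ.f γ.fᵈ J points into out id (λ { {t} (t∈ , a , b) → γ.closed (t , t∈) (le a) (le b) })

      in-graph : ∀ t → 0# ≤ t → t ≤ L → ⟨ proj₁ t , γ.f (proj₁ t) ⟩ ∈ Map.graph ρ
      in-graph t (le a) (le b) = MapProperties.graph-∈ ρ (proj₂ t , a , b)

      opaque
        isometric : ∀ s t → d (Map.apply ρ s) (Map.apply ρ t) ≈′ ∣ (proj₁ s , proj₁ (proj₂ s)) + - (proj₁ t , proj₁ (proj₂ t)) ∣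
        isometric (s , s∈ , a , b) (t , t∈ , a′ , b′) = uneq (Eq.trans (antisym upper lower) (Eq.sym (abs-≈ s′ t′)))
          where
          s′ t′ : ℝ
          s′ = s , s∈
          t′ = t , t∈
          fs ft : Point
          fs = Map.apply ρ (s , s∈ , a , b)
          ft = Map.apply ρ (t , t∈ , a′ , b′)
          upper : d fs ft ≤ gap s′ t′
          upper = γ.lipschitz s′ t′ _ _ (le a) (le b) (le a′) (le b′)
          from-x : ∀ t p → (0≤t : 0# ≤ t) (t≤L : t ≤ L) → d x (γ.f (proj₁ t) , p) ≤ t
          from-x t p 0≤t t≤L = ≤-trans (≤-reflexive (d-cong {x} {_ , γ.closed 0# ≤-refl γ.0≤L} {_ , p} {_ , p} (sym γ.start) refl))
            (≤-trans (γ.lipschitz 0# t _ p ≤-refl γ.0≤L 0≤t t≤L)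
              (gap-≤ (linarith (t ∷ []) (λ t → (:0 :≤ t) ∷ [] ⊢ :0 :- t :≤ t) (0≤t , tt)) (linarith (t ∷ []) (λ t → [] ⊢ t :- :0 :≤ t) tt)))
          to-y : ∀ t p → (0≤t : 0# ≤ t) (t≤L : t ≤ L) → d (γ.f (proj₁ t) , p) y ≤ L + - t
          to-y t p 0≤t t≤L = ≤-trans (≤-reflexive (d-cong {_ , p} {_ , p} {y} {_ , γ.closed L γ.0≤L ≤-refl} refl (sym γ.end)))
            (≤-trans (γ.lipschitz t L p _ 0≤t t≤L γ.0≤L ≤-refl)
              (gap-≤ (linarith (t ∷ L ∷ []) (λ t l → (t :≤ l) ∷ [] ⊢ t :- l :≤ l :- t) (t≤L , tt)) ≤-refl))
          far : ∀ s t p q → 0# ≤ s → s ≤ L → 0# ≤ t → t ≤ L → t + - s ≤ d (γ.f (proj₁ s) , p) (γ.f (proj₁ t) , q)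
          far s t p q a b a′ b′ = linarith (d x y ∷ d x (_ , p) ∷ d (_ , p) y ∷ d (_ , p) (_ , q) ∷ d (_ , q) y ∷ s ∷ t ∷ [])
            (λ L a b c e s t → (L :≤ a :+ b) ∷ (b :≤ c :+ e) ∷ (a :≤ s) ∷ (e :≤ L :- t) ∷ [] ⊢ t :- s :≤ c)
            (d-triangle x (_ , p) y , d-triangle (_ , p) (_ , q) y , from-x s p a b , to-y t q a′ b′ , tt)
          lower : gap s′ t′ ≤ d fs ft
          lower = gap-≤ (≤-trans (far t′ s′ _ _ (le a′) (le b′) (le a) (le b)) (≤-reflexive (d-sym ft fs))) (far s′ t′ _ _ (le a) (le b) (le a′) (le b′))

    private
      distDef : ∀ J x → Def {1} (λ v → ∃ λ j → j ∈ points × j ∈ J × lookup v (# 0) ≡ Map.graph distance ‵ ⟨ x , j ⟩)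
      distDef J x = ∃∈ (cst points) ((var (# 0) ∈ᵈ cst J) ×ᵈ (var (# 1) ≡ᵈ ‵ᵈ (cst (Map.graph distance)) (pairᵈ (cst x) (var (# 0)))))

    opaque
      -- To obtain the infimum, the distances to J must form a set of the model; therefore J has to
      -- be given by a set `Jˢ`.
      B-intro : ∀ {J : Pred Point ℓ} (Jˢ : V) → (∀ j → J j ⇔ proj₁ j ∈ Jˢ) → ∀ {x p} j → J j → d x j ≤ p → B J p x
      B-intro {J} Jˢ J⇔ {x} {p} j Jj h = infimum (distDef Jˢ (proj₁ x)) 0#
          (λ s Ps → back s Ps |>′ λ (j , _ , e) → ≤-trans d-nonNeg (≤-reflexive (Eq.sym e)))
          (d x j , forth (d x j) (j , Jj , Eq.refl)) |>′ λ (r , lower , greatest) →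
        r , ((λ s (j , Jj , e) → lower s (forth s (j , Jj , eq e))) , λ b b-lower → greatest b λ s Ps → back s Ps |>′ λ (j , Jj , e) → b-lower s (j , Jj , uneq e)) ,
        unle (≤-trans (le {r} {d x j} (lower (d x j) (forth (d x j) (j , Jj , Eq.refl)))) h)
        where
        value : ∀ j → Map.graph distance ‵ ⟨ proj₁ x , proj₁ j ⟩ ≡ proj₁ (d x j)
        value j = MapProperties.apply-‵ distance _
        forth : ∀ (s : ℝ) → (∃ λ j → J j × s ≈ d x j) → ∃ λ j → j ∈ points × j ∈ Jˢ × proj₁ s ≡ Map.graph distance ‵ ⟨ proj₁ x , j ⟩
        forth s (j , Jj , e) = proj₁ j , proj₂ j , to (J⇔ j) Jj , trans (uneq e) (sym (value j))
        back : ∀ (s : ℝ) → (∃ λ j → j ∈ points × j ∈ Jˢ × proj₁ s ≡ Map.graph distance ‵ ⟨ proj₁ x , j ⟩) → ∃ λ j → J j × s ≈ d x j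
        back s (j , j∈ , j∈J , e) = (j , j∈) , from (J⇔ (j , j∈)) j∈J , eq (trans e (value (j , j∈)))

      -- The infimum need not be attained, hence the slack 1.
      B-elim : ∀ {J : Pred Point ℓ} {p} x → B J p x → ∃ λ j → J j × d x j ≤ p + 1#
      B-elim {J} {p} x (r , (_ , greatest) , r≤p) = decidable-stable em λ none →
        1≰0 (linarith (p ∷ 1# ∷ r ∷ []) (λ p o r → (p :+ o :≤ r) ∷ (r :≤ p) ∷ [] ⊢ o :≤ :0)
          (le (greatest (p + 1#) λ s (j , Jj , e) → unle (≤-trans (<⇒≤ λ h → none (j , Jj , h)) (≤-reflexive (Eq.sym (eq {s} {d x j} e))))) , le r≤p , tt))

    private
      imageDef : ∀ g g′ → Def {1} (λ v → (∃ λ t → ⟨ t , lookup v (# 0) ⟩ ∈ g) ⊎ (∃ λ t → ⟨ t , lookup v (# 0) ⟩ ∈ g′))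
      imageDef g g′ = ∃ᵈ (pairᵈ (var (# 0)) (var (# 1)) ∈ᵈ cst g) ⊎ᵈ ∃ᵈ (pairᵈ (var (# 0)) (var (# 1)) ∈ᵈ cst g′)

    module FourPoint (C : ℝ)
      (four : ∀ x y z p → (d x y + d z p ≤ (d x z + d y p) + C) ⊎ (d x y + d z p ≤ (d x p + d y z) + C)) where

      private
        module _ {x z : Point} (σ : Segment x z) where
          open Segment σ using (ρ; isometric; start; end)
          at : ∀ t → 0# ≤ t → t ≤ d x z → ∃ λ (w : Point) → segment σ w × (d x w ≈ t) × (d w z ≈ d x z + - t)
          at t@(t₀ , t∈) (le a) (le b) = w , ((t₀ , t∈ , a , b) , refl) ,
              Eq.trans (d-cong {x} {Map.apply ρ s₀} {w} {w} (sym start≡) refl)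
                (Eq.trans (eq (isometric s₀ (t₀ , t∈ , a , b))) (Eq.trans (abs-≈ 0# t) (antisym
                  (gap-≤ (linarith (t ∷ []) (λ t → (:0 :≤ t) ∷ [] ⊢ :0 :- t :≤ t) (le a , tt)) (linarith (t ∷ []) (λ t → [] ⊢ t :- :0 :≤ t) tt))
                  (≤-trans (linarith (t ∷ []) (λ t → [] ⊢ t :≤ t :- :0) tt) (gap-≥ʳ 0# t))))) ,
              Eq.trans (d-cong {w} {w} {z} {Map.apply ρ s₁} refl (sym end≡))
                (Eq.trans (eq (isometric (t₀ , t∈ , a , b) s₁)) (Eq.trans (abs-≈ t (d x z)) (antisym
                  (gap-≤ (linarith (t ∷ d x z ∷ []) (λ t l → (t :≤ l) ∷ [] ⊢ t :- l :≤ l :- t) (le b , tt)) ≤-refl)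
                  (gap-≥ʳ t (d x z)))))
            where
            w : Point
            w = Map.apply ρ (t₀ , t∈ , a , b)
            s₀ s₁ : El (Interval 0# (d x z))
            s₀ = proj₁ 0# , proj₂ 0# , unle (≤-refl {0#}) , unle (d-nonNeg {x} {z})
            s₁ = proj₁ (d x z) , proj₂ (d x z) , unle (d-nonNeg {x} {z}) , unle (≤-refl {d x z})
            start≡ : proj₁ (Map.apply ρ s₀) ≡ proj₁ x
            start≡ = MapProperties.graph-unique ρ (proj₂ s₀) (proj₂ x) start
            end≡ : proj₁ (Map.apply ρ s₁) ≡ proj₁ z
            end≡ = MapProperties.graph-unique ρ (proj₂ s₁) (proj₂ z) end

          -- The point p is compared with the point w of [x , z] at distance d(x , p) from x, or
          -- with z if the segment is too short; the four-point condition for x, z, p, w then bounds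
          -- d(p , w) by 2C.
          near : 0# ≤ C → ∀ p → d x p + d z p ≤ d x z + C → ∃ λ w → segment σ w × d p w ≤ C + C
          near 0≤C p h = [ (λ k → at (d x p) d-nonNeg k |>′ λ (w , w∈ , e , f) → w , w∈ , bound w e f ≤-refl)
                         , (λ k → at (d x z) d-nonNeg ≤-refl |>′ λ (w , w∈ , e , f) → w , w∈ , bound′ w e f k) ]′ (total (d x p) (d x z))
            where
            bound : ∀ w → d x w ≈ d x p → d w z ≈ d x z + - d x p → d x p ≤ d x p → d p w ≤ C + C
            bound w e f _ = [ (λ k → linarith (d x z ∷ d p w ∷ d x p ∷ d z w ∷ d w z ∷ C ∷ [])
                    (λ xz pw xp zw wz c → (xz :+ pw :≤ xp :+ zw :+ c) ∷ (zw :≈ wz) ∷ (wz :≈ xz :- xp) ∷ (:0 :≤ c) ∷ [] ⊢ pw :≤ c :+ c) (k , d-sym z w , f , 0≤C , tt))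
                , (λ k → linarith (d x z ∷ d p w ∷ d x w ∷ d x p ∷ d z p ∷ C ∷ [])
                    (λ xz pw xw xp zp c → (xz :+ pw :≤ xw :+ zp :+ c) ∷ (xw :≈ xp) ∷ (xp :+ zp :≤ xz :+ c) ∷ [] ⊢ pw :≤ c :+ c) (k , e , h , tt)) ]′ (four x z p w)
            bound′ : ∀ w → d x w ≈ d x z → d w z ≈ d x z + - d x z → d x z ≤ d x p → d p w ≤ C + C
            bound′ w e f g = [ (λ k → linarith (d x z ∷ d p w ∷ d x p ∷ d z w ∷ d w z ∷ C ∷ d z p ∷ [])
                    (λ xz pw xp zw wz c zp → (xz :+ pw :≤ xp :+ zw :+ c) ∷ (zw :≈ wz) ∷ (wz :≈ xz :- xz) ∷ (xp :+ zp :≤ xz :+ c) ∷ (:0 :≤ zp) ∷ [] ⊢ pw :≤ c :+ c)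
                    (k , d-sym z w , f , h , d-nonNeg , tt))
                , (λ k → linarith (d x z ∷ d p w ∷ d x w ∷ d x p ∷ d z p ∷ C ∷ [])
                    (λ xz pw xw xp zp c → (xz :+ pw :≤ xw :+ zp :+ c) ∷ (xw :≈ xz) ∷ (xz :≤ xp) ∷ (xp :+ zp :≤ xz :+ c) ∷ [] ⊢ pw :≤ c :+ c) (k , e , g , h , tt)) ]′ (four x z p w)

          on-segment : ∀ p → segment σ p → d x p + d p z ≈ d x z
          on-segment p ((t₀ , t∈ , a , b) , e) = at (t₀ , t∈) (le a) (le b) |>′ λ (w , _ , f , g) → linarith
            (d x p ∷ d p z ∷ d x z ∷ (t₀ , t∈) ∷ []) (λ a b c t → (a :≈ t) ∷ (b :≈ c :- t) ∷ [] ⊢ a :+ b :≈ c)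
            ( Eq.trans (d-cong {x} {x} {p} {proj₁ (at (t₀ , t∈) (le a) (le b))} refl (sym e)) (proj₁ (proj₂ (proj₂ (at (t₀ , t∈) (le a) (le b)))))
            , Eq.trans (d-cong {p} {proj₁ (at (t₀ , t∈) (le a) (le b))} {z} {z} (sym e) refl) (proj₂ (proj₂ (proj₂ (at (t₀ , t∈) (le a) (le b))))) , tt)

      opaque
        -- As p lies on [x , y], d(x , p) + d(p , y) = d(x , y). Inserted into the four-point
        -- condition this leaves d(x , p) + d(p , z) ≤ d(x , z) + C, or the same with y for x, and
        -- `near` applies to that side.
        hyperbolic : 0# ≤ C → DeltaHyperbolic (C + C)
        hyperbolic 0≤C x y z xy xz yz p p∈ = finish ([
            (λ h → inj₁ (near xz 0≤C p (linarith (d x y ∷ d z p ∷ d x z ∷ d y p ∷ d x p ∷ d p y ∷ C ∷ [])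
               (λ xy zp xz yp xp py c → (xy :+ zp :≤ xz :+ yp :+ c) ∷ (xp :+ py :≈ xy) ∷ (py :≈ yp) ∷ [] ⊢ xp :+ zp :≤ xz :+ c) (h , on-segment xy p p∈ , d-sym p y , tt)))) ,
            (λ h → inj₂ (near yz 0≤C p (linarith (d x y ∷ d z p ∷ d y z ∷ d y p ∷ d x p ∷ d p y ∷ C ∷ [])
               (λ xy zp yz yp xp py c → (xy :+ zp :≤ xp :+ yz :+ c) ∷ (xp :+ py :≈ xy) ∷ (py :≈ yp) ∷ [] ⊢ yp :+ zp :≤ yz :+ c) (h , on-segment xy p p∈ , d-sym p y , tt)))) ]′ (four x y z p))
          where
          g g′ J : V
          g = Map.graph (Segment.ρ xz)
          g′ = Map.graph (Segment.ρ yz)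
          J = comp (imageDef g g′) points []
          image⇔ : ∀ {a b} (σ : Segment a b) j → segment σ j ⇔ (∃ λ t → ⟨ t , proj₁ j ⟩ ∈ Map.graph (Segment.ρ σ))
          image⇔ {a} {b} σ j = mk⇔
            (λ ((t , c) , e) → t , subst (λ w → ⟨ t , w ⟩ ∈ Map.graph (Segment.ρ σ)) e (MapProperties.graph-∈ (Segment.ρ σ) c))
            (λ (t , m) → Map.graph⊆ (Segment.ρ σ) m |>′ λ (t′ , j′ , c , _ , e) →
               (t , subst (Interval 0# (d a b)) (sym (pair-inj₁ e)) c) , MapProperties.graph-unique′ (Segment.ρ σ) _ m)
          J⇔ : ∀ j → (segment xz ∪ segment yz) j ⇔ proj₁ j ∈ J
          J⇔ j = mk⇔ (λ h → from (∈comp (imageDef g g′) _) (proj₂ j , Sum.map (to (image⇔ xz j)) (to (image⇔ yz j)) h))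
                     (λ m → Sum.map (from (image⇔ xz j)) (from (image⇔ yz j)) (proj₂ (to (∈comp (imageDef g g′) _) m)))
          finish : (∃ λ w → segment xz w × d p w ≤ C + C) ⊎ (∃ λ w → segment yz w × d p w ≤ C + C) → B (segment xz ∪ segment yz) (C + C) p
          finish (inj₁ (w , w∈ , h)) = B-intro J J⇔ w (inj₁ w∈) h
          finish (inj₂ (w , w∈ , h)) = B-intro J J⇔ w (inj₂ w∈) h

-- The cone of a family as a geodesic hyperbolic space of the model.

module Cones {ℓ : Level} (em : ExcludedMiddle ℓ) (M : ZFModel ℓ) (𝓡 : Internal.RealNumbers M) where

  open import Data.Fin using (#_)
  open import Data.Vec.Base using (Vec; []; _∷_; lookup)
  open import Data.List.Base using ([]; _∷_)
  open import Data.Product.Base using (∃; _×_; _,_; proj₁; proj₂)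
  open import Data.Sum.Base as Sum using (_⊎_; [_,_]′)
  open import Data.Unit.Polymorphic.Base using (tt)
  open import Function.Base using (_|>′_)
  open import Relation.Binary.PropositionalEquality using (_≡_; refl; sym; trans; cong; cong₂; subst)
  open DefinablePredicates em M
  open Sets em M
  open OrderedField em M 𝓡
  open MetricSpaces em M 𝓡

  code : V → V → V → V → V → V
  code X x y u h = ⟨ X , ⟨ ⟨ x , y ⟩ , ⟨ u , h ⟩ ⟩ ⟩

  uᵛ hᵛ : V → V
  uᵛ p = fst (snd (snd p))
  hᵛ p = snd (snd (snd p))

  -- Defined on all sets, with junk values outside the codes, so that `dist` is a total term.
  decode : V → Raw
  decode p = raw (fst p) (fst (fst (snd p))) (snd (fst (snd p))) (toR (uᵛ p)) (toR (hᵛ p))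

  encode : Raw → V
  encode (raw X x y u h) = code X x y (proj₁ u) (proj₁ h)

  dist : V → V → ℝ
  dist p q = δ (decode p) (decode q)

  opaque
    decode-code : ∀ X x y u h → decode (code X x y u h) ≡ raw X x y (toR u) (toR h)
    decode-code X x y u h
      rewrite fst-β X ⟨ ⟨ x , y ⟩ , ⟨ u , h ⟩ ⟩ | snd-β X ⟨ ⟨ x , y ⟩ , ⟨ u , h ⟩ ⟩
            | fst-β ⟨ x , y ⟩ ⟨ u , h ⟩ | snd-β ⟨ x , y ⟩ ⟨ u , h ⟩
            | fst-β x y | snd-β x y | fst-β u h | snd-β u h = refl

    codeᵈ : ∀ {n} {A B C D E : Vec V n → V} → DefT A → DefT B → DefT C → DefT D → DefT E →
            DefT (λ v → code (A v) (B v) (C v) (D v) (E v))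
    codeᵈ a b c d e = pairᵈ a (pairᵈ (pairᵈ b c) (pairᵈ d e))

  opaque
    unfolding δ

    -- The formula has to follow the definition of `δ` clause by clause, hence the unfolding.
    distDef : DefR (λ (v : Vec V 2) → dist (lookup v (# 0)) (lookup v (# 1)))
    distDef = pickᵈ (fstᵈ p ≡ᵈ fstᵈ q) (pickᵈ ((gapᵈ (h p) (h q) +ᵈ Dᵈ) ≤ᵈ (h p +ᵈ h q)) (gapᵈ (h p) (h q) +ᵈ Dᵈ) (h p +ᵈ h q)) (h p +ᵈ h q)
      where
      p : DefT (λ (v : Vec V 2) → lookup v (# 0))
      p = var (# 0)
      q : DefT (λ (v : Vec V 2) → lookup v (# 1))
      q = var (# 1)
      h : ∀ {n} {F : Vec V n → V} → DefT F → DefR (λ v → toR (hᵛ (F v)))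
      h t = toRᵈ (sndᵈ (sndᵈ (sndᵈ t)))
      u : ∀ {n} {F : Vec V n → V} → DefT F → DefR (λ v → toR (uᵛ (F v)))
      u t = toRᵈ (fstᵈ (sndᵈ (sndᵈ t)))
      αᵈ : DefR (λ (v : Vec V 2) → α (decode (lookup v (# 0))) (decode (lookup v (# 1))))
      αᵈ = pickᵈ (fstᵈ (fstᵈ (sndᵈ p)) ≡ᵈ fstᵈ (fstᵈ (sndᵈ q))) (gapᵈ (u p) (u q)) ((cstR 1# +ᵈ cstR 1#) -ᵈ (u p +ᵈ u q))
      βᵈ : DefR (λ (v : Vec V 2) → β (decode (lookup v (# 0))) (decode (lookup v (# 1))))
      βᵈ = pickᵈ (sndᵈ (fstᵈ (sndᵈ p)) ≡ᵈ sndᵈ (fstᵈ (sndᵈ q))) (gapᵈ (u p) (u q)) (u p +ᵈ u q)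
      Dᵈ : DefR (λ (v : Vec V 2) → D (decode (lookup v (# 0))) (decode (lookup v (# 1))))
      Dᵈ = (αᵈ +ᵈ βᵈ) -ᵈ gapᵈ (u p) (u q)

  module ConeSpace (Z : V) where

    open Chains (λ x X → x ∈ X × X ∈ Z) public using (Valid; valid; isOk; x∈X; y∈X; Chain; glue; moveU; moveH; _⟫_; linked)

    private
      ambient : V
      ambient = Z ×ˢ ((⋃ Z ×ˢ ⋃ Z) ×ˢ (carrier ×ˢ carrier))

      okDef : Def {1} (λ v → (fst (fst (snd (lookup v (# 0)))) ∈ fst (lookup v (# 0)) × snd (fst (snd (lookup v (# 0)))) ∈ fst (lookup v (# 0))) ×
                             0# ≤ toR (uᵛ (lookup v (# 0))) × toR (uᵛ (lookup v (# 0))) ≤ 1# × 0# ≤ toR (hᵛ (lookup v (# 0))))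
      okDef = ((fstᵈ (fstᵈ (sndᵈ (var (# 0)))) ∈ᵈ fstᵈ (var (# 0))) ×ᵈ (sndᵈ (fstᵈ (sndᵈ (var (# 0)))) ∈ᵈ fstᵈ (var (# 0)))) ×ᵈ
              (cstR 0# ≤ᵈ u) ×ᵈ (u ≤ᵈ cstR 1#) ×ᵈ (cstR 0# ≤ᵈ toRᵈ (sndᵈ (sndᵈ (sndᵈ (var (# 0))))))
        where
        u : DefR (λ (v : Vec V 1) → toR (uᵛ (lookup v (# 0))))
        u = toRᵈ (fstᵈ (sndᵈ (sndᵈ (var (# 0)))))

    opaque
      P : V
      P = comp okDef ambient []

      P-valid : ∀ {p} → p ∈ P → Valid (decode p)
      P-valid p∈ = to (∈comp okDef _) p∈ |>′ λ (m , (x∈ , y∈) , a , b , c) → valid (ok a b c) (x∈ , fst-∈ m) (y∈ , fst-∈ m)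

      encode-decode : ∀ {p} → p ∈ P → encode (decode p) ≡ p
      encode-decode {p} p∈ = to (∈comp okDef _) p∈ |>′ λ (m , _) → sym (trans (pair-η m) (cong ⟨ fst p ,_⟩
        (trans (pair-η (snd-∈ m)) (cong₂ ⟨_,_⟩ (pair-η (fst-∈ (snd-∈ m)))
          (trans (pair-η (snd-∈ (snd-∈ m))) (cong₂ ⟨_,_⟩ (sym (toR-∈ (fst-∈ (snd-∈ (snd-∈ m))))) (sym (toR-∈ (snd-∈ (snd-∈ (snd-∈ m)))))))))))

      u-∈ : ∀ {p} → p ∈ P → uᵛ p ∈ carrier
      u-∈ p∈ = fst-∈ (snd-∈ (snd-∈ (proj₁ (to (∈comp okDef _) p∈))))

      encode-∈ : ∀ {r} → Valid r → encode r ∈ P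
      encode-∈ {r@(raw X x y u h)} (valid (ok a b c) (x∈ , X∈) (y∈ , _)) = from (∈comp okDef _)
        (pair∈× X∈ (pair∈× (pair∈× (from (∈⋃ x) (X , X∈ , x∈)) (from (∈⋃ y) (X , X∈ , y∈))) (pair∈× (proj₂ u) (proj₂ h))) , conditions)
        where
        conditions : (fst (fst (snd (encode r))) ∈ fst (encode r) × snd (fst (snd (encode r))) ∈ fst (encode r)) ×
                     0# ≤ toR (uᵛ (encode r)) × toR (uᵛ (encode r)) ≤ 1# × 0# ≤ toR (hᵛ (encode r))
        conditions = subst (λ s → (Raw.x s ∈ Raw.X s × Raw.y s ∈ Raw.X s) × 0# ≤ Raw.u s × Raw.u s ≤ 1# × 0# ≤ Raw.h s)
          (sym (decode-code X x y (proj₁ u) (proj₁ h)))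
          ((x∈ , y∈) , ≤-trans a (≤-reflexive (Eq.sym (toR-ℝ u))) , ≤-trans (≤-reflexive (toR-ℝ u)) b , ≤-trans c (≤-reflexive (Eq.sym (toR-ℝ h))))

      private
        near-zero : ∀ X x y u u′ h h′ → Ok (raw X x y u h) → u ≈ u′ → h ≈ h′ → δ (raw X x y u h) (raw X x y u′ h′) ≤ 0#
        near-zero X x y u u′ h h′ o@(ok a b c) e f = ≤-trans (δ-triangle o (ok a′ b′ c) (ok a′ b′ (≤-trans c (≤-reflexive f))))
          (≤-trans (add-mono (≤-trans (move-u X x y u u′ h) (zero-gap e)) (≤-trans (move-h X x y u′ h h′) (zero-gap f)))
            (linarith {n = 0} [] ([] ⊢ :0 :+ :0 :≤ :0) tt))
          where
          a′ : 0# ≤ u′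
          a′ = ≤-trans a (≤-reflexive e)
          b′ : u′ ≤ 1#
          b′ = ≤-trans (≤-reflexive (Eq.sym e)) b
          zero-gap : ∀ {s t} → s ≈ t → gap s t ≤ 0#
          zero-gap {s} {t} e = gap-≤ (linarith (s ∷ t ∷ []) (λ s t → (s :≈ t) ∷ [] ⊢ s :- t :≤ :0) (e , tt))
                                     (linarith (s ∷ t ∷ []) (λ s t → (s :≈ t) ∷ [] ⊢ t :- s :≤ :0) (e , tt))

      -- Encoding forgets the proofs that u and h are real, so decoding returns these coordinates
      -- only up to `≈`; the triangle inequality absorbs the difference.
      dist-encode : ∀ {r s} → Valid r → Valid s → dist (encode r) (encode s) ≈ δ r s
      dist-encode {r@(raw X x y u h)} {s@(raw X′ x′ y′ u′ h′)} vr vs = antisym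
        (linarith (dist (encode r) (encode s) ∷ δ r̂ r ∷ δ r ŝ ∷ δ r s ∷ δ s ŝ ∷ [])
          (λ a b c d e → (a :≤ b :+ c) ∷ (c :≤ d :+ e) ∷ (b :≤ :0) ∷ (e :≤ :0) ∷ [] ⊢ a :≤ d)
          (δ-triangle ok-r̂ or ok-ŝ , δ-triangle or os ok-ŝ , ≤-trans (δ-sym r̂ r) r-r̂ , s-ŝ , tt))
        (linarith (δ r s ∷ δ r r̂ ∷ δ r̂ s ∷ dist (encode r) (encode s) ∷ δ ŝ s ∷ [])
          (λ a b c d e → (a :≤ b :+ c) ∷ (c :≤ d :+ e) ∷ (b :≤ :0) ∷ (e :≤ :0) ∷ [] ⊢ a :≤ d)
          (δ-triangle or ok-r̂ os , δ-triangle ok-r̂ ok-ŝ os , r-r̂ , ≤-trans (δ-sym ŝ s) s-ŝ , tt))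
        where
        r̂ ŝ : Raw
        r̂ = decode (encode r)
        ŝ = decode (encode s)
        or : Ok r
        or = isOk vr
        os : Ok s
        os = isOk vs
        ok-r̂ : Ok r̂
        ok-r̂ = isOk (P-valid (encode-∈ vr))
        ok-ŝ : Ok ŝ
        ok-ŝ = isOk (P-valid (encode-∈ vs))
        r-r̂ : δ r r̂ ≤ 0#
        r-r̂ = subst (λ w → δ r w ≤ 0#) (sym (decode-code X x y (proj₁ u) (proj₁ h)))
          (near-zero X x y u _ h _ or (Eq.sym (toR-ℝ u)) (Eq.sym (toR-ℝ h)))
        s-ŝ : δ s ŝ ≤ 0#
        s-ŝ = subst (λ w → δ s w ≤ 0#) (sym (decode-code X′ x′ y′ (proj₁ u′) (proj₁ h′)))
          (near-zero X′ x′ y′ u′ _ h′ _ os (Eq.sym (toR-ℝ u′)) (Eq.sym (toR-ℝ h′)))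

    private
      P-ok : ∀ {p} → p ∈ P → Ok (decode p)
      P-ok p∈ = isOk (P-valid p∈)

    open Quotient P dist distDef (λ p∈ → δ-self (P-ok p∈)) (λ p∈ q∈ → δ-nonNeg (P-ok p∈) (P-ok q∈))
      (λ _ _ → δ-sym _ _) (λ p∈ q∈ r∈ → δ-triangle (P-ok p∈) (P-ok q∈) (P-ok r∈)) public
    open MetricSpace space public using (Point; d; Geodesic; Hyperbolic; Segment; DeltaHyperbolic)
    open MetricProperties space public

    opaque
      normal : ∀ (x : Point) → ∃ λ r → Valid r × proj₁ x ≡ cls (encode r)
      normal x = representative (proj₂ x) |>′ λ (p , p∈ , e) → decode p , P-valid p∈ , trans e (cong cls (sym (encode-decode p∈)))

      d-encode : ∀ (x y : Point) {r s} → Valid r → Valid s → proj₁ x ≡ cls (encode r) → proj₁ y ≡ cls (encode s) → d x y ≈ δ r s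
      d-encode x y vr vs e f = Eq.trans (d-rep x y (encode-∈ vr) (encode-∈ vs) e f) (dist-encode vr vs)

    pt : ∀ {r} → Valid r → Point
    pt vr = point (encode-∈ vr)

    private
      -- A path that runs along the curve e with the parameter φ t at time t.
      ride : (e : ℝ → Raw) (eᵛ : V → V) → (∀ {n} {F : Vec V n → V} → DefT F → DefT (λ v → eᵛ (F v))) →
             (∀ t → encode (e t) ≡ eᵛ (proj₁ t)) → (∀ s t → δ (e s) (e t) ≤ gap s t) →
             (φ : ℝ → ℝ) → (∀ {n} {F : Vec V n → ℝ} → DefR F → DefR (λ v → φ (F v))) →
             (∀ {s t} → s ≈ t → φ s ≈ φ t) → (∀ s t → gap (φ s) (φ t) ≤ gap s t) →
             ∀ {L a b} → 0# ≤ L → (∀ t → 0# ≤ t → t ≤ L → Valid (e (φ t))) →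
             φ 0# ≈ a → φ L ≈ b → (v : Valid (e a)) (v′ : Valid (e b)) → Path (pt v) (pt v′) L
      ride e eᵛ eᵈ e≡ e-lip φ φᵈ φ-cong φ-lip {L} {a} {b} 0≤L w φ0 φL v v′ = record
        { f = λ t → cls (eᵛ (proj₁ (φ (toR t))))
        ; fᵈ = clsᵈ (eᵈ (termᵈ (φᵈ (toRᵈ (var (# 0))))))
        ; 0≤L = 0≤L
        ; closed = λ t p q → subst (_∈ pointSet) (sym (value t)) (cls-∈ (encode-∈ (w t p q)))
        ; lipschitz = λ s t p q c c′ d d′ → ≤-trans (≤-reflexive (d-encode (_ , p) (_ , q) (w s c c′) (w t d d′) (value s) (value t)))
            (≤-trans (e-lip (φ s) (φ t)) (φ-lip s t))
        ; start = trans (value 0#) (encode-cong φ0)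
        ; end = trans (value L) (encode-cong φL) }
        where
        encode-cong : ∀ {s t} → s ≈ t → cls (encode (e s)) ≡ cls (encode (e t))
        encode-cong {s} {t} (eq p) = cong cls (trans (e≡ s) (trans (cong eᵛ p) (sym (e≡ t))))
        value : ∀ t → cls (eᵛ (proj₁ (φ (toR (proj₁ t))))) ≡ cls (encode (e (φ t)))
        value t = cong cls (trans (cong eᵛ (uneq (φ-cong (toR-ℝ t)))) (sym (e≡ (φ t))))

      -- Time starts at 0 and only increases, so the parameter is a + t or a - t according to the
      -- direction of motion.
      travel : (e : ℝ → Raw) (eᵛ : V → V) → (∀ {n} {F : Vec V n → V} → DefT F → DefT (λ v → eᵛ (F v))) →
               (∀ t → encode (e t) ≡ eᵛ (proj₁ t)) → (∀ s t → δ (e s) (e t) ≤ gap s t) →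
               (∀ {s t u} → Valid (e s) → Valid (e t) → s ≤ u → u ≤ t → Valid (e u)) →
               ∀ {a b} (v : Valid (e a)) (v′ : Valid (e b)) → Path (pt v) (pt v′) (gap a b)
      travel e eᵛ eᵈ e≡ e-lip convex {a} {b} v v′ = [ up , down ]′ (gap-spec a b)
        where
        up : a ≤ b × gap a b ≈ b + - a → Path (pt v) (pt v′) (gap a b)
        up (h , g) = retarget (Eq.sym g) (ride e eᵛ eᵈ e≡ e-lip (a +_) (cstR a +ᵈ_)
          (λ {s} {t} p → linarith (a ∷ s ∷ t ∷ []) (λ a s t → (s :≈ t) ∷ [] ⊢ a :+ s :≈ a :+ t) (p , tt))
          (λ s t → gap-≤ (linarith (a ∷ s ∷ t ∷ gap s t ∷ []) (λ a s t g → (s :- t :≤ g) ∷ [] ⊢ (a :+ s) :- (a :+ t) :≤ g) (gap-≥ˡ s t , tt))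
                         (linarith (a ∷ s ∷ t ∷ gap s t ∷ []) (λ a s t g → (t :- s :≤ g) ∷ [] ⊢ (a :+ t) :- (a :+ s) :≤ g) (gap-≥ʳ s t , tt)))
          (linarith (a ∷ b ∷ []) (λ a b → (a :≤ b) ∷ [] ⊢ :0 :≤ b :- a) (h , tt))
          (λ t p q → convex v v′ (linarith (a ∷ t ∷ []) (λ a t → (:0 :≤ t) ∷ [] ⊢ a :≤ a :+ t) (p , tt))
                                 (linarith (a ∷ b ∷ t ∷ []) (λ a b t → (t :≤ b :- a) ∷ [] ⊢ a :+ t :≤ b) (q , tt)))
          (linarith (a ∷ []) (λ a → [] ⊢ a :+ :0 :≈ a) tt) (linarith (a ∷ b ∷ []) (λ a b → [] ⊢ a :+ (b :- a) :≈ b) tt) v v′)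
        down : b ≤ a × gap a b ≈ a + - b → Path (pt v) (pt v′) (gap a b)
        down (h , g) = retarget (Eq.sym g) (ride e eᵛ eᵈ e≡ e-lip (λ t → a + - t) (cstR a -ᵈ_)
          (λ {s} {t} p → linarith (a ∷ s ∷ t ∷ []) (λ a s t → (s :≈ t) ∷ [] ⊢ a :- s :≈ a :- t) (p , tt))
          (λ s t → gap-≤ (linarith (a ∷ s ∷ t ∷ gap s t ∷ []) (λ a s t g → (t :- s :≤ g) ∷ [] ⊢ (a :- s) :- (a :- t) :≤ g) (gap-≥ʳ s t , tt))
                         (linarith (a ∷ s ∷ t ∷ gap s t ∷ []) (λ a s t g → (s :- t :≤ g) ∷ [] ⊢ (a :- t) :- (a :- s) :≤ g) (gap-≥ˡ s t , tt)))
          (linarith (a ∷ b ∷ []) (λ a b → (b :≤ a) ∷ [] ⊢ :0 :≤ a :- b) (h , tt))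
          (λ t p q → convex v′ v (linarith (a ∷ b ∷ t ∷ []) (λ a b t → (t :≤ a :- b) ∷ [] ⊢ b :≤ a :- t) (q , tt))
                                 (linarith (a ∷ t ∷ []) (λ a t → (:0 :≤ t) ∷ [] ⊢ a :- t :≤ a) (p , tt)))
          (linarith (a ∷ []) (λ a → [] ⊢ a :- :0 :≈ a) tt) (linarith (a ∷ b ∷ []) (λ a b → [] ⊢ a :- (a :- b) :≈ b) tt) v v′)

    opaque
      chain-path : ∀ {r s k} (v : Valid r) (v′ : Valid s) → Chain r s k → Path (pt v) (pt v′) k
      chain-path v v′ (glue w w′ h) = constant (cls-≡ (encode-∈ v) (encode-∈ v′) (≤-trans (≤-reflexive (dist-encode v v′)) h))
      chain-path v v′ (moveU {X} {x} {y} {u} {u′} {h} _ _) = travel (λ t → raw X x y t h) (λ t → code X x y t (proj₁ h))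
        (λ t → codeᵈ (cst X) (cst x) (cst y) t (cst (proj₁ h))) (λ _ → refl) (λ s t → move-u X x y s t h)
        (λ (valid (ok a b c) x∈ y∈) (valid (ok a′ b′ _) _ _) p q → valid (ok (≤-trans a p) (≤-trans q b′) c) x∈ y∈) v v′
      chain-path v v′ (moveH {X} {x} {y} {u} {h} {h′} _ _) = travel (λ t → raw X x y u t) (λ t → code X x y (proj₁ u) t)
        (λ t → codeᵈ (cst X) (cst x) (cst y) (cst (proj₁ u)) t) (λ _ → refl) (λ s t → move-h X x y u s t)
        (λ (valid (ok a b c) x∈ y∈) (valid (ok _ _ c′) _ _) p q → valid (ok a b (≤-trans c p)) x∈ y∈) v v′
      chain-path v v′ (c ⟫ c′) = concat (chain-path v (middle c) c) (chain-path (middle c) v′ c′)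
        where
        middle : ∀ {r s k} → Chain r s k → Valid s
        middle (glue _ w _) = w
        middle (moveU _ w) = w
        middle (moveH _ w) = w
        middle (_ ⟫ c) = middle c

    geodesic : Geodesic
    geodesic x y = segmentOf path
      where
      opaque
        path : Path x y (d x y)
        path = normal x |>′ λ (r , vr , e) → normal y |>′ λ (s , vs , f) → linked vr vs |>′ λ (k , k≈ , c) →
          record { Path (retarget (Eq.trans k≈ (Eq.sym (d-encode x y vr vs e f))) (chain-path vr vs c)) using (f; fᵈ; 0≤L; closed; lipschitz)
                 ; start = trans (Path.start (retarget (Eq.trans k≈ (Eq.sym (d-encode x y vr vs e f))) (chain-path vr vs c))) (sym e)
                 ; end = trans (Path.end (retarget (Eq.trans k≈ (Eq.sym (d-encode x y vr vs e f))) (chain-path vr vs c))) (sym f) }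

    private
      4# : ℝ
      4# = (1# + 1#) + (1# + 1#)

    opaque
      four-point : ∀ x y z p → (d x y + d z p ≤ (d x z + d y p) + 4#) ⊎ (d x y + d z p ≤ (d x p + d y z) + 4#)
      four-point x y z p = normal x |>′ λ (rx , vx , ex) → normal y |>′ λ (ry , vy , ey) → normal z |>′ λ (rz , vz , ez) → normal p |>′ λ (rp , vp , ep) →
        Sum.map
          (λ h → linarith (d x y ∷ d z p ∷ d x z ∷ d y p ∷ δ rx ry ∷ δ rz rp ∷ δ rx rz ∷ δ ry rp ∷ 4# ∷ [])
            (λ a b c e a′ b′ c′ e′ o → (a′ :+ b′ :≤ c′ :+ e′ :+ o) ∷ (a :≈ a′) ∷ (b :≈ b′) ∷ (c :≈ c′) ∷ (e :≈ e′) ∷ [] ⊢ a :+ b :≤ c :+ e :+ o)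
            (h , d-encode x y vx vy ex ey , d-encode z p vz vp ez ep , d-encode x z vx vz ex ez , d-encode y p vy vp ey ep , tt))
          (λ h → linarith (d x y ∷ d z p ∷ d x p ∷ d y z ∷ δ rx ry ∷ δ rz rp ∷ δ rx rp ∷ δ ry rz ∷ 4# ∷ [])
            (λ a b c e a′ b′ c′ e′ o → (a′ :+ b′ :≤ c′ :+ e′ :+ o) ∷ (a :≈ a′) ∷ (b :≈ b′) ∷ (c :≈ c′) ∷ (e :≈ e′) ∷ [] ⊢ a :+ b :≤ c :+ e :+ o)
            (h , d-encode x y vx vy ex ey , d-encode z p vz vp ez ep , d-encode x p vx vp ex ep , d-encode y z vy vz ey ez , tt))
          (δ-four (isOk vx) (isOk vy) (isOk vz) (isOk vp))

    -- The thin-triangle constant 8 is twice the four-point error 4.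
    hyperbolicSpace : Hyperbolic
    hyperbolicSpace = geodesic , 4# + 4# ,
      unle (linarith (1# ∷ []) (λ o → (:0 :≤ o) ∷ [] ⊢ :0 :≤ ((o :+ o) :+ (o :+ o)) :+ ((o :+ o) :+ (o :+ o))) (0≤1 , tt)) ,
      FourPoint.hyperbolic 4# four-point (linarith (1# ∷ []) (λ o → (:0 :≤ o) ∷ [] ⊢ :0 :≤ (o :+ o) :+ (o :+ o)) (0≤1 , tt))

-- The quasi-isometry onto the cone over singletons.

module Collapsing {ℓ : Level} (em : ExcludedMiddle ℓ) (M : ZFModel ℓ) (𝓡 : Internal.RealNumbers M) where

  open import Data.Fin using (#_)
  open import Data.Vec.Base using (Vec; []; _∷_; lookup)
  open import Data.List.Base using ([]; _∷_)
  open import Data.Product.Base using (∃; _×_; _,_; proj₁; proj₂)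
  open import Data.Sum.Base using (inj₁; [_,_]′)
  open import Data.Unit.Polymorphic.Base using (tt)
  open import Function.Base using (_∘_; id; _|>′_)
  open import Function.Bundles using (mk⇔)
  open import Relation.Binary.PropositionalEquality using (_≡_; refl; sym; trans; cong; cong₂; subst)
  open DefinablePredicates em M
  open Sets em M
  open OrderedField em M 𝓡
  open MetricSpaces em M 𝓡
  open Cones em M 𝓡
  open Internal M using (set; El; Map; Image) renaming (_≈_ to _≈′_)

  module Collapse (Z : V) (nonempty : ∀ X → X ∈ Z → ∃ λ x → x ∈ X) where

    private
      singletonDef : Def {1} (λ v → ∃ λ X → X ∈ Z × lookup v (# 0) ≡ upair X X)
      singletonDef = ∃∈ (cst Z) (var (# 1) ≡ᵈ upairᵈ (var (# 0)) (var (# 0)))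

    opaque
      -- Over {X} the graph is a single edge from X to X, so the new cone has at X a strip that is
      -- described without any element of X.
      Z₁ : V
      Z₁ = comp singletonDef (𝒫 Z) []

      ∈Z₁ : ∀ w → w ∈ Z₁ → ∃ λ X → X ∈ Z × w ≡ upair X X
      ∈Z₁ w w∈ = proj₂ (to (∈comp singletonDef w) w∈)

      singleton-∈ : ∀ {X} → X ∈ Z → upair X X ∈ Z₁
      singleton-∈ {X} X∈ = from (∈comp singletonDef _) (from (∈𝒫 _) (λ y y∈ → subst (_∈ Z) (sym ([ id , id ]′ (to (∈upair y) y∈))) X∈) , X , X∈ , refl)

    module S = ConeSpace Z
    module T = ConeSpace Z₁

    trunk : V → ℝ → ℝ → Raw
    trunk X u h = raw (upair X X) X X u h

    collapse : Raw → Raw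
    collapse (raw X x y u h) = trunk X u h

    opaque
      trunk-valid : ∀ {X u h} → X ∈ Z → 0# ≤ u → u ≤ 1# → 0# ≤ h → T.Valid (trunk X u h)
      trunk-valid X∈ a b c = T.valid (ok a b c) (from (∈upair _) (inj₁ refl) , singleton-∈ X∈) (from (∈upair _) (inj₁ refl) , singleton-∈ X∈)

      is-trunk : ∀ {r} → T.Valid r → ∃ λ X → X ∈ Z × r ≡ trunk X (Raw.u r) (Raw.h r)
      is-trunk {raw W x y u h} (T.valid _ (x∈ , W∈) (y∈ , _)) = ∈Z₁ W W∈ |>′ λ { (X , X∈ , refl) →
        X , X∈ , cong₂ (λ a b → raw (upair X X) a b u h) ([ id , id ]′ (to (∈upair x) x∈)) ([ id , id ]′ (to (∈upair y) y∈)) }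

      collapse-valid : ∀ {r} → S.Valid r → T.Valid (collapse r)
      collapse-valid (S.valid (ok a b c) (_ , X∈) _) = trunk-valid X∈ a b c

      -- Every graph distance is at least |u - u′|, and in a single edge it equals |u - u′|.
      collapse-lower : ∀ {r s} → S.Valid r → S.Valid s → δ (collapse r) (collapse s) ≤ δ r s
      collapse-lower {r} {s} vr vs = [
          (λ (e , f) → ≤-trans (δ-direct r₁ s₁ (cong (λ X → upair X X) e)) (≤-trans (add-mono (≤-refl {gap (Raw.h r) (Raw.h s)})
             (≤-trans (≤-reflexive (D-same r₁ s₁ e e)) (D≥gap (S.isOk vr) (S.isOk vs)))) (≤-reflexive (Eq.sym f)))) ,
          (λ f → ≤-trans (δ-base r₁ s₁) (≤-reflexive (Eq.sym f))) ]′ (δ-spec r s)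
        where
        r₁ s₁ : Raw
        r₁ = collapse r
        s₁ = collapse s

      -- Both cones lie over the same tree of rays, which `δ` exceeds by at most 2.
      collapse-upper : ∀ {r s} → S.Valid r → S.Valid s → δ r s ≤ δ (collapse r) (collapse s) + (1# + 1#)
      collapse-upper {r} {s} vr vs = ≤-trans (δ≤τ+2 (S.isOk vr) (S.isOk vs)) (add-mono (≤-trans (eq? (Raw.X r) (Raw.X s)
          (λ e → ≤-reflexive (Eq.trans (τ-eq r s e) (Eq.sym (τ-eq r₁ s₁ (cong (λ X → upair X X) e)))))
          (λ n → ≤-reflexive (Eq.trans (τ-neq r s n) (Eq.sym (τ-neq r₁ s₁ (n ∘ upair-injˡ))))))
          (τ≤δ (T.isOk (collapse-valid vr)) (T.isOk (collapse-valid vs)))) ≤-refl)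
        where
        r₁ s₁ : Raw
        r₁ = collapse r
        s₁ = collapse s

    private
      collapseᵛ : V → V
      collapseᵛ p = encode (collapse (decode p))

      collapseᵈ : ∀ {n} {F : Vec V n → V} → DefT F → DefT (λ v → collapseᵛ (F v))
      collapseᵈ t = codeᵈ (upairᵈ (fstᵈ t) (fstᵈ t)) (fstᵈ t) (fstᵈ t) (termᵈ (toRᵈ (fstᵈ (sndᵈ (sndᵈ t))))) (termᵈ (toRᵈ (sndᵈ (sndᵈ (sndᵈ t)))))

      imageDef : Def {2} (λ v → ∃ λ p → p ∈ lookup v (# 1) × lookup v (# 0) ≡ T.cls (collapseᵛ p))
      imageDef = ∃∈ (var (# 1)) (var (# 1) ≡ᵈ T.clsᵈ (collapseᵈ (var (# 0))))

    opaque
      -- The image of a class is described as the common class of the images of its members.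
      push : V → V
      push c = ⋃ (comp imageDef T.pointSet (c ∷ []))

      pushᵈ : ∀ {n} {F : Vec V n → V} → DefT F → DefT (λ v → push (F v))
      pushᵈ t = ⋃ᵈ (comp₁ᵈ imageDef (cst T.pointSet) t)

      push-cls : ∀ {r} → S.Valid r → push (S.cls (encode r)) ≡ T.cls (encode (collapse r))
      push-cls {r} vr = ⋃-single λ z → mk⇔
        (λ z∈ → proj₂ (to (∈comp imageDef z) z∈) |>′ λ (p , p∈ , e) → trans e (sym (same-class p (proj₁ (to (S.∈cls p) p∈)) (proj₂ (to (S.∈cls p) p∈)))))
        (λ e → from (∈comp imageDef z) (subst (_∈ T.pointSet) (sym e) (T.cls-∈ (T.encode-∈ (collapse-valid vr))) ,
           encode r , from (S.∈cls _) (S.encode-∈ vr , r-r) , trans e (same-class (encode r) (S.encode-∈ vr) r-r)))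
        where
        r-r : dist (encode r) (encode r) ≤ 0#
        r-r = ≤-trans (≤-reflexive (S.dist-encode vr vr)) (≤-reflexive (δ-self (S.isOk vr)))
        same-class : ∀ p → p ∈ S.P → dist (encode r) p ≤ 0# → T.cls (encode (collapse r)) ≡ T.cls (collapseᵛ p)
        same-class p p∈ h = T.cls-≡ (T.encode-∈ (collapse-valid vr)) (T.encode-∈ (collapse-valid (S.P-valid p∈)))
          (≤-trans (≤-reflexive (T.dist-encode (collapse-valid vr) (collapse-valid (S.P-valid p∈))))
            (≤-trans (collapse-lower vr (S.P-valid p∈))
              (≤-trans (≤-reflexive (Eq.sym (S.dist-encode vr (S.P-valid p∈)))) (subst (λ q → dist (encode r) q ≤ 0#) (sym (S.encode-decode p∈)) h))))

      push-∈ : ∀ {c} → c ∈ S.pointSet → push c ∈ T.pointSet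
      push-∈ {c} c∈ = S.normal (c , c∈) |>′ λ (r , vr , e) →
        subst (_∈ T.pointSet) (sym (trans (cong push e) (push-cls vr))) (T.cls-∈ (T.encode-∈ (collapse-valid vr)))

    collapseMap : Map (set S.pointSet) (set T.pointSet)
    collapseMap = lamMap push (pushᵈ (var (# 0))) S.pointSet T.pointSet id id id push-∈

    opaque
      d-collapse : ∀ x y {r s} → S.Valid r → S.Valid s → proj₁ x ≡ S.cls (encode r) → proj₁ y ≡ S.cls (encode s) →
                   T.d (Map.apply collapseMap x) (Map.apply collapseMap y) ≈ δ (collapse r) (collapse s)
      d-collapse x y vr vs e f = T.d-encode (Map.apply collapseMap x) (Map.apply collapseMap y) (collapse-valid vr) (collapse-valid vs)
        (trans (cong push e) (push-cls vr)) (trans (cong push f) (push-cls vs))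

      bounds : ∀ x y → (T.d (Map.apply collapseMap x) (Map.apply collapseMap y) ≤ S.d x y) ×
                       (S.d x y ≤ T.d (Map.apply collapseMap x) (Map.apply collapseMap y) + (1# + 1#))
      bounds x y = S.normal x |>′ λ (r , vr , e) → S.normal y |>′ λ (s , vs , f) →
        ≤-trans (≤-reflexive (d-collapse x y vr vs e f)) (≤-trans (collapse-lower vr vs) (≤-reflexive (Eq.sym (S.d-encode x y vr vs e f)))) ,
        ≤-trans (≤-reflexive (S.d-encode x y vr vs e f)) (≤-trans (collapse-upper vr vs)
          (add-mono (≤-reflexive (Eq.sym (d-collapse x y vr vs e f))) ≤-refl))

      -- An element of X is taken for one point y at a time and only to prove existence; no set is
      -- formed from these elements.
      onto : ∀ y → Image collapseMap y
      onto y = T.normal y |>′ λ (r , vr , e) → is-trunk vr |>′ λ (X , X∈ , t) → nonempty X X∈ |>′ λ (x , x∈) →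
        preimage X X∈ x x∈ r vr t |>′ λ (v , f) → S.pt v , trans (push-cls v) (trans (cong (T.cls ∘ encode) f) (sym e))
        where
        preimage : ∀ X → X ∈ Z → ∀ x → x ∈ X → ∀ r → T.Valid r → r ≡ trunk X (Raw.u r) (Raw.h r) →
               ∃ λ (v : S.Valid (raw X x x (Raw.u r) (Raw.h r))) → trunk X (Raw.u r) (Raw.h r) ≡ r
        preimage X X∈ x x∈ r (T.valid o _ _) t = S.valid (ok (Ok.0≤u o) (Ok.u≤1 o) (Ok.0≤h o)) (x∈ , X∈) (x∈ , X∈) , sym t

      half-≤ : ∀ {c⁻¹} → (1# + 1#) * c⁻¹ ≈ 1# → ∀ a → 0# ≤ a → c⁻¹ * a ≤ a
      half-≤ {c⁻¹} e a h = linarith (c⁻¹ * a ∷ (1# + 1#) * (c⁻¹ * a) ∷ a ∷ [])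
        (λ b t a → (t :≈ b :+ b) ∷ (t :≈ a) ∷ (:0 :≤ a) ∷ [] ⊢ b :≤ a) (1+1-* (c⁻¹ * a) , *-cancel-inverse {1# + 1#} e a , h , tt)

    quasiIsometric : QuasiIsometric S.space T.space
    quasiIsometric = collapseMap , record
      -- The additive error 2 of collapsing dictates N; the factor 2 only weakens the estimates.
      { N = 1# + 1#
      ; N⁻¹ = proj₁ inverse
      ; natural = λ A 0∈ step → subst (_∈ A) (uneq (linarith (1# ∷ []) (λ o → [] ⊢ :0 :+ o :+ o :≈ o :+ o) tt)) (step (0# + 1#) (step 0# 0∈))
      ; 1≤N = unle (linarith (1# ∷ []) (λ o → (:0 :≤ o) ∷ [] ⊢ o :≤ o :+ o) (0≤1 , tt))
      ; inverse = proj₂ inverse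
      ; surjective = λ y → T.B-intro T.pointSet (λ j → mk⇔ (λ _ → proj₂ j) (λ _ → onto j)) y (onto y)
          (≤-trans (≤-reflexive (T.d-zero {y} {y} refl)) (linarith (1# ∷ []) (λ o → (:0 :≤ o) ∷ [] ⊢ :0 :≤ o :+ o) (0≤1 , tt)))
      ; lower = λ x y → unle (linarith (proj₁ inverse * S.d x y ∷ S.d x y ∷ T.d (Map.apply collapseMap x) (Map.apply collapseMap y) ∷ 1# ∷ [])
          (λ a s t o → (a :≤ s) ∷ (s :≤ t :+ (o :+ o)) ∷ [] ⊢ a :- (o :+ o) :≤ t)
          (half-≤ (eq (proj₂ inverse)) (S.d x y) S.d-nonNeg , proj₂ (bounds x y) , tt))
      ; upper = λ x y → unle (linarith (S.d x y ∷ (1# + 1#) * S.d x y ∷ T.d (Map.apply collapseMap x) (Map.apply collapseMap y) ∷ 1# ∷ [])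
          (λ s m t o → (t :≤ s) ∷ (m :≈ s :+ s) ∷ (:0 :≤ s) ∷ (:0 :≤ o) ∷ [] ⊢ t :≤ m :+ (o :+ o))
          (proj₁ (bounds x y) , 1+1-* (S.d x y) , S.d-nonNeg , 0≤1 , tt)) }
      where
      opaque
        inverse : ∃ λ c → (1# + 1#) * c ≈′ 1#
        inverse = invertible (1# + 1#) λ e → 1≰0 (linarith (1# ∷ []) (λ o → (o :+ o :≈ :0) ∷ (:0 :≤ o) ∷ [] ⊢ o :≤ :0) (eq e , 0≤1 , tt))

-- Extraction of a choice set from the inverse quasi-isometry.

module Choosing {ℓ : Level} (em : ExcludedMiddle ℓ) (M : ZFModel ℓ) (𝓡 : Internal.RealNumbers M) where

  open import Data.Fin using (#_)
  open import Data.Vec.Base using (Vec; []; _∷_; lookup)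
  open import Data.List.Base using ([]; _∷_)
  open import Data.Product.Base using (Σ; ∃; _×_; _,_; proj₁; proj₂)
  open import Data.Product using (∃!)
  open import Data.Sum.Base using ([_,_]′)
  open import Data.Unit.Polymorphic.Base using (tt)
  open import Function.Base using (_∘_; _|>′_)
  open import Relation.Binary.PropositionalEquality using (_≡_; _≢_; refl; sym; trans; cong; subst; subst₂)
  open import Relation.Nullary using (¬_; yes; no; contradiction)
  open import Relation.Nullary.Decidable using (decidable-stable)
  open DefinablePredicates em M
  open Sets em M
  open OrderedField em M 𝓡
  open MetricSpaces em M 𝓡
  open Cones em M 𝓡
  open Collapsing em M 𝓡
  open Internal M using (set; El; Map; Image) renaming (_≈_ to _≈′_)

  module QuasiIsometryBounds (S T : MetricSpace) (g : Map (set (MetricSpace.points S)) (set (MetricSpace.points T)))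
                             (qi : IsQuasiIsometry S T g) where
    open IsQuasiIsometry qi
    private
      module S = MetricSpace S
      module T = MetricSpace T

    opaque
      0≤N : 0# ≤ N
      0≤N = ≤-trans 0≤1 (le 1≤N)

      upper-bound : ∀ x y {K} → S.d x y ≤ K → T.d (Map.apply g x) (Map.apply g y) ≤ N * K + N
      upper-bound x y h = ≤-trans (le (upper x y)) (add-mono (*-monoʳ-≤ 0≤N h) ≤-refl)

      lower-bound : ∀ x y {K} → T.d (Map.apply g x) (Map.apply g y) ≤ K → S.d x y ≤ N * K + N * N
      lower-bound x y {K} h = ≤-trans (≤-reflexive (Eq.sym (*-cancel-inverse (eq inverse) (S.d x y))))
        (≤-trans (*-monoʳ-≤ 0≤N (linarith (N⁻¹ * S.d x y ∷ N ∷ T.d (Map.apply g x) (Map.apply g y) ∷ K ∷ [])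
            (λ a n t k → (a :- n :≤ t) ∷ (t :≤ k) ∷ [] ⊢ a :≤ k :+ n) (le (lower x y) , h , tt)))
          (≤-reflexive (*-distribˡ-+ N K N)))

  module ChoiceFunction (Z : V) (nonempty : ∀ X → X ∈ Z → ∃ λ x → x ∈ X)
    (disjoint : ∀ X Y → X ∈ Z → Y ∈ Z → X ≢ Y → ¬ (∃ λ x → x ∈ X × x ∈ Y)) (X₀ : V) (X₀∈ : X₀ ∈ Z)
    (g : Map (set (ConeSpace.pointSet (Collapse.Z₁ Z nonempty))) (set (ConeSpace.pointSet Z)))
    (qi : IsQuasiIsometry (ConeSpace.space (Collapse.Z₁ Z nonempty)) (ConeSpace.space Z) g) where

    open Collapse Z nonempty
    open IsQuasiIsometry qi using (N)
    open QuasiIsometryBounds T.space S.space g qi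

    private
      0u : 0# ≤ 0#
      0u = ≤-refl

    -- The side u = 0 of the strip at X serves as its ray.
    trunkPoint : ∀ X (h : ℝ) → X ∈ Z → 0# ≤ h → T.Point
    trunkPoint X h X∈ 0≤h = T.pt (trunk-valid {X} {0#} {h} X∈ 0u 0≤1 0≤h)

    image : ∀ X (h : ℝ) → X ∈ Z → 0# ≤ h → S.Point
    image X h X∈ 0≤h = Map.apply g (trunkPoint X h X∈ 0≤h)

    opaque
      d-trunk : ∀ {X h X′ h′} (X∈ : X ∈ Z) (0≤h : 0# ≤ h) (X′∈ : X′ ∈ Z) (0≤h′ : 0# ≤ h′) →
                T.d (trunkPoint X h X∈ 0≤h) (trunkPoint X′ h′ X′∈ 0≤h′) ≈ δ (trunk X 0# h) (trunk X′ 0# h′)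
      d-trunk {X} {h} {X′} {h′} X∈ 0≤h X′∈ 0≤h′ = T.d-encode (trunkPoint X h X∈ 0≤h) (trunkPoint X′ h′ X′∈ 0≤h′)
        (trunk-valid X∈ 0u 0≤1 0≤h) (trunk-valid X′∈ 0u 0≤1 0≤h′) refl refl

      member : ∀ (x : S.Point) {p} → p ∈ proj₁ x → S.Valid (decode p) × proj₁ x ≡ S.cls (encode (decode p))
      member x {p} p∈ = S.normal x |>′ λ (r , vr , e) → to (S.∈cls p) (subst (p ∈_) e p∈) |>′ λ (p∈P , h) →
        S.P-valid p∈P , trans e (trans (S.cls-≡ (S.encode-∈ vr) p∈P h) (cong S.cls (sym (S.encode-decode p∈P))))

      inhabitant : ∀ (x : S.Point) → ∃ λ p → p ∈ proj₁ x
      inhabitant x = S.normal x |>′ λ (r , vr , e) → encode r , subst (encode r ∈_) (sym e)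
        (from (S.∈cls _) (S.encode-∈ vr , ≤-trans (≤-reflexive (S.dist-encode vr vr)) (≤-reflexive (δ-self (S.isOk vr)))))

      d-member : ∀ (x y : S.Point) {p q} → p ∈ proj₁ x → q ∈ proj₁ y → S.d x y ≈ δ (decode p) (decode q)
      d-member x y p∈ q∈ = S.d-encode x y (proj₁ (member x p∈)) (proj₁ (member y q∈)) (proj₂ (member x p∈)) (proj₂ (member y q∈))

    H : V → ℝ
    H p = toR (hᵛ p)

    opaque
      base : S.Point
      base = image X₀ 0# X₀∈ ≤-refl
      base≡ : base ≡ image X₀ 0# X₀∈ ≤-refl
      base≡ = refl
      -- The height at which the apex of the singleton cone lands. It is read off a representative
      -- once and enters the formulas as a constant.
      h₀ : ℝ
      h₀ = H (proj₁ (inhabitant base))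
      h₀≡ : h₀ ≡ H (proj₁ (inhabitant base))
      h₀≡ = refl

    -- `E`: coarse surjectivity reaches a point within N + 1, and moving its preimage to the side u
    -- = 0 costs N · 1 + N more. `K`: two images over the same Y with heights within E of H₀ are at
    -- distance at most 2E + 2. `L`: their preimages are then within N K + N². `W`: preimages that
    -- close to the apex have images within N L + N of the image of the apex. `H₀` exceeds h₀ + W by
    -- E, so that such images are too low, and by N · 1 + N + 1, so that the infimum still lands
    -- away from the apex.
    E K L W H₀ : ℝ
    E = (N + 1#) + (N * 1# + N)
    K = (E + E) + (1# + 1#)
    L = N * K + N * N
    W = N * L + N
    H₀ = h₀ + (W + (E + ((N * 1# + N) + 1#)))

    opaque
      0≤N1 : 0# ≤ N * 1#
      0≤N1 = ≤-trans 0≤N (≤-reflexive (Eq.sym (*-oneʳ N)))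
      0≤E : 0# ≤ E
      0≤E = linarith (N ∷ 1# ∷ N * 1# ∷ []) (λ n o m → (:0 :≤ n) ∷ (:0 :≤ o) ∷ (:0 :≤ m) ∷ [] ⊢ :0 :≤ (n :+ o) :+ (m :+ n)) (0≤N , 0≤1 , 0≤N1 , tt)
      0≤h₀ : 0# ≤ h₀
      0≤h₀ = subst (0# ≤_) (sym h₀≡) (Ok.0≤h (S.isOk (proj₁ (member base (proj₂ (inhabitant base))))))
      0≤N* : ∀ {a} → 0# ≤ a → 0# ≤ N * a
      0≤N* {a} h = ≤-trans (linarith (N * 0# ∷ []) (λ z → (z :≈ :0) ∷ [] ⊢ :0 :≤ z) (N*0 , tt)) (*-monoʳ-≤ 0≤N h)
        where
        N*0 : N * 0# ≈ 0#
        N*0 = linarith (N * 0# ∷ N * (0# + 0#) ∷ []) (λ a b → (b :≈ a :+ a) ∷ (a :≈ b) ∷ [] ⊢ a :≈ :0)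
          (*-distribˡ-+ N 0# 0# , antisym (*-monoʳ-≤ 0≤N (linarith {n = 0} [] ([] ⊢ :0 :≤ :0 :+ :0) tt)) (*-monoʳ-≤ 0≤N (linarith {n = 0} [] ([] ⊢ :0 :+ :0 :≤ :0) tt)) , tt)
      0≤K : 0# ≤ K
      0≤K = linarith (E ∷ 1# ∷ []) (λ e o → (:0 :≤ e) ∷ (:0 :≤ o) ∷ [] ⊢ :0 :≤ (e :+ e) :+ (o :+ o)) (0≤E , 0≤1 , tt)
      0≤L : 0# ≤ L
      0≤L = ≤-trans (linarith {n = 0} [] ([] ⊢ :0 :≤ :0 :+ :0) tt) (add-mono (0≤N* 0≤K) (0≤N* 0≤N))
      0≤W : 0# ≤ W
      0≤W = ≤-trans (linarith {n = 0} [] ([] ⊢ :0 :≤ :0 :+ :0) tt) (add-mono (0≤N* 0≤L) 0≤N)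
      0≤H₀ : 0# ≤ H₀
      0≤H₀ = linarith (h₀ ∷ W ∷ E ∷ N * 1# ∷ N ∷ 1# ∷ []) (λ h w e m n o → (:0 :≤ h) ∷ (:0 :≤ w) ∷ (:0 :≤ e) ∷ (:0 :≤ m) ∷ (:0 :≤ n) ∷ (:0 :≤ o) ∷ [] ⊢
        :0 :≤ h :+ (w :+ (e :+ ((m :+ n) :+ o)))) (0≤h₀ , 0≤W , 0≤E , 0≤N1 , 0≤N , 0≤1 , tt)

    imageᵛ : V → V → V
    imageᵛ X h = Map.graph g ‵ T.cls (code (upair X X) X X (proj₁ 0#) h)

    opaque
      image-value : ∀ X h X∈ 0≤h → imageᵛ X (proj₁ h) ≡ proj₁ (image X h X∈ 0≤h)
      image-value X h X∈ 0≤h = MapProperties.apply-‵ g (proj₂ (trunkPoint X h X∈ 0≤h))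

    Lands : V → V → Set ℓ
    Lands Y p = fst p ≡ Y × gap (H p) H₀ ≤ E

    -- The image is a class of codes; the condition concerns some code p in it, whose coordinates
    -- give the height and the member of Z below.
    Good : V → V → V → Set ℓ
    Good Y X h = 0# ≤ toR h × ∃ λ p → p ∈ imageᵛ X h × Lands Y p

    goodᵈ : ∀ {n} {F G J : Vec V n → V} → DefT F → DefT G → DefT J → Def (λ v → Good (F v) (G v) (J v))
    goodᵈ Y X h = (cstR 0# ≤ᵈ toRᵈ h) ×ᵈ ∃∈ (‵ᵈ (cst (Map.graph g)) (T.clsᵈ (codeᵈ (upairᵈ X X) X X (cst (proj₁ 0#)) h)))
      ((fstᵈ (var (# 0)) ≡ᵈ wkT Y) ×ᵈ (gapᵈ (toRᵈ (sndᵈ (sndᵈ (sndᵈ (var (# 0)))))) (cstR H₀) ≤ᵈ cstR E))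

    opaque
      toR-nonNeg : ∀ (h : ℝ) → 0# ≤ toR (proj₁ h) → 0# ≤ h
      toR-nonNeg h p = ≤-trans p (≤-reflexive (toR-ℝ h))

      -- The target is the point at height H₀ over an element of Y. Some image is within N + 1 of
      -- it, and sliding the preimage to u = 0 keeps the image within E. So close to the target it
      -- must lie over Y, since the route through the apex costs at least H₀.
      good-exists : ∀ Y → Y ∈ Z → ∃ λ X → X ∈ Z × ∃ λ (h : ℝ) → Good Y X (proj₁ h)
      good-exists Y Y∈ = nonempty Y Y∈ |>′ λ (y , y∈) → start y y∈
        where
        start : ∀ y → y ∈ Y → ∃ λ X → X ∈ Z × ∃ λ (h : ℝ) → Good Y X (proj₁ h)
        start y y∈ = T.normal t |>′ λ (r , vr , e) → is-trunk vr |>′ λ (X , X∈ , f) → found r vr e X X∈ f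
          where
          v : S.Valid (raw Y y y 0# H₀)
          v = S.valid (ok ≤-refl 0≤1 0≤H₀) (y∈ , Y∈) (y∈ , Y∈)
          q : S.Point
          q = S.pt v
          hit : ∃ λ j → Image g j × S.d q j ≤ N + 1#
          hit = S.B-elim q (IsQuasiIsometry.surjective qi q)
          t : T.Point
          t = proj₁ (proj₁ (proj₂ hit))
          found : ∀ r → T.Valid r → proj₁ t ≡ T.cls (encode r) → ∀ X → X ∈ Z → r ≡ trunk X (Raw.u r) (Raw.h r) →
                  ∃ λ X → X ∈ Z × ∃ λ (h : ℝ) → Good Y X (proj₁ h)
          found r vr e X X∈ f = X , X∈ , h , ≤-trans 0≤h (≤-reflexive (Eq.sym (toR-ℝ h))) ,
              p , subst (p ∈_) (sym (image-value X h X∈ 0≤h)) p∈ , same-Y , near-H₀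
            where
            u h : ℝ
            u = Raw.u r
            h = Raw.h r
            o : Ok r
            o = T.isOk vr
            0≤h : 0# ≤ h
            0≤h = Ok.0≤h o
            t₀ : T.Point
            t₀ = trunkPoint X h X∈ 0≤h
            t-t₀ : T.d t t₀ ≤ 1#
            t-t₀ = ≤-trans (≤-reflexive (T.d-encode t t₀ vr (trunk-valid X∈ 0u 0≤1 0≤h) e refl))
              (subst (λ s → δ s (trunk X 0# h) ≤ 1#) (sym f) (≤-trans (move-u (upair X X) X X u 0# h)
                (gap-≤ (linarith (u ∷ 1# ∷ []) (λ u o → (u :≤ o) ∷ [] ⊢ u :- :0 :≤ o) (Ok.u≤1 o , tt))
                       (linarith (u ∷ 1# ∷ []) (λ u o → (:0 :≤ u) ∷ (:0 :≤ o) ∷ [] ⊢ :0 :- u :≤ o) (Ok.0≤u o , 0≤1 , tt)))))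
            x : S.Point
            x = image X h X∈ 0≤h
            q-x : S.d q x ≤ E
            q-x = ≤-trans (S.d-triangle q (Map.apply g t) x) (add-mono
              (≤-trans (≤-reflexive (S.d-cong {q} {q} {Map.apply g t} {proj₁ hit} refl (proj₂ (proj₁ (proj₂ hit))))) (proj₂ (proj₂ hit)))
              (upper-bound t t₀ t-t₀))
            p : V
            p = proj₁ (inhabitant x)
            p∈ : p ∈ proj₁ x
            p∈ = proj₂ (inhabitant x)
            vp : S.Valid (decode p)
            vp = proj₁ (member x p∈)
            δ≤E : δ (raw Y y y 0# H₀) (decode p) ≤ E
            δ≤E = ≤-trans (≤-reflexive (Eq.sym (S.d-encode q x v vp refl (proj₂ (member x p∈))))) q-x
            near-H₀ : gap (H p) H₀ ≤ E
            near-H₀ = ≤-trans (gap-sym (H p) H₀) (≤-trans (δ≥gap (S.isOk v) (S.isOk vp)) δ≤E)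
            same-Y : fst p ≡ Y
            same-Y = decidable-stable em λ n → 1≰0 (linarith (δ (raw Y y y 0# H₀) (decode p) ∷ E ∷ H p ∷ h₀ ∷ W ∷ N * 1# ∷ N ∷ 1# ∷ [])
              (λ d e k h w m n o → (d :≤ e) ∷ (d :≈ (h :+ (w :+ (e :+ ((m :+ n) :+ o)))) :+ k) ∷ (:0 :≤ k) ∷ (:0 :≤ h) ∷ (:0 :≤ w) ∷ (:0 :≤ m) ∷ (:0 :≤ n) ∷ [] ⊢ o :≤ :0)
              (δ≤E , δ-apart (raw Y y y 0# H₀) (decode p) (n ∘ sym) , Ok.0≤h (S.isOk vp) , 0≤h₀ , 0≤W , 0≤N1 , 0≤N , tt))

      good-data : ∀ {Y X} (h : ℝ) (X∈ : X ∈ Z) → Good Y X (proj₁ h) →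
                  Σ (0# ≤ h) λ 0≤h → ∃ λ p → p ∈ proj₁ (image X h X∈ 0≤h) × Lands Y p
      good-data {Y} {X} h X∈ (0≤ , p , p∈ , l) = toR-nonNeg h 0≤ , p , subst (p ∈_) (image-value X h X∈ (toR-nonNeg h 0≤)) p∈ , l

      -- Two good images over Y are within K, so the preimages are within L. On different rays the
      -- latter distance is h + h′, so h ≤ L; then the image of the first point is within W of that
      -- of the apex, at height at most h₀ + W, below the range that `Lands` allows.
      good-unique : ∀ {Y X X′} → X ∈ Z → X′ ∈ Z → ∀ (h h′ : ℝ) → Good Y X (proj₁ h) → Good Y X′ (proj₁ h′) → X ≡ X′
      good-unique {Y} {X} {X′} X∈ X′∈ h h′ G G′ = good-data h X∈ G |>′ λ (0≤h , p , p∈ , l) → good-data h′ X′∈ G′ |>′ λ (0≤h′ , p′ , p′∈ , l′) →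
        go 0≤h p p∈ l 0≤h′ p′ p′∈ l′
        where
        go : ∀ 0≤h p → p ∈ proj₁ (image X h X∈ 0≤h) → Lands Y p → ∀ 0≤h′ p′ → p′ ∈ proj₁ (image X′ h′ X′∈ 0≤h′) → Lands Y p′ → X ≡ X′
        go 0≤h p p∈ (p-Y , p-H) 0≤h′ p′ p′∈ (p′-Y , p′-H) = decidable-stable em λ n →
            1≰0 (linarith (H p ∷ h₀ ∷ W ∷ E ∷ N * 1# ∷ N ∷ 1# ∷ gap (H p) H₀ ∷ gap (H p) h₀ ∷ [])
              (λ k h w e m n o γ γ′ → (h :+ (w :+ (e :+ ((m :+ n) :+ o))) :- k :≤ γ) ∷ (γ :≤ e) ∷ (k :- h :≤ γ′) ∷ (γ′ :≤ w) ∷ (:0 :≤ m) ∷ (:0 :≤ n) ∷ [] ⊢ o :≤ :0)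
              (gap-≥ʳ (H p) H₀ , p-H , gap-≥ˡ (H p) h₀ , near-base n , 0≤N1 , 0≤N , tt))
          where
          x x′ : S.Point
          x = image X h X∈ 0≤h
          x′ = image X′ h′ X′∈ 0≤h′
          t t′ : T.Point
          t = trunkPoint X h X∈ 0≤h
          t′ = trunkPoint X′ h′ X′∈ 0≤h′
          vp : S.Valid (decode p)
          vp = proj₁ (member x p∈)
          vp′ : S.Valid (decode p′)
          vp′ = proj₁ (member x′ p′∈)
          close : S.d x x′ ≤ K
          close = ≤-trans (≤-reflexive (d-member x x′ p∈ p′∈)) (≤-trans (δ≤τ+2 (S.isOk vp) (S.isOk vp′))
            (add-mono (≤-trans (≤-reflexive (τ-eq (decode p) (decode p′) (trans p-Y (sym p′-Y))))
               (≤-trans (gap-triangle (H p) H₀ (H p′)) (add-mono p-H (≤-trans (gap-sym H₀ (H p′)) p′-H)))) ≤-refl))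
          h≤L : X ≢ X′ → h ≤ L
          h≤L n = linarith (T.d t t′ ∷ δ (trunk X 0# h) (trunk X′ 0# h′) ∷ h ∷ h′ ∷ L ∷ [])
            (λ d e h h′ l → (d :≤ l) ∷ (d :≈ e) ∷ (e :≈ h :+ h′) ∷ (:0 :≤ h′) ∷ [] ⊢ h :≤ l)
            (lower-bound t t′ close , d-trunk X∈ 0≤h X′∈ 0≤h′ , δ-apart (trunk X 0# h) (trunk X′ 0# h′) (n ∘ upair-injˡ) , 0≤h′ , tt)
          t-base : X ≢ X′ → T.d t (trunkPoint X₀ 0# X₀∈ ≤-refl) ≤ L
          t-base n = linarith (T.d t (trunkPoint X₀ 0# X₀∈ ≤-refl) ∷ δ (trunk X 0# h) (trunk X₀ 0# 0#) ∷ h ∷ L ∷ [])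
            (λ d e h l → (d :≈ e) ∷ (e :≤ h :+ :0) ∷ (h :≤ l) ∷ [] ⊢ d :≤ l)
            (d-trunk X∈ 0≤h X₀∈ ≤-refl , δ-base (trunk X 0# h) (trunk X₀ 0# 0#) , h≤L n , tt)
          near-base : X ≢ X′ → gap (H p) h₀ ≤ W
          near-base n = subst (λ z → gap (H p) z ≤ W) (sym h₀≡)
            (≤-trans (δ≥gap (S.isOk vp) (S.isOk (proj₁ (member base (proj₂ (inhabitant base))))))
              (≤-trans (≤-reflexive (Eq.sym (d-member x base p∈ (proj₂ (inhabitant base)))))
                (subst (λ b → S.d x b ≤ W) (sym base≡) (upper-bound t (trunkPoint X₀ 0# X₀∈ ≤-refl) (t-base n)))))

    -- The infimum of the good heights, with quantifiers bounded by the carrier so that it is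
    -- expressed by a formula.
    Least : V → V → V → Set ℓ
    Least Y X m = (∀ h → h ∈ carrier → Good Y X h → toR m ≤ toR h) ×
                  (∀ b → b ∈ carrier → (∀ h → h ∈ carrier → Good Y X h → toR b ≤ toR h) → toR b ≤ toR m)

    leastᵈ : ∀ {n} {F G J : Vec V n → V} → DefT F → DefT G → DefT J → Def (λ v → Least (F v) (G v) (J v))
    leastᵈ Y X m = ∀∈ (cst carrier) (goodᵈ (wkT Y) (wkT X) (var (# 0)) →ᵈ (toRᵈ (wkT m) ≤ᵈ toRᵈ (var (# 0)))) ×ᵈ
      ∀∈ (cst carrier) (∀∈ (cst carrier) (goodᵈ (wkT (wkT Y)) (wkT (wkT X)) (var (# 0)) →ᵈ (toRᵈ (var (# 1)) ≤ᵈ toRᵈ (var (# 0))))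
                        →ᵈ (toRᵈ (var (# 0)) ≤ᵈ toRᵈ (wkT m)))

    opaque
      least-exists : ∀ {Y X} (h : ℝ) → Good Y X (proj₁ h) → ∃ λ (m : ℝ) → Least Y X (proj₁ m)
      least-exists {Y} {X} h G = proj₁ inf , lower , greatest
        where
        P : Vec V 1 → Set ℓ
        P v = Good Y X (lookup v (# 0))
        Pᵈ : Def P
        Pᵈ = goodᵈ (cst Y) (cst X) (var (# 0))
        inf : ∃ λ r → IsInfimum (λ x → P (proj₁ x ∷ [])) r
        inf = infimum Pᵈ 0# (λ x G → toR-nonNeg x (proj₁ G)) (h , G)
        m : ℝ
        m = proj₁ inf
        lower : ∀ h → h ∈ carrier → Good Y X h → toR (proj₁ m) ≤ toR h
        lower h h∈ G = ≤-trans (≤-reflexive (toR-ℝ m)) (≤-trans (le {m} {h , h∈} (proj₁ (proj₂ inf) (h , h∈) G)) (≤-reflexive (Eq.sym (toR-ℝ (h , h∈)))))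
        greatest : ∀ b → b ∈ carrier → (∀ h → h ∈ carrier → Good Y X h → toR b ≤ toR h) → toR b ≤ toR (proj₁ m)
        greatest b b∈ b-lower = ≤-trans (≤-reflexive (toR-ℝ (b , b∈))) (≤-trans (le {b , b∈} {m} (proj₂ (proj₂ inf) (b , b∈) λ x Gx →
           unle {b , b∈} {x} (≤-trans (≤-reflexive (Eq.sym (toR-ℝ (b , b∈)))) (≤-trans (b-lower (proj₁ x) (proj₂ x) Gx) (≤-reflexive (toR-ℝ x))))))
           (≤-reflexive (Eq.sym (toR-ℝ m))))

      least-unique : ∀ {Y X} (m m′ : ℝ) → Least Y X (proj₁ m) → Least Y X (proj₁ m′) → m ≈ m′
      least-unique m m′ (l , g) (l′ , g′) = Eq.trans (Eq.sym (toR-ℝ m)) (Eq.trans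
        (antisym (g′ (proj₁ m) (proj₂ m) l) (g (proj₁ m′) (proj₂ m′) l′)) (toR-ℝ m′))

      -- The infimum m need not be good, but some good height is at most m + 1, and the two images
      -- are within N · 1 + N. The good image lies higher above the apex than that, so the image at
      -- m stays over Y and off the apex.
      least-lands : ∀ {Y X} (X∈ : X ∈ Z) (h : ℝ) → Good Y X (proj₁ h) → ∀ (m : ℝ) → Least Y X (proj₁ m) →
                    Σ (0# ≤ m) λ 0≤m → ∀ p → p ∈ proj₁ (image X m X∈ 0≤m) → fst p ≡ Y × ¬ H p ≤ 0#
      least-lands {Y} {X} X∈ h₁ G₁ m (lower , greatest) = 0≤m , lands
        where
        0≤m : 0# ≤ m
        0≤m = ≤-trans (≤-trans (≤-reflexive (Eq.sym (toR-ℝ 0#))) (greatest (proj₁ 0#) (proj₂ 0#) λ h h∈ (p , _) → ≤-trans (≤-reflexive (toR-ℝ 0#)) p)) (≤-reflexive (toR-ℝ m))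
        witness : ∃ λ (h : ℝ) → Good Y X (proj₁ h) × h ≤ m + 1#
        -- Otherwise m + 1 would be a lower bound of the good heights, although m is the greatest
        -- one.
        witness = decidable-stable em λ none → 1≰0 (linarith (m ∷ 1# ∷ toR (proj₁ (m + 1#)) ∷ toR (proj₁ m) ∷ [])
          (λ m o a b → (a :≤ b) ∷ (a :≈ m :+ o) ∷ (b :≈ m) ∷ [] ⊢ o :≤ :0)
          (greatest (proj₁ (m + 1#)) (proj₂ (m + 1#)) (λ h h∈ G → ≤-trans (≤-reflexive (toR-ℝ (m + 1#)))
             (≤-trans (<⇒≤ λ k → none ((h , h∈) , G , k)) (≤-reflexive (Eq.sym (toR-ℝ (h , h∈)))))) , toR-ℝ (m + 1#) , toR-ℝ m , tt))
        lands : ∀ p → p ∈ proj₁ (image X m X∈ 0≤m) → fst p ≡ Y × ¬ H p ≤ 0#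
        lands p p∈ = witness |>′ λ (h , G , h≤) → good-data h X∈ G |>′ λ (0≤h , q , q∈ , q-Y , q-H) → go h h≤ G 0≤h q q∈ q-Y q-H
          where
          go : ∀ h → h ≤ m + 1# → Good Y X (proj₁ h) → ∀ 0≤h q → q ∈ proj₁ (image X h X∈ 0≤h) → fst q ≡ Y → gap (H q) H₀ ≤ E → fst p ≡ Y × ¬ H p ≤ 0#
          go h h≤ G 0≤h q q∈ q-Y q-H = decidable-stable em (λ n → 1≰0 (linarith (δ (decode p) (decode q) ∷ H p ∷ H q ∷ gap (H q) H₀ ∷ h₀ ∷ W ∷ E ∷ N * 1# ∷ N ∷ 1# ∷ [])
                (λ d k k′ γ h w e a n o → (d :≤ a :+ n) ∷ (d :≈ k :+ k′) ∷ (:0 :≤ k) ∷ (h :+ (w :+ (e :+ ((a :+ n) :+ o))) :- k′ :≤ γ) ∷ (γ :≤ e) ∷ (:0 :≤ h) ∷ (:0 :≤ w) ∷ [] ⊢ o :≤ :0)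
                (close , δ-apart (decode p) (decode q) (λ e → n (trans e q-Y)) , Ok.0≤h (S.isOk vp) , gap-≥ʳ (H q) H₀ , q-H , 0≤h₀ , 0≤W , tt)))
            , (λ Hp≤0 → 1≰0 (linarith (δ (decode p) (decode q) ∷ gap (H p) (H q) ∷ H p ∷ H q ∷ gap (H q) H₀ ∷ h₀ ∷ W ∷ E ∷ N * 1# ∷ N ∷ 1# ∷ [])
                (λ d c k k′ γ h w e a n o → (d :≤ a :+ n) ∷ (c :≤ d) ∷ (k′ :- k :≤ c) ∷ (k :≤ :0) ∷ (h :+ (w :+ (e :+ ((a :+ n) :+ o))) :- k′ :≤ γ) ∷ (γ :≤ e) ∷ (:0 :≤ h) ∷ (:0 :≤ w) ∷ [] ⊢ o :≤ :0)
                (close , δ≥gap (S.isOk vp) (S.isOk vq) , gap-≥ʳ (H p) (H q) , Hp≤0 , gap-≥ʳ (H q) H₀ , q-H , 0≤h₀ , 0≤W , tt)))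
            where
            x y : S.Point
            x = image X m X∈ 0≤m
            y = image X h X∈ 0≤h
            vp : S.Valid (decode p)
            vp = proj₁ (member x p∈)
            vq : S.Valid (decode q)
            vq = proj₁ (member y q∈)
            m≤h : m ≤ h
            m≤h = ≤-trans (≤-reflexive (Eq.sym (toR-ℝ m))) (≤-trans (lower (proj₁ h) (proj₂ h) G) (≤-reflexive (toR-ℝ h)))
            t-close : T.d (trunkPoint X m X∈ 0≤m) (trunkPoint X h X∈ 0≤h) ≤ 1#
            t-close = ≤-trans (≤-reflexive (d-trunk X∈ 0≤m X∈ 0≤h)) (≤-trans (move-h (upair X X) X X 0# m h)
              (gap-≤ (linarith (m ∷ h ∷ 1# ∷ []) (λ m h o → (m :≤ h) ∷ (:0 :≤ o) ∷ [] ⊢ m :- h :≤ o) (m≤h , 0≤1 , tt))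
                     (linarith (m ∷ h ∷ 1# ∷ []) (λ m h o → (h :≤ m :+ o) ∷ [] ⊢ h :- m :≤ o) (h≤ , tt))))
            close : δ (decode p) (decode q) ≤ N * 1# + N
            close = ≤-trans (≤-reflexive (Eq.sym (d-member x y p∈ q∈))) (upper-bound (trunkPoint X m X∈ 0≤m) (trunkPoint X h X∈ 0≤h) t-close)

    -- Away from the apex a point determines the initial vertex x of its edge, except at the terminal vertex y itself.
    label : V → V
    label p = ⟪ em {uᵛ p ≡ proj₁ 1#} ⟫ (snd (fst (snd p))) (fst (fst (snd p)))

    opaque
      labelᵈ : ∀ {n} {F : Vec V n → V} → DefT F → DefT (λ v → label (F v))
      labelᵈ t = iteᵈ (fstᵈ (sndᵈ (sndᵈ t)) ≡ᵈ cst (proj₁ 1#)) (sndᵈ (fstᵈ (sndᵈ t))) (fstᵈ (fstᵈ (sndᵈ t)))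

      label-∈ : ∀ {p} → S.Valid (decode p) → label p ∈ fst p
      label-∈ {p} (S.valid _ (x∈ , _) (y∈ , _)) with em {uᵛ p ≡ proj₁ 1#}
      ... | yes _ = y∈
      ... | no  _ = x∈

      -- Positive height excludes the route through the apex, so `D` vanishes and the parameters u
      -- agree. Then α ≤ D forces equal x unless u = 1, and β ≤ D forces equal y if u = 1; these are
      -- the two cases of `label`.
      label-unique : ∀ (x : S.Point) {p q} → p ∈ proj₁ x → q ∈ proj₁ x → ¬ H p ≤ 0# → label p ≡ label q
      label-unique x {p} {q} p∈ q∈ H>0 = [ (λ (_ , e) → along e) , (λ e → contradiction (≤-trans (linarith (H p ∷ H q ∷ δ r s ∷ [])
          (λ a b d → (d :≈ a :+ b) ∷ (d :≤ :0) ∷ (:0 :≤ b) ∷ [] ⊢ a :≤ :0) (e , δ≤0 , Ok.0≤h os , tt)) ≤-refl) H>0) ]′ (δ-spec r s)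
        where
        r s : Raw
        r = decode p
        s = decode q
        or : Ok r
        or = S.isOk (proj₁ (member x p∈))
        os : Ok s
        os = S.isOk (proj₁ (member x q∈))
        δ≤0 : δ r s ≤ 0#
        δ≤0 = ≤-trans (≤-reflexive (Eq.sym (d-member x x p∈ q∈))) (≤-reflexive (S.d-zero {x} {x} refl))
        u-carrier : ∀ {p} → p ∈ proj₁ x → uᵛ p ∈ carrier
        u-carrier {p} p∈ = S.normal x |>′ λ (r , _ , e) → S.u-∈ (proj₁ (to (S.∈cls p) (subst (p ∈_) e p∈)))
        along : δ r s ≈ gap (H p) (H q) + D r s → label p ≡ label q
        along e = cases
          where
          D≤0 : D r s ≤ 0#
          D≤0 = linarith (δ r s ∷ gap (H p) (H q) ∷ D r s ∷ []) (λ d g D → (d :≈ g :+ D) ∷ (d :≤ :0) ∷ (:0 :≤ g) ∷ [] ⊢ D :≤ :0) (e , δ≤0 , gap-nonNeg (H p) (H q) , tt)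
          u v : ℝ
          u = toR (uᵛ p)
          v = toR (uᵛ q)
          u≈v : u ≈ v
          u≈v = antisym
            (linarith (u ∷ v ∷ gap u v ∷ D r s ∷ []) (λ u v g D → (u :- v :≤ g) ∷ (g :≤ D) ∷ (D :≤ :0) ∷ [] ⊢ u :≤ v) (gap-≥ˡ u v , D≥gap or os , D≤0 , tt))
            (linarith (u ∷ v ∷ gap u v ∷ D r s ∷ []) (λ u v g D → (v :- u :≤ g) ∷ (g :≤ D) ∷ (D :≤ :0) ∷ [] ⊢ v :≤ u) (gap-≥ʳ u v , D≥gap or os , D≤0 , tt))
          u≡v : uᵛ p ≡ uᵛ q
          u≡v = trans (sym (toR-∈ (u-carrier p∈))) (trans (uneq u≈v) (toR-∈ (u-carrier q∈)))
          x≡ : uᵛ p ≢ proj₁ 1# → fst (fst (snd p)) ≡ fst (fst (snd q))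
          x≡ n = decidable-stable em λ m → n (trans (sym (toR-∈ (u-carrier p∈))) (uneq (antisym (Ok.u≤1 or)
            (linarith (u ∷ v ∷ 1# ∷ α r s ∷ D r s ∷ []) (λ u v o a D → (a :≈ o :+ o :- (u :+ v)) ∷ (a :≤ D) ∷ (D :≤ :0) ∷ (v :≤ o) ∷ [] ⊢ o :≤ u)
              (α-neq r s m , D≥α or os , D≤0 , Ok.u≤1 os , tt)))))
          y≡ : uᵛ p ≡ proj₁ 1# → snd (fst (snd p)) ≡ snd (fst (snd q))
          y≡ k = decidable-stable em λ m → 1≰0 (linarith (u ∷ v ∷ 1# ∷ β r s ∷ D r s ∷ [])
            (λ u v o b D → (b :≈ u :+ v) ∷ (b :≤ D) ∷ (D :≤ :0) ∷ (:0 :≤ v) ∷ (u :≈ o) ∷ [] ⊢ o :≤ :0)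
            (β-neq r s m , D≥β or os , D≤0 , Ok.0≤u os , Eq.trans (eq (cong (λ z → proj₁ (toR z)) k)) (toR-ℝ 1#) , tt))
          cases : label p ≡ label q
          cases with em {uᵛ p ≡ proj₁ 1#} | em {uᵛ q ≡ proj₁ 1#}
          ... | yes a | yes b = y≡ a
          ... | yes a | no  b = contradiction (trans (sym u≡v) a) b
          ... | no  a | yes b = contradiction (trans u≡v b) a
          ... | no  a | no  b = x≡ a

    -- A formula in Y and z with fixed parameters. The ray X and the infimum m are unique and the
    -- label does not depend on p, so z is determined by Y.
    Chosen : V → V → Set ℓ
    Chosen Y z = ∃ λ X → X ∈ Z × (∃ λ h → h ∈ carrier × Good Y X h) × ∃ λ m → m ∈ carrier × Least Y X m × ∃ λ p → p ∈ imageᵛ X m × z ≡ label p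

    private
      chosenDef : Def {1} (λ v → ∃ λ Y → Y ∈ Z × Chosen Y (lookup v (# 0)))
      chosenDef = ∃∈ (cst Z) (∃∈ (cst Z) (∃∈ (cst carrier) (goodᵈ (var (# 2)) (var (# 1)) (var (# 0))) ×ᵈ
        ∃∈ (cst carrier) (leastᵈ (var (# 2)) (var (# 1)) (var (# 0)) ×ᵈ
          ∃∈ (‵ᵈ (cst (Map.graph g)) (T.clsᵈ (codeᵈ (upairᵈ (var (# 1)) (var (# 1))) (var (# 1)) (var (# 1)) (cst (proj₁ 0#)) (var (# 0)))))
            (var (# 4) ≡ᵈ labelᵈ (var (# 0))))))

    opaque
      chosen-∈ : ∀ {Y z} → Chosen Y z → z ∈ Y
      chosen-∈ (X , X∈ , (h , h∈ , G) , m , m∈ , l , p , p∈ , refl) = least-lands X∈ (h , h∈) G (m , m∈) l |>′ λ (0≤m , lands) →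
        inImage 0≤m |>′ λ p∈′ → subst (label p ∈_) (proj₁ (lands p p∈′)) (label-∈ (proj₁ (member (image X (m , m∈) X∈ 0≤m) p∈′)))
        where
        inImage : ∀ 0≤m → p ∈ proj₁ (image X (m , m∈) X∈ 0≤m)
        inImage 0≤m = subst (p ∈_) (image-value X (m , m∈) X∈ 0≤m) p∈

      labels-agree : ∀ {Y X p p′} → X ∈ Z → (h m : ℝ) → Good Y X (proj₁ h) → Least Y X (proj₁ m) →
                     p ∈ imageᵛ X (proj₁ m) → p′ ∈ imageᵛ X (proj₁ m) → label p ≡ label p′
      labels-agree {Y} {X} {p} {p′} X∈ h m G l p∈ p′∈ = label-unique (image X m X∈ 0≤m) (inImage p∈) (inImage p′∈) (proj₂ (proj₂ lands p (inImage p∈)))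
        where
        lands : Σ (0# ≤ m) λ 0≤m → ∀ p → p ∈ proj₁ (image X m X∈ 0≤m) → fst p ≡ Y × ¬ H p ≤ 0#
        lands = least-lands X∈ h G m l
        0≤m : 0# ≤ m
        0≤m = proj₁ lands
        inImage : ∀ {p} → p ∈ imageᵛ X (proj₁ m) → p ∈ proj₁ (image X m X∈ 0≤m)
        inImage {p} = subst (p ∈_) (image-value X m X∈ 0≤m)

      chosen-unique : ∀ {Y z z′} → Chosen Y z → Chosen Y z′ → z ≡ z′
      chosen-unique {Y} (X , X∈ , (h , h∈ , G) , m , m∈ , l , p , p∈ , e) (X′ , X′∈ , (h′ , h′∈ , G′) , m′ , m′∈ , l′ , p′ , p′∈ , e′) =
        trans e (trans (labels-agree X∈ (h , h∈) (m , m∈) G l p∈ (subst₂ (λ a b → p′ ∈ imageᵛ a b) (sym X≡) (sym m≡) p′∈)) (sym e′))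
        where
        X≡ : X ≡ X′
        X≡ = good-unique X∈ X′∈ (h , h∈) (h′ , h′∈) G G′
        m≡ : m ≡ m′
        m≡ = uneq (least-unique (m , m∈) (m′ , m′∈) l (subst (λ W → Least Y W m′) (sym X≡) l′))

      chosen-exists : ∀ Y → Y ∈ Z → ∃ λ z → Chosen Y z
      chosen-exists Y Y∈ = good-exists Y Y∈ |>′ λ (X , X∈ , h , G) → least-exists h G |>′ λ (m , l) → least-lands X∈ h G m l |>′ λ (0≤m , _) →
        inhabitant (image X m X∈ 0≤m) |>′ λ (p , p∈) →
        label p , X , X∈ , (proj₁ h , proj₂ h , G) , proj₁ m , proj₂ m , l , p , subst (p ∈_) (sym (image-value X m X∈ 0≤m)) p∈ , refl

    opaque
      A : V
      A = comp chosenDef (⋃ Z) []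

      ∈A : ∀ {Y z} → Y ∈ Z → Chosen Y z → z ∈ A
      ∈A {Y} {z} Y∈ c = from (∈comp chosenDef z) (from (∈⋃ z) (Y , Y∈ , chosen-∈ c) , Y , Y∈ , c)

      A-chosen : ∀ {z} → z ∈ A → ∃ λ Y → Y ∈ Z × Chosen Y z
      A-chosen {z} z∈ = proj₂ (to (∈comp chosenDef z) z∈)

      -- An element of `A` was chosen for some Y′ and lies in it; as it also lies in Y, disjointness
      -- gives Y′ = Y.
      chosen-at : ∀ {Y z} → Y ∈ Z → z ∈ A → z ∈ Y → Chosen Y z
      chosen-at {Y} {z} Y∈ z∈A z∈Y = move (A-chosen z∈A)
        where
        move : (∃ λ Y′ → Y′ ∈ Z × Chosen Y′ z) → Chosen Y z
        move (Y′ , Y′∈ , c) = subst (λ W → Chosen W z) (decidable-stable em λ n → disjoint Y′ Y Y′∈ Y∈ n (z , chosen-∈ c , z∈Y)) c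

      choose : ∀ Y → Y ∈ Z → ∃! _≡_ λ z → z ∈ A × z ∈ Y
      choose Y Y∈ = unique (chosen-exists Y Y∈)
        where
        unique : (∃ λ z → Chosen Y z) → ∃! _≡_ λ z → z ∈ A × z ∈ Y
        unique (z , c) = z , (∈A Y∈ c , chosen-∈ c) , λ (z∈A , z∈Y) → chosen-unique c (chosen-at Y∈ z∈A z∈Y)

-- The constructed reals instantiate SQHS, and the collapsing map is the quasi-isometry to be
-- reversed. The reverse map is one object of the model, so the choice set can be separated from ⋃ Z
-- with it as a parameter; X₀ supplies a code of the apex.
theorem1 : ∀ {ℓ} → ExcludedMiddle ℓ → (M : ZFModel ℓ) → SQHS M → AxiomOfChoice M
theorem1 em M sqhs Z (X₀ , X₀∈) nonempty disjoint = A , choose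
  where
  𝓡 = RealNumberField.reals em M
  open Collapsing.Collapse em M 𝓡 Z nonempty
  inverse = sqhs 𝓡 S.space T.space S.hyperbolicSpace T.hyperbolicSpace quasiIsometric
  open Choosing.ChoiceFunction em M 𝓡 Z nonempty disjoint X₀ X₀∈ (proj₁ inverse) (proj₂ inverse)
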